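{- Let $m\ge2$ and let $k$ be an integer with $(k-7)(m-1)\ge20$. Then $UC_3(c_1=k-3)$, $UC_3(c_1=k-4,c_2=1)$ and $U_3C(c_1=k-4)$ are, in this order, the connected unicyclic $m$-uniform hypergraphs with $k$ edges in $\mathcal{P}(\mathcal{H})$ having the first three largest spectral radii; that is, $\lambda_1(UC_3(c_1=k-3))>\lambda_1(UC_3(c_1=k-4,c_2=1))>\lambda_1(U_3C(c_1=k-4))$, and every other connected unicyclic $m$-uniform hypergraph with $k$ edges in $\mathcal{P}(\mathcal{H})$ has spectral radius strictly smaller than $\lambda_1(U_3C(c_1=k-4))$.
   Context: A hypergraph has a finite vertex set and an edge set of non-empty subsets of the vertex set; it is $m$-uniform if all edges have cardinality $m$, and linear if two distinct edges share at most one vertex. The adjacency matrix of a linear $m$-uniform hypergraph has $(i,j)$ entry $\frac{1}{m-1}$ if $i\ne j$ lie in a common edge, and $0$ otherwise; $\lambda_1$ denotes the spectral radius of this matrix. The $m$-th power hypergraph of a graph $G(V,E)$ is the $m$-uniform hypergraph obtained by adding to each edge $e\in E$ $m-2$ new vertices $v_{e,1},\dots,v_{e,m-2}$ (distinct for distinct edges). $\mathcal{P}(\mathcal{H})$ denotes the set of $m$-th power hypergraphs of graphs. A loose cycle of length $l\ge3$, $C_L(l)=v_1e_1v_2e_2\dots v_le_lv_1$, is the $m$-uniform hypergraph with edges $e_1,\dots,e_l$ in which $e_{i-1}\cap e_i=\{v_i\}$ (indices mod $l$, the $v_i$ distinct) and non-consecutive edges are disjoint; $v_1,\dots,v_l$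 are its core vertices. A linear hypergraph is unicyclic if it contains exactly one loose cycle. Attaching an edge at a vertex $v$ means adding a new edge consisting of $v$ and $m-1$ new vertices. $UC_l(c_1,\dots,c_l)$ is obtained from $C_L(l)$ by attaching $c_i$ (pendant) edges at $v_i$ for $i=1,\dots,l$; when only some of the $c_i$ are listed, the others are $0$. $U_3C(c_1=k-4)$ is the hypergraph with $k$ edges obtained from $UC_3(c_1=k-4)$ by attaching one more edge at a degree-one vertex of one of the $k-4$ pendant edges at $v_1$. -}

module Defs where

open import Algebra.Bundles using (CommutativeRing)
open import Data.Fin.Base using (Fin; zero; suc; toℕ; _↑ˡ_; _↑ʳ_; combine; splitAt; join)
open import Data.Fin.Properties using (any?; join-splitAt) renaming (_≟_ to _≟ᶠ_)
open import Data.Fin.Subset using (Subset; Nonempty; Empty; _∈_; _∩_; _∪_; ⁅_⁆; ⊥; ∣_∣; inside)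
open import Data.Fin.Subset.Properties using (_∈?_; x∈⁅x⁆; x∈⁅y⁆⇒x≡y; ∉⊥; x∈p∪q⁺)
open import Data.Nat.Base using (ℕ; _+_; _*_; _∸_; _≤_; NonZero; NonTrivial; 2+)
open import Data.Nat.DivMod using (_mod_)
open import Data.Product.Base using (Σ; ∃; ∃-syntax; _×_; _,_)
open import Data.Sum.Base using (_⊎_; inj₁; inj₂; [_,_]′)
open import Data.Vec.Base using (lookup; replicate; concat; map; _++_)
open import Data.Vec.Functional using (Vector) renaming (_++_ to _++ᵛ_; replicate to replicateᵛ)
open import Data.Vec.Properties
  using (++-injectiveˡ; ++-injectiveʳ; lookup-++ˡ; lookup-concat; lookup-map; lookup-replicate;
         lookup⇒[]=; []=⇒lookup)
open import Function.Bundles using (_↔_; _⇔_; Inverse)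
open import Function.Definitions using (Injective)
open import Level using (0ℓ)
open import Relation.Binary.Construct.Closure.ReflexiveTransitive using (Star)
open import Relation.Binary.Core using (Rel)
open import Relation.Binary.PropositionalEquality
  using (_≡_; _≢_; refl; sym; trans; cong; subst; module ≡-Reasoning)
open import Relation.Binary.Structures using (IsStrictTotalOrder)
import Relation.Binary.Construct.StrictToNonStrict as NonStrict
open import Relation.Nullary using (¬_; Dec; yes; no; contradiction)
open import Relation.Nullary.Decidable using (_×-dec_; ¬?; ⌊_⌋)
open import Relation.Unary using (Pred)
open import Data.Bool.Base using (if_then_else_)
import Algebra.Properties.CommutativeMonoid.Sum as Sum
import Algebra.Properties.Semiring.Mult as Mult

-- The real numbers, axiomatised as a complete ordered field (classically
-- unique up to isomorphism).  The value of 0# ⁻¹ is left unspecified.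
record CompleteOrderedField : Set₁ where
  infix  8 _⁻¹
  infix  4 _<_
  field
    commutativeRing : CommutativeRing 0ℓ 0ℓ
  open CommutativeRing commutativeRing public
    renaming (Carrier to ℝ; _+_ to _+ʳ_; _*_ to _*ʳ_; -_ to -ʳ_)
    hiding (refl; sym; trans; zero)
  field
    _<_                : Rel ℝ 0ℓ
    isStrictTotalOrder : IsStrictTotalOrder _≈_ _<_
    0<1                : 0# < 1#
    +-monoˡ-<          : ∀ z {x y} → x < y → (x +ʳ z) < (y +ʳ z)
    *-pos              : ∀ {x y} → 0# < x → 0# < y → 0# < (x *ʳ y)
    _⁻¹                : ℝ → ℝ
    ⁻¹-inverseʳ        : ∀ {x} → ¬ (x ≈ 0#) → (x *ʳ x ⁻¹) ≈ 1#
  open IsStrictTotalOrder isStrictTotalOrder public using (compare; _<?_)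
  open NonStrict _≈_ _<_ public using () renaming (_≤_ to _≤ʳ_)

  IsUpperBound : Pred ℝ 0ℓ → ℝ → Set
  IsUpperBound S b = ∀ {x} → S x → x ≤ʳ b

  field
    complete : (S : Pred ℝ 0ℓ) → ∃ S → ∃ (IsUpperBound S) →
               ∃[ s ] IsUpperBound S s × (∀ {b} → IsUpperBound S b → s ≤ʳ b)

  open Sum +-commutativeMonoid public using (sum)
  open Mult semiring public using () renaming (_×_ to _·_)

  ∣_∣ʳ : ℝ → ℝ
  ∣ x ∣ʳ = if ⌊ x <? 0# ⌋ then -ʳ x else x

record Hypergraph : Set where
  field
    order    : ℕ
    size     : ℕ
    edge     : Fin size → Subset order
    nonempty : ∀ i → Nonempty (edge i)
    distinct : Injective _≡_ _≡_ edge

  Vertex : Set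
  Vertex = Fin order

  InCommonEdge : Rel Vertex 0ℓ
  InCommonEdge u v = ∃[ i ] u ∈ edge i × v ∈ edge i

  inCommonEdge? : ∀ u v → Dec (InCommonEdge u v)
  inCommonEdge? u v = any? (λ i → (u ∈? edge i) ×-dec (v ∈? edge i))

open Hypergraph

Uniform : ℕ → Hypergraph → Set
Uniform m H = ∀ i → ∣ edge H i ∣ ≡ m

Linear : Hypergraph → Set
Linear H = ∀ {i j} → i ≢ j → ∣ edge H i ∩ edge H j ∣ ≤ 1

Connected : Hypergraph → Set
Connected H = ∀ u v → Star (InCommonEdge H) u v

infix 4 _≅_

record _≅_ (H K : Hypergraph) : Set where
  field
    vertices  : Vertex H ↔ Vertex K
    edges     : Fin (size H) ↔ Fin (size K)
    incidence : ∀ v i → v ∈ edge H i ⇔ Inverse.to vertices v ∈ edge K (Inverse.to edges i)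

next : ∀ {l} .{{_ : NonZero l}} → Fin l → Fin l
next {l} i = (1 + toℕ i) mod l

record LooseCycle (H : Hypergraph) : Set where
  field
    length-3 : ℕ

  length : ℕ
  length = 3 + length-3

  field
    core           : Fin length → Vertex H
    cycleEdge      : Fin length → Fin (size H)
    core-distinct  : Injective _≡_ _≡_ core
    edge-distinct  : Injective _≡_ _≡_ cycleEdge
    consecutive    : ∀ i → edge H (cycleEdge i) ∩ edge H (cycleEdge (next i)) ≡ ⁅ core (next i) ⁆
    nonConsecutive : ∀ {i j} → i ≢ j → j ≢ next i → i ≢ next j →
                     Empty (edge H (cycleEdge i) ∩ edge H (cycleEdge j))

open LooseCycle

-- A loose cycle is a subhypergraph: rotating or reversing its listing gives
-- the same cycle, so cycles are compared by their sets of edges.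
SameCycle : ∀ {H} → LooseCycle H → LooseCycle H → Set
SameCycle {H} C D = ∀ (e : Fin (size H)) →
  (∃[ i ] cycleEdge C i ≡ e) ⇔ (∃[ i ] cycleEdge D i ≡ e)

Unicyclic : Hypergraph → Set
Unicyclic H = Linear H × LooseCycle H × (∀ (C D : LooseCycle H) → SameCycle C D)

-- The j-th of q consecutive blocks of p vertices; its i-th vertex is
-- combine j i.
block : ∀ {q} p → Fin q → Subset (q * p)
block p j = concat (map (replicate p) ⁅ j ⁆)

lookup-block : ∀ {q p} (j j′ : Fin q) (i : Fin p) →
               lookup (block p j) (combine j′ i) ≡ lookup ⁅ j ⁆ j′
lookup-block {q} {p} j j′ i = begin
  lookup (block p j) (combine j′ i)               ≡⟨ lookup-concat (map (replicate p) ⁅ j ⁆) j′ i ⟩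
  lookup (lookup (map (replicate p) ⁅ j ⁆) j′) i  ≡⟨ cong (λ xs → lookup xs i) (lookup-map j′ (replicate p) ⁅ j ⁆) ⟩
  lookup (replicate p (lookup ⁅ j ⁆ j′)) i        ≡⟨ lookup-replicate i _ ⟩
  lookup ⁅ j ⁆ j′                                 ∎
  where open ≡-Reasoning

∈-block : ∀ {q p} (j : Fin q) (i : Fin p) → combine j i ∈ block p j
∈-block j i = lookup⇒[]= (combine j i) _
  (trans (lookup-block j j i) ([]=⇒lookup (x∈⁅x⁆ j)))

block-injective : ∀ {q p} → Fin p → {j j′ : Fin q} → block p j ≡ block p j′ → j ≡ j′
block-injective {p = p} i {j} {j′} eq = x∈⁅y⁆⇒x≡y j′ (lookup⇒[]= j ⁅ j′ ⁆ (begin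
  lookup ⁅ j′ ⁆ j                     ≡⟨ lookup-block j′ j i ⟨
  lookup (block p j′) (combine j i)   ≡⟨ []=⇒lookup (subst (combine j i ∈_) eq (∈-block j i)) ⟩
  inside                              ∎))
  where open ≡-Reasoning

∈-++ˡ : ∀ {a b} {S : Subset a} (T : Subset b) {v} → v ∈ S → v ↑ˡ b ∈ S ++ T
∈-++ˡ {S = S} T {v} v∈S = lookup⇒[]= _ (S ++ T) (trans (lookup-++ˡ S T v) ([]=⇒lookup v∈S))

-- The vertices of power m G are the order G vertices of G followed by one
-- block of m ∸ 2 new vertices for each edge.
power : ℕ → Hypergraph → Hypergraph
power m G = record
  { order    = order G + size G * (m ∸ 2)
  ; size     = size G
  ; edge     = λ i → edge G i ++ block (m ∸ 2) i
  ; nonempty = λ i → let v , v∈e = nonempty G i in _ , ∈-++ˡ (block (m ∸ 2) i) v∈e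
  ; distinct = λ {i} {j} eq → distinct G (++-injectiveˡ (edge G i) (edge G j) eq)
  }

IsGraph : Hypergraph → Set
IsGraph = Uniform 2

IsPowerOfGraph : ℕ → Hypergraph → Set
IsPowerOfGraph m H = ∃[ G ] IsGraph G × H ≅ power m G

newVertex : ∀ m .{{_ : NonTrivial m}} → Fin (m ∸ 1)
newVertex (2+ _) = zero

-- Attaching q edges: the j-th one at the vertex v j, its m ∸ 1 new vertices
-- being the j-th block.
module _ (m : ℕ) .{{_ : NonTrivial m}} (H : Hypergraph) {q : ℕ} (v : Vector (Vertex H) q) where

  oldEdge : Fin (size H) → Subset (order H + q * (m ∸ 1))
  oldEdge i = edge H i ++ ⊥

  newEdge : Fin q → Subset (order H + q * (m ∸ 1))
  newEdge j = ⁅ v j ⁆ ++ block (m ∸ 1) j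

  private
    ⊥≢block : ∀ (j : Fin q) → ⊥ ≢ block (m ∸ 1) j
    ⊥≢block j eq = ∉⊥ (subst (combine j (newVertex m) ∈_) (sym eq) (∈-block j (newVertex m)))

    edges : Fin (size H) ⊎ Fin q → Subset (order H + q * (m ∸ 1))
    edges = [ oldEdge , newEdge ]′

    edges-nonempty : ∀ x → Nonempty (edges x)
    edges-nonempty (inj₁ i) = let _ , u∈e = nonempty H i in _ , ∈-++ˡ ⊥ u∈e
    edges-nonempty (inj₂ j) = _ , ∈-++ˡ (block (m ∸ 1) j) (x∈⁅x⁆ (v j))

    edges-injective : ∀ x y → edges x ≡ edges y → x ≡ y
    edges-injective (inj₁ i) (inj₁ j) eq =
      cong inj₁ (distinct H (++-injectiveˡ (edge H i) (edge H j) eq))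
    edges-injective (inj₁ i) (inj₂ j) eq =
      contradiction (++-injectiveʳ (edge H i) ⁅ v j ⁆ eq) (⊥≢block j)
    edges-injective (inj₂ i) (inj₁ j) eq =
      contradiction (sym (++-injectiveʳ ⁅ v i ⁆ (edge H j) eq)) (⊥≢block i)
    edges-injective (inj₂ i) (inj₂ j) eq =
      cong inj₂ (block-injective (newVertex m) (++-injectiveʳ ⁅ v i ⁆ ⁅ v j ⁆ eq))

    splitAt-injective : ∀ {i j : Fin (size H + q)} → splitAt (size H) i ≡ splitAt (size H) j → i ≡ j
    splitAt-injective {i} {j} eq = trans (sym (join-splitAt (size H) q i))
      (trans (cong (join (size H) q) eq) (join-splitAt (size H) q j))

  attach : Hypergraph
  attach = record
    { order    = order H + q * (m ∸ 1)
    ; size     = size H + q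
    ; edge     = oldEdge ++ᵛ newEdge
    ; nonempty = λ i → edges-nonempty (splitAt (size H) i)
    ; distinct = λ {i} {j} eq → splitAt-injective
        (edges-injective (splitAt (size H) i) (splitAt (size H) j) eq)
    }

triangle : Hypergraph
triangle = record
  { order    = 3
  ; size     = 3
  ; edge     = side
  ; nonempty = λ i → i , x∈p∪q⁺ (inj₁ (x∈⁅x⁆ i))
  ; distinct = λ {i} {j} → side-injective i j
  }
  where
  side : Fin 3 → Subset 3
  side i = ⁅ i ⁆ ∪ ⁅ next i ⁆

  side-injective : ∀ i j → side i ≡ side j → i ≡ j
  side-injective zero             zero             _  = refl
  side-injective zero             (suc zero)       ()
  side-injective zero             (suc (suc zero)) ()
  side-injective (suc zero)       zero             ()
  side-injective (suc zero)       (suc zero)       _  = refl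
  side-injective (suc zero)       (suc (suc zero)) ()
  side-injective (suc (suc zero)) zero             ()
  side-injective (suc (suc zero)) (suc zero)       ()
  side-injective (suc (suc zero)) (suc (suc zero)) _  = refl

-- The loose cycle of length 3, for m ≥ 2: its i-th edge consists of the core
-- vertices i and next i and of m ∸ 2 further vertices in no other edge.
C₃ : ℕ → Hypergraph
C₃ m = power m triangle

coreVertex : ∀ m → Fin 3 → Vertex (C₃ m)
coreVertex m i = i ↑ˡ (3 * (m ∸ 2))

module _ (m : ℕ) .{{_ : NonTrivial m}} where

  UC₃ : (c₁ c₂ c₃ : ℕ) → Hypergraph
  UC₃ c₁ c₂ c₃ = attach m (C₃ m)
    (replicateᵛ c₁ (coreVertex m zero) ++ᵛ
      (replicateᵛ c₂ (coreVertex m (suc zero)) ++ᵛ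
        replicateᵛ c₃ (coreVertex m (suc (suc zero)))))

  -- The i-th degree-one vertex of the j-th pendant edge at the first core vertex.
  tip : ∀ {c₁} c₂ c₃ → Fin c₁ → Fin (m ∸ 1) → Vertex (UC₃ c₁ c₂ c₃)
  tip c₂ c₃ j i = order (C₃ m) ↑ʳ combine (j ↑ˡ (c₂ + c₃)) i

  U₃C : (c : ℕ) → Fin c → Fin (m ∸ 1) → Hypergraph
  U₃C c j i = attach m (UC₃ c 0 0) (replicateᵛ 1 (tip 0 0 j i))

IsConnectedUnicyclicPower : (m k : ℕ) → Hypergraph → Set
IsConnectedUnicyclicPower m k H =
  Connected H × Unicyclic H × Uniform m H × size H ≡ k × IsPowerOfGraph m H

module Spectral (𝓡 : CompleteOrderedField) where
  open CompleteOrderedField 𝓡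

  Matrix : ℕ → Set
  Matrix n = Fin n → Fin n → ℝ

  adjacency : ℕ → (H : Hypergraph) → Matrix (order H)
  adjacency m H u v =
    if ⌊ ¬? (u ≟ᶠ v) ×-dec inCommonEdge? H u v ⌋ then ((m ∸ 1) · 1#) ⁻¹ else 0#

  IsEigenvalue : ∀ {n} → Matrix n → ℝ → Set
  IsEigenvalue {n} A μ = Σ (Vector ℝ n) λ x →
    (∃[ i ] ¬ (x i ≈ 0#)) × (∀ i → sum (λ j → A i j *ʳ x j) ≈ (μ *ʳ x i))

  -- Adjacency matrices are real symmetric, so all their complex eigenvalues
  -- are real and it suffices to range over real ones.
  IsSpectralRadius : ∀ {n} → Matrix n → ℝ → Set
  IsSpectralRadius A ρ =
    (∃[ μ ] IsEigenvalue A μ × ρ ≈ ∣ μ ∣ʳ) × (∀ {μ} → IsEigenvalue A μ → ∣ μ ∣ʳ ≤ʳ ρ)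

-- λ₁(H) = ρ.  A matrix has at most one spectral radius up to _≈_.
λ₁[_,_,_]≈_ : (𝓡 : CompleteOrderedField) → ℕ → Hypergraph → CompleteOrderedField.ℝ 𝓡 → Set
λ₁[ 𝓡 , m , H ]≈ ρ = IsSpectralRadius (adjacency m H) ρ
  where open Spectral 𝓡

infix 4 less
less : (𝓡 : CompleteOrderedField) → Rel (CompleteOrderedField.ℝ 𝓡) 0ℓ
less = CompleteOrderedField._<_

syntax less 𝓡 x y = x <[ 𝓡 ] y

-- Let N = m - 1.  Eliminating the new vertices of each edge turns the eigenvalue equation of the m-th
-- power of a graph, with s = N λ - (m - 2) and c = (m - 2) / (s + N), into
--   (s + c) x v = Σ (x w + c x v)   over the edges v w of the graph.
-- The hypothesis (k - 7) N ≥ 20 says exactly that c (k - 3) + (k - 2) / s ≥ s holds at s = 5.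
--
-- Lower bounds.  On each of the three graphs all equations but the one at the vertex of largest degree
-- are solved explicitly; the remaining one has the form s = hub s and has, by completeness, a solution
-- beyond every t ≥ 5 with t < hub t.  For s ≥ 5 one has hub₃ s < hub₂ s < hub₁ s.
--
-- Upper bounds.  The absolute values y of an eigenvector satisfy the equations with ≤.  On the second
-- and third graph elimination gives s ≤ hub s.  For any other graph suppose hub₃ s ≤ s, and let u be
-- a vertex at which y is maximal.  Two applications of the inequality at u bound s² by a sum over
-- the paths u v w, and counting these with the help of the unique cycle shows that at most two edges
-- miss u.  Such a graph is one of the three, or a quadrangle with pendant edges at one vertex, whose
-- radius is small by elimination again.

module Submission where

open import Algebra.Bundles using (RawRing)
import Algebra.Properties.AbelianGroup as AbelianGroupProperties
import Algebra.Properties.Ring as RingProperties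
import Algebra.Properties.Semiring.Mult as SemiringMult
import Algebra.Properties.Semiring.Mult.TCOptimised as SemiringMult′
import Algebra.Properties.Semiring.Sum as SemiringSum
import Algebra.Solver.Ring as RingSolver
open import Algebra.Solver.Ring.AlmostCommutativeRing using (_-Raw-AlmostCommutative⟶_;
  fromCommutativeRing)
open import Data.Bool.Base using (Bool; false; if_then_else_; true)
open import Data.Empty using () renaming (⊥ to Empty⊥; ⊥-elim to Empty⊥-elim)
open import Data.Fin.Base using (Fin; _↑ʳ_; _↑ˡ_; combine; fromℕ; inject₁; punchIn; punchOut;
  remQuot; splitAt; suc; toℕ; zero)
open import Data.Fin.Patterns
open import Data.Fin.Permutation using (_⟨$⟩ʳ_; insert; insert-punchIn) renaming (id to idᴾ)
open import Data.Fin.Properties using (*↔×; +↔⊎; _≟_; all?; any?; combine-remQuot; injective⇒≤;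
  punchIn-punchOut; punchInᵢ≢i; punchOut-injective; punchOut-punchIn; splitAt-↑ʳ; splitAt-↑ˡ;
  splitAt⁻¹-↑ʳ; splitAt⁻¹-↑ˡ; suc-injective; toℕ-fromℕ; toℕ-fromℕ<; toℕ-injective; toℕ-inject₁;
  toℕ<n; ↑ʳ-injective; ↑ˡ-injective)
open import Data.Fin.Subset using (Nonempty; Subset; _∈_; _∩_; _∪_; inside; outside; ⁅_⁆; ∣_∣; ⊥)
open import Data.Fin.Subset.Properties using (Empty-unique; nonempty?; p⊆q⇒∣p∣≤∣q∣; x∈p∩q⁺; x∈p∩q⁻;
  x∈p∪q⁺; x∈p∪q⁻; x∈⁅x⁆; x∈⁅y⁆⇒x≡y; ∉⊥; ∣⁅x⁆∣≡1; ∣⊤∣≡n; ∣⊥∣≡0; ∪-identityʳ; ∪-identityˡ; ⊆-antisym)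
open import Data.Integer.Base as ℤ using (+_; -[1+_]; _⊖_; ℤ)
import Data.Integer.Properties as ℤ
open import Data.Maybe.Base using (Maybe; just; nothing)
open import Data.Nat.Base as ℕ using (2+; NonTrivial; suc; zero; ℕ)
import Data.Nat.DivMod as ℕ
import Data.Nat.Properties as ℕ
open import Data.Product.Base using (_,_; _×_; proj₁; proj₂; Σ-syntax; ∃-syntax)
open import Data.Product.Properties using (,-injective)
open import Data.Sum.Base as Sum using ([_,_]′; _⊎_; inj₁; inj₂)
open import Data.Sum.Function.Propositional using (_⊎-↔_)
open import Data.Sum.Properties using (inj₁-injective; inj₂-injective)
open import Data.Vec.Base as Vec using ([]; _++_; _∷_; concat; lookup; map; replicate)
open import Data.Vec.Functional using () renaming ([] to []ᵛ; _++_ to _++ᵛ_; _∷_ to _∷ᵛ_; replicate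
  to replicateᵛ)
open import Data.Vec.Properties using ([]=⇒lookup; lookup-splitAt; lookup⇒[]=)
open import Data.Vec.Relation.Unary.Any using (here; there)
open import Defs
open import Function.Base using (_∘_; id)
open import Function.Bundles using (Equivalence; Injection; Inverse; _↔_; _⇔_; mk↔ₛ′; mk⇔)
open import Function.Construct.Composition using (_↔-∘_; _⇔-∘_)
open import Function.Construct.Identity using (↔-id)
open import Function.Construct.Symmetry using (↔-sym)
open import Function.Definitions using (Injective)
open import Function.Properties.Inverse using (↔⇒↣)
open import Level using (0ℓ)
open import Relation.Binary.Bundles using (StrictPartialOrder)
open import Relation.Binary.Construct.Closure.ReflexiveTransitive using (Star; _◅_; _◅◅_; gmap; ε)
import Relation.Binary.Construct.StrictToNonStrict as NonStrict
open import Relation.Binary.Definitions using (tri<; tri>; tri≈)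
open import Relation.Binary.PropositionalEquality as ≡ using (_≡_; _≢_)
import Relation.Binary.Reasoning.Setoid as SetoidReasoning
import Relation.Binary.Reasoning.StrictPartialOrder as StrictPartialOrderReasoning
open import Relation.Binary.Structures using (IsStrictTotalOrder)
open import Relation.Nullary using (Dec; contradiction; does; no; yes; ¬_)
open import Relation.Nullary.Decidable using (_×-dec_; _→-dec_; _⊎-dec_; dec-false; dec-true;
  toWitness; ¬?)

-- Neither a positive eigenvector nor the monotonicity of a hub function is called upon. A radius is
-- used in two ways: it bounds every eigenvalue, so an explicit eigenvector gives a lower bound; and
-- it is the modulus of some eigenvalue, so absolute values give upper bounds. Two radii are
-- compared by evaluating two hub functions at one and the same s, which is why lower bounds start
-- from an arbitrary t with t < hub t. A radius with s below 5 is beaten by the choice t = 5.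
--
-- All m are treated together: except in the estimate at s = 5, the inequalities know of c only that
-- 0 ≤ c ≤ 1. The threshold 5 keeps all denominators at least 1, and the counting of paths asks for
-- it: for c = 0 one of its requirements is s² - 5 s + 2 ≥ 0, true at 5 and false at 4.
--
-- The counting is tight when exactly three edges miss u. A triangle at u contributes paths u v w
-- inside the neighbourhood, so it needs an estimate of its own, which also feeds on the edge of the
-- triangle opposite u. Without a triangle, the number of edges leaving the neighbourhood has to be
-- recognised as an integer.

label↔ : ∀ {n k p} → Fin (n ℕ.+ k ℕ.* p) ↔ (Fin n ⊎ (Fin k × Fin p))
label↔ = (↔-id _ ⊎-↔ *↔×) ↔-∘ +↔⊎

open Hypergraph

↔-injective : ∀ {A B : Set} (f : A ↔ B) {x y} → Inverse.to f x ≡ Inverse.to f y → x ≡ y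
↔-injective f = Injection.injective (↔⇒↣ f)

-- Simple graphs and the hypergraphs that are their powers.

record Graph : Set where
  field
    n k     : ℕ
    src tgt : Fin k → Fin n

  -- Edges are indexed and carry an arbitrary orientation, so that sums over edges can be written
  -- with `src` and `tgt`; `Joins` forgets the orientation again.
  Joins : Fin k → Fin n → Fin n → Set
  Joins e v w = (v ≡ src e × w ≡ tgt e) ⊎ (v ≡ tgt e × w ≡ src e)

  Ends : Fin k → Fin n → Set
  Ends e v = v ≡ src e ⊎ v ≡ tgt e

  field
    loopless : ∀ e → src e ≢ tgt e
    parallel : ∀ {e f} → Joins e (src f) (tgt f) → e ≡ f

  simple : ∀ {e f v w} → Joins e v w → Joins f v w → e ≡ f
  simple joins (inj₁ (≡.refl , ≡.refl)) = parallel joins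
  simple (inj₁ (p , q)) (inj₂ (≡.refl , ≡.refl)) = parallel (inj₂ (q , p))
  simple (inj₂ (p , q)) (inj₂ (≡.refl , ≡.refl)) = parallel (inj₁ (q , p))

  Joins-sym : ∀ {e v w} → Joins e v w → Joins e w v
  Joins-sym (inj₁ (p , q)) = inj₂ (q , p)
  Joins-sym (inj₂ (p , q)) = inj₁ (q , p)

  Joins⇒≢ : ∀ {e v w} → Joins e v w → v ≢ w
  Joins⇒≢ {e} (inj₁ (p , q)) v≡w = loopless e (≡.trans (≡.sym p) (≡.trans v≡w q))
  Joins⇒≢ {e} (inj₂ (p , q)) v≡w = loopless e (≡.trans (≡.sym q) (≡.trans (≡.sym v≡w) p))

  same-ends : ∀ {e v w x y} → Joins e v w → Joins e x y → (x ≡ v × y ≡ w) ⊎ (x ≡ w × y ≡ v)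
  same-ends (inj₁ (p , q)) (inj₁ (r , t)) = inj₁ (≡.trans r (≡.sym p) , ≡.trans t (≡.sym q))
  same-ends (inj₁ (p , q)) (inj₂ (r , t)) = inj₂ (≡.trans r (≡.sym q) , ≡.trans t (≡.sym p))
  same-ends (inj₂ (p , q)) (inj₁ (r , t)) = inj₂ (≡.trans r (≡.sym q) , ≡.trans t (≡.sym p))
  same-ends (inj₂ (p , q)) (inj₂ (r , t)) = inj₁ (≡.trans r (≡.sym p) , ≡.trans t (≡.sym q))

  end-of : ∀ {e v w x} → Joins e v w → Ends e x → x ≡ v ⊎ x ≡ w
  end-of (inj₁ (p , _)) (inj₁ r) = inj₁ (≡.trans r (≡.sym p))
  end-of (inj₁ (_ , q)) (inj₂ r) = inj₂ (≡.trans r (≡.sym q))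
  end-of (inj₂ (_ , q)) (inj₁ r) = inj₂ (≡.trans r (≡.sym q))
  end-of (inj₂ (p , _)) (inj₂ r) = inj₁ (≡.trans r (≡.sym p))

  Joins⇒Ends : ∀ {e v w} → Joins e v w → Ends e v
  Joins⇒Ends (inj₁ (p , _)) = inj₁ p
  Joins⇒Ends (inj₂ (p , _)) = inj₂ p

  Ends⇒Joins : ∀ {e v} → Ends e v → ∃[ w ] Joins e v w
  Ends⇒Joins (inj₁ p) = _ , inj₁ (p , ≡.refl)
  Ends⇒Joins (inj₂ p) = _ , inj₂ (p , ≡.refl)

  Ends² : ∀ {e v w} → v ≢ w → Ends e v → Ends e w → Joins e v w
  Ends² v≢w (inj₁ p) (inj₁ q) = contradiction (≡.trans p (≡.sym q)) v≢w
  Ends² v≢w (inj₁ p) (inj₂ q) = inj₁ (p , q)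
  Ends² v≢w (inj₂ p) (inj₁ q) = inj₂ (p , q)
  Ends² v≢w (inj₂ p) (inj₂ q) = contradiction (≡.trans p (≡.sym q)) v≢w

-- The vertices of the (2 + p)-th power of Γ.
Label : ℕ → Graph → Set
Label p Γ = Fin n ⊎ (Fin k × Fin p)
  where open Graph Γ

Member : ∀ {p} (Γ : Graph) → Label p Γ → Fin (Graph.k Γ) → Set
Member Γ (inj₁ v)       e = Graph.Ends Γ e v
Member Γ (inj₂ (f , _)) e = f ≡ e

-- Only incidence is recorded, through a labelling of vertices and edges. In this form the property
-- passes along isomorphisms and through attachments without arithmetic on the numbering of the
-- vertices.
record IsPower (p : ℕ) (Γ : Graph) (H : Hypergraph) : Set where
  open Graph Γ
  field
    vertices  : Vertex H ↔ Label p Γ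
    edges     : Fin (size H) ↔ Fin k
    incidence : ∀ v i → v ∈ edge H i ⇔ Member Γ (Inverse.to vertices v) (Inverse.to edges i)

↑ˡ≢↑ʳ : ∀ {m n} {i : Fin m} {j : Fin n} → i ↑ˡ n ≢ m ↑ʳ j
↑ˡ≢↑ʳ {m} {n} {i} {j} eq with ≡.trans (≡.sym (splitAt-↑ˡ m i n)) (≡.trans (≡.cong (splitAt m) eq) (splitAt-↑ʳ m n j))
... | ()

addPendants : (Γ : Graph) → ∀ {q} → (Fin q → Fin (Graph.n Γ)) → Graph
addPendants Γ {q} v = record
  { n = n ℕ.+ q
  ; k = k ℕ.+ q
  ; src = source ∘ splitAt k
  ; tgt = target ∘ splitAt k
  ; loopless = λ e → loopless′ (splitAt k e)
  ; parallel = λ {e} {f} joins → splitAt-injective (parallel′ (splitAt k e) (splitAt k f) joins)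
  }
  where
  open Graph Γ
  source target : Fin k ⊎ Fin q → Fin (n ℕ.+ q)
  source = [ (λ e → src e ↑ˡ q) , (λ j → v j ↑ˡ q) ]′
  target = [ (λ e → tgt e ↑ˡ q) , (λ j → n ↑ʳ j) ]′

  loopless′ : ∀ x → source x ≢ target x
  loopless′ (inj₁ e) eq = loopless e (↑ˡ-injective q _ _ eq)
  loopless′ (inj₂ j) eq = ↑ˡ≢↑ʳ eq

  splitAt-injective : ∀ {e f : Fin (k ℕ.+ q)} → splitAt k e ≡ splitAt k f → e ≡ f
  splitAt-injective {e} {f} eq with splitAt k e in eqₑ | splitAt k f in eqf
  splitAt-injective ≡.refl | inj₁ x | inj₁ .x = ≡.trans (≡.sym (splitAt⁻¹-↑ˡ eqₑ)) (splitAt⁻¹-↑ˡ eqf)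
  splitAt-injective ≡.refl | inj₂ x | inj₂ .x = ≡.trans (≡.sym (splitAt⁻¹-↑ʳ eqₑ)) (splitAt⁻¹-↑ʳ eqf)

  inl : ∀ {a b} → a ↑ˡ q ≡ b ↑ˡ q → a ≡ b
  inl = ↑ˡ-injective q _ _

  inr : ∀ {a b} → n ↑ʳ a ≡ n ↑ʳ b → a ≡ b
  inr = ↑ʳ-injective n _ _

  parallel′ : ∀ x y → (source y ≡ source x × target y ≡ target x) ⊎ (source y ≡ target x × target y ≡ source x) → x ≡ y
  parallel′ (inj₁ e) (inj₁ f) (inj₁ (p , r)) = ≡.cong inj₁ (parallel (inj₁ (inl p , inl r)))
  parallel′ (inj₁ e) (inj₁ f) (inj₂ (p , r)) = ≡.cong inj₁ (parallel (inj₂ (inl p , inl r)))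
  parallel′ (inj₁ e) (inj₂ j) (inj₁ (p , r)) = contradiction (≡.sym r) ↑ˡ≢↑ʳ
  parallel′ (inj₁ e) (inj₂ j) (inj₂ (p , r)) = contradiction (≡.sym r) ↑ˡ≢↑ʳ
  parallel′ (inj₂ i) (inj₁ f) (inj₁ (p , r)) = contradiction r ↑ˡ≢↑ʳ
  parallel′ (inj₂ i) (inj₁ f) (inj₂ (p , r)) = contradiction p ↑ˡ≢↑ʳ
  parallel′ (inj₂ i) (inj₂ j) (inj₁ (p , r)) = ≡.cong inj₂ (inr (≡.sym r))
  parallel′ (inj₂ i) (inj₂ j) (inj₂ (p , r)) = contradiction p ↑ˡ≢↑ʳ

private
  distinct-ends? : ∀ {n k} (s t : Fin k → Fin n) → Dec (∀ e → s e ≢ t e)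
  distinct-ends? s t = all? λ e → ¬? (s e ≟ t e)

  no-parallel? : ∀ {n k} (s t : Fin k → Fin n) → Dec (∀ e f →
    (s f ≡ s e × t f ≡ t e) ⊎ (s f ≡ t e × t f ≡ s e) → e ≡ f)
  no-parallel? s t = all? λ e → all? λ f →
    (((s f ≟ s e) ×-dec (t f ≟ t e)) ⊎-dec ((s f ≟ t e) ×-dec (t f ≟ s e))) →-dec (e ≟ f)

triangleGraph squareGraph : Graph
triangleGraph = record
  { n = 3 ; k = 3 ; src = λ e → e ; tgt = next
  ; loopless = toWitness {a? = distinct-ends? (λ e → e) next} _
  ; parallel = λ {e} {f} → toWitness {a? = no-parallel? (λ e → e) next} _ e f
  }
squareGraph = record
  { n = 4 ; k = 4 ; src = λ e → e ; tgt = next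
  ; loopless = toWitness {a? = distinct-ends? (λ e → e) next} _
  ; parallel = λ {e} {f} → toWitness {a? = no-parallel? (λ e → e) next} _ e f
  }

-- The `q` pendant edges at the hub `0F` are attached last, so the exceptional vertices and edges
-- have the same small numerals for every `q`.
graph₁ graph₂ graph₃ graph₄ : ℕ → Graph
graph₁ q = addPendants triangleGraph {q} (λ _ → 0F)
graph₂ q = addPendants (addPendants triangleGraph {1} (λ _ → 1F)) {q} (λ _ → 0F)
graph₃ q = addPendants (addPendants (addPendants triangleGraph {1} (λ _ → 0F)) {1} (λ _ → 3F)) {q} (λ _ → 0F)
graph₄ q = addPendants squareGraph {q} (λ _ → 0F)

-- Cyclic listings and cycles of graphs.

toℕ-next : ∀ {l} (i : Fin (suc l)) → toℕ (next i) ≡ suc (toℕ i) ⊎ (toℕ (next i) ≡ 0 × toℕ i ≡ l)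
toℕ-next {l} i with ℕ.m≤n⇒m<n∨m≡n (ℕ.s≤s⁻¹ (toℕ<n i))
... | inj₁ i<l = inj₁ (≡.trans (toℕ-fromℕ< _) (ℕ.m<n⇒m%n≡m (ℕ.s≤s i<l)))
... | inj₂ i≡l = inj₂ (≡.trans (toℕ-fromℕ< _) (≡.trans (≡.cong (λ x → suc x ℕ.% suc l) i≡l) (ℕ.n%n≡0 (suc l))) , i≡l)

next-injective : ∀ {l} {i j : Fin (suc l)} → next i ≡ next j → i ≡ j
next-injective {i = i} {j} eq with toℕ-next i | toℕ-next j
... | inj₁ p | inj₁ q = toℕ-injective (ℕ.suc-injective (≡.trans (≡.sym p) (≡.trans (≡.cong toℕ eq) q)))
... | inj₁ p | inj₂ (q , _) = contradiction (≡.trans (≡.sym p) (≡.trans (≡.cong toℕ eq) q)) λ ()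
... | inj₂ (p , _) | inj₁ q = contradiction (≡.trans (≡.sym p) (≡.trans (≡.cong toℕ eq) q)) λ ()
... | inj₂ (_ , p) | inj₂ (_ , q) = toℕ-injective (≡.trans p (≡.sym q))

next-surjective : ∀ {l} (i : Fin (suc l)) → ∃[ j ] next j ≡ i
next-surjective {l} zero = fromℕ l , last (toℕ-next (fromℕ l))
  where
  last : ∀ {i : Fin (suc l)} → toℕ i ≡ suc (toℕ (fromℕ l)) ⊎ (toℕ i ≡ 0 × toℕ (fromℕ l) ≡ l) → i ≡ zero
  last {i} (inj₁ p) = contradiction (toℕ<n i) (ℕ.<-irrefl (≡.trans p (≡.cong suc (toℕ-fromℕ l))))
  last (inj₂ (p , _)) = toℕ-injective p
next-surjective {suc l} (suc i) = inject₁ i , step (toℕ-next (inject₁ i))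
  where
  step : toℕ (next (inject₁ i)) ≡ suc (toℕ (inject₁ i)) ⊎ (toℕ (next (inject₁ i)) ≡ 0 × toℕ (inject₁ i) ≡ suc l) → next (inject₁ i) ≡ suc i
  step (inj₁ p) = toℕ-injective (≡.trans p (≡.cong suc (toℕ-inject₁ i)))
  step (inj₂ (_ , p)) = contradiction (toℕ<n i) (ℕ.<-irrefl (≡.trans (≡.sym (toℕ-inject₁ i)) p))

next≢ : ∀ {l} (i : Fin (2 ℕ.+ l)) → next i ≢ i
next≢ i eq with toℕ-next i
... | inj₁ p = ℕ.1+n≢n (≡.trans (≡.sym p) (≡.cong toℕ eq))
... | inj₂ (p , q) = contradiction (≡.trans (≡.sym q) (≡.trans (≡.sym (≡.cong toℕ eq)) p)) λ ()

-- Two steps along a cyclic listing return to the start only at length one or two. This is where the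
-- length of cycles being at least three is used.
next²≢ : ∀ {l} (i : Fin (3 ℕ.+ l)) → next (next i) ≢ i
next²≢ i eq with toℕ-next i | toℕ-next (next i)
... | inj₁ p | inj₁ q = ℕ.m≢1+n+m (toℕ i) {1} (≡.trans (≡.sym (≡.cong toℕ eq)) (≡.trans q (≡.cong suc p)))
... | inj₁ p | inj₂ (q , r) = contradiction (≡.trans (≡.sym r) (≡.trans p (≡.cong suc (≡.trans (≡.sym (≡.cong toℕ eq)) q)))) λ ()
... | inj₂ (p , q) | inj₁ r = contradiction (≡.trans (≡.sym q) (≡.trans (≡.sym (≡.cong toℕ eq)) (≡.trans r (≡.cong suc p)))) λ ()
... | inj₂ (p , _) | inj₂ (_ , r) = contradiction (≡.trans (≡.sym r) p) λ ()

record Cycle (Γ : Graph) : Set where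
  open Graph Γ
  field
    length-3        : ℕ
    vertex          : Fin (3 ℕ.+ length-3) → Fin n
    edgeAt          : Fin (3 ℕ.+ length-3) → Fin k
    vertex-distinct : Injective _≡_ _≡_ vertex
    joins           : ∀ i → Joins (edgeAt i) (vertex i) (vertex (next i))

  -- Equal edges have equal ends. If the ends correspond in reverse order, then i is the successor
  -- of j and j that of i, which `next²≢` forbids.
  edge-distinct : Injective _≡_ _≡_ edgeAt
  edge-distinct {i} {j} eq with ends (≡.subst (λ e → Joins e (vertex i) (vertex (next i))) eq (joins i)) (joins j)
    where
    ends : ∀ {e a b c d} → Joins e a b → Joins e c d → (a ≡ c × b ≡ d) ⊎ (a ≡ d × b ≡ c)
    ends (inj₁ (≡.refl , ≡.refl)) (inj₁ (≡.refl , ≡.refl)) = inj₁ (≡.refl , ≡.refl)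
    ends (inj₁ (≡.refl , ≡.refl)) (inj₂ (≡.refl , ≡.refl)) = inj₂ (≡.refl , ≡.refl)
    ends (inj₂ (≡.refl , ≡.refl)) (inj₁ (≡.refl , ≡.refl)) = inj₂ (≡.refl , ≡.refl)
    ends (inj₂ (≡.refl , ≡.refl)) (inj₂ (≡.refl , ≡.refl)) = inj₁ (≡.refl , ≡.refl)
  ... | inj₁ (p , _) = vertex-distinct p
  ... | inj₂ (p , q) = contradiction (≡.trans (≡.cong next (≡.sym (vertex-distinct p))) (vertex-distinct q)) (next²≢ j)

-- One inclusion of edge sets suffices, since the two cycles range over all ordered pairs.
AtMostOneCycle : Graph → Set
AtMostOneCycle Γ = ∀ (C D : Cycle Γ) i → ∃[ j ] Cycle.edgeAt C j ≡ Cycle.edgeAt D i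

-- An edge shared by both cycles brings its ends along. The local consequences of uniqueness below
-- are all drawn from common vertices in this way.
on-cycle : ∀ {Γ} → AtMostOneCycle Γ → ∀ (C D : Cycle Γ) i → ∃[ j ] Cycle.vertex C j ≡ Cycle.vertex D i
on-cycle {Γ} unique C D i with unique C D i
... | j , eq = end (C.joins j) (≡.subst (λ e → Joins e _ _) (≡.sym eq) (D.joins i))
  where
  open Graph Γ
  module C = Cycle C
  module D = Cycle D
  end : ∀ {e x} → Joins e (C.vertex j) (C.vertex (next j)) → Joins e (D.vertex i) x → ∃[ j ] C.vertex j ≡ D.vertex i
  end (inj₁ (p , _)) (inj₁ (r , _)) = j , ≡.trans p (≡.sym r)
  end (inj₁ (_ , q)) (inj₂ (r , _)) = next j , ≡.trans q (≡.sym r)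
  end (inj₂ (_ , q)) (inj₁ (r , _)) = next j , ≡.trans q (≡.sym r)
  end (inj₂ (p , _)) (inj₂ (r , _)) = j , ≡.trans p (≡.sym r)

module ShortCycles (Γ : Graph) where

  open Graph Γ

  triangle-cycle : ∀ {v₀ v₁ v₂ e₀ e₁ e₂} → Joins e₀ v₀ v₁ → Joins e₁ v₁ v₂ → Joins e₂ v₂ v₀ → Cycle Γ
  triangle-cycle {v₀} {v₁} {v₂} {e₀} {e₁} {e₂} j₀ j₁ j₂ = record
    { length-3 = 0
    ; vertex = λ { 0F → v₀ ; 1F → v₁ ; 2F → v₂ }
    ; edgeAt = λ { 0F → e₀ ; 1F → e₁ ; 2F → e₂ }
    ; vertex-distinct = λ
      { {0F} {0F} _ → ≡.refl ; {1F} {1F} _ → ≡.refl ; {2F} {2F} _ → ≡.refl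
      ; {0F} {1F} eq → contradiction eq (Joins⇒≢ j₀)
      ; {1F} {0F} eq → contradiction (≡.sym eq) (Joins⇒≢ j₀)
      ; {1F} {2F} eq → contradiction eq (Joins⇒≢ j₁)
      ; {2F} {1F} eq → contradiction (≡.sym eq) (Joins⇒≢ j₁)
      ; {2F} {0F} eq → contradiction eq (Joins⇒≢ j₂)
      ; {0F} {2F} eq → contradiction (≡.sym eq) (Joins⇒≢ j₂) }
    ; joins = λ { 0F → j₀ ; 1F → j₁ ; 2F → j₂ }
    }

  square-cycle : ∀ {v₀ v₁ v₂ v₃ e₀ e₁ e₂ e₃} → v₀ ≢ v₂ → v₁ ≢ v₃ →
    Joins e₀ v₀ v₁ → Joins e₁ v₁ v₂ → Joins e₂ v₂ v₃ → Joins e₃ v₃ v₀ → Cycle Γ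
  square-cycle {v₀} {v₁} {v₂} {v₃} {e₀} {e₁} {e₂} {e₃} v₀≢v₂ v₁≢v₃ j₀ j₁ j₂ j₃ = record
    { length-3 = 1
    ; vertex = λ { 0F → v₀ ; 1F → v₁ ; 2F → v₂ ; 3F → v₃ }
    ; edgeAt = λ { 0F → e₀ ; 1F → e₁ ; 2F → e₂ ; 3F → e₃ }
    ; vertex-distinct = λ
      { {0F} {0F} _ → ≡.refl ; {1F} {1F} _ → ≡.refl ; {2F} {2F} _ → ≡.refl ; {3F} {3F} _ → ≡.refl
      ; {0F} {1F} eq → contradiction eq (Joins⇒≢ j₀)
      ; {1F} {0F} eq → contradiction (≡.sym eq) (Joins⇒≢ j₀)
      ; {1F} {2F} eq → contradiction eq (Joins⇒≢ j₁)
      ; {2F} {1F} eq → contradiction (≡.sym eq) (Joins⇒≢ j₁)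
      ; {2F} {3F} eq → contradiction eq (Joins⇒≢ j₂)
      ; {3F} {2F} eq → contradiction (≡.sym eq) (Joins⇒≢ j₂)
      ; {3F} {0F} eq → contradiction eq (Joins⇒≢ j₃)
      ; {0F} {3F} eq → contradiction (≡.sym eq) (Joins⇒≢ j₃)
      ; {0F} {2F} eq → contradiction eq v₀≢v₂
      ; {2F} {0F} eq → contradiction (≡.sym eq) v₀≢v₂
      ; {1F} {3F} eq → contradiction eq v₁≢v₃
      ; {3F} {1F} eq → contradiction (≡.sym eq) v₁≢v₃ }
    ; joins = λ { 0F → j₀ ; 1F → j₁ ; 2F → j₂ ; 3F → j₃ }
    }

-- A cycle that avoids an edge of the triangle would inject its three or more indices into the two
-- edges that remain.
triangleGraph-atMostOneCycle : AtMostOneCycle triangleGraph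
triangleGraph-atMostOneCycle C D i with any? (λ j → Cycle.edgeAt C j ≟ Cycle.edgeAt D i)
... | yes found = found
... | no missed = contradiction
  (injective⇒≤ {f = λ j → punchOut (λ eq → missed (j , ≡.sym eq))}
    (λ {j} {j′} eq → Cycle.edge-distinct C (punchOut-injective (λ eq → missed (j , ≡.sym eq)) (λ eq → missed (j′ , ≡.sym eq)) eq)))
  λ { (ℕ.s≤s (ℕ.s≤s ())) }

-- A pendant vertex lies on one edge only, so no cycle passes through it.
module _ (Γ : Graph) {q : ℕ} (v : Fin q → Fin (Graph.n Γ)) where

  private
    Γ⁺ = addPendants Γ v
    open Graph Γ
    module Γ⁺ = Graph Γ⁺

  pendant-end : ∀ e j → Γ⁺.Ends e (n ↑ʳ j) → e ≡ k ↑ʳ j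
  pendant-end e j end with splitAt k e in eq
  pendant-end e j (inj₁ p) | inj₁ f = contradiction (≡.sym p) ↑ˡ≢↑ʳ
  pendant-end e j (inj₂ p) | inj₁ f = contradiction (≡.sym p) ↑ˡ≢↑ʳ
  pendant-end e j (inj₁ p) | inj₂ i = contradiction (≡.sym p) ↑ˡ≢↑ʳ
  pendant-end e j (inj₂ p) | inj₂ i = ≡.trans (≡.sym (splitAt⁻¹-↑ʳ eq)) (≡.cong (k ↑ʳ_) (≡.sym (↑ʳ-injective n j i p)))

  private
    old-joins : ∀ e {x y} → Γ⁺.Joins (e ↑ˡ q) x y → ∃[ a ] ∃[ b ] Joins e a b × a ↑ˡ q ≡ x × b ↑ˡ q ≡ y
    old-joins e joins rewrite splitAt-↑ˡ k e q with joins
    ... | inj₁ (p , r) = _ , _ , inj₁ (≡.refl , ≡.refl) , ≡.sym p , ≡.sym r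
    ... | inj₂ (p , r) = _ , _ , inj₂ (≡.refl , ≡.refl) , ≡.sym p , ≡.sym r

    new-end : ∀ j {x y} → Γ⁺.Joins (k ↑ʳ j) x y → x ≡ n ↑ʳ j ⊎ y ≡ n ↑ʳ j
    new-end j joins rewrite splitAt-↑ʳ k q j with joins
    ... | inj₁ (_ , r) = inj₂ r
    ... | inj₂ (p , _) = inj₁ p

  old-cycle : (C : Cycle Γ⁺) → ∃[ C′ ]
    (∀ i → ∃[ j ] Cycle.edgeAt C j ≡ Cycle.edgeAt {Γ} C′ i ↑ˡ q) ×
    (∀ i → ∃[ j ] Cycle.edgeAt {Γ} C′ j ↑ˡ q ≡ Cycle.edgeAt C i)
  old-cycle C = C′ , (λ i → i , ≡.sym (proj₂ (old-edge i))) , λ i → i , proj₂ (old-edge i)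
    where
    open Cycle C
    -- Vertex i lies on the cycle edge at i and on the one before it; at a pendant vertex both would
    -- be the single pendant edge, although the edges of a cycle are distinct.
    two-edges : ∀ i j → vertex i ≢ n ↑ʳ j
    two-edges i j eq with next-surjective i
    ... | i′ , ≡.refl = next≢ i′ (edge-distinct (≡.trans
      (pendant-end _ j (≡.subst (Γ⁺.Ends _) eq (Γ⁺.Joins⇒Ends (joins (next i′)))))
      (≡.sym (pendant-end _ j (≡.subst (Γ⁺.Ends _) eq (Γ⁺.Joins⇒Ends (Γ⁺.Joins-sym (joins i′))))))))
    old-edge : ∀ i → ∃[ e ] e ↑ˡ q ≡ edgeAt i
    old-edge i with splitAt k (edgeAt i) in eq
    ... | inj₁ e = e , splitAt⁻¹-↑ˡ eq
    ... | inj₂ j with new-end j (≡.subst (λ e → Γ⁺.Joins e _ _) (≡.sym (splitAt⁻¹-↑ʳ eq)) (joins i))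
    ...   | inj₁ p = contradiction p (two-edges i j)
    ...   | inj₂ p = contradiction p (two-edges (next i) j)
    old : ∀ i → ∃[ a ] ∃[ b ] Joins (proj₁ (old-edge i)) a b × a ↑ˡ q ≡ vertex i × b ↑ˡ q ≡ vertex (next i)
    old i = old-joins _ (≡.subst (λ e → Γ⁺.Joins e _ _) (≡.sym (proj₂ (old-edge i))) (joins i))
    C′ : Cycle Γ
    C′ = record
      { length-3 = length-3
      ; vertex = λ i → proj₁ (old i)
      ; edgeAt = λ i → proj₁ (old-edge i)
      ; vertex-distinct = λ {i} {j} eq → vertex-distinct (≡.trans (≡.sym (at i)) (≡.trans (≡.cong (_↑ˡ q) eq) (at j)))
      ; joins = λ i → ≡.subst (Joins _ _) (↑ˡ-injective q _ _ (≡.trans (proj₂ (proj₂ (proj₂ (proj₂ (old i))))) (≡.sym (at (next i)))))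
          (proj₁ (proj₂ (proj₂ (old i))))
      }
      where
      at : ∀ i → proj₁ (old i) ↑ˡ q ≡ vertex i
      at i = proj₁ (proj₂ (proj₂ (proj₂ (old i))))

  addPendants-atMostOneCycle : AtMostOneCycle Γ → AtMostOneCycle Γ⁺
  addPendants-atMostOneCycle unique C D i with old-cycle C | old-cycle D
  ... | C′ , C′⊆C , _ | D′ , _ , D⊆D′ with D⊆D′ i
  ...   | j , D≡ with unique C′ D′ j
  ...     | i′ , C′≡ with C′⊆C i′
  ...       | j′ , C≡ = j′ , ≡.trans C≡ (≡.trans (≡.cong (_↑ˡ q) C′≡) D≡)

-- Loose cycles of a power correspond to cycles of its graph.

module PowerCycles {p : ℕ} {Γ : Graph} {H : Hypergraph} (H-power : IsPower p Γ H) where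

  open Graph Γ
  open IsPower H-power
  private
    module V = Inverse vertices
    module E = Inverse edges

  ∈⇒Member : ∀ {v i} → v ∈ edge H i → Member Γ (V.to v) (E.to i)
  ∈⇒Member {v} {i} = Equivalence.to (incidence v i)

  Member⇒∈ : ∀ {x : Label p Γ} {e} → Member Γ x e → V.from x ∈ edge H (E.from e)
  Member⇒∈ {x} {e} mem = Equivalence.from (incidence _ _)
    (≡.subst₂ (Member Γ) (≡.sym (V.strictlyInverseˡ x)) (≡.sym (E.strictlyInverseˡ e)) mem)

  -- A new vertex lies on one edge only, so distinct edges can meet in nothing but vertices of the
  -- graph.
  shared-label : ∀ (x : Label p Γ) {e f} → Member Γ x e → Member Γ x f → e ≢ f → ∃[ v ] x ≡ inj₁ v
  shared-label (inj₁ v) _ _ _ = v , ≡.refl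
  shared-label (inj₂ (g , _)) p q e≢f = contradiction (≡.trans (≡.sym p) q) e≢f

  -- A core vertex lies on two distinct edges and is therefore a vertex of the graph. The two
  -- inclusions speak of edge sets because `SameCycle` compares nothing else.
  cycle : (C : LooseCycle H) → ∃[ C′ ]
    (∀ i → ∃[ j ] Cycle.edgeAt {Γ} C′ j ≡ E.to (LooseCycle.cycleEdge C i)) ×
    (∀ i → ∃[ j ] E.to (LooseCycle.cycleEdge C j) ≡ Cycle.edgeAt {Γ} C′ i)
  cycle C = C′ , (λ i → i , ≡.refl) , (λ i → i , ≡.refl)
    where
    open LooseCycle C
    both : ∀ i → core (next i) ∈ edge H (cycleEdge i) × core (next i) ∈ edge H (cycleEdge (next i))
    both i = x∈p∩q⁻ _ _ (≡.subst (core (next i) ∈_) (≡.sym (consecutive i)) (x∈⁅x⁆ _))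
    starts : ∀ i → core i ∈ edge H (cycleEdge i)
    starts i with next-surjective i
    ... | i′ , ≡.refl = proj₂ (both i′)
    labelled : ∀ i → ∃[ v ] V.to (core i) ≡ inj₁ v
    labelled i with next-surjective i
    ... | i′ , ≡.refl = shared-label _ (∈⇒Member (proj₁ (both i′))) (∈⇒Member (proj₂ (both i′)))
      (λ eq → next≢ i′ (≡.sym (edge-distinct (↔-injective edges eq))))
    vertex : Fin length → Fin n
    vertex i = proj₁ (labelled i)
    vertex-distinct : Injective _≡_ _≡_ vertex
    vertex-distinct {i} {j} eq = core-distinct (↔-injective vertices
      (≡.trans (proj₂ (labelled i)) (≡.trans (≡.cong inj₁ eq) (≡.sym (proj₂ (labelled j))))))
    C′ : Cycle Γ
    C′ = record
      { length-3 = length-3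
      ; vertex = vertex
      ; edgeAt = E.to ∘ cycleEdge
      ; vertex-distinct = vertex-distinct
      ; joins = λ i → Ends² (λ eq → next≢ i (≡.sym (vertex-distinct eq)))
          (≡.subst (λ x → Member Γ x _) (proj₂ (labelled i)) (∈⇒Member (starts i)))
          (≡.subst (λ x → Member Γ x _) (proj₂ (labelled (next i))) (∈⇒Member (proj₁ (both i))))
      }

  looseCycle : (C : Cycle Γ) → ∃[ C′ ]
    (∀ i → ∃[ j ] Cycle.edgeAt C j ≡ E.to (LooseCycle.cycleEdge {H} C′ i)) ×
    (∀ i → ∃[ j ] E.to (LooseCycle.cycleEdge {H} C′ j) ≡ Cycle.edgeAt C i)
  looseCycle C = C′ , (λ i → i , ≡.sym (E.strictlyInverseˡ _)) , λ i → i , E.strictlyInverseˡ _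
    where
    open Cycle C
    ends : ∀ i {v} → Ends (edgeAt i) v → v ≡ vertex i ⊎ v ≡ vertex (next i)
    ends i end with joins i | end
    ... | inj₁ (p , q) | inj₁ r = inj₁ (≡.trans r (≡.sym p))
    ... | inj₁ (p , q) | inj₂ r = inj₂ (≡.trans r (≡.sym q))
    ... | inj₂ (p , q) | inj₁ r = inj₂ (≡.trans r (≡.sym q))
    ... | inj₂ (p , q) | inj₂ r = inj₁ (≡.trans r (≡.sym p))
    core : Fin (3 ℕ.+ length-3) → Vertex H
    core = V.from ∘ inj₁ ∘ vertex
    cycleEdge : Fin (3 ℕ.+ length-3) → Fin (size H)
    cycleEdge = E.from ∘ edgeAt
    E-from-injective : ∀ {e f} → E.from e ≡ E.from f → e ≡ f
    E-from-injective {e} {f} eq = ≡.trans (≡.sym (E.strictlyInverseˡ e)) (≡.trans (≡.cong E.to eq) (E.strictlyInverseˡ f))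
    V-from-injective : ∀ {e f} → V.from e ≡ V.from f → e ≡ f
    V-from-injective {e} {f} eq = ≡.trans (≡.sym (V.strictlyInverseˡ e)) (≡.trans (≡.cong V.to eq) (V.strictlyInverseˡ f))
    inj₁-inj : ∀ {a b} → _≡_ {A = Label p Γ} (inj₁ a) (inj₁ b) → a ≡ b
    inj₁-inj ≡.refl = ≡.refl
    common : ∀ {x i j} → i ≢ j → x ∈ edge H (cycleEdge i) → x ∈ edge H (cycleEdge j) →
      ∃[ v ] V.to x ≡ inj₁ v × Ends (edgeAt i) v × Ends (edgeAt j) v
    common {x} {i} {j} i≢j xi xj = v , eq , ≡.subst (λ y → Member Γ y _) eq mi , ≡.subst (λ y → Member Γ y _) eq mj
      where
      mi : Member Γ (V.to x) (edgeAt i)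
      mi = ≡.subst (Member Γ (V.to x)) (E.strictlyInverseˡ _) (∈⇒Member xi)
      mj : Member Γ (V.to x) (edgeAt j)
      mj = ≡.subst (Member Γ (V.to x)) (E.strictlyInverseˡ _) (∈⇒Member xj)
      shared = shared-label (V.to x) mi mj (i≢j ∘ edge-distinct)
      v = proj₁ shared
      eq = proj₂ shared
    C′ : LooseCycle H
    C′ = record
      { length-3 = length-3
      ; core = core
      ; cycleEdge = cycleEdge
      ; core-distinct = λ eq → vertex-distinct (inj₁-inj (V-from-injective eq))
      ; edge-distinct = edge-distinct ∘ E-from-injective
      ; consecutive = λ i → ⊆-antisym
          (λ {x} x∈ → let xi , xj = x∈p∩q⁻ _ _ x∈ in
            ≡.subst (_∈ ⁅ core (next i) ⁆) (≡.sym (meet i (common (next≢ i ∘ ≡.sym) xi xj))) (x∈⁅x⁆ _))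
          (λ {x} x∈ → ≡.subst (_∈ _) (≡.sym (x∈⁅y⁆⇒x≡y _ x∈)) (x∈p∩q⁺
            (Member⇒∈ (Joins⇒Ends (Joins-sym (joins i))) , Member⇒∈ (Joins⇒Ends (joins (next i))))))
      ; nonConsecutive = λ {i} {j} i≢j j≢ni i≢nj (x , x∈) → let xi , xj = x∈p∩q⁻ _ _ x∈ in
          apart i≢j j≢ni i≢nj (common i≢j xi xj)
      }
      where
      -- The one other possibility is that the beginning of one edge is the end of the following
      -- one, that is, a cycle closing after two steps.
      meet : ∀ i {x} → ∃[ v ] V.to x ≡ inj₁ v × Ends (edgeAt i) v × Ends (edgeAt (next i)) v → x ≡ core (next i)
      meet i {x} (v , eq , p , q) with ends i p | ends (next i) q
      ... | inj₂ r | _      = ≡.trans (≡.sym (V.strictlyInverseʳ x)) (≡.cong V.from (≡.trans eq (≡.cong inj₁ r)))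
      ... | inj₁ _ | inj₁ r = ≡.trans (≡.sym (V.strictlyInverseʳ x)) (≡.cong V.from (≡.trans eq (≡.cong inj₁ r)))
      ... | inj₁ r | inj₂ t = contradiction (vertex-distinct (≡.trans (≡.sym t) r)) (next²≢ i)
      apart : ∀ {i j x} → i ≢ j → j ≢ next i → i ≢ next j → ¬ (∃[ v ] V.to x ≡ inj₁ v × Ends (edgeAt i) v × Ends (edgeAt j) v)
      apart {i} {j} i≢j j≢ni i≢nj (v , _ , p , q) with ends i p | ends j q
      ... | inj₁ r | inj₁ t = i≢j (vertex-distinct (≡.trans (≡.sym r) t))
      ... | inj₁ r | inj₂ t = i≢nj (vertex-distinct (≡.trans (≡.sym r) t))
      ... | inj₂ r | inj₁ t = j≢ni (vertex-distinct (≡.trans (≡.sym t) r))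
      ... | inj₂ r | inj₂ t = i≢j (next-injective (vertex-distinct (≡.trans (≡.sym r) t)))

  atMostOneCycle : (∀ (C D : LooseCycle H) → SameCycle C D) → AtMostOneCycle Γ
  atMostOneCycle same C D i with looseCycle C | looseCycle D
  ... | C′ , C′⊆C , _ | D′ , _ , D⊆D′ with D⊆D′ i
  ...   | i′ , eq with Equivalence.from (same C′ D′ _) (i′ , ≡.refl)
  ...     | j , eq′ with C′⊆C j
  ...       | j′ , eq″ = j′ , ≡.trans eq″ (≡.trans (≡.cong E.to eq′) eq)

  sameCycle : AtMostOneCycle Γ → ∀ (C D : LooseCycle H) → SameCycle C D
  sameCycle unique C D e = mk⇔ (included C D) (included D C)
    where
    included : ∀ C D {e} → ∃[ i ] LooseCycle.cycleEdge C i ≡ e → ∃[ i ] LooseCycle.cycleEdge D i ≡ e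
    included C D (i , ≡.refl) with cycle C | cycle D
    ... | C′ , C⊆C′ , _ | D′ , _ , D′⊆D with C⊆C′ i
    ...   | i′ , eq with unique D′ C′ i′
    ...     | j , eq′ with D′⊆D j
    ...       | j′ , eq″ = j′ , ↔-injective edges (≡.trans eq″ (≡.trans eq′ eq))

-- Adjacency, and what a second short cycle would contradict.

module Adjacency (Γ : Graph) where

  open Graph Γ

  Adj : Fin n → Fin n → Set
  Adj v w = ∃[ e ] Joins e v w

  joins? : ∀ e v w → Dec (Joins e v w)
  joins? e v w = ((v ≟ src e) ×-dec (w ≟ tgt e)) ⊎-dec ((v ≟ tgt e) ×-dec (w ≟ src e))

  adj? : ∀ v w → Dec (Adj v w)
  adj? v w = any? λ e → joins? e v w

  ends? : ∀ e v → Dec (Ends e v)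
  ends? e v = (v ≟ src e) ⊎-dec (v ≟ tgt e)

  Adj-sym : ∀ {v w} → Adj v w → Adj w v
  Adj-sym (e , j) = e , Joins-sym j

  Adj-irrefl : ∀ {v} → ¬ Adj v v
  Adj-irrefl (_ , j) = Joins⇒≢ j ≡.refl

  Adj⇒≢ : ∀ {v w} → Adj v w → v ≢ w
  Adj⇒≢ (_ , j) = Joins⇒≢ j

  -- The count is phrased positively: once two missing edges are known, every further edge is a
  -- spoke at `u`, which is the form in which the recognition lemmas take it.
  AtMostTwoMiss : Fin n → Set
  AtMostTwoMiss u = ∀ {e f g} → e ≢ f → e ≢ g → f ≢ g → ¬ Ends e u → ¬ Ends f u → Ends g u

  module _ (unique : AtMostOneCycle Γ) where

    open ShortCycles Γ

    -- Two triangles at `u` have the same vertices by `on-cycle`; what is left is the order of the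
    -- other two.
    unique-triangle : ∀ {u x z v w} → Adj u x → Adj u z → Adj x z → Adj u v → Adj u w → Adj v w →
      (v ≡ x × w ≡ z) ⊎ (v ≡ z × w ≡ x)
    unique-triangle {u} {x} {z} {v} {w} (_ , ux) uz@(_ , uz′) (_ , xz) (_ , uv) uw@(_ , uw′) (_ , vw)
      with on-cycle unique C D 1F | on-cycle unique C D 2F
      where
      C = triangle-cycle ux xz (Joins-sym uz′)
      D = triangle-cycle uv vw (Joins-sym uw′)
    ... | 0F , eq | _       = contradiction eq (Joins⇒≢ uv)
    ... | 1F , _  | 0F , eq = contradiction eq (Joins⇒≢ uw′)
    ... | 1F , p  | 1F , q  = contradiction (≡.trans (≡.sym p) q) (Joins⇒≢ vw)
    ... | 1F , p  | 2F , q  = inj₁ (≡.sym p , ≡.sym q)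
    ... | 2F , _  | 0F , eq = contradiction eq (Joins⇒≢ uw′)
    ... | 2F , p  | 1F , q  = inj₂ (≡.sym p , ≡.sym q)
    ... | 2F , p  | 2F , q  = contradiction (≡.trans (≡.sym p) q) (Joins⇒≢ vw)

    -- Otherwise u v w v′ is a square, and its vertex `w`, neither `u` nor adjacent to `u`, would
    -- have to lie on the triangle. In the counting this bounds the common neighbours of `u` and `w`
    -- by one.
    no-triangle-and-square : ∀ {u x z v v′ w} → Adj u x → Adj u z → Adj x z →
      u ≢ w → ¬ Adj u w → Adj u v → Adj u v′ → Adj v w → Adj v′ w → v ≡ v′
    no-triangle-and-square {v = v} {v′} (_ , ux) uz@(_ , uz′) (_ , xz) u≢w ¬uw (_ , uv) (_ , uv′) (_ , vw) (_ , v′w)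
      with v ≟ v′
    ... | yes eq = eq
    ... | no v≢v′ with on-cycle unique (triangle-cycle ux xz (Joins-sym uz′))
                         (square-cycle u≢w v≢v′ uv vw (Joins-sym v′w) (Joins-sym uv′)) 2F
    ...   | 0F , eq = contradiction eq u≢w
    ...   | 1F , ≡.refl = contradiction (_ , ux) ¬uw
    ...   | 2F , ≡.refl = contradiction uz ¬uw

    -- The squares u v₁ w v₂ and u v₁ w v₃ would be two cycles, since v₃ is not on the first. In the
    -- counting this bounds the common neighbours of `u` and `w` by two.
    no-three-paths : ∀ {u w v₁ v₂ v₃} → u ≢ w → v₁ ≢ v₂ → v₁ ≢ v₃ → v₂ ≢ v₃ →
      Adj u v₁ → Adj w v₁ → Adj u v₂ → Adj w v₂ → Adj u v₃ → ¬ Adj w v₃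
    no-three-paths u≢w v₁≢v₂ v₁≢v₃ v₂≢v₃ (_ , uv₁) (_ , wv₁) (_ , uv₂) (_ , wv₂) (_ , uv₃) (_ , wv₃)
      with on-cycle unique (square-cycle u≢w v₁≢v₂ uv₁ (Joins-sym wv₁) wv₂ (Joins-sym uv₂))
             (square-cycle u≢w v₁≢v₃ uv₁ (Joins-sym wv₁) wv₃ (Joins-sym uv₃)) 3F
    ... | 0F , eq = Joins⇒≢ uv₃ eq
    ... | 1F , eq = v₁≢v₃ eq
    ... | 2F , eq = Joins⇒≢ wv₃ eq
    ... | 3F , eq = v₂≢v₃ eq

-- Isomorphisms of graphs and the recognition of a graph from a small subgraph.

infix 4 _≅ᴳ_

record _≅ᴳ_ (Γ Γ′ : Graph) : Set where
  private
    module Γ = Graph Γ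
    module Γ′ = Graph Γ′
  field
    vertices : Fin Γ.n ↔ Fin Γ′.n
    edges    : Fin Γ.k ↔ Fin Γ′.k
    joins    : ∀ e → Γ′.Joins (Inverse.to edges e) (Inverse.to vertices (Γ.src e)) (Inverse.to vertices (Γ.tgt e))

≅ᴳ-power : ∀ {p Γ Γ′ H} → Γ ≅ᴳ Γ′ → IsPower p Γ′ H → IsPower p Γ H
≅ᴳ-power {p} {Γ} {Γ′} {H} iso power = record
  { vertices = mk↔ₛ′ (relabel⁻¹ ∘ V.to) (V.from ∘ relabel)
      (λ x → ≡.trans (≡.cong relabel⁻¹ (V.strictlyInverseˡ _)) (relabel⁻¹-relabel x))
      (λ v → ≡.trans (≡.cong V.from (relabel-relabel⁻¹ _)) (V.strictlyInverseʳ v))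
  ; edges = ↔-sym I.edges ↔-∘ P.edges
  ; incidence = λ v i → mk⇔ (λ v∈i → forward (V.to v) (Equivalence.to (P.incidence v i) v∈i))
      (λ mem → Equivalence.from (P.incidence v i) (backward (V.to v) mem))
  }
  where
  module I = _≅ᴳ_ iso
  module P = IsPower power
  module V = Inverse P.vertices
  module IV = Inverse I.vertices
  module IE = Inverse I.edges
  module Γ = Graph Γ
  module Γ′ = Graph Γ′
  relabel : Label p Γ → Label p Γ′
  relabel (inj₁ v) = inj₁ (IV.to v)
  relabel (inj₂ (e , i)) = inj₂ (IE.to e , i)
  relabel⁻¹ : Label p Γ′ → Label p Γ
  relabel⁻¹ (inj₁ v) = inj₁ (IV.from v)
  relabel⁻¹ (inj₂ (e , i)) = inj₂ (IE.from e , i)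
  relabel⁻¹-relabel : ∀ x → relabel⁻¹ (relabel x) ≡ x
  relabel⁻¹-relabel (inj₁ v) = ≡.cong inj₁ (IV.strictlyInverseʳ v)
  relabel⁻¹-relabel (inj₂ (e , i)) = ≡.cong (λ e → inj₂ (e , i)) (IE.strictlyInverseʳ e)
  relabel-relabel⁻¹ : ∀ x → relabel (relabel⁻¹ x) ≡ x
  relabel-relabel⁻¹ (inj₁ v) = ≡.cong inj₁ (IV.strictlyInverseˡ v)
  relabel-relabel⁻¹ (inj₂ (e , i)) = ≡.cong (λ e → inj₂ (e , i)) (IE.strictlyInverseˡ e)
  V-from-injective : ∀ {v w} → IV.from v ≡ IV.from w → v ≡ w
  V-from-injective {v} {w} eq = ≡.trans (≡.sym (IV.strictlyInverseˡ v)) (≡.trans (≡.cong IV.to eq) (IV.strictlyInverseˡ w))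
  joins′ : ∀ e → Γ′.Joins e (IV.to (Γ.src (IE.from e))) (IV.to (Γ.tgt (IE.from e)))
  joins′ e = ≡.subst (λ f → Γ′.Joins f _ _) (IE.strictlyInverseˡ e) (I.joins (IE.from e))
  forward : ∀ x {e} → Member Γ′ x e → Member Γ (relabel⁻¹ x) (IE.from e)
  forward (inj₁ v) {e} end with joins′ e | end
  ... | inj₁ (p , _) | inj₁ ≡.refl = inj₁ (≡.trans (≡.cong IV.from (≡.sym p)) (IV.strictlyInverseʳ _))
  ... | inj₁ (_ , q) | inj₂ ≡.refl = inj₂ (≡.trans (≡.cong IV.from (≡.sym q)) (IV.strictlyInverseʳ _))
  ... | inj₂ (_ , q) | inj₁ ≡.refl = inj₂ (≡.trans (≡.cong IV.from (≡.sym q)) (IV.strictlyInverseʳ _))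
  ... | inj₂ (p , _) | inj₂ ≡.refl = inj₁ (≡.trans (≡.cong IV.from (≡.sym p)) (IV.strictlyInverseʳ _))
  forward (inj₂ _) ≡.refl = ≡.refl
  backward : ∀ x {e} → Member Γ (relabel⁻¹ x) (IE.from e) → Member Γ′ x e
  backward (inj₁ v) {e} end with joins′ e | end
  ... | inj₁ (p , _) | inj₁ r = inj₁ (≡.trans (V-from-injective (≡.trans r (≡.sym (IV.strictlyInverseʳ _)))) p)
  ... | inj₁ (_ , q) | inj₂ r = inj₂ (≡.trans (V-from-injective (≡.trans r (≡.sym (IV.strictlyInverseʳ _)))) q)
  ... | inj₂ (p , _) | inj₁ r = inj₂ (≡.trans (V-from-injective (≡.trans r (≡.sym (IV.strictlyInverseʳ _)))) p)
  ... | inj₂ (_ , q) | inj₂ r = inj₁ (≡.trans (V-from-injective (≡.trans r (≡.sym (IV.strictlyInverseʳ _)))) q)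
  backward (inj₂ (f , _)) {e} eq = ≡.trans (≡.sym (IE.strictlyInverseˡ f)) (≡.trans (≡.cong IE.to eq) (IE.strictlyInverseˡ e))

-- Incidence depends on the labels alone. Together with `≅ᴳ-power` this turns a shape of the
-- underlying graph into an isomorphism with one of the three given hypergraphs, which the last
-- claim of the theorem excludes.
powers-≅ : ∀ {p Γ H K} → IsPower p Γ H → IsPower p Γ K → H ≅ K
powers-≅ {p} {Γ} {H} {K} P Q = record
  { vertices = ↔-sym Q.vertices ↔-∘ P.vertices
  ; edges = ↔-sym Q.edges ↔-∘ P.edges
  ; incidence = λ v i → mk⇔
      (λ v∈i → Equivalence.from (Q.incidence _ _) (≡.subst₂ (Member Γ)
        (≡.sym (QV.strictlyInverseˡ _)) (≡.sym (QE.strictlyInverseˡ _)) (Equivalence.to (P.incidence v i) v∈i)))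
      (λ v∈i → Equivalence.from (P.incidence v i) (≡.subst₂ (Member Γ)
        (QV.strictlyInverseˡ _) (QE.strictlyInverseˡ _) (Equivalence.to (Q.incidence _ _) v∈i)))
  }
  where
  module P = IsPower P
  module Q = IsPower Q
  module QV = Inverse Q.vertices
  module QE = Inverse Q.edges

-- By induction, the image of `0F` is punched out of the target and put back by `insert`. This
-- numbers the edges of a graph so that those of a given copy come first and the pendant ones
-- follow.
extend-injection : ∀ a {q k} → k ≡ a ℕ.+ q → (f : Fin a → Fin k) → Injective _≡_ _≡_ f →
  Σ[ π ∈ (Fin (a ℕ.+ q) ↔ Fin k) ] ∀ i → Inverse.to π (i ↑ˡ q) ≡ f i
extend-injection zero    ≡.refl f _ = idᴾ , λ ()
extend-injection (suc a) {q} ≡.refl f f-injective = insert 0F (f 0F) π , extends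
  where
  f0≢ : ∀ i → f 0F ≢ f (suc i)
  f0≢ i eq = contradiction (f-injective eq) λ ()
  IH = extend-injection a ≡.refl (λ i → punchOut (f0≢ i))
    (λ {i} {j} eq → suc-injective (f-injective (punchOut-injective (f0≢ i) (f0≢ j) eq)))
  π = proj₁ IH
  extends : ∀ i → insert 0F (f 0F) π ⟨$⟩ʳ (i ↑ˡ q) ≡ f i
  extends 0F = ≡.refl
  extends (suc i) = ≡.trans (insert-punchIn 0F (f 0F) π (i ↑ˡ q))
    (≡.trans (≡.cong (punchIn (f 0F)) (proj₂ IH i)) (punchIn-punchOut (f0≢ i)))

-- Suppose that the edges of Γ outside a copy of Γ₀ all contain u and leave
-- the copy; then Γ arises from Γ₀ by attaching pendant edges at u.
module Embedding (Γ : Graph) (covered : ∀ v → ∃[ e ] Graph.Ends Γ e v) (Γ₀ : Graph)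
    (φ₀ : Fin (Graph.n Γ₀) → Fin (Graph.n Γ)) (φ₀-injective : Injective _≡_ _≡_ φ₀)
    (ψ₀ : Fin (Graph.k Γ₀) → Fin (Graph.k Γ)) (ψ₀-injective : Injective _≡_ _≡_ ψ₀)
    (joins₀ : ∀ e → Graph.Joins Γ (ψ₀ e) (φ₀ (Graph.src Γ₀ e)) (φ₀ (Graph.tgt Γ₀ e)))
    (h : Fin (Graph.n Γ₀))
    (outside-hub : ∀ e → (∀ i → ψ₀ i ≢ e) → Graph.Ends Γ e (φ₀ h))
    (outside-leaves : ∀ e i → Graph.Joins Γ e (φ₀ h) (φ₀ i) → ∃[ j ] ψ₀ j ≡ e) where

  open Graph Γ
  private
    module Γ₀ = Graph Γ₀
    u = φ₀ h

  -- The edges beyond the copy are spokes at `u`. Their far ends are pairwise distinct by simplicity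
  -- and lie outside the copy by `outside-leaves`; since every vertex is on some edge, copy and far
  -- ends exhaust the graph, and no vertices need to be counted.
  embedding-≅ᴳ : ∀ {q} → k ≡ Γ₀.k ℕ.+ q → addPendants Γ₀ {q} (λ _ → h) ≅ᴳ Γ
  embedding-≅ᴳ {q} k≡ = record
    { vertices = mk↔ₛ′ φ (proj₁ ∘ φ-surjective) (proj₂ ∘ φ-surjective)
        (λ x → φ-injective (proj₂ (φ-surjective (φ x))))
    ; edges = π
    ; joins = joins
    }
    where
    extension = extend-injection Γ₀.k k≡ ψ₀ ψ₀-injective
    π = proj₁ extension
    π-extends = proj₂ extension
    module π = Inverse π

    leaf-outside : ∀ j i → ψ₀ i ≢ π.to (Γ₀.k ↑ʳ j)
    leaf-outside j i eq = ↑ˡ≢↑ʳ (↔-injective π (≡.trans (π-extends i) eq))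

    leaf : ∀ j → ∃[ w ] Joins (π.to (Γ₀.k ↑ʳ j)) u w
    leaf j = Ends⇒Joins (outside-hub _ (leaf-outside j))

    vertex : Fin Γ₀.n ⊎ Fin q → Fin n
    vertex = [ φ₀ , proj₁ ∘ leaf ]′

    φ : Fin (Γ₀.n ℕ.+ q) → Fin n
    φ = vertex ∘ splitAt Γ₀.n

    vertex-injective : ∀ x y → vertex x ≡ vertex y → x ≡ y
    vertex-injective (inj₁ i) (inj₁ j) eq = ≡.cong inj₁ (φ₀-injective eq)
    vertex-injective (inj₁ i) (inj₂ j) eq with outside-leaves _ i (≡.subst (Joins _ u) (≡.sym eq) (proj₂ (leaf j)))
    ... | i′ , eq′ = contradiction eq′ (leaf-outside j i′)
    vertex-injective (inj₂ i) (inj₁ j) eq = ≡.sym (vertex-injective (inj₁ j) (inj₂ i) (≡.sym eq))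
    vertex-injective (inj₂ i) (inj₂ j) eq = ≡.cong inj₂ (↑ʳ-injective Γ₀.k i j (↔-injective π
      (simple (proj₂ (leaf i)) (≡.subst (Joins _ u) (≡.sym eq) (proj₂ (leaf j))))))

    φ-injective : ∀ {x y} → φ x ≡ φ y → x ≡ y
    φ-injective {x} {y} eq with splitAt Γ₀.n x in eqx | splitAt Γ₀.n y in eqy | vertex-injective (splitAt Γ₀.n x) (splitAt Γ₀.n y) eq
    ... | inj₁ i | inj₁ j | ≡.refl = ≡.trans (≡.sym (splitAt⁻¹-↑ˡ eqx)) (splitAt⁻¹-↑ˡ eqy)
    ... | inj₂ i | inj₂ j | ≡.refl = ≡.trans (≡.sym (splitAt⁻¹-↑ʳ eqx)) (splitAt⁻¹-↑ʳ eqy)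

    φ-old : ∀ i → φ (i ↑ˡ q) ≡ φ₀ i
    φ-old i = ≡.cong vertex (splitAt-↑ˡ Γ₀.n i q)

    φ-leaf : ∀ j → φ (Γ₀.n ↑ʳ j) ≡ proj₁ (leaf j)
    φ-leaf j = ≡.cong vertex (splitAt-↑ʳ Γ₀.n q j)

    on-edge : ∀ x {v} → Ends (π.to x) v → ∃[ y ] φ y ≡ v
    on-edge x {v} end with splitAt Γ₀.k x in eq
    ... | inj₁ e with end-of (joins₀ e) (≡.subst (λ f → Ends f v) (≡.trans (≡.cong π.to (≡.sym (splitAt⁻¹-↑ˡ eq))) (π-extends e)) end)
    ...   | inj₁ ≡.refl = _ , φ-old _
    ...   | inj₂ ≡.refl = _ , φ-old _
    on-edge x {v} end | inj₂ j with end-of (proj₂ (leaf j)) (≡.subst (λ y → Ends (π.to y) v) (≡.sym (splitAt⁻¹-↑ʳ eq)) end)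
    ...   | inj₁ ≡.refl = _ , φ-old h
    ...   | inj₂ ≡.refl = _ , φ-leaf j

    φ-surjective : ∀ v → ∃[ y ] φ y ≡ v
    φ-surjective v with covered v
    ... | e , end = on-edge (π.from e) (≡.subst (λ f → Ends f v) (≡.sym (π.strictlyInverseˡ e)) end)

    open Graph (addPendants Γ₀ {q} (λ _ → h)) using () renaming (src to src⁺; tgt to tgt⁺)

    joins : ∀ e → Joins (π.to e) (φ (src⁺ e)) (φ (tgt⁺ e))
    joins e with splitAt Γ₀.k e in eq
    ... | inj₁ i = ≡.subst₂ (Joins _) (≡.sym (φ-old _)) (≡.sym (φ-old _))
      (≡.subst (λ f → Joins f _ _) (≡.trans (≡.sym (π-extends i)) (≡.cong π.to (splitAt⁻¹-↑ˡ eq))) (joins₀ i))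
    ... | inj₂ j = ≡.subst₂ (Joins _) (≡.sym (φ-old _)) (≡.sym (φ-leaf j))
      (≡.subst (λ f → Joins (π.to f) _ _) (splitAt⁻¹-↑ʳ eq) (proj₂ (leaf j)))

-- The shapes of a graph in which at most two edges miss the hub.

private
  ∷-injective : ∀ {m n} {x : Fin n} {f : Fin m → Fin n} → (∀ i → x ≢ f i) → Injective _≡_ _≡_ f → Injective _≡_ _≡_ (x ∷ᵛ f)
  ∷-injective x∉f f-injective {0F}    {0F}    _  = ≡.refl
  ∷-injective x∉f f-injective {0F}    {suc j} eq = contradiction eq (x∉f j)
  ∷-injective x∉f f-injective {suc i} {0F}    eq = contradiction (≡.sym eq) (x∉f i)
  ∷-injective x∉f f-injective {suc i} {suc j} eq = ≡.cong suc (f-injective eq)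

  []-injective : ∀ {n} → Injective _≡_ _≡_ ([]ᵛ {A = Fin n})
  []-injective {_} {()}

-- The arguments are chosen so that all four graphs have 5 + q edges.
data Shape (Γ : Graph) (q : ℕ) : Set where
  shape₁ : graph₁ (2 ℕ.+ q) ≅ᴳ Γ → Shape Γ q
  shape₂ : graph₂ (1 ℕ.+ q) ≅ᴳ Γ → Shape Γ q
  shape₃ : graph₃ q ≅ᴳ Γ → Shape Γ q
  shape₄ : graph₄ (1 ℕ.+ q) ≅ᴳ Γ → Shape Γ q

module HubShapes (Γ : Graph) (covered : ∀ v → ∃[ e ] Graph.Ends Γ e v) (u : Fin (Graph.n Γ)) where

  open Graph Γ
  open Adjacency Γ

  private
    ¬end⇒≢ : ∀ {e f} → Ends f u → ¬ Ends e u → f ≢ e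
    ¬end⇒≢ end ¬end ≡.refl = ¬end end

    at : ∀ {e f v} → Joins e u v → Joins f u v → e ≡ f
    at = simple

    spokes-≢ : ∀ {e f v w} → Joins e u v → Joins f u w → v ≢ w → e ≢ f
    spokes-≢ (inj₁ (p , q)) (inj₁ (r , t)) v≢w ≡.refl = v≢w (≡.trans q (≡.sym t))
    spokes-≢ (inj₁ (p , q)) (inj₂ (r , t)) v≢w ≡.refl = loopless _ (≡.trans (≡.sym p) r)
    spokes-≢ (inj₂ (p , q)) (inj₁ (r , t)) v≢w ≡.refl = loopless _ (≡.trans (≡.sym r) p)
    spokes-≢ (inj₂ (p , q)) (inj₂ (r , t)) v≢w ≡.refl = v≢w (≡.trans q (≡.sym t))

  module _ {a b ea eb f} (ua : Joins ea u a) (ub : Joins eb u b) (ab : Joins f a b) (f∌u : ¬ Ends f u) where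

    private
      a≢b = Joins⇒≢ ab
      u≢a = Joins⇒≢ ua
      u≢b = Joins⇒≢ ub
      ea≢f = ¬end⇒≢ (Joins⇒Ends ua) f∌u
      eb≢f = ¬end⇒≢ (Joins⇒Ends ub) f∌u
      ea≢eb = spokes-≢ ua ub a≢b

    to-graph₁ : (∀ e → e ≢ f → Ends e u) → ∀ {q} → k ≡ 3 ℕ.+ q → graph₁ q ≅ᴳ Γ
    to-graph₁ spokes = Embedding.embedding-≅ᴳ Γ covered triangleGraph
      (Cycle.vertex cyc₃) (Cycle.vertex-distinct cyc₃)
      (Cycle.edgeAt cyc₃) (Cycle.edge-distinct cyc₃) (Cycle.joins cyc₃)
      0F
      (λ e e∉ → spokes e (e∉ 1F ∘ ≡.sym))
      (λ { e 0F j → contradiction ≡.refl (Joins⇒≢ j) ; e 1F j → 0F , at ua j ; e 2F j → 2F , at ub j })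
      where cyc₃ = ShortCycles.triangle-cycle Γ ua ab (Joins-sym ub)

    module _ {l g} (l≢u : l ≢ u) (ul : ¬ Adj u l) (g∌u : ¬ Ends g u) (spokes : ∀ e → e ≢ f → e ≢ g → Ends e u) where

      private
        l≢ : ∀ {v e} → Joins e u v → v ≢ l
        l≢ j ≡.refl = ul (_ , j)

      to-graph₂ : Joins g a l → ∀ {q} → k ≡ 4 ℕ.+ q → graph₂ q ≅ᴳ Γ
      to-graph₂ al = Embedding.embedding-≅ᴳ Γ covered (addPendants triangleGraph {1} (λ _ → 1F))
        (u ∷ᵛ a ∷ᵛ b ∷ᵛ l ∷ᵛ []ᵛ)
        (∷-injective (λ { 0F → u≢a ; 1F → u≢b ; 2F → l≢u ∘ ≡.sym }) (∷-injective (λ { 0F → a≢b ; 1F → l≢ ua })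
          (∷-injective (λ { 0F → l≢ ub }) (∷-injective (λ ()) []-injective))))
        (ea ∷ᵛ f ∷ᵛ eb ∷ᵛ g ∷ᵛ []ᵛ)
        (∷-injective (λ { 0F → ea≢f ; 1F → ea≢eb ; 2F → ¬end⇒≢ (Joins⇒Ends ua) g∌u })
          (∷-injective (λ { 0F → eb≢f ∘ ≡.sym ; 1F → f≢g })
            (∷-injective (λ { 0F → ¬end⇒≢ (Joins⇒Ends ub) g∌u }) (∷-injective (λ ()) []-injective))))
        (λ { 0F → ua ; 1F → ab ; 2F → Joins-sym ub ; 3F → al })
        0F
        (λ e e∉ → spokes e (e∉ 1F ∘ ≡.sym) (e∉ 3F ∘ ≡.sym))
        (λ { e 0F j → contradiction ≡.refl (Joins⇒≢ j) ; e 1F j → 0F , at ua j ; e 2F j → 2F , at ub j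
           ; e 3F j → contradiction (e , j) ul })
        where
        f≢g : f ≢ g
        f≢g eq with same-ends ab (≡.subst (λ e → Joins e a l) (≡.sym eq) al)
        ... | inj₁ (_ , l≡b) = l≢ ub (≡.sym l≡b)
        ... | inj₂ (a≡b , _) = a≢b a≡b

      to-graph₃ : ∀ {w ew} → Joins ew u w → a ≢ w → b ≢ w → Joins g w l → ∀ {q} → k ≡ 5 ℕ.+ q → graph₃ q ≅ᴳ Γ
      to-graph₃ {w} {ew} uw a≢w b≢w wl = Embedding.embedding-≅ᴳ Γ covered
        (addPendants (addPendants triangleGraph {1} (λ _ → 0F)) {1} (λ _ → 3F))
        (u ∷ᵛ a ∷ᵛ b ∷ᵛ w ∷ᵛ l ∷ᵛ []ᵛ)
        (∷-injective (λ { 0F → u≢a ; 1F → u≢b ; 2F → Joins⇒≢ uw ; 3F → l≢u ∘ ≡.sym })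
          (∷-injective (λ { 0F → a≢b ; 1F → a≢w ; 2F → l≢ ua })
            (∷-injective (λ { 0F → b≢w ; 1F → l≢ ub }) (∷-injective (λ { 0F → l≢ uw }) (∷-injective (λ ()) []-injective)))))
        (ea ∷ᵛ f ∷ᵛ eb ∷ᵛ ew ∷ᵛ g ∷ᵛ []ᵛ)
        (∷-injective (λ { 0F → ea≢f ; 1F → ea≢eb ; 2F → spokes-≢ ua uw a≢w ; 3F → ¬end⇒≢ (Joins⇒Ends ua) g∌u })
          (∷-injective (λ { 0F → eb≢f ∘ ≡.sym ; 1F → ¬end⇒≢ (Joins⇒Ends uw) f∌u ∘ ≡.sym ; 2F → f≢g })
            (∷-injective (λ { 0F → spokes-≢ ub uw b≢w ; 1F → ¬end⇒≢ (Joins⇒Ends ub) g∌u })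
              (∷-injective (λ { 0F → ¬end⇒≢ (Joins⇒Ends uw) g∌u }) (∷-injective (λ ()) []-injective)))))
        (λ { 0F → ua ; 1F → ab ; 2F → Joins-sym ub ; 3F → uw ; 4F → wl })
        0F
        (λ e e∉ → spokes e (e∉ 1F ∘ ≡.sym) (e∉ 4F ∘ ≡.sym))
        (λ { e 0F j → contradiction ≡.refl (Joins⇒≢ j) ; e 1F j → 0F , at ua j ; e 2F j → 2F , at ub j
           ; e 3F j → 3F , at uw j ; e 4F j → contradiction (e , j) ul })
        where
        f≢g : f ≢ g
        f≢g eq with same-ends ab (≡.subst (λ e → Joins e w l) (≡.sym eq) wl)
        ... | inj₁ (w≡a , _) = a≢w (≡.sym w≡a)
        ... | inj₂ (w≡b , _) = b≢w (≡.sym w≡b)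

  to-graph₄ : ∀ {a x b ea e₁ e₂ eb} → Joins ea u a → Joins e₁ a x → Joins e₂ x b → Joins eb b u →
    u ≢ x → a ≢ b → ¬ Adj u x → (∀ e → e ≢ e₁ → e ≢ e₂ → Ends e u) → ∀ {q} → k ≡ 4 ℕ.+ q → graph₄ q ≅ᴳ Γ
  to-graph₄ {a} {x} {b} {ea} {e₁} {e₂} {eb} ua ax xb bu u≢x a≢b ¬ux spokes = Embedding.embedding-≅ᴳ Γ covered squareGraph
    (Cycle.vertex cyc₄) (Cycle.vertex-distinct cyc₄)
    (Cycle.edgeAt cyc₄) (Cycle.edge-distinct cyc₄) (Cycle.joins cyc₄)
    0F
    (λ e e∉ → spokes e (e∉ 1F ∘ ≡.sym) (e∉ 2F ∘ ≡.sym))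
    (λ { e 0F j → contradiction ≡.refl (Joins⇒≢ j) ; e 1F j → 0F , at ua j ; e 2F j → contradiction (e , j) ¬ux
       ; e 3F j → 3F , at (Joins-sym bu) j })
    where cyc₄ = ShortCycles.square-cycle Γ u≢x a≢b ua ax xb bu

module Classify (Γ : Graph) (connected : ∀ v w → Star (Adjacency.Adj Γ) v w)
    (unique : AtMostOneCycle Γ) (C : Cycle Γ) where

  open Graph Γ
  open Adjacency Γ
  open Cycle C

  covered : ∀ v → ∃[ e ] Ends e v
  covered v with vertex 0F ≟ v
  ... | no v₀≢v = first (connected v (vertex 0F)) (v₀≢v ∘ ≡.sym)
    where
    first : ∀ {v w} → Star Adj v w → v ≢ w → ∃[ e ] Ends e v
    first ε v≢v = contradiction ≡.refl v≢v
    first ((e , j) ◅ _) _ = e , Joins⇒Ends j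
  ... | yes ≡.refl = _ , Joins⇒Ends (joins 0F)

  module _ (u : Fin n) (few : AtMostTwoMiss u) where

    open HubShapes Γ covered u

    private
      avoids : ∀ {e v w} → v ≢ u → w ≢ u → Joins e v w → ¬ Ends e u
      avoids v≢u w≢u joins end with end-of joins end
      ... | inj₁ u≡v = v≢u (≡.sym u≡v)
      ... | inj₂ u≡w = w≢u (≡.sym u≡w)

      misses : ∀ i → vertex i ≢ u → vertex (next i) ≢ u → ¬ Ends (edgeAt i) u
      misses i v≢u w≢u = avoids v≢u w≢u (joins i)

      closing : ∀ i {j} → next i ≡ j → Adj (vertex i) (vertex j)
      closing i ≡.refl = edgeAt i , joins i

      edge-≢ : ∀ {i j} → i ≢ j → edgeAt i ≢ edgeAt j
      edge-≢ i≢j = i≢j ∘ edge-distinct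

    TriangleAt SquareAt : Set
    TriangleAt = ∃[ a ] ∃[ b ] Adj u a × Adj u b × Adj a b
    SquareAt = ∃[ a ] ∃[ x ] ∃[ b ] u ≢ x × a ≢ b × Adj u a × Adj a x × Adj x b × Adj b u

    -- Three consecutive edges of the cycle cannot all miss u, so the cycle
    -- passes through u and has at most two further edges.
    short-cycle : TriangleAt ⊎ SquareAt
    short-cycle with any? (λ i → vertex i ≟ u)
    ... | no off = contradiction (few (edge-≢ (next≢ _ ∘ ≡.sym)) (edge-≢ (next²≢ _ ∘ ≡.sym)) (edge-≢ (next≢ _ ∘ ≡.sym))
        (miss 0F) (miss (next 0F))) (miss (next (next 0F)))
      where
      miss : ∀ i → ¬ Ends (edgeAt i) u
      miss i = misses i (λ eq → off (i , eq)) (λ eq → off (next i , eq))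
    ... | yes (i , ≡.refl) with next (next (next i)) ≟ i
    ...   | yes i₃≡i = inj₁ (_ , _ , (_ , joins i) , Adj-sym (closing (next (next i)) i₃≡i) , (_ , joins (next i)))
    ...   | no i₃≢i with next (next (next (next i))) ≟ i
    ...     | yes i₄≡i = inj₂ (_ , _ , _ , (λ eq → next²≢ i (≡.sym (vertex-distinct eq))) ,
      (λ eq → next²≢ (next i) (≡.sym (vertex-distinct eq))) , (_ , joins i) , (_ , joins (next i)) , (_ , joins (next (next i))) ,
      closing (next (next (next i))) i₄≡i)
    ...     | no i₄≢i = contradiction (few (edge-≢ (next≢ _ ∘ ≡.sym)) (edge-≢ (next²≢ _ ∘ ≡.sym)) (edge-≢ (next≢ _ ∘ ≡.sym))
        (misses (next i) (next≢ i ∘ vertex-distinct) (next²≢ i ∘ vertex-distinct))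
        (misses (next (next i)) (next²≢ i ∘ vertex-distinct) (i₃≢i ∘ vertex-distinct)))
        (misses (next (next (next i))) (i₃≢i ∘ vertex-distinct) (i₄≢i ∘ vertex-distinct))

    private
      at-hub : ∀ {e v w} → v ≢ u → Joins e v w → Ends e u → w ≡ u
      at-hub v≢u joins end with end-of joins end
      ... | inj₁ u≡v = contradiction (≡.sym u≡v) v≢u
      ... | inj₂ u≡w = ≡.sym u≡w

    module _ {a b : Fin n} (ua : Adj u a) (ub : Adj u b) (ab : Adj a b) where

      private
        f = proj₁ ab
        f∌u : ¬ Ends f u
        f∌u = avoids (Adj⇒≢ ua ∘ ≡.sym) (Adj⇒≢ ub ∘ ≡.sym) (proj₂ ab)

      -- Two edges miss `u`: the side `f` of the triangle and `g`, which hangs at a neighbour `w` of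
      -- `u`. If `w` is a corner of the triangle the graph is the second one, otherwise the third.
      pendant-shape : ∀ {g w l} → g ≢ f → ¬ Ends g u → Joins g w l → Adj u w → ¬ Adj u l → ∀ {q} → k ≡ 5 ℕ.+ q → Shape Γ q
      pendant-shape {g} {w} {l} g≢f g∌u wl uw ul {q} k≡ with a ≟ w | b ≟ w
      ... | yes ≡.refl | _ = shape₂ (to-graph₂ (proj₂ ua) (proj₂ ub) (proj₂ ab) f∌u l≢u ul g∌u spokes wl k≡)
        where
        l≢u : l ≢ u
        l≢u ≡.refl = g∌u (Joins⇒Ends (Joins-sym wl))
        spokes : ∀ e → e ≢ f → e ≢ g → Ends e u
        spokes e e≢f e≢g = few (g≢f ∘ ≡.sym) (e≢f ∘ ≡.sym) (e≢g ∘ ≡.sym) f∌u g∌u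
      ... | no _ | yes ≡.refl = shape₂ (to-graph₂ (proj₂ ub) (proj₂ ua) (Joins-sym (proj₂ ab)) f∌u l≢u ul g∌u spokes wl k≡)
        where
        l≢u : l ≢ u
        l≢u ≡.refl = g∌u (Joins⇒Ends (Joins-sym wl))
        spokes : ∀ e → e ≢ f → e ≢ g → Ends e u
        spokes e e≢f e≢g = few (g≢f ∘ ≡.sym) (e≢f ∘ ≡.sym) (e≢g ∘ ≡.sym) f∌u g∌u
      ... | no a≢w | no b≢w = shape₃ (to-graph₃ (proj₂ ua) (proj₂ ub) (proj₂ ab) f∌u l≢u ul g∌u spokes (proj₂ uw) a≢w b≢w wl k≡)
        where
        l≢u : l ≢ u
        l≢u ≡.refl = g∌u (Joins⇒Ends (Joins-sym wl))
        spokes : ∀ e → e ≢ f → e ≢ g → Ends e u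
        spokes e e≢f e≢g = few (g≢f ∘ ≡.sym) (e≢f ∘ ≡.sym) (e≢g ∘ ≡.sym) f∌u g∌u

      -- An edge with both ends outside the closed neighbourhood of u would be a component.
      isolated : ∀ {g w l} → g ≢ f → ¬ Ends g u → Joins g w l → Adj u w ⊎ Adj u l
      isolated {g} {w} {l} g≢f g∌u wl with adj? u w | adj? u l
      ... | yes uw | _ = inj₁ uw
      ... | no _ | yes ul = inj₂ ul
      ... | no ¬uw | no ¬ul = contradiction (connected w u) (λ path → trapped path (inj₁ ≡.refl) ≡.refl)
        where
        w≢u : w ≢ u
        w≢u ≡.refl = g∌u (Joins⇒Ends wl)
        l≢u : l ≢ u
        l≢u ≡.refl = g∌u (Joins⇒Ends (Joins-sym wl))
        -- No walk leaves the two ends of `g`: the ends of `f` are neighbours of `u`, and every edge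
        -- other than `f` and `g` contains `u`, so either would make `w` or `l` adjacent to `u`.
        step : ∀ {v x} → v ≡ w ⊎ v ≡ l → Adj v x → x ≡ w ⊎ x ≡ l
        step {v} {x} v∈ (e , vx) with e ≟ g | e ≟ f
        step {v} {x} v∈ (e , vx) | yes ≡.refl | _ with same-ends wl vx
        ... | inj₁ (_ , x≡l) = inj₂ x≡l
        ... | inj₂ (_ , x≡w) = inj₁ x≡w
        step {v} {x} v∈ (e , vx) | no _ | yes ≡.refl with same-ends (proj₂ ab) vx | v∈
        ... | inj₁ (≡.refl , _) | inj₁ ≡.refl = contradiction ua ¬uw
        ... | inj₁ (≡.refl , _) | inj₂ ≡.refl = contradiction ua ¬ul
        ... | inj₂ (≡.refl , _) | inj₁ ≡.refl = contradiction ub ¬uw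
        ... | inj₂ (≡.refl , _) | inj₂ ≡.refl = contradiction ub ¬ul
        step {v} {x} v∈ (e , vx) | no e≢g | no e≢f
          with v∈ | few (g≢f ∘ ≡.sym) (e≢f ∘ ≡.sym) (e≢g ∘ ≡.sym) f∌u g∌u
        ... | inj₁ ≡.refl | eu with at-hub w≢u vx eu
        ...   | ≡.refl = contradiction (e , Joins-sym vx) ¬uw
        step {v} {x} v∈ (e , vx) | no e≢g | no e≢f | inj₂ ≡.refl | eu with at-hub l≢u vx eu
        ...   | ≡.refl = contradiction (e , Joins-sym vx) ¬ul
        trapped : ∀ {v x} → Star Adj v x → v ≡ w ⊎ v ≡ l → x ≢ u
        trapped ε (inj₁ ≡.refl) = w≢u
        trapped ε (inj₂ ≡.refl) = l≢u
        trapped (vx ◅ path) v∈ = trapped path (step v∈ vx)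

      triangle-shape : ∀ {q} → k ≡ 5 ℕ.+ q → Shape Γ q
      triangle-shape k≡ with any? (λ g → ¬? (g ≟ f) ×-dec ¬? (ends? g u))
      ... | no none = shape₁ (to-graph₁ (proj₂ ua) (proj₂ ub) (proj₂ ab) f∌u spokes k≡)
        where
        spokes : ∀ e → e ≢ f → Ends e u
        spokes e e≢f with ends? e u
        ... | yes end = end
        ... | no ¬end = contradiction (e , e≢f , ¬end) none
      ... | yes (g , g≢f , g∌u) with adj? u (src g) | adj? u (tgt g) | isolated g≢f g∌u (inj₁ (≡.refl , ≡.refl))
      ...   | yes us | no ¬ut | _ = pendant-shape g≢f g∌u (inj₁ (≡.refl , ≡.refl)) us ¬ut k≡
      ...   | no ¬us | yes ut | _ = pendant-shape g≢f g∌u (inj₂ (≡.refl , ≡.refl)) ut ¬us k≡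
      ...   | no ¬us | no ¬ut | inj₁ us = contradiction us ¬us
      ...   | no ¬us | no ¬ut | inj₂ ut = contradiction ut ¬ut
      -- With both ends next to `u`, the edge `g` closes a triangle at `u`; by uniqueness it would
      -- be `f`.
      ...   | yes us | yes ut | _ with unique-triangle unique ua ub ab us ut (g , inj₁ (≡.refl , ≡.refl))
      ...     | inj₁ (p , q) = contradiction (simple (≡.subst₂ (Joins g) p q (inj₁ (≡.refl , ≡.refl))) (proj₂ ab)) g≢f
      ...     | inj₂ (p , q) = contradiction (simple (≡.subst₂ (Joins g) q p (inj₂ (≡.refl , ≡.refl))) (proj₂ ab)) g≢f

    shape : ∀ {q} → k ≡ 5 ℕ.+ q → Shape Γ q
    shape k≡ with short-cycle
    ... | inj₁ (a , b , ua , ub , ab) = triangle-shape ua ub ab k≡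
    ... | inj₂ (a , x , b , u≢x , a≢b , ua , ax , xb , bu) with adj? u x
    -- The chord from `u` to the opposite corner makes one half of the square a triangle at `u`.
    ...   | yes ux = triangle-shape ua ux ax k≡
    ...   | no ¬ux = shape₄ (to-graph₄ (proj₂ ua) (proj₂ ax) (proj₂ xb) (proj₂ bu) u≢x a≢b ¬ux spokes k≡)
      where
      e₁∌u = avoids (Adj⇒≢ ua ∘ ≡.sym) (u≢x ∘ ≡.sym) (proj₂ ax)
      e₂∌u = avoids (u≢x ∘ ≡.sym) (Adj⇒≢ bu) (proj₂ xb)
      e₁≢e₂ : proj₁ ax ≢ proj₁ xb
      e₁≢e₂ eq with same-ends (proj₂ ax) (≡.subst (λ e → Joins e x b) (≡.sym eq) (proj₂ xb))
      ... | inj₁ (x≡a , _) = Adj⇒≢ ax (≡.sym x≡a)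
      ... | inj₂ (_ , b≡a) = a≢b (≡.sym b≡a)
      spokes : ∀ e → e ≢ proj₁ ax → e ≢ proj₁ xb → Ends e u
      spokes e e≢ e≢′ = few e₁≢e₂ (e≢ ∘ ≡.sym) (e≢′ ∘ ≡.sym) e₁∌u e₂∌u

-- Membership and cardinality in concatenations of subsets and blocks.

∈-++⇔ : ∀ {a b} (S : Subset a) (T : Subset b) v → v ∈ S ++ T ⇔ [ _∈ S , _∈ T ]′ (splitAt a v)
∈-++⇔ {a} S T v = mk⇔ (λ v∈ → to (splitAt a v) (≡.trans (≡.sym (lookup-splitAt a S T v)) ([]=⇒lookup v∈)))
  (λ v∈ → lookup⇒[]= v (S ++ T) (≡.trans (lookup-splitAt a S T v) (from (splitAt a v) v∈)))
  where
  to : ∀ x → [ lookup S , lookup T ]′ x ≡ inside → [ _∈ S , _∈ T ]′ x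
  to (inj₁ x) eq = lookup⇒[]= x S eq
  to (inj₂ y) eq = lookup⇒[]= y T eq
  from : ∀ x → [ _∈ S , _∈ T ]′ x → [ lookup S , lookup T ]′ x ≡ inside
  from (inj₁ x) x∈S = []=⇒lookup x∈S
  from (inj₂ y) y∈T = []=⇒lookup y∈T

∈-block⇔ : ∀ {q} p (j : Fin q) x → x ∈ block p j ⇔ proj₁ (remQuot {q} p x) ≡ j
∈-block⇔ {q} p j x = mk⇔
  (λ x∈ → x∈⁅y⁆⇒x≡y j (lookup⇒[]= i ⁅ j ⁆ (≡.trans (≡.sym (lookup-block j i _))
    (≡.trans (≡.cong (lookup (block p j)) (combine-remQuot {q} p x)) ([]=⇒lookup x∈)))))
  (λ eq → ≡.subst (_∈ block p j) (combine-remQuot {q} p x) (≡.subst (λ i → combine i i′ ∈ block p j) (≡.sym eq) (∈-block j i′)))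
  where
  i = proj₁ (remQuot {q} p x)
  i′ = proj₂ (remQuot {q} p x)

-- Membership read off the label of a vertex. `B` states which blocks belong: exactly one for a
-- power edge or a new edge, none for an old edge after an attachment.
Inside : ∀ {n k p} → Subset n → (Fin k → Set) → Fin n ⊎ (Fin k × Fin p) → Set
Inside S B (inj₁ v)       = v ∈ S
Inside S B (inj₂ (f , _)) = B f

∈-++block⇔ : ∀ {n k} p (S : Subset n) (j : Fin k) v →
  v ∈ S ++ block p j ⇔ Inside S (_≡ j) (Inverse.to (label↔ {n} {k} {p}) v)
∈-++block⇔ {n} p S j v = split (splitAt n v) ⇔-∘ ∈-++⇔ S (block p j) v
  where
  split : ∀ x → [ _∈ S , _∈ block p j ]′ x ⇔ Inside S (_≡ j) (Inverse.to (↔-id (Fin n) ⊎-↔ *↔×) x)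
  split (inj₁ x) = mk⇔ id id
  split (inj₂ y) = ∈-block⇔ p j y

∈-++⊥⇔ : ∀ {n k p} (S : Subset n) v →
  v ∈ S ++ ⊥ ⇔ Inside S (λ _ → Empty⊥) (Inverse.to (label↔ {n} {k} {p}) v)
∈-++⊥⇔ {n} {k} {p} S v = split (splitAt n v) ⇔-∘ ∈-++⇔ S ⊥ v
  where
  split : ∀ x → [ _∈ S , _∈ ⊥ ]′ x ⇔ Inside S (λ _ → Empty⊥) (Inverse.to (↔-id (Fin n) ⊎-↔ *↔× {k} {p}) x)
  split (inj₁ x) = mk⇔ id id
  split (inj₂ y) = mk⇔ ∉⊥ λ ()

∣++∣ : ∀ {a b} (S : Subset a) (T : Subset b) → ∣ S ++ T ∣ ≡ ∣ S ∣ ℕ.+ ∣ T ∣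
∣++∣ []            T = ≡.refl
∣++∣ (outside ∷ S) T = ∣++∣ S T
∣++∣ (inside  ∷ S) T = ≡.cong suc (∣++∣ S T)

∣block∣ : ∀ {q} p (j : Fin q) → ∣ block p j ∣ ≡ p
∣block∣ {suc q} p zero = ≡.trans (∣++∣ (replicate p inside) _)
  (≡.trans (≡.cong₂ ℕ._+_ (∣⊤∣≡n p) (empty q)) (ℕ.+-identityʳ p))
  where
  empty : ∀ q → ∣ concat (map (replicate p) (⊥ {q})) ∣ ≡ 0
  empty zero    = ≡.refl
  empty (suc q) = ≡.trans (∣++∣ (replicate p outside) _) (≡.cong₂ ℕ._+_ (∣⊥∣≡0 p) (empty q))
∣block∣ {suc q} p (suc j) = ≡.trans (∣++∣ (replicate p outside) _) (≡.cong₂ ℕ._+_ (∣⊥∣≡0 p) (∣block∣ p j))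

∣⁅x⁆∪⁅y⁆∣≡2 : ∀ {n} {x y : Fin n} → x ≢ y → ∣ ⁅ x ⁆ ∪ ⁅ y ⁆ ∣ ≡ 2
∣⁅x⁆∪⁅y⁆∣≡2 {x = zero}  {zero}  x≢y = contradiction ≡.refl x≢y
∣⁅x⁆∪⁅y⁆∣≡2 {x = zero}  {suc y} x≢y = ≡.cong suc (≡.trans (≡.cong ∣_∣ (∪-identityˡ ⁅ y ⁆)) (∣⁅x⁆∣≡1 y))
∣⁅x⁆∪⁅y⁆∣≡2 {x = suc x} {zero}  x≢y = ≡.cong suc (≡.trans (≡.cong ∣_∣ (∪-identityʳ ⁅ x ⁆)) (∣⁅x⁆∣≡1 x))
∣⁅x⁆∪⁅y⁆∣≡2 {x = suc x} {suc y} x≢y = ∣⁅x⁆∪⁅y⁆∣≡2 (x≢y ∘ ≡.cong suc)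

∣S∣≡0⇒∉ : ∀ {n} (S : Subset n) → ∣ S ∣ ≡ 0 → ∀ {x} → ¬ x ∈ S
∣S∣≡0⇒∉ (outside ∷ S) eq (Vec.there x∈S) = ∣S∣≡0⇒∉ S eq x∈S

∣S∣≡1⇒singleton : ∀ {n} (S : Subset n) → ∣ S ∣ ≡ 1 → ∃[ a ] a ∈ S × ∀ {x} → x ∈ S → x ≡ a
∣S∣≡1⇒singleton (outside ∷ S) eq with ∣S∣≡1⇒singleton S eq
... | a , a∈ , only = suc a , Vec.there a∈ , λ { (Vec.there x∈) → ≡.cong suc (only x∈) }
∣S∣≡1⇒singleton (inside ∷ S) eq = zero , Vec.here ,
  λ { Vec.here → ≡.refl ; (Vec.there x∈) → contradiction x∈ (∣S∣≡0⇒∉ S (ℕ.suc-injective eq)) }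

∣S∣≡2⇒pair : ∀ {n} (S : Subset n) → ∣ S ∣ ≡ 2 → ∃[ a ] ∃[ b ] a ≢ b × a ∈ S × b ∈ S × ∀ {x} → x ∈ S → x ≡ a ⊎ x ≡ b
∣S∣≡2⇒pair (outside ∷ S) eq with ∣S∣≡2⇒pair S eq
... | a , b , a≢b , a∈ , b∈ , only = suc a , suc b , (λ { ≡.refl → a≢b ≡.refl }) , Vec.there a∈ , Vec.there b∈ ,
  λ { (Vec.there x∈) → Sum.map (≡.cong suc) (≡.cong suc) (only x∈) }
∣S∣≡2⇒pair (inside ∷ S) eq with ∣S∣≡1⇒singleton S (ℕ.suc-injective eq)
... | b , b∈ , only = zero , suc b , (λ ()) , Vec.here , Vec.there b∈ ,
  λ { Vec.here → inj₁ ≡.refl ; (Vec.there x∈) → inj₂ (≡.cong suc (only x∈)) }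

∣S∣≤1 : ∀ {n} (S : Subset n) → (∀ {x y} → x ∈ S → y ∈ S → x ≡ y) → ∣ S ∣ ℕ.≤ 1
∣S∣≤1 {n} S unique with nonempty? S
... | yes (x , x∈S) = ≡.subst (∣ S ∣ ℕ.≤_) (∣⁅x⁆∣≡1 x) (p⊆q⇒∣p∣≤∣q∣ (λ {y} y∈S → ≡.subst (_∈ ⁅ x ⁆) (unique x∈S y∈S) (x∈⁅x⁆ x)))
... | no empty = ≡.subst (ℕ._≤ 1) (≡.sym (≡.trans (≡.cong ∣_∣ (Empty-unique empty)) (∣⊥∣≡0 n))) ℕ.z≤n

-- Translation between 2-uniform hypergraphs and graphs.

module _ (G : Hypergraph) (G-graph : IsGraph G) where

  private
    pair : ∀ e → ∃[ a ] ∃[ b ] a ≢ b × a ∈ edge G e × b ∈ edge G e × ∀ {x} → x ∈ edge G e → x ≡ a ⊎ x ≡ b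
    pair e = ∣S∣≡2⇒pair (edge G e) (G-graph e)

    s t : Fin (size G) → Vertex G
    s e = proj₁ (pair e)
    t e = proj₁ (proj₂ (pair e))

    edge⇒ends : ∀ {e x} → x ∈ edge G e → x ≡ s e ⊎ x ≡ t e
    edge⇒ends {e} = proj₂ (proj₂ (proj₂ (proj₂ (proj₂ (pair e)))))

    ends⇒edge : ∀ {e x} → x ≡ s e ⊎ x ≡ t e → x ∈ edge G e
    ends⇒edge {e} (inj₁ ≡.refl) = proj₁ (proj₂ (proj₂ (proj₂ (pair e))))
    ends⇒edge {e} (inj₂ ≡.refl) = proj₁ (proj₂ (proj₂ (proj₂ (proj₂ (pair e)))))

  underlyingGraph : Graph
  underlyingGraph = record
    { n = order G ; k = size G ; src = s ; tgt = t
    ; loopless = λ e → proj₁ (proj₂ (proj₂ (pair e)))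
    ; parallel = λ {e} {f} joins → distinct G (⊆-antisym
        (λ x∈e → ends⇒edge (Sum.[ (λ p → to joins (inj₁ p)) , (λ p → to joins (inj₂ p)) ] (edge⇒ends x∈e)))
        (λ x∈f → ends⇒edge (Sum.[ (λ p → from joins (inj₁ p)) , (λ p → from joins (inj₂ p)) ] (edge⇒ends x∈f))))
    }
    where
    to : ∀ {e f x} → (s f ≡ s e × t f ≡ t e) ⊎ (s f ≡ t e × t f ≡ s e) → x ≡ s e ⊎ x ≡ t e → x ≡ s f ⊎ x ≡ t f
    to (inj₁ (p , q)) (inj₁ r) = inj₁ (≡.trans r (≡.sym p))
    to (inj₁ (p , q)) (inj₂ r) = inj₂ (≡.trans r (≡.sym q))
    to (inj₂ (p , q)) (inj₁ r) = inj₂ (≡.trans r (≡.sym q))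
    to (inj₂ (p , q)) (inj₂ r) = inj₁ (≡.trans r (≡.sym p))
    from : ∀ {e f x} → (s f ≡ s e × t f ≡ t e) ⊎ (s f ≡ t e × t f ≡ s e) → x ≡ s f ⊎ x ≡ t f → x ≡ s e ⊎ x ≡ t e
    from (inj₁ (p , q)) (inj₁ r) = inj₁ (≡.trans r p)
    from (inj₁ (p , q)) (inj₂ r) = inj₂ (≡.trans r q)
    from (inj₂ (p , q)) (inj₁ r) = inj₂ (≡.trans r p)
    from (inj₂ (p , q)) (inj₂ r) = inj₁ (≡.trans r q)

  power-isPower : ∀ p → IsPower p underlyingGraph (power (2+ p) G)
  power-isPower p = record
    { vertices = label↔
    ; edges = ↔-id _
    ; incidence = λ v e → member (Inverse.to label↔ v) ⇔-∘ ∈-++block⇔ p (edge G e) e v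
    }
    where
    member : ∀ {e} x → Inside (edge G e) (_≡ e) x ⇔ Member {p} underlyingGraph x e
    member (inj₁ v) = mk⇔ edge⇒ends ends⇒edge
    member (inj₂ _) = mk⇔ id id

isPower-resp-≅ : ∀ {p Γ H K} → H ≅ K → IsPower p Γ K → IsPower p Γ H
isPower-resp-≅ iso power = record
  { vertices = vertices power ↔-∘ I.vertices
  ; edges = edges power ↔-∘ I.edges
  ; incidence = λ v i → incidence power _ _ ⇔-∘ I.incidence v i
  }
  where
  open IsPower
  module I = _≅_ iso

isPowerOfGraph⇒isPower : ∀ {p H} → IsPowerOfGraph (2+ p) H → ∃[ Γ ] IsPower p Γ H
isPowerOfGraph⇒isPower {p} (G , G-graph , iso) = underlyingGraph G G-graph , isPower-resp-≅ iso (power-isPower G G-graph p)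

graphHypergraph : Graph → Hypergraph
graphHypergraph Γ = record
  { order = n ; size = k
  ; edge = λ e → ⁅ src e ⁆ ∪ ⁅ tgt e ⁆
  ; nonempty = λ e → src e , x∈p∪q⁺ (inj₁ (x∈⁅x⁆ _))
  ; distinct = λ {e} {f} eq → parallel (Ends² (loopless f)
      (ends (≡.subst (src f ∈_) (≡.sym eq) (x∈p∪q⁺ (inj₁ (x∈⁅x⁆ _)))))
      (ends (≡.subst (tgt f ∈_) (≡.sym eq) (x∈p∪q⁺ (inj₂ (x∈⁅x⁆ _))))))
  }
  where
  open Graph Γ
  ends : ∀ {e x} → x ∈ ⁅ src e ⁆ ∪ ⁅ tgt e ⁆ → Ends e x
  ends x∈ = Sum.map (x∈⁅y⁆⇒x≡y _) (x∈⁅y⁆⇒x≡y _) (x∈p∪q⁻ _ _ x∈)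

∈-pair⇔ : ∀ {n} {x a b : Fin n} → x ∈ ⁅ a ⁆ ∪ ⁅ b ⁆ ⇔ (x ≡ a ⊎ x ≡ b)
∈-pair⇔ {x = x} = mk⇔ (λ x∈ → Sum.map (x∈⁅y⁆⇒x≡y _) (x∈⁅y⁆⇒x≡y _) (x∈p∪q⁻ _ _ x∈))
  λ { (inj₁ ≡.refl) → x∈p∪q⁺ (inj₁ (x∈⁅x⁆ _)) ; (inj₂ ≡.refl) → x∈p∪q⁺ (inj₂ (x∈⁅x⁆ _)) }

module _ (p : ℕ) (Γ : Graph) where

  open Graph Γ

  -- The proofs of non-emptiness and distinctness stay arbitrary, so that the lemma covers both
  -- `graphHypergraph` and `triangle`, whose edges have the same form but come with other proofs.
  pairs-isPower : {ne : ∀ e → Nonempty (⁅ src e ⁆ ∪ ⁅ tgt e ⁆)}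
    {inj : ∀ {e f} → ⁅ src e ⁆ ∪ ⁅ tgt e ⁆ ≡ ⁅ src f ⁆ ∪ ⁅ tgt f ⁆ → e ≡ f} →
    IsPower p Γ (power (2+ p) (record
      { order = n ; size = k ; edge = λ e → ⁅ src e ⁆ ∪ ⁅ tgt e ⁆ ; nonempty = ne ; distinct = λ {e} {f} → inj {e} {f} }))
  pairs-isPower = record
    { vertices = label↔
    ; edges = ↔-id _
    ; incidence = λ v e → member (Inverse.to label↔ v) ⇔-∘ ∈-++block⇔ p (⁅ src e ⁆ ∪ ⁅ tgt e ⁆) e v
    }
    where
    member : ∀ {e} x → Inside (⁅ src e ⁆ ∪ ⁅ tgt e ⁆) (_≡ e) x ⇔ Member {p} Γ x e
    member (inj₁ v) = ∈-pair⇔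
    member (inj₂ _) = mk⇔ id id

isPower⇒isPowerOfGraph : ∀ {p Γ H} → IsPower p Γ H → IsPowerOfGraph (2+ p) H
isPower⇒isPowerOfGraph {p} {Γ} H-power = graphHypergraph Γ , (λ e → ∣⁅x⁆∪⁅y⁆∣≡2 (Graph.loopless Γ e)) ,
  powers-≅ H-power (pairs-isPower p Γ {nonempty (graphHypergraph Γ)} {distinct (graphHypergraph Γ)})

triangle-power : ∀ p → IsPower p triangleGraph (C₃ (2+ p))
triangle-power p = pairs-isPower p triangleGraph {nonempty triangle} {distinct triangle}

-- Linearity, connectedness and size of a power.

module PowerProperties {p : ℕ} {Γ : Graph} {H : Hypergraph} (H-power : IsPower p Γ H) where

  open Graph Γ
  open Adjacency Γ
  open IsPower H-power
  open PowerCycles H-power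
  private
    module V = Inverse vertices
    module E = Inverse edges

  -- Two edges meet only in vertices of the graph, and two such vertices are joined by a single
  -- edge.
  linear : Linear H
  linear {i} {j} i≢j = ∣S∣≤1 (edge H i ∩ edge H j) λ {x} {y} x∈ y∈ →
    same (proj₁ (x∈p∩q⁻ _ _ x∈)) (proj₂ (x∈p∩q⁻ _ _ x∈)) (proj₁ (x∈p∩q⁻ _ _ y∈)) (proj₂ (x∈p∩q⁻ _ _ y∈))
    where
    Ei≢Ej : E.to i ≢ E.to j
    Ei≢Ej = i≢j ∘ ↔-injective edges
    same : ∀ {x y} → x ∈ edge H i → x ∈ edge H j → y ∈ edge H i → y ∈ edge H j → x ≡ y
    same {x} {y} xi xj yi yj = decide (a ≟ b)
      where
      xl = shared-label (V.to x) (∈⇒Member xi) (∈⇒Member xj) Ei≢Ej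
      yl = shared-label (V.to y) (∈⇒Member yi) (∈⇒Member yj) Ei≢Ej
      a = proj₁ xl
      b = proj₁ yl
      end : ∀ {x e v} → V.to x ≡ inj₁ v → Member Γ (V.to x) e → Ends e v
      end eq mem = ≡.subst (λ y → Member {p} Γ y _) eq mem
      decide : Dec (a ≡ b) → x ≡ y
      decide (yes a≡b) = ↔-injective vertices (≡.trans (proj₂ xl) (≡.trans (≡.cong inj₁ a≡b) (≡.sym (proj₂ yl))))
      decide (no a≢b) = contradiction (simple
        (Ends² a≢b (end (proj₂ xl) (∈⇒Member xi)) (end (proj₂ yl) (∈⇒Member yi)))
        (Ends² a≢b (end (proj₂ xl) (∈⇒Member xj)) (end (proj₂ yl) (∈⇒Member yj)))) Ei≢Ej

  -- A new vertex is retracted to the source of its edge. The retraction carries edges to edges or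
  -- points, hence walks in the power to walks in the graph.
  anchor : Label p Γ → Fin n
  anchor (inj₁ v)       = v
  anchor (inj₂ (e , _)) = src e

  anchor-end : ∀ (x : Label p Γ) {e} → Member Γ x e → Ends e (anchor x)
  anchor-end (inj₁ v) end = end
  anchor-end (inj₂ _) ≡.refl = inj₁ ≡.refl

  connected⇒ : Connected H → ∀ v w → Star Adj v w
  connected⇒ conn v w = ≡.subst₂ (Star Adj) (anchor-from v) (anchor-from w) (walk (conn (V.from (inj₁ v)) (V.from (inj₁ w))))
    where
    anchor-from : ∀ v → anchor (V.to (V.from (inj₁ v))) ≡ v
    anchor-from v = ≡.cong anchor (V.strictlyInverseˡ (inj₁ v))
    step : ∀ {x y} → InCommonEdge H x y → Star Adj (anchor (V.to x)) (anchor (V.to y))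
    step {x} {y} (i , xi , yi) with anchor (V.to x) ≟ anchor (V.to y)
    ... | yes eq = ≡.subst (Star Adj _) eq ε
    ... | no neq = (E.to i , Ends² neq (anchor-end (V.to x) (∈⇒Member xi)) (anchor-end (V.to y) (∈⇒Member yi))) ◅ ε
    walk : ∀ {x y} → Star (InCommonEdge H) x y → Star Adj (anchor (V.to x)) (anchor (V.to y))
    walk ε = ε
    walk (xy ◅ path) = step xy ◅◅ walk path

  ⇒connected : (∀ v w → Star Adj v w) → Connected H
  ⇒connected conn x y = ≡.subst₂ (Star (InCommonEdge H)) (V.strictlyInverseʳ x) (V.strictlyInverseʳ y)
    (to-anchor (V.to x) ◅◅ gmap (V.from ∘ inj₁) common (conn _ _) ◅◅ from-anchor (V.to y))
    where
    common : ∀ {v w} → Adj v w → InCommonEdge H (V.from (inj₁ v)) (V.from (inj₁ w))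
    common (e , vw) = E.from e , Member⇒∈ (Joins⇒Ends vw) , Member⇒∈ (Joins⇒Ends (Joins-sym vw))
    to-anchor : ∀ x → Star (InCommonEdge H) (V.from x) (V.from (inj₁ (anchor x)))
    to-anchor (inj₁ v) = ε
    to-anchor (inj₂ (e , i)) = (E.from e , Member⇒∈ {x = inj₂ (e , i)} ≡.refl , Member⇒∈ {x = inj₁ (src e)} (inj₁ ≡.refl)) ◅ ε
    from-anchor : ∀ x → Star (InCommonEdge H) (V.from (inj₁ (anchor x))) (V.from x)
    from-anchor (inj₁ v) = ε
    from-anchor (inj₂ (e , i)) = (E.from e , Member⇒∈ {x = inj₁ (src e)} (inj₁ ≡.refl) , Member⇒∈ {x = inj₂ (e , i)} ≡.refl) ◅ ε

  size≡ : size H ≡ k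
  size≡ = ℕ.≤-antisym (injective⇒≤ (↔-injective edges)) (injective⇒≤ (↔-injective (↔-sym edges)))

-- Attaching edges to a power attaches pendant edges to its graph.

module _ {p : ℕ} (Γ : Graph) {q : ℕ} (v : Fin q → Fin (Graph.n Γ)) where

  private
    open Graph Γ
    Γ⁺ = addPendants Γ v
    module Γ⁺ = Graph Γ⁺

  lift : Label p Γ → Label p Γ⁺
  lift (inj₁ w) = inj₁ (w ↑ˡ q)
  lift (inj₂ (e , i)) = inj₂ (e ↑ˡ q , i)

  src-old : ∀ e → Γ⁺.src (e ↑ˡ q) ≡ src e ↑ˡ q
  src-old e = ≡.cong [ _ , _ ]′ (splitAt-↑ˡ k e q)

  tgt-old : ∀ e → Γ⁺.tgt (e ↑ˡ q) ≡ tgt e ↑ˡ q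
  tgt-old e = ≡.cong [ _ , _ ]′ (splitAt-↑ˡ k e q)

  src-new : ∀ j → Γ⁺.src (k ↑ʳ j) ≡ v j ↑ˡ q
  src-new j = ≡.cong [ _ , _ ]′ (splitAt-↑ʳ k q j)

  tgt-new : ∀ j → Γ⁺.tgt (k ↑ʳ j) ≡ n ↑ʳ j
  tgt-new j = ≡.cong [ _ , _ ]′ (splitAt-↑ʳ k q j)

  lift-old : ∀ x {e} → Member Γ x e ⇔ Member Γ⁺ (lift x) (e ↑ˡ q)
  lift-old (inj₁ w) {e} = mk⇔
    (Sum.map (λ eq → ≡.trans (≡.cong (_↑ˡ q) eq) (≡.sym (src-old e))) (λ eq → ≡.trans (≡.cong (_↑ˡ q) eq) (≡.sym (tgt-old e))))
    (Sum.map (λ eq → ↑ˡ-injective q _ _ (≡.trans eq (src-old e))) (λ eq → ↑ˡ-injective q _ _ (≡.trans eq (tgt-old e))))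
  lift-old (inj₂ (f , i)) = mk⇔ (≡.cong (_↑ˡ q)) (↑ˡ-injective q _ _)

  lift-new : ∀ x j → (x ≡ inj₁ (v j)) ⇔ Member Γ⁺ (lift x) (k ↑ʳ j)
  lift-new (inj₁ w) j = mk⇔
    (λ { ≡.refl → inj₁ (≡.sym (src-new j)) })
    λ { (inj₁ eq) → ≡.cong inj₁ (↑ˡ-injective q _ _ (≡.trans eq (src-new j)))
      ; (inj₂ eq) → contradiction (≡.trans eq (tgt-new j)) ↑ˡ≢↑ʳ }
  lift-new (inj₂ (f , i)) j = mk⇔ (λ ()) λ eq → contradiction eq ↑ˡ≢↑ʳ

  -- Of the new vertices of an edge, the i₀-th one becomes a vertex of the graph.
  module _ (i₀ : Fin (suc p)) where

    -- The choice of `i₀` is left free because the third hypergraph has an edge attached at an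
    -- arbitrary tip of a pendant edge, and that very tip must become a vertex of the graph.
    fresh : Fin q → Fin (suc p) → Label p Γ⁺
    fresh j i with i₀ ≟ i
    ... | yes _    = inj₁ (n ↑ʳ j)
    ... | no i₀≢i = inj₂ (k ↑ʳ j , punchOut i₀≢i)

    fresh-i₀ : ∀ j → fresh j i₀ ≡ inj₁ (n ↑ʳ j)
    fresh-i₀ j with i₀ ≟ i₀
    ... | yes _    = ≡.refl
    ... | no i₀≢i₀ = contradiction ≡.refl i₀≢i₀

    fresh-punchIn : ∀ j i → fresh j (punchIn i₀ i) ≡ inj₂ (k ↑ʳ j , i)
    fresh-punchIn j i with i₀ ≟ punchIn i₀ i
    ... | yes eq = contradiction (≡.sym eq) (punchInᵢ≢i i₀ i)
    ... | no neq = ≡.cong (λ x → inj₂ (k ↑ʳ j , x)) (punchOut-punchIn i₀ {j = i})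

    fresh-old : ∀ j i {e} → ¬ Member Γ⁺ (fresh j i) (e ↑ˡ q)
    fresh-old j i {e} mem with i₀ ≟ i
    fresh-old j i {e} (inj₁ eq) | yes _ = ↑ˡ≢↑ʳ (≡.sym (≡.trans eq (src-old e)))
    fresh-old j i {e} (inj₂ eq) | yes _ = ↑ˡ≢↑ʳ (≡.sym (≡.trans eq (tgt-old e)))
    fresh-old j i {e} eq        | no _  = ↑ˡ≢↑ʳ (≡.sym eq)

    fresh-new : ∀ j i j′ → (j ≡ j′) ⇔ Member Γ⁺ (fresh j i) (k ↑ʳ j′)
    fresh-new j i j′ with i₀ ≟ i
    ... | yes _ = mk⇔ (λ { ≡.refl → inj₂ (≡.sym (tgt-new j)) })
      λ { (inj₁ eq) → contradiction (≡.sym (≡.trans eq (src-new j′))) ↑ˡ≢↑ʳ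
        ; (inj₂ eq) → ↑ʳ-injective n _ _ (≡.trans eq (tgt-new j′)) }
    ... | no _ = mk⇔ (≡.cong (k ↑ʳ_)) (↑ʳ-injective k _ _)

    module _ {H : Hypergraph} (H-power : IsPower p Γ H) (w : Fin q → Vertex H)
        (w≡ : ∀ j → Inverse.to (IsPower.vertices H-power) (w j) ≡ inj₁ (v j)) where

      private
        open IsPower H-power
        module V = Inverse vertices
        module E = Inverse edges
        Old = Vertex H ⊎ (Fin q × Fin (suc p))

        to : Old → Label p Γ⁺
        to (inj₁ x) = lift (V.to x)
        to (inj₂ (j , i)) = fresh j i

        from₁ : Fin n ⊎ Fin q → Old
        from₁ (inj₁ y) = inj₁ (V.from (inj₁ y))
        from₁ (inj₂ j) = inj₂ (j , i₀)
        from₂ : Fin p → Fin k ⊎ Fin q → Old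
        from₂ i (inj₁ e) = inj₁ (V.from (inj₂ (e , i)))
        from₂ i (inj₂ j) = inj₂ (j , punchIn i₀ i)

        from : Label p Γ⁺ → Old
        from (inj₁ y) = from₁ (splitAt n y)
        from (inj₂ (e , i)) = from₂ i (splitAt k e)

        to-from : ∀ y → to (from y) ≡ y
        to-from (inj₁ y) with splitAt n y in eq
        ... | inj₁ y′ = ≡.trans (≡.cong lift (V.strictlyInverseˡ _)) (≡.cong inj₁ (splitAt⁻¹-↑ˡ eq))
        ... | inj₂ j = ≡.trans (fresh-i₀ j) (≡.cong inj₁ (splitAt⁻¹-↑ʳ eq))
        to-from (inj₂ (e , i)) with splitAt k e in eq
        ... | inj₁ e′ = ≡.trans (≡.cong lift (V.strictlyInverseˡ _)) (≡.cong (λ e → inj₂ (e , i)) (splitAt⁻¹-↑ˡ eq))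
        ... | inj₂ j = ≡.trans (fresh-punchIn j i) (≡.cong (λ e → inj₂ (e , i)) (splitAt⁻¹-↑ʳ eq))

        from-lift : ∀ x → from (lift x) ≡ inj₁ (V.from x)
        from-lift (inj₁ y) = ≡.cong from₁ (splitAt-↑ˡ n y q)
        from-lift (inj₂ (e , i)) = ≡.cong (from₂ i) (splitAt-↑ˡ k e q)

        from-to : ∀ x → from (to x) ≡ x
        from-to (inj₁ x) = ≡.trans (from-lift (V.to x)) (≡.cong inj₁ (V.strictlyInverseʳ x))
        from-to (inj₂ (j , i)) with i₀ ≟ i
        ... | yes ≡.refl = ≡.cong from₁ (splitAt-↑ʳ n q j)
        ... | no i₀≢i = ≡.trans (≡.cong (from₂ _) (splitAt-↑ʳ k q j)) (≡.cong (λ i → inj₂ (j , i)) (punchIn-punchOut i₀≢i))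

        edge↔ : Fin (size H ℕ.+ q) ↔ Fin (k ℕ.+ q)
        edge↔ = ↔-sym +↔⊎ ↔-∘ ((edges ⊎-↔ ↔-id _) ↔-∘ +↔⊎)

        member : ∀ x i → x ∈ edge (attach (2+ p) H w) i ⇔ Member Γ⁺ (to (Inverse.to label↔ x)) (Inverse.to edge↔ i)
        member x i with splitAt (size H) i
        ... | inj₁ e = old (Inverse.to label↔ x) ⇔-∘ ∈-++⊥⇔ {k = q} {p = suc p} (edge H e) x
          where
          old : ∀ y → Inside (edge H e) (λ _ → Empty⊥) y ⇔ Member Γ⁺ (to y) (E.to e ↑ˡ q)
          old (inj₁ y) = lift-old (V.to y) ⇔-∘ incidence y e
          old (inj₂ (j , i)) = mk⇔ (λ ()) (λ mem → Empty⊥-elim (fresh-old j i mem))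
        ... | inj₂ j = new (Inverse.to label↔ x) ⇔-∘ ∈-++block⇔ (suc p) ⁅ w j ⁆ j x
          where
          new : ∀ y → Inside ⁅ w j ⁆ (_≡ j) y ⇔ Member Γ⁺ (to y) (k ↑ʳ j)
          new (inj₁ y) = lift-new (V.to y) j ⇔-∘ mk⇔
            (λ y∈ → ≡.trans (≡.cong V.to (x∈⁅y⁆⇒x≡y _ y∈)) (w≡ j))
            (λ eq → ≡.subst (_∈ ⁅ w j ⁆) (≡.sym (↔-injective vertices (≡.trans eq (≡.sym (w≡ j))))) (x∈⁅x⁆ _))
          new (inj₂ (j′ , i)) = fresh-new j′ i j

      attach-power : IsPower p Γ⁺ (attach (2+ p) H w)
      attach-power = record
        { vertices = mk↔ₛ′ to from to-from from-to ↔-∘ label↔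
        ; edges = edge↔
        ; incidence = member
        }

      attach-new : ∀ j i → Inverse.to (IsPower.vertices attach-power) (order H ↑ʳ combine j i) ≡ fresh j i
      attach-new j i = ≡.cong to (Inverse.strictlyInverseˡ (label↔ {order H} {q} {suc p}) (inj₂ (j , i)))

attach-uniform : ∀ {p H q} {w : Fin q → Vertex H} → Uniform (2+ p) H → Uniform (2+ p) (attach (2+ p) H w)
attach-uniform {p} {H} {q} {w} uniform i with splitAt (size H) i
... | inj₁ e = ≡.trans (∣++∣ (edge H e) ⊥) (≡.trans (≡.cong₂ ℕ._+_ (uniform e) (∣⊥∣≡0 (q ℕ.* suc p))) (ℕ.+-identityʳ _))
... | inj₂ j = ≡.trans (∣++∣ ⁅ w j ⁆ (block (suc p) j)) (≡.cong₂ ℕ._+_ (∣⁅x⁆∣≡1 (w j)) (∣block∣ (suc p) j))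

power-uniform : ∀ {p G} → IsGraph G → Uniform (2+ p) (power (2+ p) G)
power-uniform {p} {G} G-graph e = ≡.trans (∣++∣ (edge G e) (block p e)) (≡.cong₂ ℕ._+_ (G-graph e) (∣block∣ p e))

-- Pendant edges preserve connectedness and the cycle.

module AddPendants (Γ : Graph) {q : ℕ} (v : Fin q → Fin (Graph.n Γ)) where

  private
    open Graph Γ
    Γ⁺ = addPendants Γ v
    module Γ⁺ = Graph Γ⁺
    open Adjacency Γ
    open Adjacency Γ⁺ using () renaming (Adj to Adj⁺; Adj-sym to Adj⁺-sym)

  joins-old : ∀ {e a b} → Joins e a b → Γ⁺.Joins (e ↑ˡ q) (a ↑ˡ q) (b ↑ˡ q)
  joins-old {e} (inj₁ (≡.refl , ≡.refl)) = inj₁ (≡.sym (src-old {0} Γ v e) , ≡.sym (tgt-old {0} Γ v e))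
  joins-old {e} (inj₂ (≡.refl , ≡.refl)) = inj₂ (≡.sym (tgt-old {0} Γ v e) , ≡.sym (src-old {0} Γ v e))

  joins-new : ∀ j → Γ⁺.Joins (k ↑ʳ j) (v j ↑ˡ q) (n ↑ʳ j)
  joins-new j = inj₁ (≡.sym (src-new {0} Γ v j) , ≡.sym (tgt-new {0} Γ v j))

  cycle-old : Cycle Γ → Cycle Γ⁺
  cycle-old C = record
    { length-3 = C.length-3
    ; vertex = λ i → C.vertex i ↑ˡ q
    ; edgeAt = λ i → C.edgeAt i ↑ˡ q
    ; vertex-distinct = C.vertex-distinct ∘ ↑ˡ-injective q _ _
    ; joins = joins-old ∘ C.joins
    }
    where module C = Cycle C

  connected : (∀ a b → Star Adj a b) → ∀ a b → Star Adj⁺ a b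
  connected conn a b = up a ◅◅ gmap (_↑ˡ q) (λ (e , ab) → e ↑ˡ q , joins-old ab) (conn (foot a) (foot b)) ◅◅ down b
    where
    root : Fin n ⊎ Fin q → Fin n
    root = [ id , v ]′
    foot : Fin (n ℕ.+ q) → Fin n
    foot = root ∘ splitAt n
    up : ∀ a → Star Adj⁺ a (foot a ↑ˡ q)
    up a with splitAt n a in eq
    ... | inj₁ a′ = ≡.subst (Star Adj⁺ a) (≡.sym (splitAt⁻¹-↑ˡ eq)) ε
    ... | inj₂ j = ≡.subst (λ a → Star Adj⁺ a (v j ↑ˡ q)) (splitAt⁻¹-↑ʳ eq) ((k ↑ʳ j , Γ⁺.Joins-sym (joins-new j)) ◅ ε)
    down : ∀ a → Star Adj⁺ (foot a ↑ˡ q) a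
    down a with splitAt n a in eq
    ... | inj₁ a′ = ≡.subst (Star Adj⁺ _) (splitAt⁻¹-↑ˡ eq) ε
    ... | inj₂ j = ≡.subst (Star Adj⁺ (v j ↑ˡ q)) (splitAt⁻¹-↑ʳ eq) ((k ↑ʳ j , joins-new j) ◅ ε)

record ConnectedUnicyclicGraph (Γ : Graph) : Set where
  open Adjacency Γ
  field
    connected : ∀ v w → Star Adj v w
    cycle     : Cycle Γ
    unique    : AtMostOneCycle Γ

addPendants-connectedUnicyclic : ∀ {Γ q} (v : Fin q → Fin (Graph.n Γ)) →
  ConnectedUnicyclicGraph Γ → ConnectedUnicyclicGraph (addPendants Γ v)
addPendants-connectedUnicyclic {Γ} v G = record
  { connected = AddPendants.connected Γ v G.connected
  ; cycle = AddPendants.cycle-old Γ v G.cycle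
  ; unique = addPendants-atMostOneCycle Γ v G.unique
  }
  where module G = ConnectedUnicyclicGraph G

triangle-connectedUnicyclic : ConnectedUnicyclicGraph triangleGraph
triangle-connectedUnicyclic = record
  { connected = λ v w → connect v w
  ; cycle = ShortCycles.triangle-cycle triangleGraph {e₀ = 0F} {1F} {2F} (inj₁ (≡.refl , ≡.refl)) (inj₁ (≡.refl , ≡.refl)) (inj₁ (≡.refl , ≡.refl))
  ; unique = triangleGraph-atMostOneCycle
  }
  where
  open Adjacency triangleGraph
  connect : ∀ v w → Star Adj v w
  connect v w with v ≟ w | next v ≟ w | next w ≟ v
  ... | yes ≡.refl | _ | _ = ε
  ... | no _ | yes ≡.refl | _ = (v , inj₁ (≡.refl , ≡.refl)) ◅ ε
  ... | no _ | no _ | yes ≡.refl = (w , inj₂ (≡.refl , ≡.refl)) ◅ ε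
  connect 0F 0F | no v≢w | _ | _ = contradiction ≡.refl v≢w
  connect 1F 1F | no v≢w | _ | _ = contradiction ≡.refl v≢w
  connect 2F 2F | no v≢w | _ | _ = contradiction ≡.refl v≢w
  connect 0F 1F | no _ | no p | _ = contradiction ≡.refl p
  connect 1F 2F | no _ | no p | _ = contradiction ≡.refl p
  connect 2F 0F | no _ | no p | _ = contradiction ≡.refl p
  connect 1F 0F | no _ | _ | no p = contradiction ≡.refl p
  connect 2F 1F | no _ | _ | no p = contradiction ≡.refl p
  connect 0F 2F | no _ | _ | no p = contradiction ≡.refl p

isConnectedUnicyclicPower : ∀ {p Γ H k} → IsPower p Γ H → ConnectedUnicyclicGraph Γ → Uniform (2+ p) H → size H ≡ k →
  IsConnectedUnicyclicPower (2+ p) k H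
isConnectedUnicyclicPower H-power G uniform size≡k =
  ⇒connected G.connected , (linear , proj₁ (looseCycle G.cycle) , sameCycle G.unique) , uniform , size≡k , isPower⇒isPowerOfGraph H-power
  where
  module G = ConnectedUnicyclicGraph G
  open PowerProperties H-power
  open PowerCycles H-power

-- The three extremal hypergraphs as powers of explicit graphs.

module ThreeGraphs (p : ℕ) where

  private
    m = 2+ p

  core : ∀ c₁ c₂ c₃ → Fin (c₁ ℕ.+ (c₂ ℕ.+ c₃)) → Fin 3
  core c₁ c₂ c₃ = replicateᵛ c₁ 0F ++ᵛ (replicateᵛ c₂ 1F ++ᵛ replicateᵛ c₃ 2F)

  UC₃-graph : ℕ → ℕ → ℕ → Graph
  UC₃-graph c₁ c₂ c₃ = addPendants triangleGraph (core c₁ c₂ c₃)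

  private
    core-vertices : ∀ c₁ c₂ c₃ → Fin (c₁ ℕ.+ (c₂ ℕ.+ c₃)) → Vertex (C₃ m)
    core-vertices c₁ c₂ c₃ = replicateᵛ c₁ (coreVertex m 0F) ++ᵛ
      (replicateᵛ c₂ (coreVertex m 1F) ++ᵛ replicateᵛ c₃ (coreVertex m 2F))

    located : ∀ c₁ c₂ c₃ j → Inverse.to (label↔ {3} {3} {p}) (core-vertices c₁ c₂ c₃ j) ≡ inj₁ (core c₁ c₂ c₃ j)
    located c₁ c₂ c₃ j with splitAt c₁ j
    ... | inj₁ _ = Inverse.strictlyInverseˡ (label↔ {3} {3} {p}) (inj₁ 0F)
    ... | inj₂ j′ with splitAt c₂ j′
    ...   | inj₁ _ = Inverse.strictlyInverseˡ (label↔ {3} {3} {p}) (inj₁ 1F)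
    ...   | inj₂ _ = Inverse.strictlyInverseˡ (label↔ {3} {3} {p}) (inj₁ 2F)

  UC₃-power : ∀ (i₀ : Fin (suc p)) c₁ c₂ c₃ → IsPower p (UC₃-graph c₁ c₂ c₃) (UC₃ m c₁ c₂ c₃)
  UC₃-power i₀ c₁ c₂ c₃ = attach-power triangleGraph (core c₁ c₂ c₃) i₀ (triangle-power p)
    (core-vertices c₁ c₂ c₃) (located c₁ c₂ c₃)

  UC₃-uniform : ∀ c₁ c₂ c₃ → Uniform m (UC₃ m c₁ c₂ c₃)
  UC₃-uniform c₁ c₂ c₃ = attach-uniform {H = C₃ m} (power-uniform {G = triangle} λ { 0F → ≡.refl ; 1F → ≡.refl ; 2F → ≡.refl })

  UC₃-connectedUnicyclic : ∀ c₁ c₂ c₃ → ConnectedUnicyclicGraph (UC₃-graph c₁ c₂ c₃)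
  UC₃-connectedUnicyclic c₁ c₂ c₃ = addPendants-connectedUnicyclic (core c₁ c₂ c₃) triangle-connectedUnicyclic

  module _ (c : ℕ) (j : Fin c) (i : Fin (suc p)) where

    private
      w : Fin (3 ℕ.+ (c ℕ.+ 0))
      w = 3 ↑ʳ (j ↑ˡ 0)

    U₃C-graph : Graph
    U₃C-graph = addPendants (UC₃-graph c 0 0) {1} (λ _ → w)

    -- The pendant edges of the underlying `UC₃` are labelled with the distinguished position `i`,
    -- so the tip that receives the last edge is labelled by the graph vertex `w`.
    U₃C-power : IsPower p U₃C-graph (U₃C m c j i)
    U₃C-power = attach-power (UC₃-graph c 0 0) (λ _ → w) i (UC₃-power i c 0 0) _ λ _ →
      ≡.trans (attach-new triangleGraph (core c 0 0) i (triangle-power p) (core-vertices c 0 0) (located c 0 0) (j ↑ˡ 0) i)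
        (fresh-i₀ triangleGraph (core c 0 0) i (j ↑ˡ 0))

    U₃C-connectedUnicyclic : ConnectedUnicyclicGraph U₃C-graph
    U₃C-connectedUnicyclic = addPendants-connectedUnicyclic (λ _ → w) (UC₃-connectedUnicyclic c 0 0)

    U₃C-uniform : Uniform m (U₃C m c j i)
    U₃C-uniform = attach-uniform {H = UC₃ m c 0 0} {w = replicateᵛ 1 (tip m 0 0 j i)} (UC₃-uniform c 0 0)

  k≡ : ∀ a c → a ℕ.+ (c ℕ.+ 0) ≡ a ℕ.+ c
  k≡ a c = ≡.cong (a ℕ.+_) (ℕ.+-identityʳ c)

  private
    module Base = AddPendants triangleGraph
    side : ∀ {c₁ c₂ c₃} (i : Fin 3) → Graph.Joins (UC₃-graph c₁ c₂ c₃) (i ↑ˡ _) (i ↑ˡ _) (next i ↑ˡ _)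
    side {c₁} {c₂} {c₃} i = Base.joins-old (core c₁ c₂ c₃) {i} (inj₁ (≡.refl , ≡.refl))

    covered : ∀ {Γ} → ConnectedUnicyclicGraph Γ → ∀ v → ∃[ e ] Graph.Ends Γ e v
    covered {Γ} G = Classify.covered Γ G.connected G.unique G.cycle
      where module G = ConnectedUnicyclicGraph G

    core-spoke : ∀ c {j} → core c 0 0 j ≡ 0F
    core-spoke c {j} with splitAt c j
    ... | inj₁ _ = ≡.refl

    UC₃-spokes : ∀ c e → e ≢ 1F → Graph.Ends (UC₃-graph c 0 0) e 0F
    UC₃-spokes c 0F _ = inj₁ ≡.refl
    UC₃-spokes c 1F e≢1 = contradiction ≡.refl e≢1
    UC₃-spokes c 2F _ = inj₂ ≡.refl
    UC₃-spokes c (suc (suc (suc j))) _ = inj₁ (≡.cong (_↑ˡ (c ℕ.+ 0)) (≡.sym (core-spoke c)))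

  -- `UC₃-graph` groups its pendant edges by core vertex, with sums such as c + 0 in its size. Going
  -- through the recognition lemmas avoids every explicit renumbering, here and for the other two
  -- graphs.
  H₁-graph : ∀ c {q} → q ≡ c → graph₁ q ≅ᴳ UC₃-graph c 0 0
  H₁-graph c ≡.refl = HubShapes.to-graph₁ Γ (covered (UC₃-connectedUnicyclic c 0 0)) 0F
    {a = 1F} {b = 2F} {ea = 0F} {eb = 2F} {f = 1F}
    (side {c} {0} {0} 0F) (Γ.Joins-sym {2F} (side {c} {0} {0} 2F)) (side {c} {0} {0} 1F) (λ { (inj₁ ()) ; (inj₂ ()) }) (UC₃-spokes c) (k≡ 3 c)
    where
    Γ = UC₃-graph c 0 0
    module Γ = Graph Γ

  H₂-graph : ∀ c {q} → q ≡ c → graph₂ q ≅ᴳ UC₃-graph c 1 0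
  H₂-graph c ≡.refl = HubShapes.to-graph₂ Γ (covered (UC₃-connectedUnicyclic c 1 0)) 0F
    {a = 1F} {b = 2F} {ea = 0F} {eb = 2F} {f = 1F}
    (side {c} {1} {0} 0F) (Γ.Joins-sym {2F} (side {c} {1} {0} 2F)) (side {c} {1} {0} 1F) (λ { (inj₁ ()) ; (inj₂ ()) })
    {l = 3 ↑ʳ g} {g = 3 ↑ʳ g} (λ ()) not-adjacent misses spokes pendant (≡.cong (3 ℕ.+_) (ℕ.+-comm c 1))
    where
    Γ = UC₃-graph c 1 0
    module Γ = Graph Γ
    g : Fin (c ℕ.+ 1)
    g = c ↑ʳ 0F
    core-g : core c 1 0 g ≡ 1F
    core-g = ≡.cong [ _ , _ ]′ (splitAt-↑ʳ c 1 0F)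
    pendant : Γ.Joins (3 ↑ʳ g) 1F (3 ↑ʳ g)
    pendant = ≡.subst (λ x → Γ.Joins (3 ↑ʳ g) (x ↑ˡ (c ℕ.+ 1)) (3 ↑ʳ g)) core-g (Base.joins-new (core c 1 0) g)
    misses : ¬ Γ.Ends (3 ↑ʳ g) 0F
    misses end with Γ.end-of {3 ↑ʳ g} pendant end
    ... | inj₁ ()
    ... | inj₂ ()
    not-adjacent : ¬ (∃[ e ] Γ.Joins e 0F (3 ↑ʳ g))
    not-adjacent (e , joins) = misses (≡.subst (λ e → Γ.Ends e 0F)
      (pendant-end triangleGraph (core c 1 0) e g (Γ.Joins⇒Ends {e} (Γ.Joins-sym {e} joins))) (Γ.Joins⇒Ends {e} joins))
    spokes : ∀ e → e ≢ 1F → e ≢ 3 ↑ʳ g → Γ.Ends e 0F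
    spokes 0F _ _ = inj₁ ≡.refl
    spokes 1F e≢1 _ = contradiction ≡.refl e≢1
    spokes 2F _ _ = inj₂ ≡.refl
    spokes (suc (suc (suc j))) _ e≢g = inj₁ (≡.cong (_↑ˡ (c ℕ.+ 1)) (≡.sym at-hub))
      where
      at-hub : core c 1 0 j ≡ 0F
      at-hub with splitAt c j in eq
      ... | inj₁ _ = ≡.refl
      ... | inj₂ 0F = contradiction (≡.cong (3 ↑ʳ_) (≡.sym (splitAt⁻¹-↑ʳ eq))) e≢g

  -- One of the `c` pendant edges carries the additional edge, so `q` counts the others. The result
  -- is independent of `j` and `i`: up to isomorphism the choice of tip does not matter.
  H₃-graph : ∀ c {q} → suc q ≡ c → (j : Fin c) (i : Fin (suc p)) → graph₃ q ≅ᴳ U₃C-graph c j i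
  H₃-graph (suc c) ≡.refl j i = HubShapes.to-graph₃ Γ (covered (U₃C-connectedUnicyclic (suc c) j i)) 0F
    {a = 1F} {b = 2F} {ea = 0F} {eb = 2F} {f = 1F}
    (old {0F} (side {suc c} {0} {0} 0F)) (Γ.Joins-sym {2F} (old {2F} (side {suc c} {0} {0} 2F)))
    (old {1F} (side {suc c} {0} {0} 1F)) (λ { (inj₁ ()) ; (inj₂ ()) })
    {l = l} {g = g} (λ ()) not-adjacent misses spokes {w = (3 ↑ʳ j′) ↑ˡ 1} {ew = (3 ↑ʳ j′) ↑ˡ 1}
    spoke (λ ()) (λ ()) pendant (≡.trans (ℕ.+-comm (3 ℕ.+ (suc c ℕ.+ 0)) 1) (k≡ 5 c))
    where
    Γ = U₃C-graph (suc c) j i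
    module Γ = Graph Γ
    j′ = j ↑ˡ 0
    Γ₁ = UC₃-graph (suc c) 0 0
    open AddPendants Γ₁ {1} (λ _ → 3 ↑ʳ j′) renaming (joins-old to old)
    g l : Fin ((3 ℕ.+ (suc c ℕ.+ 0)) ℕ.+ 1)
    g = (3 ℕ.+ (suc c ℕ.+ 0)) ↑ʳ 0F
    l = (3 ℕ.+ (suc c ℕ.+ 0)) ↑ʳ 0F
    pendant : Γ.Joins g ((3 ↑ʳ j′) ↑ˡ 1) l
    pendant = joins-new 0F
    spoke : Γ.Joins ((3 ↑ʳ j′) ↑ˡ 1) 0F ((3 ↑ʳ j′) ↑ˡ 1)
    spoke = old {3 ↑ʳ j′} (≡.subst (λ x → Graph.Joins Γ₁ (3 ↑ʳ j′) (x ↑ˡ (suc c ℕ.+ 0)) (3 ↑ʳ j′)) (core-spoke (suc c) {j′}) (Base.joins-new (core (suc c) 0 0) j′))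
    misses : ¬ Γ.Ends g 0F
    misses end with Γ.end-of {g} pendant end
    ... | inj₁ ()
    ... | inj₂ ()
    not-adjacent : ¬ (∃[ e ] Γ.Joins e 0F l)
    not-adjacent (e , joins) = misses (≡.subst (λ e → Γ.Ends e 0F)
      (pendant-end Γ₁ {1} (λ _ → 3 ↑ʳ j′) e 0F (Γ.Joins⇒Ends {e} (Γ.Joins-sym {e} joins))) (Γ.Joins⇒Ends {e} joins))
    spokes : ∀ e → e ≢ 1F → e ≢ g → Γ.Ends e 0F
    spokes e e≢1 e≢g with splitAt (3 ℕ.+ (suc c ℕ.+ 0)) e in eq
    ... | inj₁ e′ = Sum.map (≡.cong (_↑ˡ 1)) (≡.cong (_↑ˡ 1)) (UC₃-spokes (suc c) e′ λ { ≡.refl → e≢1 (≡.sym (splitAt⁻¹-↑ˡ eq)) })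
    ... | inj₂ 0F = contradiction (≡.sym (splitAt⁻¹-↑ʳ eq)) e≢g

-- Arithmetic in a complete ordered field.

module OrderedField (𝓡 : CompleteOrderedField) where

  open CompleteOrderedField 𝓡 public
    renaming (_+ʳ_ to _+_; _*ʳ_ to _*_; -ʳ_ to -_; _≤ʳ_ to _≤_)
  open IsStrictTotalOrder isStrictTotalOrder public
    using (<-resp-≈) renaming (trans to <-trans; irrefl to <-irrefl)
  module Eq = IsStrictTotalOrder.Eq isStrictTotalOrder
  private
    module M = SemiringMult semiring
    module M′ = SemiringMult′ semiring
    module R = RingProperties ring
    module A = AbelianGroupProperties +-abelianGroup
    module S = IsStrictTotalOrder isStrictTotalOrder

  infix 9 #_
  -- With this version of multiples `# 1` is `1#` and `# 2` is `1# + 1#` by computation, so numerals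
  -- match the constants of the solver.
  #_ : ℕ → ℝ
  # n = n M′.× 1#

  #-suc : ∀ n → # suc n ≈ 1# + # n
  #-suc n = M′.1+× n 1#

  #-+ : ∀ m n → # (m ℕ.+ n) ≈ # m + # n
  #-+ = M′.×-homo-+ 1#

  #-* : ∀ m n → # (m ℕ.* n) ≈ # m * # n
  #-* = M′.×1-homo-*

  ·1≈# : ∀ n → n · 1# ≈ # n
  ·1≈# n = M′.×ᵤ≈× n 1#

  private
    ⟦_⟧ᶻ : ℤ → ℝ
    ⟦ + n ⟧ᶻ = # n
    ⟦ -[1+ n ] ⟧ᶻ = - # suc n

    ⊖-homo : ∀ m n → ⟦ m ⊖ n ⟧ᶻ ≈ # m + - # n
    ⊖-homo zero zero = Eq.sym (-‿inverseʳ 0#)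
    ⊖-homo (suc m) zero = Eq.sym (Eq.trans (+-congˡ R.-0#≈0#) (+-identityʳ _))
    ⊖-homo zero (suc n) = Eq.sym (+-identityˡ _)
    ⊖-homo (suc m) (suc n) = begin
      ⟦ suc m ⊖ suc n ⟧ᶻ             ≡⟨ ≡.cong ⟦_⟧ᶻ (ℤ.[1+m]⊖[1+n]≡m⊖n m n) ⟩
      ⟦ m ⊖ n ⟧ᶻ                     ≈⟨ ⊖-homo m n ⟩
      # m + - # n                    ≈⟨ +-congʳ (+-identityʳ _) ⟨
      # m + 0# + - # n               ≈⟨ +-congʳ (+-congˡ (-‿inverseʳ 1#)) ⟨
      # m + (1# + - 1#) + - # n      ≈⟨ +-congʳ (+-assoc _ _ _) ⟨
      # m + 1# + - 1# + - # n        ≈⟨ +-assoc _ _ _ ⟩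
      # m + 1# + (- 1# + - # n)      ≈⟨ +-cong (+-comm _ _) (A.⁻¹-∙-comm 1# (# n)) ⟩
      1# + # m + - (1# + # n)        ≈⟨ +-cong (#-suc m) (-‿cong (#-suc n)) ⟨
      # suc m + - # suc n            ∎
      where open SetoidReasoning setoid

    +-homoᶻ : ∀ i j → ⟦ i ℤ.+ j ⟧ᶻ ≈ ⟦ i ⟧ᶻ + ⟦ j ⟧ᶻ
    +-homoᶻ (+ m) (+ n) = #-+ m n
    +-homoᶻ (+ m) -[1+ n ] = ⊖-homo m (suc n)
    +-homoᶻ -[1+ m ] (+ n) = Eq.trans (⊖-homo n (suc m)) (+-comm _ _)
    +-homoᶻ -[1+ m ] -[1+ n ] = begin
      - # suc (suc (m ℕ.+ n))    ≡⟨ ≡.cong (λ x → - # suc x) (ℕ.+-suc m n) ⟨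
      - # (suc m ℕ.+ suc n)      ≈⟨ -‿cong (#-+ (suc m) (suc n)) ⟩
      - (# suc m + # suc n)      ≈⟨ A.⁻¹-∙-comm (# suc m) (# suc n) ⟨
      - # suc m + - # suc n      ∎
      where open SetoidReasoning setoid

    -‿homoᶻ : ∀ i → ⟦ ℤ.- i ⟧ᶻ ≈ - ⟦ i ⟧ᶻ
    -‿homoᶻ (+ zero) = Eq.sym R.-0#≈0#
    -‿homoᶻ (+ suc n) = Eq.refl
    -‿homoᶻ -[1+ n ] = Eq.sym (R.-‿involutive (# suc n))

    *-homo⁺ : ∀ m j → ⟦ + m ℤ.* j ⟧ᶻ ≈ # m * ⟦ j ⟧ᶻ
    *-homo⁺ m (+ n) = Eq.trans (Eq.reflexive (≡.cong ⟦_⟧ᶻ (≡.sym (ℤ.pos-* m n)))) (#-* m n)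
    *-homo⁺ m -[1+ n ] = begin
      ⟦ + m ℤ.* -[1+ n ] ⟧ᶻ       ≡⟨ ≡.cong ⟦_⟧ᶻ (ℤ.neg-distribʳ-* (+ m) (+ suc n)) ⟨
      ⟦ ℤ.- (+ m ℤ.* + suc n) ⟧ᶻ  ≈⟨ -‿homoᶻ (+ m ℤ.* + suc n) ⟩
      - ⟦ + m ℤ.* + suc n ⟧ᶻ      ≈⟨ -‿cong (*-homo⁺ m (+ suc n)) ⟩
      - (# m * # suc n)           ≈⟨ R.-‿distribʳ-* _ _ ⟩
      # m * - # suc n             ∎
      where open SetoidReasoning setoid

    *-homoᶻ : ∀ i j → ⟦ i ℤ.* j ⟧ᶻ ≈ ⟦ i ⟧ᶻ * ⟦ j ⟧ᶻ
    *-homoᶻ (+ m) j = *-homo⁺ m j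
    *-homoᶻ -[1+ m ] j = begin
      ⟦ -[1+ m ] ℤ.* j ⟧ᶻ        ≡⟨ ≡.cong ⟦_⟧ᶻ (ℤ.neg-distribˡ-* (+ suc m) j) ⟨
      ⟦ ℤ.- (+ suc m ℤ.* j) ⟧ᶻ   ≈⟨ -‿homoᶻ (+ suc m ℤ.* j) ⟩
      - ⟦ + suc m ℤ.* j ⟧ᶻ       ≈⟨ -‿cong (*-homo⁺ (suc m) j) ⟩
      - (# suc m * ⟦ j ⟧ᶻ)       ≈⟨ R.-‿distribˡ-* _ _ ⟩
      - # suc m * ⟦ j ⟧ᶻ         ∎
      where open SetoidReasoning setoid

    ℤ-rawRing : RawRing 0ℓ 0ℓ
    ℤ-rawRing = record
      { Carrier = ℤ ; _≈_ = _≡_ ; _+_ = ℤ._+_ ; _*_ = ℤ._*_ ; -_ = ℤ.-_ ; 0# = + 0 ; 1# = + 1 }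

    homomorphism : ℤ-rawRing -Raw-AlmostCommutative⟶ fromCommutativeRing commutativeRing
    homomorphism = record
      { ⟦_⟧ = ⟦_⟧ᶻ ; +-homo = +-homoᶻ ; *-homo = *-homoᶻ ; -‿homo = -‿homoᶻ
      ; 0-homo = Eq.refl ; 1-homo = Eq.refl }

    coefficient≟ : ∀ i j → Maybe (⟦ i ⟧ᶻ ≈ ⟦ j ⟧ᶻ)
    coefficient≟ i j with i ℤ.≟ j
    ... | yes i≡j = just (Eq.reflexive (≡.cong ⟦_⟧ᶻ i≡j))
    ... | no _    = nothing

  -- Integer coefficients compute and have decidable equality, which lets the solver combine
  -- numerals and cancel terms.
  module Solver = RingSolver ℤ-rawRing (fromCommutativeRing commutativeRing)
    homomorphism coefficient≟
  open Solver public using (solve; _:=_; _:+_; _:*_; _:-_; :-_; Polynomial)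

  :# : ∀ {n} → ℕ → Polynomial n
  :# k = Solver.con (+ k)

  strictPartialOrder : StrictPartialOrder 0ℓ 0ℓ 0ℓ
  strictPartialOrder = record { isStrictPartialOrder = S.isStrictPartialOrder }

  module ≤-Reasoning = StrictPartialOrderReasoning strictPartialOrder
  module ≈-Reasoning = SetoidReasoning setoid

  <⇒≤ : ∀ {x y} → x < y → x ≤ y
  <⇒≤ = inj₁

  ≤-reflexive : ∀ {x y} → x ≈ y → x ≤ y
  ≤-reflexive = inj₂

  ≤-refl : ∀ {x} → x ≤ x
  ≤-refl = inj₂ Eq.refl

  ≤-trans : ∀ {x y z} → x ≤ y → y ≤ z → x ≤ z
  ≤-trans = NonStrict.trans _≈_ _<_ S.isEquivalence <-resp-≈ <-trans

  <-≤-trans : ∀ {x y z} → x < y → y ≤ z → x < z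
  <-≤-trans = NonStrict.<-≤-trans _≈_ _<_ <-trans S.<-respʳ-≈

  ≤-<-trans : ∀ {x y z} → x ≤ y → y < z → x < z
  ≤-<-trans = NonStrict.≤-<-trans _≈_ _<_ Eq.sym <-trans S.<-respˡ-≈

  ≤⇒≯ : ∀ {x y} → x ≤ y → ¬ y < x
  ≤⇒≯ x≤y y<x = <-irrefl Eq.refl (≤-<-trans x≤y y<x)

  ≤-antisym : ∀ {x y} → x ≤ y → y ≤ x → x ≈ y
  ≤-antisym = NonStrict.antisym _≈_ _<_ S.isEquivalence <-trans <-irrefl

  <-or-≥ : ∀ x y → x < y ⊎ y ≤ x
  <-or-≥ x y with compare x y
  ... | tri< x<y _ _ = inj₁ x<y
  ... | tri≈ _ x≈y _ = inj₂ (inj₂ (Eq.sym x≈y))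
  ... | tri> _ _ y<x = inj₂ (inj₁ y<x)

  ≮⇒≥ : ∀ {x y} → ¬ x < y → y ≤ x
  ≮⇒≥ {x} {y} x≮y with <-or-≥ x y
  ... | inj₁ x<y = contradiction x<y x≮y
  ... | inj₂ y≤x = y≤x

  ≰⇒> : ∀ {x y} → ¬ x ≤ y → y < x
  ≰⇒> {x} {y} x≰y with <-or-≥ y x
  ... | inj₁ y<x = y<x
  ... | inj₂ x≤y = contradiction x≤y x≰y

  +-monoʳ-< : ∀ z {x y} → x < y → z + x < z + y
  +-monoʳ-< z x<y = S.<-respˡ-≈ (+-comm _ _) (S.<-respʳ-≈ (+-comm _ _) (+-monoˡ-< z x<y))

  +-monoˡ-≤ : ∀ z {x y} → x ≤ y → x + z ≤ y + z
  +-monoˡ-≤ z (inj₁ x<y) = inj₁ (+-monoˡ-< z x<y)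
  +-monoˡ-≤ z (inj₂ x≈y) = inj₂ (+-congʳ x≈y)

  +-monoʳ-≤ : ∀ z {x y} → x ≤ y → z + x ≤ z + y
  +-monoʳ-≤ z (inj₁ x<y) = inj₁ (+-monoʳ-< z x<y)
  +-monoʳ-≤ z (inj₂ x≈y) = inj₂ (+-congˡ x≈y)

  +-mono-≤ : ∀ {x y u v} → x ≤ y → u ≤ v → x + u ≤ y + v
  +-mono-≤ x≤y u≤v = ≤-trans (+-monoˡ-≤ _ x≤y) (+-monoʳ-≤ _ u≤v)

  +-mono-<-≤ : ∀ {x y u v} → x < y → u ≤ v → x + u < y + v
  +-mono-<-≤ x<y u≤v = <-≤-trans (+-monoˡ-< _ x<y) (+-monoʳ-≤ _ u≤v)

  +-nonneg : ∀ {x y} → 0# ≤ x → 0# ≤ y → 0# ≤ x + y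
  +-nonneg 0≤x 0≤y = ≤-trans (≤-reflexive (Eq.sym (+-identityˡ 0#))) (+-mono-≤ 0≤x 0≤y)

  +-pos : ∀ {x y} → 0# < x → 0# ≤ y → 0# < x + y
  +-pos 0<x 0≤y = ≤-<-trans (≤-reflexive (Eq.sym (+-identityˡ 0#))) (+-mono-<-≤ 0<x 0≤y)

  *-nonneg : ∀ {x y} → 0# ≤ x → 0# ≤ y → 0# ≤ x * y
  *-nonneg (inj₁ 0<x) (inj₁ 0<y) = inj₁ (*-pos 0<x 0<y)
  *-nonneg (inj₁ 0<x) (inj₂ 0≈y) = inj₂ (Eq.trans (Eq.sym (zeroʳ _)) (*-congˡ 0≈y))
  *-nonneg (inj₂ 0≈x) _          = inj₂ (Eq.trans (Eq.sym (zeroˡ _)) (*-congʳ 0≈x))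

  -- The pattern of most estimates below: `d` is a combination of gaps of known inequalities with
  -- nonnegative multipliers, and the equation is a ring identity. The content of such a proof is
  -- the choice of the multipliers.
  ≤-by : ∀ {x y} d → 0# ≤ d → y ≈ x + d → x ≤ y
  ≤-by {x} {y} d 0≤d y≈x+d = begin
    x       ≈⟨ +-identityʳ x ⟨
    x + 0#  ≤⟨ +-monoʳ-≤ x 0≤d ⟩
    x + d   ≈⟨ y≈x+d ⟨
    y       ∎
    where open ≤-Reasoning

  <-by : ∀ {x y} d → 0# < d → y ≈ x + d → x < y
  <-by {x} {y} d 0<d y≈x+d = begin-strict
    x       ≈⟨ +-identityʳ x ⟨
    x + 0#  <⟨ +-monoʳ-< x 0<d ⟩
    x + d   ≈⟨ y≈x+d ⟨
    y       ∎
    where open ≤-Reasoning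

  gap≤ : ∀ {x y} → x ≤ y → 0# ≤ y + - x
  gap≤ {x} x≤y = ≤-trans (≤-reflexive (Eq.sym (-‿inverseʳ x))) (+-monoˡ-≤ (- x) x≤y)

  gap< : ∀ {x y} → x < y → 0# < y + - x
  gap< {x} x<y = ≤-<-trans (≤-reflexive (Eq.sym (-‿inverseʳ x))) (+-monoˡ-< (- x) x<y)

  ungap≤ : ∀ {x y} → 0# ≤ y + - x → x ≤ y
  ungap≤ {x} {y} 0≤ = ≤-by _ 0≤ (solve 2 (λ x y → y := x :+ (y :- x)) Eq.refl x y)

  *-monoˡ-≤ : ∀ {z x y} → 0# ≤ z → x ≤ y → z * x ≤ z * y
  *-monoˡ-≤ {z} {x} {y} 0≤z x≤y = ≤-by _ (*-nonneg 0≤z (gap≤ x≤y))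
    (solve 3 (λ x y z → z :* y := z :* x :+ z :* (y :- x)) Eq.refl x y z)

  *-monoˡ-< : ∀ {z x y} → 0# < z → x < y → z * x < z * y
  *-monoˡ-< {z} {x} {y} 0<z x<y = <-by _ (*-pos 0<z (gap< x<y))
    (solve 3 (λ x y z → z :* y := z :* x :+ z :* (y :- x)) Eq.refl x y z)

  *-mono-≤ : ∀ {x y u v} → 0# ≤ x → 0# ≤ v → x ≤ y → u ≤ v → x * u ≤ y * v
  *-mono-≤ {x} {y} {u} {v} 0≤x 0≤v x≤y u≤v = ≤-trans (*-monoˡ-≤ 0≤x u≤v)
    (≤-trans (≤-reflexive (*-comm x v)) (≤-trans (*-monoˡ-≤ 0≤v x≤y) (≤-reflexive (*-comm v y))))

  *-cancelˡ-≤ : ∀ {z x y} → 0# < z → z * x ≤ z * y → x ≤ y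
  *-cancelˡ-≤ 0<z zx≤zy = ≮⇒≥ (λ y<x → ≤⇒≯ zx≤zy (*-monoˡ-< 0<z y<x))

  *-cancelˡ-< : ∀ {z x y} → 0# < z → z * x < z * y → x < y
  *-cancelˡ-< 0<z zx<zy = ≰⇒> (λ y≤x → ≤⇒≯ (*-monoˡ-≤ (<⇒≤ 0<z) y≤x) zx<zy)

  >0⇒≉0 : ∀ {x} → 0# < x → ¬ x ≈ 0#
  >0⇒≉0 0<x x≈0 = <-irrefl (Eq.sym x≈0) 0<x

  *-cancelˡ : ∀ {z x y} → 0# < z → z * x ≈ z * y → x ≈ y
  *-cancelˡ 0<z eq = ≤-antisym (*-cancelˡ-≤ 0<z (≤-reflexive eq))
    (*-cancelˡ-≤ 0<z (≤-reflexive (Eq.sym eq)))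

  *⁻¹ : ∀ {x} → 0# < x → x * x ⁻¹ ≈ 1#
  *⁻¹ 0<x = ⁻¹-inverseʳ (>0⇒≉0 0<x)

  ⁻¹-pos : ∀ {x} → 0# < x → 0# < x ⁻¹
  ⁻¹-pos {x} 0<x = *-cancelˡ-< 0<x (≤-<-trans (≤-reflexive (zeroʳ x))
    (<-≤-trans 0<1 (≤-reflexive (Eq.sym (*⁻¹ 0<x)))))

  #-nonneg : ∀ n → 0# ≤ # n
  #-nonneg zero    = ≤-refl
  #-nonneg (suc n) = ≤-trans (+-nonneg (<⇒≤ 0<1) (#-nonneg n)) (≤-reflexive (Eq.sym (#-suc n)))

  #-pos : ∀ n → 0# < # suc n
  #-pos n = <-≤-trans (+-pos 0<1 (#-nonneg n)) (≤-reflexive (Eq.sym (#-suc n)))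

  #-mono : ∀ {m n} → m ℕ.≤ n → # m ≤ # n
  #-mono {m} {n} m≤n = ≤-by (# (n ℕ.∸ m)) (#-nonneg (n ℕ.∸ m))
    (Eq.trans (Eq.reflexive (≡.cong #_ (≡.sym (ℕ.m+[n∸m]≡n m≤n)))) (#-+ m (n ℕ.∸ m)))

  ∣∣-cases : ∀ x → (x < 0# × ∣ x ∣ʳ ≡ - x) ⊎ (0# ≤ x × ∣ x ∣ʳ ≡ x)
  ∣∣-cases x with x <? 0#
  ... | yes x<0 = inj₁ (x<0 , ≡.refl)
  ... | no  x≮0 = inj₂ (≮⇒≥ x≮0 , ≡.refl)

  ∣∣-nonneg : ∀ x → 0# ≤ ∣ x ∣ʳ
  ∣∣-nonneg x with ∣∣-cases x
  ... | inj₁ (x<0 , eq) = ≡.subst (0# ≤_) (≡.sym eq)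
    (≤-trans (gap≤ (<⇒≤ x<0)) (≤-reflexive (+-identityˡ (- x))))
  ... | inj₂ (0≤x , eq) = ≡.subst (0# ≤_) (≡.sym eq) 0≤x

  x≤∣x∣ : ∀ x → x ≤ ∣ x ∣ʳ
  x≤∣x∣ x with ∣∣-cases x
  ... | inj₁ (x<0 , eq) = ≤-trans (<⇒≤ x<0) (∣∣-nonneg x)
  ... | inj₂ (_ , eq)   = ≤-reflexive (Eq.reflexive (≡.sym eq))

  -x≤∣x∣ : ∀ x → - x ≤ ∣ x ∣ʳ
  -x≤∣x∣ x with ∣∣-cases x
  ... | inj₁ (_ , eq)   = ≤-reflexive (Eq.reflexive (≡.sym eq))
  ... | inj₂ (0≤x , eq) = ≤-trans
    (ungap≤ (≤-trans 0≤x (≤-reflexive (solve 1 (λ x → x := :# 0 :- (:- x)) Eq.refl x))))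
    (∣∣-nonneg x)

  ∣∣-≈0 : ∀ {x} → ∣ x ∣ʳ ≤ 0# → x ≈ 0#
  ∣∣-≈0 {x} ∣x∣≤0 = ≤-antisym (≤-trans (x≤∣x∣ x) ∣x∣≤0)
    (≤-trans (gap≤ (≤-trans (-x≤∣x∣ x) ∣x∣≤0))
      (≤-reflexive (solve 1 (λ x → :# 0 :- (:- x) := x) Eq.refl x)))

  ∣∣*∣∣-lub : ∀ {x y z} → x * y ≤ z → - (x * y) ≤ z → ∣ x ∣ʳ * ∣ y ∣ʳ ≤ z
  ∣∣*∣∣-lub {x} {y} {z} xy≤z -xy≤z with ∣∣-cases x | ∣∣-cases y
  ... | inj₁ (_ , p) | inj₁ (_ , q) = ≡.subst₂ (λ a b → a * b ≤ z) (≡.sym p) (≡.sym q)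
    (≤-trans (≤-reflexive (solve 2 (λ x y → (:- x) :* (:- y) := x :* y) Eq.refl x y)) xy≤z)
  ... | inj₁ (_ , p) | inj₂ (_ , q) = ≡.subst₂ (λ a b → a * b ≤ z) (≡.sym p) (≡.sym q)
    (≤-trans (≤-reflexive (solve 2 (λ x y → (:- x) :* y := :- (x :* y)) Eq.refl x y)) -xy≤z)
  ... | inj₂ (_ , p) | inj₁ (_ , q) = ≡.subst₂ (λ a b → a * b ≤ z) (≡.sym p) (≡.sym q)
    (≤-trans (≤-reflexive (solve 2 (λ x y → x :* (:- y) := :- (x :* y)) Eq.refl x y)) -xy≤z)
  ... | inj₂ (_ , p) | inj₂ (_ , q) = ≡.subst₂ (λ a b → a * b ≤ z) (≡.sym p) (≡.sym q) xy≤z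

  ⁻¹-unique : ∀ {x y} → 0# < x → x * y ≈ 1# → y ≈ x ⁻¹
  ⁻¹-unique 0<x xy≈1 = *-cancelˡ 0<x (Eq.trans xy≈1 (Eq.sym (*⁻¹ 0<x)))

  ⁻¹-cong : ∀ {x y} → 0# < x → x ≈ y → x ⁻¹ ≈ y ⁻¹
  ⁻¹-cong 0<x x≈y = ⁻¹-unique (<-≤-trans 0<x (≤-reflexive x≈y))
    (Eq.trans (*-congʳ (Eq.sym x≈y)) (*⁻¹ 0<x))

  -- Finite sums, indicators and counting.

  private module ∑ = SemiringSum semiring

  ∑-cong : ∀ {n} {f g : Fin n → ℝ} → (∀ i → f i ≈ g i) → sum f ≈ sum g
  ∑-cong = ∑.sum-cong-≋

  ∑-mono : ∀ {n} {f g : Fin n → ℝ} → (∀ i → f i ≤ g i) → sum f ≤ sum g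
  ∑-mono {zero}  f≤g = ≤-refl
  ∑-mono {suc n} f≤g = +-mono-≤ (f≤g zero) (∑-mono (f≤g ∘ suc))

  ∑-zero : ∀ {n} {f : Fin n → ℝ} → (∀ i → f i ≈ 0#) → sum f ≈ 0#
  ∑-zero {n} f≈0 = Eq.trans (∑-cong f≈0) (∑.sum-replicate-zero n)

  ∑-nonneg : ∀ {n} {f : Fin n → ℝ} → (∀ i → 0# ≤ f i) → 0# ≤ sum f
  ∑-nonneg {n} 0≤f = ≤-trans (≤-reflexive (Eq.sym (∑.sum-replicate-zero n))) (∑-mono 0≤f)

  ∑-+ : ∀ {n} (f g : Fin n → ℝ) → sum (λ i → f i + g i) ≈ sum f + sum g
  ∑-+ = ∑.∑-distrib-+

  ∑-* : ∀ {n} r (f : Fin n → ℝ) → r * sum f ≈ sum (λ i → r * f i)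
  ∑-* = ∑.*-distribˡ-sum

  ∑-swap : ∀ {m n} (f : Fin m → Fin n → ℝ) →
    sum (λ i → sum (f i)) ≈ sum (λ j → sum (λ i → f i j))
  ∑-swap = ∑.∑-comm

  ∑-const : ∀ n x → sum {n} (λ _ → x) ≈ # n * x
  ∑-const zero    x = Eq.sym (zeroˡ x)
  ∑-const (suc n) x = Eq.trans (+-congˡ (∑-const n x)) (Eq.trans
    (solve 2 (λ n x → x :+ n :* x := (:# 1 :+ n) :* x) Eq.refl (# n) x) (*-congʳ (Eq.sym (#-suc n))))

  ∑-single : ∀ {n} {f : Fin n → ℝ} j → (∀ i → i ≢ j → f i ≈ 0#) → sum f ≈ f j
  ∑-single zero    f≈0 = Eq.trans (+-congˡ (∑-zero (λ i → f≈0 (suc i) λ ()))) (+-identityʳ _)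
  ∑-single (suc j) f≈0 = Eq.trans (+-congʳ (f≈0 zero λ ()))
    (Eq.trans (+-identityˡ _) (∑-single j (λ i i≢j → f≈0 (suc i) (i≢j ∘ suc-injective))))

  term≤∑ : ∀ {n} {f : Fin n → ℝ} → (∀ i → 0# ≤ f i) → ∀ j → f j ≤ sum f
  term≤∑ {f = f} 0≤f zero    = ≤-by _ (∑-nonneg (0≤f ∘ suc)) Eq.refl
  term≤∑ {f = f} 0≤f (suc j) = ≤-trans (term≤∑ (0≤f ∘ suc) j) (≤-by (f zero) (0≤f zero) (+-comm _ _))

  ∑-++ : ∀ m {n} (f : Fin (m ℕ.+ n) → ℝ) →
    sum f ≈ sum (λ i → f (i ↑ˡ n)) + sum (λ j → f (m ↑ʳ j))
  ∑-++ zero    f = Eq.sym (+-identityˡ _)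
  ∑-++ (suc m) f = Eq.trans (+-congˡ (∑-++ m (f ∘ suc))) (Eq.sym (+-assoc _ _ _))

  ∑-combine : ∀ m {n} (f : Fin (m ℕ.* n) → ℝ) →
    sum f ≈ sum (λ i → sum (λ j → f (combine {m} {n} i j)))
  ∑-combine zero        f = Eq.refl
  ∑-combine (suc m) {n} f = Eq.trans (∑-++ n f) (+-congˡ (∑-combine m (f ∘ (n ↑ʳ_))))

  ∑-permute : ∀ {m n} (π : Fin m ↔ Fin n) (f : Fin n → ℝ) → sum f ≈ sum (f ∘ Inverse.to π)
  ∑-permute π f = ∑.sum-permute f π

  ∑-⊎× : ∀ {l n k p} (π : Fin l ↔ (Fin n ⊎ (Fin k × Fin p))) (f : Fin n ⊎ (Fin k × Fin p) → ℝ) →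
    sum (f ∘ Inverse.to π) ≈ sum (f ∘ inj₁) + sum (λ e → sum (λ i → f (inj₂ (e , i))))
  ∑-⊎× {l} {n} {k} {p} π f = begin
    sum (f ∘ Inverse.to π)                          ≈⟨ ∑-cong (λ i → Eq.reflexive (≡.cong f (label.strictlyInverseˡ (Inverse.to π i)))) ⟨
    sum (f ∘ label.to ∘ label.from ∘ Inverse.to π)  ≈⟨ ∑-permute (↔-sym label↔ ↔-∘ π) (f ∘ label.to) ⟨
    sum (f ∘ label.to)                              ≈⟨ ∑-++ n (f ∘ label.to) ⟩
    sum (λ i → f (label.to (i ↑ˡ k ℕ.* p))) + sum (λ j → f (label.to (n ↑ʳ j)))
      ≈⟨ +-cong (∑-cong (λ i → Eq.reflexive (≡.cong f (label.strictlyInverseˡ (inj₁ i))))) (Eq.trans (∑-combine k _)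
           (∑-cong (λ e → ∑-cong (λ i → Eq.reflexive (≡.cong f (label.strictlyInverseˡ (inj₂ (e , i)))))))) ⟩
    sum (f ∘ inj₁) + sum (λ e → sum (λ i → f (inj₂ (e , i)))) ∎
    where
    open ≈-Reasoning
    module label = Inverse (label↔ {n} {k} {p})

  when : Bool → ℝ → ℝ
  when b x = if b then x else 0#

  when-cong : ∀ b {x y} → x ≈ y → when b x ≈ when b y
  when-cong true  x≈y = x≈y
  when-cong false _   = Eq.refl

  when-* : ∀ b r x → r * when b x ≈ when b (r * x)
  when-* true  r x = Eq.refl
  when-* false r x = zeroʳ r

  when-+ : ∀ b x y → when b (x + y) ≈ when b x + when b y
  when-+ true  x y = Eq.refl
  when-+ false x y = Eq.sym (+-identityˡ 0#)

  when-∑ : ∀ b {n} (f : Fin n → ℝ) → when b (sum f) ≈ sum (λ i → when b (f i))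
  when-∑ true  f = Eq.refl
  when-∑ false {n} f = Eq.sym (∑-zero {n} (λ _ → Eq.refl))

  infixr 8 [_≟_]_
  [_≟_]_ : ∀ {n} → Fin n → Fin n → ℝ → ℝ
  [ i ≟ j ] x = when (does (i ≟ j)) x

  [≟]-refl : ∀ {n} (i : Fin n) x → [ i ≟ i ] x ≡ x
  [≟]-refl i x = ≡.cong (λ b → when b x) (dec-true (i ≟ i) ≡.refl)

  [≟]-≢ : ∀ {n} {i j : Fin n} → i ≢ j → ∀ x → [ i ≟ j ] x ≡ 0#
  [≟]-≢ {i = i} {j} i≢j x = ≡.cong (λ b → when b x) (dec-false (i ≟ j) i≢j)

  ∑-[≟] : ∀ {n} j (f : Fin n → ℝ) → sum (λ i → [ i ≟ j ] f i) ≈ f j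
  ∑-[≟] j f = Eq.trans (∑-single j (λ i i≢j → Eq.reflexive ([≟]-≢ i≢j (f i))))
    (Eq.reflexive ([≟]-refl j (f j)))

  -- Indicators are real numbers, so that numbers of edges and paths enter the estimates as sums;
  -- the attached proposition keeps their combinatorial meaning.
  Bit : ℝ → Set → Set
  Bit x A = (x ≈ 0# × ¬ A) ⊎ (x ≈ 1# × A)

  bit-* : ∀ {x y A B} → Bit x A → Bit y B → Bit (x * y) (A × B)
  bit-* (inj₁ (p , ¬a)) _ = inj₁ (Eq.trans (*-congʳ p) (zeroˡ _) , ¬a ∘ proj₁)
  bit-* (inj₂ (p , a)) (inj₁ (q , ¬b)) = inj₁ (Eq.trans (*-congˡ q) (zeroʳ _) , ¬b ∘ proj₂)
  bit-* (inj₂ (p , a)) (inj₂ (q , b)) = inj₂ (Eq.trans (*-cong p q) (*-identityˡ 1#) , a , b)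

  bit≤1 : ∀ {x A} → Bit x A → x ≤ 1#
  bit≤1 (inj₁ (p , _)) = ≤-trans (≤-reflexive p) (<⇒≤ 0<1)
  bit≤1 (inj₂ (p , _)) = ≤-reflexive p

  bit-nonneg : ∀ {x A} → Bit x A → 0# ≤ x
  bit-nonneg (inj₁ (p , _)) = ≤-reflexive (Eq.sym p)
  bit-nonneg (inj₂ (p , _)) = ≤-trans (<⇒≤ 0<1) (≤-reflexive (Eq.sym p))

  bit? : ∀ {x A} → Bit x A → Dec A
  bit? (inj₁ (_ , ¬a)) = no ¬a
  bit? (inj₂ (_ , a))  = yes a

  module _ {n : ℕ} {f : Fin n → ℝ} {A : Fin n → Set} (bits : ∀ i → Bit (f i) (A i)) where

    count≤1 : (∀ {i j} → A i → A j → i ≡ j) → sum f ≤ 1#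
    count≤1 unique with any? (λ i → bit? (bits i))
    ... | no none = ≤-trans (≤-reflexive (∑-zero {n} zero′)) (<⇒≤ 0<1)
      where
      zero′ : ∀ i → f i ≈ 0#
      zero′ i with bits i
      ... | inj₁ (p , _) = p
      ... | inj₂ (_ , a) = contradiction (i , a) none
    ... | yes (i , a) = ≤-trans (≤-reflexive (∑-single {n} i others)) (bit≤1 (bits i))
      where
      others : ∀ j → j ≢ i → f j ≈ 0#
      others j j≢i with bits j
      ... | inj₁ (p , _) = p
      ... | inj₂ (_ , b) = contradiction (unique b a) j≢i

    ones≤count : ∀ {i j l} → i ≢ j → i ≢ l → j ≢ l → A i → A j → A l → # 3 ≤ sum f
    ones≤count {i} {j} {l} i≢j i≢l j≢l ai aj al = begin
      # 3
        ≈⟨ +-cong (+-cong (∑-[≟] i (λ _ → 1#)) (∑-[≟] j (λ _ → 1#))) (∑-[≟] l (λ _ → 1#)) ⟨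
      sum (λ x → [ x ≟ i ] 1#) + sum (λ x → [ x ≟ j ] 1#) + sum (λ x → [ x ≟ l ] 1#)
        ≈⟨ Eq.trans (∑-+ {n} (λ x → [ x ≟ i ] 1# + [ x ≟ j ] 1#) _) (+-congʳ (∑-+ {n} (λ x → [ x ≟ i ] 1#) _)) ⟨
      sum (λ x → [ x ≟ i ] 1# + [ x ≟ j ] 1# + [ x ≟ l ] 1#)
        ≤⟨ ∑-mono {n} pointwise ⟩
      sum f ∎
      where
      open ≤-Reasoning
      one : ∀ {x} → A x → 1# ≈ f x
      one {x} a with bits x
      ... | inj₁ (_ , ¬a) = contradiction a ¬a
      ... | inj₂ (p , _)  = Eq.sym p
      pointwise : ∀ x → [ x ≟ i ] 1# + [ x ≟ j ] 1# + [ x ≟ l ] 1# ≤ f x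
      pointwise x with x ≟ i | x ≟ j | x ≟ l
      ... | yes ≡.refl | yes p | _ = contradiction p i≢j
      ... | yes ≡.refl | no _ | yes p = contradiction p i≢l
      ... | yes ≡.refl | no _ | no _ = ≤-reflexive (Eq.trans (solve 0 (:# 1 :+ :# 0 :+ :# 0 := :# 1) Eq.refl) (one ai))
      ... | no _ | yes ≡.refl | yes p = contradiction p j≢l
      ... | no _ | yes ≡.refl | no _ = ≤-reflexive (Eq.trans (solve 0 (:# 0 :+ :# 1 :+ :# 0 := :# 1) Eq.refl) (one aj))
      ... | no _ | no _ | yes ≡.refl = ≤-reflexive (Eq.trans (solve 0 (:# 0 :+ :# 0 :+ :# 1 := :# 1) Eq.refl) (one al))
      ... | no _ | no _ | no _ = ≤-trans (≤-reflexive (solve 0 (:# 0 :+ :# 0 :+ :# 0 := :# 0) Eq.refl)) (bit-nonneg (bits x))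

  -- One index with the property is split off; of the remaining ones at most one can have it.
  count≤2 : ∀ {n} {f : Fin n → ℝ} {A : Fin n → Set} → (∀ i → Bit (f i) (A i)) →
    (∀ {i j l} → i ≢ j → i ≢ l → j ≢ l → A i → A j → ¬ A l) → sum f ≤ # 2
  count≤2 {n} {f} {A} bits no-three with any? (λ i → bit? (bits i))
  ... | no none = ≤-trans (count≤1 bits (λ {i} a _ → contradiction (i , a) none))
    (≤-by 1# (<⇒≤ 0<1) Eq.refl)
  ... | yes (i , a) = begin
    sum f
      ≈⟨ ∑-cong {n} (λ x → solve 2 (λ d f → f := d :* f :+ (:# 1 :- d) :* f) Eq.refl ([ x ≟ i ] 1#) (f x)) ⟩
    sum (λ x → [ x ≟ i ] 1# * f x + (1# + - [ x ≟ i ] 1#) * f x)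
      ≈⟨ ∑-+ {n} (λ x → [ x ≟ i ] 1# * f x) _ ⟩
    sum (λ x → [ x ≟ i ] 1# * f x) + sum (λ x → (1# + - [ x ≟ i ] 1#) * f x)
      ≤⟨ +-mono-≤ (count≤1 (λ x → bit-* (is i x) (bits x)) λ { (p , _) (q , _) → ≡.trans p (≡.sym q) })
           (count≤1 (λ x → bit-* (isn't i x) (bits x)) at-most-one) ⟩
    # 2 ∎
    where
    open ≤-Reasoning
    is : ∀ i x → Bit ([ x ≟ i ] 1#) (x ≡ i)
    is i x with x ≟ i
    ... | yes p = inj₂ (Eq.refl , p)
    ... | no ¬p = inj₁ (Eq.refl , ¬p)
    isn't : ∀ i x → Bit (1# + - [ x ≟ i ] 1#) (x ≢ i)
    isn't i x with x ≟ i
    ... | yes p = inj₁ (-‿inverseʳ 1# , λ ¬p → ¬p p)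
    ... | no ¬p = inj₂ (solve 0 (:# 1 :- :# 0 := :# 1) Eq.refl , ¬p)
    at-most-one : ∀ {j l} → j ≢ i × A j → l ≢ i × A l → j ≡ l
    at-most-one {j} {l} (j≢i , b) (l≢i , b′) with j ≟ l
    ... | yes p = p
    ... | no ¬p = contradiction b′ (no-three (j≢i ∘ ≡.sym) (l≢i ∘ ≡.sym) ¬p a b)

  IsNatural : ℝ → Set
  IsNatural x = ∃[ m ] x ≈ # m

  bit-natural : ∀ {x A} → Bit x A → IsNatural x
  bit-natural (inj₁ (p , _)) = 0 , p
  bit-natural (inj₂ (p , _)) = 1 , p

  *-natural : ∀ {x y} → IsNatural x → IsNatural y → IsNatural (x * y)
  *-natural (m , p) (n , q) = m ℕ.* n , Eq.trans (*-cong p q) (Eq.sym (#-* m n))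

  ∑-natural : ∀ {n} {f : Fin n → ℝ} → (∀ i → IsNatural (f i)) → IsNatural (sum f)
  ∑-natural {zero}  _ = 0 , Eq.refl
  ∑-natural {suc n} nat with nat zero | ∑-natural {n} (λ i → nat (suc i))
  ... | a , p | b , q = a ℕ.+ b , Eq.trans (+-cong p q) (Eq.sym (#-+ a b))

  argmax : ∀ {n} (f : Fin (suc n) → ℝ) → ∃[ u ] ∀ v → f v ≤ f u
  argmax {zero}  f = 0F , λ { 0F → ≤-refl }
  argmax {suc n} f with argmax (f ∘ suc)
  ... | u , f≤fu with <-or-≥ (f 0F) (f (suc u))
  ...   | inj₁ f0<fu = suc u , λ { 0F → <⇒≤ f0<fu ; (suc v) → f≤fu v }
  ...   | inj₂ fu≤f0 = 0F , λ { 0F → ≤-refl ; (suc v) → ≤-trans (f≤fu v) fu≤f0 }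

  -- Fixed points of Lipschitz functions.

  module LipschitzFunctions (a b : ℝ)
      (0≤a : 0# ≤ a) where

    infix 4 ∣_∣≤_
    ∣_∣≤_ : ℝ → ℝ → Set
    ∣ x ∣≤ y = x ≤ y × - x ≤ y

    ∣+∣≤ : ∀ {x y u v} → ∣ x ∣≤ u → ∣ y ∣≤ v → ∣ x + y ∣≤ u + v
    ∣+∣≤ {x} {y} (p , p′) (q , q′) = +-mono-≤ p q , ≤-trans
      (≤-reflexive (solve 2 (λ x y → :- (x :+ y) := (:- x) :+ (:- y)) Eq.refl x y)) (+-mono-≤ p′ q′)

    -- 2 (u v - x y) = (u - x) (v + y) + (u + x) (v - y), and similarly with the sign of x y
    -- changed, so no signs have to be distinguished.
    ∣*∣≤ : ∀ {x y u v} → ∣ x ∣≤ u → ∣ y ∣≤ v → ∣ x * y ∣≤ u * v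
    ∣*∣≤ {x} {y} {u} {v} (p , p′) (q , q′) =
      *-cancelˡ-≤ (#-pos 1) (≤-by _ (+-nonneg (*-nonneg (gap≤ p) (gap≤ q′)) (*-nonneg (gap≤ p′) (gap≤ q)))
        (solve 4 (λ x y u v → :# 2 :* (u :* v) := :# 2 :* (x :* y) :+
          ((u :- x) :* (v :- (:- y)) :+ (u :- (:- x)) :* (v :- y))) Eq.refl x y u v)) ,
      *-cancelˡ-≤ (#-pos 1) (≤-by _ (+-nonneg (*-nonneg (gap≤ p) (gap≤ q)) (*-nonneg (gap≤ p′) (gap≤ q′)))
        (solve 4 (λ x y u v → :# 2 :* (u :* v) := :# 2 :* (:- (x :* y)) :+
          ((u :- x) :* (v :- y) :+ (u :- (:- x)) :* (v :- (:- y)))) Eq.refl x y u v))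

    ∣-∣≤ : ∀ {x y} → ∣ x ∣≤ y → ∣ - x ∣≤ y
    ∣-∣≤ {x} (p , q) = q , ≤-trans (≤-reflexive (solve 1 (λ x → :- (:- x) := x) Eq.refl x)) p

    ∣∣≤-resp : ∀ {x x′ y y′} → x ≈ x′ → y ≤ y′ → ∣ x ∣≤ y → ∣ x′ ∣≤ y′
    ∣∣≤-resp eq y≤y′ (p , q) = ≤-trans (≤-reflexive (Eq.sym eq)) (≤-trans p y≤y′) ,
      ≤-trans (≤-reflexive (-‿cong (Eq.sym eq))) (≤-trans q y≤y′)

    -- An explicit substitute for continuity that is closed under the operations from which the hub
    -- functions are built. The bound is carried along for the sake of products.
    record Lipschitz (f : ℝ → ℝ) : Set where
      field
        bound constant  : ℝ
        constant-nonneg : 0# ≤ constant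
        bounded         : ∀ {x} → a ≤ x → x ≤ b → ∣ f x ∣≤ bound
        lipschitz       : ∀ {x y} → a ≤ x → x ≤ y → y ≤ b → ∣ f y + - f x ∣≤ constant * (y + - x)
    open Lipschitz

    const-lipschitz : ∀ r → Lipschitz (λ _ → r)
    const-lipschitz r = record
      { bound = ∣ r ∣ʳ ; constant = 0# ; constant-nonneg = ≤-refl
      ; bounded = λ _ _ → x≤∣x∣ r , -x≤∣x∣ r
      ; lipschitz = λ {x} {y} _ _ _ →
          ≤-reflexive (solve 3 (λ r x y → r :- r := :# 0 :* (y :- x)) Eq.refl r x y) ,
          ≤-reflexive (solve 3 (λ r x y → :- (r :- r) := :# 0 :* (y :- x)) Eq.refl r x y) }

    id-lipschitz : Lipschitz (λ x → x)
    id-lipschitz = record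
      { bound = b ; constant = 1# ; constant-nonneg = <⇒≤ 0<1
      ; bounded = λ {x} a≤x x≤b → x≤b , ≤-trans (-x≤x (≤-trans 0≤a a≤x)) x≤b
      ; lipschitz = λ {x} {y} _ x≤y _ →
          ≤-reflexive (solve 2 (λ x y → y :- x := :# 1 :* (y :- x)) Eq.refl x y) ,
          ≤-trans (-x≤x (gap≤ x≤y)) (≤-reflexive (solve 2 (λ x y → y :- x := :# 1 :* (y :- x)) Eq.refl x y)) }
      where
      -x≤x : ∀ {x} → 0# ≤ x → - x ≤ x
      -x≤x {x} 0≤x = ≤-by (x + x) (+-nonneg 0≤x 0≤x) (solve 1 (λ x → x := :- x :+ (x :+ x)) Eq.refl x)

    +-lipschitz : ∀ {f g} → Lipschitz f → Lipschitz g → Lipschitz (λ x → f x + g x)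
    +-lipschitz {f} {g} F G = record
      { bound = bound F + bound G ; constant = constant F + constant G
      ; constant-nonneg = +-nonneg (constant-nonneg F) (constant-nonneg G)
      ; bounded = λ p q → ∣+∣≤ (bounded F p q) (bounded G p q)
      ; lipschitz = λ {x} {y} p q r → ∣∣≤-resp
          (solve 4 (λ a b c d → (a :- b) :+ (c :- d) := (a :+ c) :- (b :+ d)) Eq.refl (f y) (f x) (g y) (g x))
          (≤-reflexive (Eq.sym (distribʳ _ _ _))) (∣+∣≤ (lipschitz F p q r) (lipschitz G p q r)) }

    neg-lipschitz : ∀ {f} → Lipschitz f → Lipschitz (λ x → - f x)
    neg-lipschitz {f} F = record
      { bound = bound F ; constant = constant F ; constant-nonneg = constant-nonneg F
      ; bounded = λ p q → ∣-∣≤ (bounded F p q)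
      ; lipschitz = λ {x} {y} p q r → ∣∣≤-resp
          (solve 2 (λ a b → :- (a :- b) := (:- a) :- (:- b)) Eq.refl (f y) (f x))
          ≤-refl (∣-∣≤ (lipschitz F p q r)) }

    *-lipschitz : ∀ {f g} → Lipschitz f → Lipschitz g → Lipschitz (λ x → f x * g x)
    *-lipschitz {f} {g} F G = record
      { bound = bound F * bound G ; constant = constant F * ∣ bound G ∣ʳ + ∣ bound F ∣ʳ * constant G
      ; constant-nonneg = +-nonneg (*-nonneg (constant-nonneg F) (∣∣-nonneg _))
          (*-nonneg (∣∣-nonneg _) (constant-nonneg G))
      ; bounded = λ p q → ∣*∣≤ (bounded F p q) (bounded G p q)
      ; lipschitz = λ {x} {y} p q r → ∣∣≤-resp
          (solve 4 (λ a b c d → (a :- b) :* c :+ b :* (c :- d) := a :* c :- b :* d) Eq.refl (f y) (f x) (g y) (g x))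
          (≤-reflexive (solve 6 (λ cf bg bf cg x y → (cf :* (y :- x)) :* bg :+ bf :* (cg :* (y :- x)) :=
            (cf :* bg :+ bf :* cg) :* (y :- x)) Eq.refl (constant F) ∣ bound G ∣ʳ ∣ bound F ∣ʳ (constant G) x y))
          (∣+∣≤ (∣*∣≤ (lipschitz F p q r) (weaken (bounded G (≤-trans p q) r)))
                (∣*∣≤ (weaken (bounded F p (≤-trans q r))) (lipschitz G p q r))) }
      where
      weaken : ∀ {x y} → ∣ x ∣≤ y → ∣ x ∣≤ ∣ y ∣ʳ
      weaken (p , q) = ≤-trans p (x≤∣x∣ _) , ≤-trans q (x≤∣x∣ _)

    -- 1 / f y - 1 / f x = - (f y - f x) / (f x f y), and both inverses are at most 1, so the
    -- constant of `f` serves again.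
    ⁻¹-lipschitz : ∀ {f} → (∀ {x} → a ≤ x → x ≤ b → 1# ≤ f x) → Lipschitz f → Lipschitz (λ x → f x ⁻¹)
    ⁻¹-lipschitz {f} 1≤f F = record
      { bound = 1# ; constant = constant F ; constant-nonneg = constant-nonneg F
      ; bounded = bounded′
      ; lipschitz = λ {x} {y} p q r →
          let p′ = ≤-trans p q ; q′ = ≤-trans q r in ∣∣≤-resp
          (difference (f x) (f y) (f x ⁻¹) (f y ⁻¹) (*⁻¹ (0<f p q′)) (*⁻¹ (0<f p′ r)))
          (≤-reflexive (solve 3 (λ c x y → (c :* (y :- x)) :* (:# 1 :* :# 1) := c :* (y :- x)) Eq.refl (constant F) x y))
          (∣*∣≤ (∣-∣≤ (lipschitz F p q r)) (∣*∣≤ (bounded′ p q′) (bounded′ p′ r))) }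
      where
      0<f : ∀ {x} → a ≤ x → x ≤ b → 0# < f x
      0<f p q = <-≤-trans 0<1 (1≤f p q)
      bounded′ : ∀ {x} → a ≤ x → x ≤ b → ∣ f x ⁻¹ ∣≤ 1#
      bounded′ {x} p q =
        *-cancelˡ-≤ (0<f p q) (≤-trans (≤-reflexive (*⁻¹ (0<f p q)))
          (≤-trans (1≤f p q) (≤-reflexive (Eq.sym (*-identityʳ _))))) ,
        ≤-trans (≤-by (f x ⁻¹) (<⇒≤ (⁻¹-pos (0<f p q)))
          (solve 1 (λ x → :# 0 := :- x :+ x) Eq.refl (f x ⁻¹))) (<⇒≤ 0<1)
      difference : ∀ u v i j → u * i ≈ 1# → v * j ≈ 1# → - (v + - u) * (i * j) ≈ j + - i
      difference u v i j ui≈1 vj≈1 = begin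
        - (v + - u) * (i * j)
          ≈⟨ solve 4 (λ u v i j → :- (v :- u) :* (i :* j) := (u :* i) :* j :- (v :* j) :* i) Eq.refl u v i j ⟩
        (u * i) * j + - ((v * j) * i)
          ≈⟨ +-cong (*-congʳ ui≈1) (-‿cong (*-congʳ vj≈1)) ⟩
        1# * j + - (1# * i)
          ≈⟨ +-cong (*-identityˡ j) (-‿cong (*-identityˡ i)) ⟩
        j + - i ∎
        where open ≈-Reasoning

    -- The supremum `s` of all x ≥ a with x ≤ g x is the fixed point: were s < g s, some point
    -- beyond `s` would still satisfy the condition, and were g s < s, some number below `s` would
    -- already be an upper bound.
    fixed-point : ∀ {g} → Lipschitz g → (∀ {x} → a ≤ x → g x ≤ b) →
      ∀ {t} → a ≤ t → t < g t → ∃[ s ] t < s × s ≈ g s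
    fixed-point {g} G g≤b {t} a≤t t<gt = s , t<s , s≈gs
      where
      S : ℝ → Set
      S x = a ≤ x × x ≤ g x

      S-bounded : ∀ {x} → S x → x ≤ b
      S-bounded (a≤x , x≤gx) = ≤-trans x≤gx (g≤b a≤x)

      sup = complete S (t , a≤t , <⇒≤ t<gt) (b , S-bounded)
      s = proj₁ sup

      s-upper : ∀ {x} → S x → x ≤ s
      s-upper = proj₁ (proj₂ sup)

      t≤s : t ≤ s
      t≤s = s-upper (a≤t , <⇒≤ t<gt)

      a≤s = ≤-trans a≤t t≤s

      s≤b : s ≤ b
      s≤b = proj₂ (proj₂ sup) S-bounded

      L = constant G
      L+1>0 : 0# < 1# + L
      L+1>0 = +-pos 0<1 (constant-nonneg G)
      i = (1# + L) ⁻¹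

      s≮gs : ¬ s < g s
      s≮gs s<gs = ≤⇒≯ (s-upper (≤-trans a≤s s≤x , x≤gx)) s<x
        where
        δ = g s + - s
        -- Along a step of length η the difference of `g` and the identity changes by at most (1 +
        -- L) η = δ, so it cannot have changed sign at the end of the step.
        η = i * δ
        0<η = *-pos (⁻¹-pos L+1>0) (gap< s<gs)
        x = s + η
        δ≈ : δ ≈ (1# + L) * η
        δ≈ = Eq.trans (Eq.sym (*-identityˡ δ)) (Eq.trans (*-congʳ (Eq.sym (*⁻¹ L+1>0))) (*-assoc _ _ _))
        s<x : s < x
        s<x = <-by η 0<η Eq.refl
        s≤x = <⇒≤ s<x
        x≤gs : x ≤ g s
        x≤gs = ≤-by (L * η) (*-nonneg (constant-nonneg G) (<⇒≤ 0<η)) (begin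
          g s                      ≈⟨ solve 2 (λ g s → g := s :+ (g :- s)) Eq.refl (g s) s ⟩
          s + δ                    ≈⟨ +-congˡ δ≈ ⟩
          s + (1# + L) * η         ≈⟨ solve 3 (λ s l e → s :+ (:# 1 :+ l) :* e := s :+ e :+ l :* e) Eq.refl s L η ⟩
          x + L * η                ∎)
          where open ≈-Reasoning
        x≤gx : x ≤ g x
        x≤gx = ≤-by _ (gap≤ (proj₂ (lipschitz G a≤s s≤x (≤-trans x≤gs (g≤b a≤s))))) (begin
          g x                      ≈⟨ solve 4 (λ gx gs s e → gx := s :+ (gs :- s) :+ (gx :- gs)) Eq.refl (g x) (g s) s η ⟩
          s + δ + (g x + - g s)    ≈⟨ +-congʳ (+-congˡ δ≈) ⟩
          s + (1# + L) * η + (g x + - g s)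
            ≈⟨ solve 5 (λ gx gs s l e → s :+ (:# 1 :+ l) :* e :+ (gx :- gs) :=
                 s :+ e :+ (l :* (s :+ e :- s) :- (:- (gx :- gs)))) Eq.refl (g x) (g s) s L η ⟩
          x + (L * (x + - s) + - - (g x + - g s)) ∎)
          where open ≈-Reasoning

      gs≮s : ¬ g s < s
      gs≮s gs<s = ≤⇒≯ (proj₂ (proj₂ sup) upper) (<-by η 0<η (solve 2 (λ s e → s := s :- e :+ e) Eq.refl s η))
        where
        δ = s + - g s
        η = i * δ
        0<η = *-pos (⁻¹-pos L+1>0) (gap< gs<s)
        δ≈ : δ ≈ (1# + L) * η
        δ≈ = Eq.trans (Eq.sym (*-identityˡ δ)) (Eq.trans (*-congʳ (Eq.sym (*⁻¹ L+1>0))) (*-assoc _ _ _))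
        upper : ∀ {x} → S x → x ≤ s + - η
        upper {x} Sx@(a≤x , x≤gx) = *-cancelˡ-≤ L+1>0 (≤-by _
          (+-nonneg (gap≤ x≤gx) (gap≤ (proj₂ (lipschitz G a≤x (s-upper Sx) s≤b)))) (begin
            (1# + L) * (s + - η)
              ≈⟨ solve 3 (λ s l e → (:# 1 :+ l) :* (s :- e) := (:# 1 :+ l) :* s :- (:# 1 :+ l) :* e) Eq.refl s L η ⟩
            (1# + L) * s + - ((1# + L) * η)
              ≈⟨ +-congˡ (-‿cong δ≈) ⟨
            (1# + L) * s + - δ
              ≈⟨ solve 5 (λ s gs l x gx → (:# 1 :+ l) :* s :- (s :- gs) := (:# 1 :+ l) :* x :+
                   ((gx :- x) :+ (l :* (s :- x) :- (:- (gs :- gx))))) Eq.refl s (g s) L x (g x) ⟩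
            (1# + L) * x + ((g x + - x) + (L * (s + - x) + - - (g s + - g x))) ∎))
          where open ≈-Reasoning

      s≈gs : s ≈ g s
      s≈gs with compare s (g s)
      ... | tri< s<gs _ _ = contradiction s<gs s≮gs
      ... | tri≈ _ eq _   = eq
      ... | tri> _ _ gs<s = contradiction gs<s gs≮s

      t<s : t < s
      -- `g` is not assumed to respect the equality of the field, so s ≈ t is refuted through the
      -- Lipschitz estimate and not by rewriting t < g t.
      t<s = ≰⇒> λ s≤t → ≤⇒≯ (≤-by _
        (+-nonneg (gap≤ (proj₂ (lipschitz G a≤t t≤s s≤b))) (*-nonneg L+1≥0 (gap≤ s≤t))) (begin
          t         ≈⟨ solve 5 (λ s gs l t gt → t := gt :+ (l :* (s :- t) :- (:- (gs :- gt)) :+ (:# 1 :+ l) :* (t :- s)) :+ (s :- gs)) Eq.refl s (g s) L t (g t) ⟩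
          g t + (L * (s + - t) + - - (g s + - g t) + (1# + L) * (t + - s)) + (s + - g s)
                    ≈⟨ +-congˡ (Eq.trans (+-congˡ (-‿cong (Eq.sym s≈gs))) (-‿inverseʳ s)) ⟩
          g t + (L * (s + - t) + - - (g s + - g t) + (1# + L) * (t + - s)) + 0#
                    ≈⟨ +-identityʳ _ ⟩
          g t + (L * (s + - t) + - - (g s + - g t) + (1# + L) * (t + - s)) ∎)) t<gt
        where
        open ≈-Reasoning
        L+1≥0 = <⇒≤ L+1>0

  -- The eigenvalue equations of a power reduced to its graph.

  module AroundVertex (Γ : Graph) where

    open Graph Γ

    -- Summation over the edges at `v`, with the far end as second argument of `h`. All edges are
    -- run through; as none is a loop, each contributes at most one of its two terms.
    around : Fin n → (Fin k → Fin n → ℝ) → ℝ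
    around v h = sum (λ e → [ v ≟ src e ] h e (tgt e) + [ v ≟ tgt e ] h e (src e))

    around-mono : ∀ v {h h′} → (∀ e w → Joins e v w → h e w ≤ h′ e w) → around v h ≤ around v h′
    around-mono v {h} {h′} h≤h′ = ∑-mono λ e → +-mono-≤ (from-src e) (from-tgt e)
      where
      from-src : ∀ e → [ v ≟ src e ] h e (tgt e) ≤ [ v ≟ src e ] h′ e (tgt e)
      from-src e with v ≟ src e
      ... | yes p = h≤h′ e (tgt e) (inj₁ (p , ≡.refl))
      ... | no _  = ≤-refl
      from-tgt : ∀ e → [ v ≟ tgt e ] h e (src e) ≤ [ v ≟ tgt e ] h′ e (src e)
      from-tgt e with v ≟ tgt e
      ... | yes p = h≤h′ e (src e) (inj₂ (p , ≡.refl))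
      ... | no _  = ≤-refl

    around-cong : ∀ v {h h′} → (∀ e w → Joins e v w → h e w ≈ h′ e w) → around v h ≈ around v h′
    around-cong v eq = ≤-antisym (around-mono v (λ e w j → ≤-reflexive (eq e w j)))
      (around-mono v (λ e w j → ≤-reflexive (Eq.sym (eq e w j))))

    around-* : ∀ v r h → r * around v h ≈ around v (λ e w → r * h e w)
    around-* v r h = Eq.trans (∑-* {k} r _) (∑-cong {k} λ e → Eq.trans (distribˡ r _ _)
      (+-cong (when-* (does (v ≟ src e)) r _) (when-* (does (v ≟ tgt e)) r _)))

  module Coupling (p : ℕ) where

    N : ℝ
    N = # suc p

    N>0 : 0# < N
    N>0 = #-pos p

    -- Determined by (s + 1) (s + p) = (s + N) (s + c): the factor s + 1 comes from clearing
    -- denominators after the new vertices of an edge are eliminated. It vanishes for ordinary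
    -- graphs, where p = 0.
    c : ℝ → ℝ
    c s = # p * (s + N) ⁻¹

    s+N>0 : ∀ {s} → 0# ≤ s → 0# < s + N
    s+N>0 0≤s = <-≤-trans (+-pos N>0 0≤s) (≤-reflexive (+-comm _ _))

    c*[s+N] : ∀ {s} → 0# ≤ s → c s * (s + N) ≈ # p
    c*[s+N] {s} 0≤s = Eq.trans (*-assoc _ _ _) (Eq.trans (*-congˡ
      (Eq.trans (*-comm _ _) (*⁻¹ (s+N>0 0≤s)))) (*-identityʳ _))

    c-nonneg : ∀ {s} → 0# ≤ s → 0# ≤ c s
    c-nonneg 0≤s = *-nonneg (#-nonneg p) (<⇒≤ (⁻¹-pos (s+N>0 0≤s)))

    c≤1 : ∀ {s} → 0# ≤ s → c s ≤ 1#
    c≤1 {s} 0≤s = *-cancelˡ-≤ (s+N>0 0≤s) (begin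
      (s + N) * c s      ≈⟨ *-comm _ _ ⟩
      c s * (s + N)      ≈⟨ c*[s+N] 0≤s ⟩
      # p                ≤⟨ ≤-by (s + 1#) (+-nonneg 0≤s (<⇒≤ 0<1)) (Eq.trans (*-congʳ (+-congˡ (#-suc p)))
                              (solve 2 (λ s p → (s :+ (:# 1 :+ p)) :* :# 1 := p :+ (s :+ :# 1)) Eq.refl s (# p))) ⟩
      (s + N) * 1#       ∎)
      where open ≤-Reasoning

  module PowerSpectrum (p : ℕ) (Γ : Graph) where

    open Graph Γ
    open AroundVertex Γ public
    open Spectral 𝓡 using (adjacency; IsEigenvalue; IsSpectralRadius)

    private
      m = 2+ p
    open Coupling p public

    -- N times the adjacency matrix in terms of labels. Its entries are written as sums of
    -- indicators, so that a row can be summed by exchanging the order of summation.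
    χ : Label p Γ → Label p Γ → ℝ
    χ (inj₁ v) (inj₁ w) = around v (λ _ x → [ w ≟ x ] 1#)
    χ (inj₁ v) (inj₂ (e , _)) = [ v ≟ src e ] 1# + [ v ≟ tgt e ] 1#
    χ (inj₂ (e , _)) (inj₁ w) = [ w ≟ src e ] 1# + [ w ≟ tgt e ] 1#
    χ (inj₂ (e , i)) (inj₂ (f , j)) = [ f ≟ e ] (1# + - ([ j ≟ i ] 1#))

    Adjacent : Label p Γ → Label p Γ → Set
    Adjacent x y = x ≢ y × ∃[ e ] Member Γ x e × Member Γ y e

    end-sum : ∀ {e v} → Ends e v → [ v ≟ src e ] 1# + [ v ≟ tgt e ] 1# ≈ 1#
    end-sum {e} {v} (inj₁ v≡s) = Eq.trans (+-cong
      (Eq.reflexive (≡.trans (≡.cong (λ x → [ v ≟ x ] 1#) (≡.sym v≡s)) ([≟]-refl v 1#)))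
      (Eq.reflexive ([≟]-≢ (λ v≡t → loopless e (≡.trans (≡.sym v≡s) v≡t)) 1#))) (+-identityʳ 1#)
    end-sum {e} {v} (inj₂ v≡t) = Eq.trans (+-cong
      (Eq.reflexive ([≟]-≢ (λ v≡s → loopless e (≡.trans (≡.sym v≡s) v≡t)) 1#))
      (Eq.reflexive (≡.trans (≡.cong (λ x → [ v ≟ x ] 1#) (≡.sym v≡t)) ([≟]-refl v 1#)))) (+-identityˡ 1#)

    non-end-sum : ∀ {e v} → ¬ Ends e v → [ v ≟ src e ] 1# + [ v ≟ tgt e ] 1# ≈ 0#
    non-end-sum ¬end = Eq.trans (+-cong (Eq.reflexive ([≟]-≢ (¬end ∘ inj₁) 1#))
      (Eq.reflexive ([≟]-≢ (¬end ∘ inj₂) 1#))) (+-identityˡ 0#)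

    joins-sum : ∀ {e v w} → Joins e v w →
      [ v ≟ src e ] ([ w ≟ tgt e ] 1#) + [ v ≟ tgt e ] ([ w ≟ src e ] 1#) ≈ 1#
    joins-sum {e} (inj₁ (≡.refl , ≡.refl)) = Eq.trans (+-cong
      (Eq.reflexive (≡.trans ([≟]-refl (src e) _) ([≟]-refl (tgt e) 1#)))
      (Eq.reflexive ([≟]-≢ (loopless e) _))) (+-identityʳ 1#)
    joins-sum {e} (inj₂ (≡.refl , ≡.refl)) = Eq.trans (+-cong
      (Eq.reflexive ([≟]-≢ (loopless e ∘ ≡.sym) _))
      (Eq.reflexive (≡.trans ([≟]-refl (tgt e) _) ([≟]-refl (src e) 1#)))) (+-identityˡ 1#)

    non-joins-sum : ∀ {e v w} → ¬ Joins e v w →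
      [ v ≟ src e ] ([ w ≟ tgt e ] 1#) + [ v ≟ tgt e ] ([ w ≟ src e ] 1#) ≈ 0#
    non-joins-sum {e} {v} {w} ¬j = Eq.trans (+-cong first second) (+-identityˡ 0#)
      where
      first : [ v ≟ src e ] ([ w ≟ tgt e ] 1#) ≈ 0#
      first with v ≟ src e | w ≟ tgt e
      ... | no _  | _     = Eq.refl
      ... | yes _ | no _  = Eq.refl
      ... | yes q | yes r = contradiction (inj₁ (q , r)) ¬j
      second : [ v ≟ tgt e ] ([ w ≟ src e ] 1#) ≈ 0#
      second with v ≟ tgt e | w ≟ src e
      ... | no _  | _     = Eq.refl
      ... | yes _ | no _  = Eq.refl
      ... | yes q | yes r = contradiction (inj₂ (q , r)) ¬j

    χ-adjacent : ∀ x y → Adjacent x y → χ x y ≈ 1#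
    χ-adjacent (inj₁ v) (inj₁ w) (v≢w , e , ve , we) = Eq.trans
      (∑-single e (λ f f≢e → non-joins-sum (λ j → f≢e (simple j joins)))) (joins-sum joins)
      where joins = Ends² (v≢w ∘ ≡.cong inj₁) ve we
    χ-adjacent (inj₁ v) (inj₂ (f , _)) (_ , e , ve , ≡.refl) = end-sum ve
    χ-adjacent (inj₂ (f , _)) (inj₁ w) (_ , e , ≡.refl , we) = end-sum we
    χ-adjacent (inj₂ (f , i)) (inj₂ (.f , j)) (i≢j , .f , ≡.refl , ≡.refl) = Eq.trans
      (Eq.reflexive ([≟]-refl f _)) (Eq.trans
        (+-congˡ (-‿cong (Eq.reflexive ([≟]-≢ (λ j≡i → i≢j (≡.cong (λ z → inj₂ (f , z)) (≡.sym j≡i))) 1#))))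
        (solve 0 (:# 1 :- :# 0 := :# 1) Eq.refl))

    χ-nonadjacent : ∀ x y → ¬ Adjacent x y → χ x y ≈ 0#
    χ-nonadjacent (inj₁ v) (inj₁ w) ¬adj = ∑-zero λ e → non-joins-sum λ j →
      ¬adj ((λ eq → Joins⇒≢ j (inj₁-injective eq)) , e , Joins⇒Ends j , Joins⇒Ends (Joins-sym j))
    χ-nonadjacent (inj₁ v) (inj₂ (f , _)) ¬adj = non-end-sum λ vf → ¬adj ((λ ()) , f , vf , ≡.refl)
    χ-nonadjacent (inj₂ (f , _)) (inj₁ w) ¬adj = non-end-sum λ wf → ¬adj ((λ ()) , f , ≡.refl , wf)
    χ-nonadjacent (inj₂ (e , i)) (inj₂ (f , j)) ¬adj with f ≟ e
    ... | no _ = Eq.refl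
    ... | yes ≡.refl with j ≟ i
    ...   | yes _  = -‿inverseʳ 1#
    ...   | no j≢i = contradiction
      ((λ eq → j≢i (≡.sym (proj₂ (,-injective (inj₂-injective eq))))) , e , ≡.refl , ≡.refl) ¬adj

    neighbours : (Label p Γ → ℝ) → Label p Γ → ℝ
    neighbours z (inj₁ v) = around v (λ e w → z (inj₁ w) + sum (λ i → z (inj₂ (e , i))))
    neighbours z (inj₂ (e , i)) =
      z (inj₁ (src e)) + z (inj₁ (tgt e)) + (sum (λ j → z (inj₂ (e , j))) + - z (inj₂ (e , i)))

    end-weight : ∀ e (f : Fin n → ℝ) →
      sum (λ w → ([ w ≟ src e ] 1# + [ w ≟ tgt e ] 1#) * f w) ≈ f (src e) + f (tgt e)
    end-weight e f = begin
      sum (λ w → ([ w ≟ src e ] 1# + [ w ≟ tgt e ] 1#) * f w)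
        ≈⟨ ∑-cong (λ w → Eq.trans (distribʳ _ _ _) (+-cong (unit w (src e)) (unit w (tgt e)))) ⟩
      sum (λ w → [ w ≟ src e ] f w + [ w ≟ tgt e ] f w)
        ≈⟨ Eq.trans (∑-+ (λ w → [ w ≟ src e ] f w) _) (+-cong (∑-[≟] (src e) f) (∑-[≟] (tgt e) f)) ⟩
      f (src e) + f (tgt e) ∎
      where
      open ≈-Reasoning
      unit : ∀ w x → [ w ≟ x ] 1# * f w ≈ [ w ≟ x ] f w
      unit w x with w ≟ x
      ... | yes _ = *-identityˡ _
      ... | no _  = zeroˡ _

    private
      unit-row : ∀ x (f : Fin n → ℝ) → sum (λ w → [ w ≟ x ] 1# * f w) ≈ f x
      unit-row x f = Eq.trans (∑-cong (λ w → Eq.trans (*-comm _ _) (Eq.trans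
        (when-* (does (w ≟ x)) (f w) 1#) (when-cong (does (w ≟ x)) (*-identityʳ (f w)))))) (∑-[≟] x f)

    around-weight : ∀ v (f : Fin n → ℝ) →
      sum (λ w → around v (λ _ x → [ w ≟ x ] 1#) * f w) ≈ around v (λ _ x → f x)
    around-weight v f = begin
      sum (λ w → around v (λ _ x → [ w ≟ x ] 1#) * f w)
        ≈⟨ ∑-cong (λ w → Eq.trans (*-comm _ _) (Eq.trans (around-* v (f w) (λ _ x → [ w ≟ x ] 1#)) (around-cong v {λ _ x → f w * [ w ≟ x ] 1#} (λ _ x _ → *-comm _ _)))) ⟩
      sum (λ w → around v (λ _ x → [ w ≟ x ] 1# * f w))
        ≈⟨ ∑-swap {n} {k} _ ⟩
      sum (λ e → sum (λ w → [ v ≟ src e ] ([ w ≟ tgt e ] 1# * f w) + [ v ≟ tgt e ] ([ w ≟ src e ] 1# * f w)))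
        ≈⟨ ∑-cong (λ e → Eq.trans (∑-+ (λ w → [ v ≟ src e ] ([ w ≟ tgt e ] 1# * f w)) _)
             (+-cong (inner (does (v ≟ src e)) (tgt e)) (inner (does (v ≟ tgt e)) (src e)))) ⟩
      around v (λ _ x → f x) ∎
      where
      open ≈-Reasoning
      inner : ∀ b x → sum (λ w → when b ([ w ≟ x ] 1# * f w)) ≈ when b (f x)
      inner b x = Eq.trans (Eq.sym (when-∑ b {n} (λ w → [ w ≟ x ] 1# * f w))) (when-cong b (unit-row x f))

    around-+ : ∀ v (h h′ : Fin k → Fin n → ℝ) →
      around v h + around v h′ ≈ around v (λ e w → h e w + h′ e w)
    around-+ v h h′ = Eq.trans (Eq.sym (∑-+ {k} _ _)) (∑-cong λ e → Eq.trans
      (solve 4 (λ a b c d → (a :+ b) :+ (c :+ d) := (a :+ c) :+ (b :+ d)) Eq.refl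
        ([ v ≟ src e ] h e (tgt e)) ([ v ≟ tgt e ] h e (src e)) ([ v ≟ src e ] h′ e (tgt e)) ([ v ≟ tgt e ] h′ e (src e)))
      (+-cong (Eq.sym (when-+ (does (v ≟ src e)) _ _)) (Eq.sym (when-+ (does (v ≟ tgt e)) _ _))))

    χ-sum : ∀ x (z : Label p Γ → ℝ) →
      sum (λ w → χ x (inj₁ w) * z (inj₁ w)) + sum (λ f → sum (λ j → χ x (inj₂ (f , j)) * z (inj₂ (f , j))))
        ≈ neighbours z x
    χ-sum (inj₁ v) z = Eq.trans (+-cong (around-weight v (z ∘ inj₁)) (∑-cong fibre))
      (around-+ v (λ _ w → z (inj₁ w)) (λ e _ → Z e))
      where
      Z : Fin k → ℝ
      Z e = sum (λ i → z (inj₂ (e , i)))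
      scale : ∀ b r → when b 1# * r ≈ when b r
      scale true  r = *-identityˡ r
      scale false r = zeroˡ r
      fibre : ∀ e → sum (λ j → ([ v ≟ src e ] 1# + [ v ≟ tgt e ] 1#) * z (inj₂ (e , j)))
        ≈ [ v ≟ src e ] Z e + [ v ≟ tgt e ] Z e
      fibre e = Eq.trans (Eq.sym (∑-* _ (λ j → z (inj₂ (e , j))))) (Eq.trans (distribʳ _ _ _)
        (+-cong (scale (does (v ≟ src e)) _) (scale (does (v ≟ tgt e)) _)))
    χ-sum (inj₂ (e , i)) z = +-cong (end-weight e (z ∘ inj₁)) (Eq.trans
      (∑-cong {k} (λ f → Eq.trans (∑-cong {p} (λ j → Eq.trans (*-comm _ _) (when-* (does (f ≟ e)) _ _)))
        (Eq.sym (when-∑ (does (f ≟ e)) {p} _))))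
      (Eq.trans (∑-[≟] e (λ f → sum (λ j → z (inj₂ (f , j)) * (1# + - ([ j ≟ i ] 1#)))))
        (Eq.trans (∑-cong {p} (λ j → Eq.trans (solve 2 (λ z x → z :* (:# 1 :- x) := z :+ (:- :# 1) :* (z :* x)) Eq.refl
            (z (inj₂ (e , j))) ([ j ≟ i ] 1#))
            (+-congˡ (*-congˡ (Eq.trans (when-* (does (j ≟ i)) _ _) (when-cong (does (j ≟ i)) (*-identityʳ _)))))))
          (Eq.trans (∑-+ (λ j → z (inj₂ (e , j))) _) (+-congˡ (Eq.trans (Eq.sym (∑-* (- 1#) (λ j → [ j ≟ i ] z (inj₂ (e , j)))))
            (Eq.trans (*-congˡ (∑-[≟] i (λ j → z (inj₂ (e , j))))) (solve 1 (λ z → (:- :# 1) :* z := :- z) Eq.refl (z (inj₂ (e , i)))))))))))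

    module _ {H : Hypergraph} (H-power : IsPower p Γ H) where

      open IsPower H-power
      private
        module V = Inverse vertices
        module E = Inverse edges

      adjacency≈χ : ∀ u w → adjacency m H u w ≈ N ⁻¹ * χ (V.to u) (V.to w)
      adjacency≈χ u w with (¬? (u ≟ w) ×-dec inCommonEdge? H u w)
      ... | yes (u≢w , i , ui , wi) = Eq.sym (Eq.trans (*-congˡ (χ-adjacent (V.to u) (V.to w) adj))
        (Eq.trans (*-identityʳ _) (⁻¹-cong N>0 (Eq.sym (·1≈# (suc p))))))
        where
        adj : Adjacent (V.to u) (V.to w)
        adj = (λ eq → u≢w (↔-injective vertices eq)) , E.to i ,
          Equivalence.to (incidence u i) ui , Equivalence.to (incidence w i) wi
      ... | no ¬adj = Eq.sym (Eq.trans (*-congˡ (χ-nonadjacent (V.to u) (V.to w) adj)) (zeroʳ _))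
        where
        adj : ¬ Adjacent (V.to u) (V.to w)
        adj (u≢w , e , ue , we) = ¬adj ((λ eq → u≢w (≡.cong V.to eq)) , E.from e ,
          Equivalence.from (incidence u _) (≡.subst (Member Γ (V.to u)) (≡.sym (E.strictlyInverseˡ e)) ue) ,
          Equivalence.from (incidence w _) (≡.subst (Member Γ (V.to w)) (≡.sym (E.strictlyInverseˡ e)) we))

      adjacency-sum : ∀ u (z : Label p Γ → ℝ) →
        N * sum (λ w → adjacency m H u w * z (V.to w)) ≈ neighbours z (V.to u)
      adjacency-sum u z = begin
        N * sum (λ w → adjacency m H u w * z (V.to w))
          ≈⟨ *-congˡ (∑-cong {order H} (λ w → Eq.trans (*-congʳ (adjacency≈χ u w)) (*-assoc _ _ _))) ⟩
        N * sum (λ w → N ⁻¹ * (χ (V.to u) (V.to w) * z (V.to w)))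
          ≈⟨ *-congˡ (∑-* {order H} (N ⁻¹) _) ⟨
        N * (N ⁻¹ * sum (λ w → χ (V.to u) (V.to w) * z (V.to w)))
          ≈⟨ Eq.trans (Eq.sym (*-assoc _ _ _)) (Eq.trans (*-congʳ (*⁻¹ N>0)) (*-identityˡ _)) ⟩
        sum (λ w → χ (V.to u) (V.to w) * z (V.to w))
          ≈⟨ ∑-⊎× vertices (λ y → χ (V.to u) y * z y) ⟩
        _ ≈⟨ χ-sum (V.to u) z ⟩
        neighbours z (V.to u) ∎
        where open ≈-Reasoning

      -- The vector is continued to the new vertices of an edge v w by (x v + x w) / (s + 1), the
      -- value that their own equations force. At old vertices the equation is multiplied by s + 1
      -- and then matches (s + N) (s + c).
      eigenvalue : ∀ {s} → 0# ≤ s → (x : Fin n → ℝ) → ∀ {v} → ¬ x v ≈ 0# →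
        (∀ v → (s + c s) * x v ≈ around v (λ _ w → x w + c s * x v)) →
        IsEigenvalue (adjacency m H) ((s + # p) * N ⁻¹)
      eigenvalue {s} 0≤s x {v₀} xv₀≉0 eigen = z ∘ V.to ,
        (V.from (inj₁ v₀) , λ z≈0 → xv₀≉0 (Eq.trans (Eq.reflexive (≡.cong z (≡.sym (V.strictlyInverseˡ _)))) z≈0)) ,
        λ u → *-cancelˡ N>0 (begin
          N * sum (λ w → adjacency m H u w * z (V.to w))  ≈⟨ adjacency-sum u z ⟩
          neighbours z (V.to u)                           ≈⟨ local (V.to u) ⟩
          (s + # p) * z (V.to u)                          ≈⟨ *-identityˡ _ ⟨
          1# * ((s + # p) * z (V.to u))                   ≈⟨ *-congʳ (*⁻¹ N>0) ⟨
          N * N ⁻¹ * ((s + # p) * z (V.to u))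
            ≈⟨ solve 4 (λ n i a z → n :* i :* (a :* z) := n :* (a :* i :* z)) Eq.refl N (N ⁻¹) (s + # p) (z (V.to u)) ⟩
          N * ((s + # p) * N ⁻¹ * z (V.to u))             ∎)
        where
        open ≈-Reasoning
        j = (s + 1#) ⁻¹
        s+1>0 : 0# < s + 1#
        s+1>0 = <-≤-trans (+-pos 0<1 0≤s) (≤-reflexive (+-comm _ _))
        z : Label p Γ → ℝ
        z (inj₁ v) = x v
        z (inj₂ (e , _)) = (x (src e) + x (tgt e)) * j
        ends : ∀ {e v w} → Joins e v w → x (src e) + x (tgt e) ≈ x v + x w
        ends (inj₁ (≡.refl , ≡.refl)) = Eq.refl
        ends (inj₂ (≡.refl , ≡.refl)) = +-comm _ _
        local : ∀ q → neighbours z q ≈ (s + # p) * z q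
        local (inj₁ v) = *-cancelˡ s+1>0 (begin
          (s + 1#) * neighbours z (inj₁ v)
            ≈⟨ around-* v (s + 1#) (λ e w → x w + sum {p} (λ _ → (x (src e) + x (tgt e)) * j)) ⟩
          around v (λ e w → (s + 1#) * (x w + sum {p} (λ _ → (x (src e) + x (tgt e)) * j)))
            ≈⟨ around-cong v (λ e w joins → begin
              (s + 1#) * (x w + sum {p} (λ _ → (x (src e) + x (tgt e)) * j))
                ≈⟨ *-congˡ (+-congˡ (Eq.trans (∑-const p _) (*-congˡ (*-congʳ (ends joins))))) ⟩
              (s + 1#) * (x w + # p * ((x v + x w) * j))
                ≈⟨ solve 5 (λ s y p a j → (s :+ :# 1) :* (y :+ p :* ((a :+ y) :* j)) :=
                     (s :+ :# 1) :* y :+ p :* (a :+ y) :* ((s :+ :# 1) :* j)) Eq.refl s (x w) (# p) (x v) j ⟩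
              (s + 1#) * x w + # p * (x v + x w) * ((s + 1#) * j)
                ≈⟨ +-congˡ (Eq.trans (*-congˡ (*⁻¹ s+1>0)) (*-identityʳ _)) ⟩
              (s + 1#) * x w + # p * (x v + x w)
                ≈⟨ solve 4 (λ s y p a → (s :+ :# 1) :* y :+ p :* (a :+ y) := (s :+ (:# 1 :+ p)) :* y :+ p :* a)
                     Eq.refl s (x w) (# p) (x v) ⟩
              (s + (1# + # p)) * x w + # p * x v
                ≈⟨ +-cong (*-congʳ (+-congˡ (#-suc p))) (*-congʳ (c*[s+N] 0≤s)) ⟨
              (s + N) * x w + c s * (s + N) * x v
                ≈⟨ solve 4 (λ t y c a → t :* y :+ c :* t :* a := t :* (y :+ c :* a)) Eq.refl (s + N) (x w) (c s) (x v) ⟩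
              (s + N) * (x w + c s * x v) ∎) ⟩
          around v (λ _ w → (s + N) * (x w + c s * x v))
            ≈⟨ around-* v (s + N) (λ _ w → x w + c s * x v) ⟨
          (s + N) * around v (λ _ w → x w + c s * x v)
            ≈⟨ *-congˡ (eigen v) ⟨
          (s + N) * ((s + c s) * x v)
            ≈⟨ solve 4 (λ t s c a → t :* ((s :+ c) :* a) := (t :* s :+ c :* t) :* a) Eq.refl (s + N) s (c s) (x v) ⟩
          ((s + N) * s + c s * (s + N)) * x v
            ≈⟨ *-congʳ (+-cong (*-congʳ (+-congˡ (#-suc p))) (c*[s+N] 0≤s)) ⟩
          ((s + (1# + # p)) * s + # p) * x v
            ≈⟨ solve 3 (λ s p a → ((s :+ (:# 1 :+ p)) :* s :+ p) :* a := (s :+ :# 1) :* ((s :+ p) :* a)) Eq.refl s (# p) (x v) ⟩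
          (s + 1#) * ((s + # p) * x v) ∎)
        local (inj₂ (e , i)) = begin
          X + (sum {p} (λ _ → X * j) + - (X * j))
            ≈⟨ +-congˡ (+-congʳ (∑-const p (X * j))) ⟩
          X + (# p * (X * j) + - (X * j))
            ≈⟨ +-congʳ (Eq.trans (*-congˡ (*⁻¹ s+1>0)) (*-identityʳ X)) ⟨
          X * ((s + 1#) * j) + (# p * (X * j) + - (X * j))
            ≈⟨ solve 4 (λ X s j p → X :* ((s :+ :# 1) :* j) :+ (p :* (X :* j) :- X :* j) := (s :+ p) :* (X :* j)) Eq.refl X s j (# p) ⟩
          (s + # p) * (X * j) ∎
          where X = x (src e) + x (tgt e)

      eigenvalue≤radius : ∀ {ρ s} → IsSpectralRadius (adjacency m H) ρ → 0# ≤ s →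
        (x : Fin n → ℝ) → ∀ {v} → ¬ x v ≈ 0# →
        (∀ v → (s + c s) * x v ≈ around v (λ _ w → x w + c s * x v)) →
        s ≤ N * ρ + - # p
      eigenvalue≤radius {ρ} {s} (_ , largest) 0≤s x x≉0 eigen = begin
        s                                     ≈⟨ solve 2 (λ s p → s := :# 1 :* (s :+ p) :- p) Eq.refl s (# p) ⟩
        1# * (s + # p) + - # p                ≈⟨ +-congʳ (*-congʳ (*⁻¹ N>0)) ⟨
        N * N ⁻¹ * (s + # p) + - # p
          ≈⟨ +-congʳ (solve 3 (λ n i a → n :* i :* a := n :* (a :* i)) Eq.refl N (N ⁻¹) (s + # p)) ⟩
        N * ((s + # p) * N ⁻¹) + - # p        ≤⟨ +-monoˡ-≤ _ (*-monoˡ-≤ (<⇒≤ N>0)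
                                                   (≤-trans (x≤∣x∣ _) (largest (eigenvalue 0≤s x x≉0 eigen)))) ⟩
        N * ρ + - # p                         ∎
        where open ≤-Reasoning

      adjacency-nonneg : ∀ u w → 0# ≤ adjacency m H u w
      adjacency-nonneg u w with (¬? (u ≟ w) ×-dec inCommonEdge? H u w)
      ... | yes _ = <⇒≤ (⁻¹-pos (<-≤-trans N>0 (≤-reflexive (Eq.sym (·1≈# (suc p))))))
      ... | no _  = ≤-refl

      -- The absolute values of an eigenvector of largest modulus, restricted to
      -- the vertices of the graph.
      radius-subinvariant : ∀ {ρ} → IsSpectralRadius (adjacency m H) ρ →
        let s = N * ρ + - # p in 0# ≤ s →
        ∃[ y ] (∀ v → 0# ≤ y v) × (∃[ v ] 0# < y v) ×
          (∀ v → (s + c s) * y v ≤ around v (λ _ w → y w + c s * y v))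
      radius-subinvariant {ρ} ((μ , (x , (u₀ , xu₀≉0) , eigen) , ρ≈∣μ∣) , _) 0≤s =
        y , (λ v → z-nonneg (inj₁ v)) , y-positive , subinvariant
        where
        s = N * ρ + - # p
        z : Label p Γ → ℝ
        z q = ∣ x (V.from q) ∣ʳ
        y = z ∘ inj₁
        z-nonneg : ∀ q → 0# ≤ z q
        z-nonneg q = ∣∣-nonneg _
        z∘to : ∀ u → z (V.to u) ≡ ∣ x u ∣ʳ
        z∘to u = ≡.cong (λ w → ∣ x w ∣ʳ) (V.strictlyInverseʳ u)

        bound : ∀ u → ρ * z (V.to u) ≤ sum (λ w → adjacency m H u w * z (V.to w))
        bound u = ≤-trans (≤-reflexive (*-cong ρ≈∣μ∣ (Eq.reflexive (z∘to u)))) (∣∣*∣∣-lub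
          (≤-trans (≤-reflexive (Eq.sym (eigen u))) (∑-mono λ w → *-monoˡ-≤ (adjacency-nonneg u w)
            (≤-trans (x≤∣x∣ (x w)) (≤-reflexive (Eq.reflexive (≡.sym (z∘to w)))))))
          (≤-trans (≤-reflexive (Eq.trans (-‿cong (Eq.sym (eigen u)))
            (Eq.trans (solve 1 (λ a → :- a := (:- :# 1) :* a) Eq.refl _) (∑-* {order H} (- 1#) _))))
            (∑-mono λ w → ≤-trans (≤-reflexive (solve 2 (λ a x → (:- :# 1) :* (a :* x) := a :* (:- x)) Eq.refl
                (adjacency m H u w) (x w)))
              (*-monoˡ-≤ (adjacency-nonneg u w)
                (≤-trans (-x≤∣x∣ (x w)) (≤-reflexive (Eq.reflexive (≡.sym (z∘to w)))))))))

        local : ∀ q → (s + # p) * z q ≤ neighbours z q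
        local q = ≡.subst (λ q → (s + # p) * z q ≤ neighbours z q) (V.strictlyInverseˡ q) (begin
          (s + # p) * z (V.to u)
            ≈⟨ solve 4 (λ n r p z → (n :* r :- p :+ p) :* z := n :* (r :* z)) Eq.refl N ρ (# p) (z (V.to u)) ⟩
          N * (ρ * z (V.to u))
            ≤⟨ *-monoˡ-≤ (<⇒≤ N>0) (bound u) ⟩
          N * sum (λ w → adjacency m H u w * z (V.to w))
            ≈⟨ adjacency-sum u z ⟩
          neighbours z (V.to u) ∎)
          where
          open ≤-Reasoning
          u = V.from q

        Z : Fin k → ℝ
        Z e = sum (λ i → z (inj₂ (e , i)))

        s+1>0 : 0# < s + 1#
        s+1>0 = <-≤-trans (+-pos 0<1 0≤s) (≤-reflexive (+-comm _ _))

        -- The values at the new vertices of `e` may differ, but adding up their inequalities gives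
        -- (s + p) Z ≤ p (Y + Z) - Z, which bounds the total `Z`, and only this total enters at the
        -- ends of `e`.
        Z-bound : ∀ e → (s + 1#) * Z e ≤ # p * (y (src e) + y (tgt e))
        Z-bound e = ≤-by _ (gap≤ summed)
          (solve 4 (λ s p Z Y → p :* Y := (s :+ :# 1) :* Z :+ (p :* (Y :+ Z) :+ (:- :# 1) :* Z :- (s :+ p) :* Z)) Eq.refl s (# p) (Z e) Y)
          where
          Y = y (src e) + y (tgt e)
          summed : (s + # p) * Z e ≤ # p * (Y + Z e) + (- 1#) * Z e
          summed = begin
            (s + # p) * Z e                                          ≈⟨ ∑-* {p} (s + # p) _ ⟩
            sum (λ i → (s + # p) * z (inj₂ (e , i)))                 ≤⟨ ∑-mono {p} (λ i → local (inj₂ (e , i))) ⟩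
            sum (λ i → Y + (Z e + - z (inj₂ (e , i))))
              ≈⟨ ∑-cong {p} (λ i → solve 3 (λ Y Z z → Y :+ (Z :- z) := (Y :+ Z) :+ (:- :# 1) :* z) Eq.refl Y (Z e) (z (inj₂ (e , i)))) ⟩
            sum (λ i → (Y + Z e) + (- 1#) * z (inj₂ (e , i)))
              ≈⟨ ∑-+ {p} (λ _ → Y + Z e) _ ⟩
            sum {p} (λ _ → Y + Z e) + sum (λ i → (- 1#) * z (inj₂ (e , i)))
              ≈⟨ +-cong (∑-const p _) (Eq.sym (∑-* {p} (- 1#) _)) ⟩
            # p * (Y + Z e) + (- 1#) * Z e ∎
            where open ≤-Reasoning

        ends : ∀ {e v w} → Joins e v w → y (src e) + y (tgt e) ≈ y v + y w
        ends (inj₁ (≡.refl , ≡.refl)) = Eq.refl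
        ends (inj₂ (≡.refl , ≡.refl)) = +-comm _ _

        subinvariant : ∀ v → (s + c s) * y v ≤ around v (λ _ w → y w + c s * y v)
        subinvariant v = *-cancelˡ-≤ (s+N>0 0≤s) (begin
          (s + N) * ((s + c s) * y v)
            ≈⟨ solve 4 (λ t s c a → t :* ((s :+ c) :* a) := (t :* s :+ c :* t) :* a) Eq.refl (s + N) s (c s) (y v) ⟩
          ((s + N) * s + c s * (s + N)) * y v
            ≈⟨ *-congʳ (+-cong (*-congʳ (+-congˡ (#-suc p))) (c*[s+N] 0≤s)) ⟩
          ((s + (1# + # p)) * s + # p) * y v
            ≈⟨ solve 3 (λ s p a → ((s :+ (:# 1 :+ p)) :* s :+ p) :* a := (s :+ :# 1) :* ((s :+ p) :* a)) Eq.refl s (# p) (y v) ⟩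
          (s + 1#) * ((s + # p) * y v)
            ≤⟨ *-monoˡ-≤ (<⇒≤ s+1>0) (local (inj₁ v)) ⟩
          (s + 1#) * around v (λ e w → y w + Z e)
            ≈⟨ around-* v (s + 1#) (λ e w → y w + Z e) ⟩
          around v (λ e w → (s + 1#) * (y w + Z e))
            ≤⟨ around-mono v (λ e w joins → begin
              (s + 1#) * (y w + Z e)
                ≈⟨ distribˡ _ _ _ ⟩
              (s + 1#) * y w + (s + 1#) * Z e
                ≤⟨ +-monoʳ-≤ _ (≤-trans (Z-bound e) (≤-reflexive (*-congˡ (ends joins)))) ⟩
              (s + 1#) * y w + # p * (y v + y w)
                ≈⟨ solve 4 (λ s y p a → (s :+ :# 1) :* y :+ p :* (a :+ y) := (s :+ (:# 1 :+ p)) :* y :+ p :* a)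
                     Eq.refl s (y w) (# p) (y v) ⟩
              (s + (1# + # p)) * y w + # p * y v
                ≈⟨ +-cong (*-congʳ (+-congˡ (#-suc p))) (*-congʳ (c*[s+N] 0≤s)) ⟨
              (s + N) * y w + c s * (s + N) * y v
                ≈⟨ solve 4 (λ t y c a → t :* y :+ c :* t :* a := t :* (y :+ c :* a)) Eq.refl (s + N) (y w) (c s) (y v) ⟩
              (s + N) * (y w + c s * y v) ∎) ⟩
          around v (λ _ w → (s + N) * (y w + c s * y v))
            ≈⟨ around-* v (s + N) (λ _ w → y w + c s * y v) ⟨
          (s + N) * around v (λ _ w → y w + c s * y v) ∎)
          where open ≤-Reasoning

        -- If `y` vanished on the graph, `Z-bound` would make the values at the new vertices vanish
        -- too, and the eigenvector would be zero.
        y-positive : ∃[ v ] 0# < y v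
        y-positive with any? (λ v → 0# <? y v)
        ... | yes found = found
        ... | no none = contradiction (∣∣-≈0 (≤-trans (≤-reflexive (Eq.reflexive (≡.sym (z∘to u₀)))) (z≤0 (V.to u₀)))) xu₀≉0
          where
          y≤0 : ∀ v → y v ≤ 0#
          y≤0 v = ≮⇒≥ (λ 0<y → none (v , 0<y))
          Z≤0 : ∀ e → Z e ≤ 0#
          Z≤0 e = *-cancelˡ-≤ s+1>0 (≤-trans (Z-bound e) (≤-trans
            (*-monoˡ-≤ (#-nonneg p) (≤-trans (+-mono-≤ (y≤0 (src e)) (y≤0 (tgt e))) (≤-reflexive (+-identityˡ 0#))))
            (≤-reflexive (Eq.trans (zeroʳ _) (Eq.sym (zeroʳ _))))))
          z≤0 : ∀ q → z q ≤ 0#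
          z≤0 (inj₁ v) = y≤0 v
          z≤0 (inj₂ (e , i)) = ≤-trans (term≤∑ (λ j → z-nonneg (inj₂ (e , j))) i) (Z≤0 e)

  -- The hub functions, their order and their solutions.

  module HubEquations (p : ℕ) where

    open Coupling p

    -- Solutions of the equations away from the hub, relative to the value 1 there: `i` at a pendant
    -- vertex, θ at a free corner of the triangle, `E` at a neighbour carrying one more edge. A
    -- pendant edge adds κ to the right-hand coefficient at its foot, so `A` and `B` are the
    -- coefficients at a corner without and with one, and `D` is the inverse determinant of the two
    -- corners.
    i κ A B θ E D : ℝ → ℝ
    i s = s ⁻¹
    κ s = c s + i s
    A s = s + - c s
    B s = A s + - κ s
    θ s = (A s + - 1#) ⁻¹
    E s = (s + - κ s) ⁻¹
    D s = (A s * B s + - 1#) ⁻¹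

    -- The right-hand side of the equation at the hub. Each spoke contributes one c; the coefficient
    -- of c is the degree of the hub minus one because one c has been moved over from the left.
    hub₁ hub₂ hub₃ : ℕ → ℝ → ℝ
    hub₁ q s = c s * # (1 ℕ.+ q) + # q * i s + (θ s + θ s)
    hub₂ q s = c s * # (1 ℕ.+ q) + # q * i s + (A s + B s + # 2) * D s
    hub₃ q s = c s * # (2 ℕ.+ q) + # q * i s + E s + (θ s + θ s)

    -- From c ≤ 1 and i ≤ 1/5 follow κ ≤ 6/5, A ≥ 4 and B ≥ 2, hence every denominator is at least
    -- 1, as `⁻¹-lipschitz` demands.
    module Large {s : ℝ} (5≤s : # 5 ≤ s) where

      0<s : 0# < s
      0<s = <-≤-trans (#-pos 4) 5≤s
      0≤s = <⇒≤ 0<s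
      0≤c = c-nonneg 0≤s
      c≤1′ = c≤1 0≤s

      s*i : s * i s ≈ 1#
      s*i = *⁻¹ 0<s
      0<i : 0# < i s
      0<i = ⁻¹-pos 0<s

      5i≤1 : # 5 * i s ≤ 1#
      5i≤1 = ≤-trans (*-mono-≤ (#-nonneg 5) (<⇒≤ 0<i) 5≤s ≤-refl) (≤-reflexive s*i)

      0<κ : 0# < κ s
      0<κ = <-≤-trans (+-pos 0<i 0≤c) (≤-reflexive (+-comm _ _))

      5κ≤6 : # 5 * κ s ≤ # 6
      5κ≤6 = ≤-by _ (+-nonneg (*-nonneg (#-nonneg 5) (gap≤ c≤1′)) (gap≤ 5i≤1))
        (solve 2 (λ c i → :# 6 := :# 5 :* (c :+ i) :+ (:# 5 :* (:# 1 :- c) :+ (:# 1 :- :# 5 :* i))) Eq.refl (c s) (i s))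

      4≤A : # 4 ≤ A s
      4≤A = ≤-by _ (+-nonneg (gap≤ 5≤s) (gap≤ c≤1′))
        (solve 2 (λ s c → s :- c := :# 4 :+ ((s :- :# 5) :+ (:# 1 :- c))) Eq.refl s (c s))

      2≤B : # 2 ≤ B s
      2≤B = *-cancelˡ-≤ (#-pos 4) (≤-by _ (+-nonneg (+-nonneg (*-nonneg (#-nonneg 5) (gap≤ 4≤A)) (gap≤ 5κ≤6)) (#-nonneg 4))
        (solve 2 (λ a k → :# 5 :* (a :- k) := :# 5 :* :# 2 :+ (:# 5 :* (a :- :# 4) :+ (:# 6 :- :# 5 :* k) :+ :# 4)) Eq.refl (A s) (κ s)))

      1≤A-1 : 1# ≤ A s + - 1#
      1≤A-1 = ≤-by _ (+-nonneg (gap≤ 4≤A) (#-nonneg 2))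
        (solve 1 (λ a → a :- :# 1 := :# 1 :+ ((a :- :# 4) :+ :# 2)) Eq.refl (A s))

      1≤s-κ : 1# ≤ s + - κ s
      1≤s-κ = ≤-by _ (+-nonneg (+-nonneg (gap≤ 2≤B) 0≤c) (<⇒≤ 0<1))
        (solve 3 (λ s c k → s :- k := :# 1 :+ (((s :- c) :- k :- :# 2) :+ c :+ :# 1)) Eq.refl s (c s) (κ s))

      7≤AB-1 : # 7 ≤ A s * B s + - 1#
      7≤AB-1 = ≤-by _ (+-nonneg (*-nonneg (#-nonneg 4) (gap≤ 2≤B))
          (*-nonneg (gap≤ 4≤A) (≤-trans (#-nonneg 2) 2≤B)))
        (solve 2 (λ a b → a :* b :- :# 1 := :# 7 :+ (:# 4 :* (b :- :# 2) :+ (a :- :# 4) :* b)) Eq.refl (A s) (B s))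

      1≤AB-1 : 1# ≤ A s * B s + - 1#
      1≤AB-1 = ≤-trans (#-mono {1} {7} (ℕ.s≤s ℕ.z≤n)) 7≤AB-1

      0<A-1 = <-≤-trans 0<1 1≤A-1
      0<s-κ = <-≤-trans 0<1 1≤s-κ
      0<AB-1 = <-≤-trans 0<1 1≤AB-1
      0<A = <-≤-trans (#-pos 3) 4≤A
      0<B = <-≤-trans (#-pos 1) 2≤B

      0<θ : 0# < θ s
      0<θ = ⁻¹-pos 0<A-1
      0<E : 0# < E s
      0<E = ⁻¹-pos 0<s-κ
      0<D : 0# < D s
      0<D = ⁻¹-pos 0<AB-1

      [A-1]*θ : (A s + - 1#) * θ s ≈ 1#
      [A-1]*θ = *⁻¹ 0<A-1
      [s-κ]*E : (s + - κ s) * E s ≈ 1#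
      [s-κ]*E = *⁻¹ 0<s-κ
      [AB-1]*D : (A s * B s + - 1#) * D s ≈ 1#
      [AB-1]*D = *⁻¹ 0<AB-1

      θ≤1 : θ s ≤ 1#
      θ≤1 = *-cancelˡ-≤ 0<A-1 (≤-trans (≤-reflexive [A-1]*θ) (≤-trans 1≤A-1 (≤-reflexive (Eq.sym (*-identityʳ _)))))

      E≈ : E s ≈ i s + κ s * (i s * E s)
      E≈ = begin
        E s                                          ≈⟨ *-identityˡ _ ⟨
        1# * E s                                     ≈⟨ *-congʳ s*i ⟨
        s * i s * E s
          ≈⟨ solve 4 (λ s k i e → s :* i :* e := i :* ((s :- k) :* e) :+ k :* (i :* e)) Eq.refl s (κ s) (i s) (E s) ⟩
        i s * ((s + - κ s) * E s) + κ s * (i s * E s) ≈⟨ +-congʳ (Eq.trans (*-congˡ [s-κ]*E) (*-identityʳ _)) ⟩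
        i s + κ s * (i s * E s)                      ∎
        where open ≈-Reasoning

      i<E : i s < E s
      i<E = <-by _ (*-pos 0<κ (*-pos 0<i 0<E)) E≈

      -- Partial fractions measure the effect of one edge moved away from the hub. Relative to a
      -- common part, the edge is worth κ at the hub, κ (A + 1) D θ at a corner and, by `E≈`, κ i E
      -- at a pendant vertex. The hub functions are ordered as these three factors are.
      pair≈ : (A s + B s + # 2) * D s ≈ θ s + θ s + κ s * ((A s + 1#) * (D s * θ s))
      pair≈ = begin
        (a + b + # 2) * d                            ≈⟨ *-identityʳ _ ⟨
        (a + b + # 2) * d * 1#                       ≈⟨ *-congˡ [A-1]*θ ⟨
        (a + b + # 2) * d * ((a + - 1#) * t)
          ≈⟨ solve 4 (λ a k d t → (a :+ (a :- k) :+ :# 2) :* d :* ((a :- :# 1) :* t) :=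
               (t :+ t) :* ((a :* (a :- k) :- :# 1) :* d) :+ k :* ((a :+ :# 1) :* (d :* t))) Eq.refl a (κ s) d t ⟩
        (t + t) * ((a * b + - 1#) * d) + κ s * ((a + 1#) * (d * t))
          ≈⟨ +-congʳ (Eq.trans (*-congˡ [AB-1]*D) (*-identityʳ _)) ⟩
        t + t + κ s * ((a + 1#) * (d * t))           ∎
        where
        open ≈-Reasoning
        a = A s
        b = B s
        d = D s
        t = θ s

      -- Clearing the positive denominators leaves (A B - 1) (A - 1) < (A + 1) s (s - κ), where A ≤
      -- s and B ≤ s - κ because they differ by c.
      iE<[A+1]Dθ : i s * E s < (A s + 1#) * (D s * θ s)
      iE<[A+1]Dθ = begin-strict
        i s * e                                      ≈⟨ solve 1 (λ x → x := x :* :# 1 :* :# 1) Eq.refl (i s * e) ⟩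
        i s * e * 1# * 1#                            ≈⟨ *-cong (*-congˡ [AB-1]*D) [A-1]*θ ⟨
        i s * e * ((a * b + - 1#) * d) * ((a + - 1#) * t)
          ≈⟨ solve 6 (λ i e a b d t → i :* e :* ((a :* b :- :# 1) :* d) :* ((a :- :# 1) :* t) :=
               i :* e :* (d :* t) :* ((a :* b :- :# 1) :* (a :- :# 1))) Eq.refl (i s) e a b d t ⟩
        i s * e * (d * t) * ((a * b + - 1#) * (a + - 1#))
          <⟨ *-monoˡ-< (*-pos (*-pos 0<i 0<E) (*-pos 0<D 0<θ)) (<-by _
               (+-pos (+-pos (*-pos 0<A 0<B) (<⇒≤ (*-pos 0<A 0<B)))
                 (+-nonneg (≤-trans (<⇒≤ 0<1) 1≤A-1)
                   (*-nonneg (*-nonneg 0≤c (+-nonneg (+-nonneg (<⇒≤ 0<A) (<⇒≤ 0<B)) 0≤c)) (+-nonneg (<⇒≤ 0<A) (<⇒≤ 0<1)))))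
               (solve 3 (λ s c k → let a = s :- c ; b = a :- k in
                 (a :+ :# 1) :* (s :* (s :- k)) := (a :* b :- :# 1) :* (a :- :# 1) :+
                   (a :* b :+ a :* b :+ ((a :- :# 1) :+ c :* (a :+ b :+ c) :* (a :+ :# 1)))) Eq.refl s (c s) (κ s))) ⟩
        i s * e * (d * t) * ((a + 1#) * (s * (s + - κ s)))
          ≈⟨ solve 7 (λ s k i e a d t → i :* e :* (d :* t) :* ((a :+ :# 1) :* (s :* (s :- k))) :=
               (a :+ :# 1) :* (d :* t) :* (s :* i) :* ((s :- k) :* e)) Eq.refl s (κ s) (i s) e a d t ⟩
        (a + 1#) * (d * t) * (s * i s) * ((s + - κ s) * e)
          ≈⟨ *-cong (*-congˡ s*i) [s-κ]*E ⟩
        (a + 1#) * (d * t) * 1# * 1#                 ≈⟨ solve 1 (λ x → x :* :# 1 :* :# 1 := x) Eq.refl _ ⟩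
        (a + 1#) * (d * t)                           ∎
        where
        open ≤-Reasoning
        a = A s
        b = B s
        d = D s
        t = θ s
        e = E s

      -- Clearing denominators leaves A + 1 < (A B - 1) (A - 1), which follows from A ≥ 4 and A B -
      -- 1 ≥ 7.
      [A+1]Dθ<1 : (A s + 1#) * (D s * θ s) < 1#
      [A+1]Dθ<1 = begin-strict
        (a + 1#) * (d * t)
          ≈⟨ *-comm _ _ ⟩
        (d * t) * (a + 1#)
          <⟨ *-monoˡ-< (*-pos 0<D 0<θ) (<-by _
               (+-pos (*-pos (#-pos 4) 0<A-1)
                 (+-nonneg (*-nonneg (gap≤ 7≤AB-1) (<⇒≤ 0<A-1)) (+-nonneg (gap≤ 4≤A) (#-nonneg 1))))
               (solve 2 (λ a b → (a :* b :- :# 1) :* (a :- :# 1) :=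
                 (a :+ :# 1) :+ (:# 5 :* (a :- :# 1) :+ ((a :* b :- :# 1 :- :# 7) :* (a :- :# 1) :+ ((a :- :# 4) :+ :# 1)))) Eq.refl a b)) ⟩
        (d * t) * ((a * b + - 1#) * (a + - 1#))
          ≈⟨ solve 4 (λ a b d t → (d :* t) :* ((a :* b :- :# 1) :* (a :- :# 1)) :=
               ((a :* b :- :# 1) :* d) :* ((a :- :# 1) :* t)) Eq.refl a b d t ⟩
        ((a * b + - 1#) * d) * ((a + - 1#) * t)
          ≈⟨ Eq.trans (*-cong [AB-1]*D [A-1]*θ) (*-identityˡ 1#) ⟩
        1# ∎
        where
        open ≤-Reasoning
        a = A s
        b = B s
        d = D s
        t = θ s

      hub₃<hub₂ : ∀ q → hub₃ q s < hub₂ (suc q) s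
      hub₃<hub₂ q = <-by _ (*-pos 0<κ (gap< iE<[A+1]Dθ)) (begin
        c s * # (2 ℕ.+ q) + # suc q * i s + (A s + B s + # 2) * D s
          ≈⟨ +-cong (+-congˡ (*-congʳ (#-suc q))) pair≈ ⟩
        c s * # (2 ℕ.+ q) + (1# + # q) * i s + (θ s + θ s + κ s * x)
          ≈⟨ solve 7 (λ a q i t k x y → a :+ (:# 1 :+ q) :* i :+ (t :+ k :* x) := a :+ q :* i :+ (i :+ k :* y) :+ t :+ k :* (x :- y))
               Eq.refl (c s * # (2 ℕ.+ q)) (# q) (i s) (θ s + θ s) (κ s) x y ⟩
        c s * # (2 ℕ.+ q) + # q * i s + (i s + κ s * y) + (θ s + θ s) + κ s * (x + - y)
          ≈⟨ +-congʳ (+-congʳ (+-congˡ E≈)) ⟨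
        hub₃ q s + κ s * (x + - y) ∎)
        where
        open ≈-Reasoning
        x = (A s + 1#) * (D s * θ s)
        y = i s * E s

      hub₂<hub₁ : ∀ q → hub₂ q s < hub₁ (suc q) s
      hub₂<hub₁ q = <-by _ (*-pos 0<κ (gap< [A+1]Dθ<1)) (begin
        c s * # (2 ℕ.+ q) + # suc q * i s + (θ s + θ s)
          ≈⟨ +-congʳ (+-cong (*-congˡ (#-suc (suc q))) (*-congʳ (#-suc q))) ⟩
        c s * (1# + # suc q) + (1# + # q) * i s + (θ s + θ s)
          ≈⟨ solve 6 (λ c q′ q i t x → c :* (:# 1 :+ q′) :+ (:# 1 :+ q) :* i :+ t :=
               c :* q′ :+ q :* i :+ (t :+ (c :+ i) :* x) :+ (c :+ i) :* (:# 1 :- x)) Eq.refl (c s) (# suc q) (# q) (i s) (θ s + θ s) x ⟩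
        c s * # suc q + # q * i s + (θ s + θ s + κ s * x) + κ s * (1# + - x)
          ≈⟨ +-congʳ (+-congˡ pair≈) ⟨
        hub₂ q s + κ s * (1# + - x) ∎)
        where
        open ≈-Reasoning
        x = (A s + 1#) * (D s * θ s)

      -- Meant for the quadrangle: it has 1 + q pendant edges when the third graph has `q` at its
      -- hub, and its two sides at the hub are bounded by θ just like those of a triangle.
      hub₁<hub₃ : ∀ q → hub₁ (suc q) s < hub₃ q s
      hub₁<hub₃ q = <-by _ (gap< i<E) (Eq.trans
        (solve 5 (λ a q i e t → a :+ q :* i :+ e :+ t := a :+ (:# 1 :+ q) :* i :+ t :+ (e :- i)) Eq.refl
          (c s * # (2 ℕ.+ q)) (# q) (i s) (E s) (θ s + θ s))
        (+-congʳ (+-congʳ (+-congˡ (*-congʳ (Eq.sym (#-suc q)))))))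

      hub₁-bound : ∀ q → hub₁ q s ≤ # (1 ℕ.+ q) + # q + # 2
      hub₁-bound q = +-mono-≤ (+-mono-≤
        (≤-trans (*-mono-≤ 0≤c (#-nonneg (1 ℕ.+ q)) c≤1′ ≤-refl) (≤-reflexive (*-identityˡ _)))
        (≤-trans (*-monoˡ-≤ (#-nonneg q) i≤1) (≤-reflexive (*-identityʳ _))))
        (+-mono-≤ θ≤1 θ≤1)
        where
        i≤1 : i s ≤ 1#
        i≤1 = ≤-trans (≤-by (# 4 * i s) (*-nonneg (#-nonneg 4) (<⇒≤ 0<i))
          (solve 1 (λ i → :# 5 :* i := i :+ :# 4 :* i) Eq.refl (i s))) 5i≤1

    module _ (q : ℕ) where

      private
        -- `hub₁-bound` at 2 + q; by the order of the hub functions it serves for all three.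
        b = # (3 ℕ.+ q) + # (2 ℕ.+ q) + # 2

      open LipschitzFunctions (# 5) b (#-nonneg 5)
      open Large

      hub₁≤b : ∀ {s} → # 5 ≤ s → hub₁ (2 ℕ.+ q) s ≤ b
      hub₁≤b 5≤s = hub₁-bound 5≤s (2 ℕ.+ q)

      hub₂≤b : ∀ {s} → # 5 ≤ s → hub₂ (1 ℕ.+ q) s ≤ b
      hub₂≤b 5≤s = ≤-trans (<⇒≤ (hub₂<hub₁ 5≤s (1 ℕ.+ q))) (hub₁≤b 5≤s)

      hub₃≤b : ∀ {s} → # 5 ≤ s → hub₃ q s ≤ b
      hub₃≤b 5≤s = ≤-trans (<⇒≤ (hub₃<hub₂ 5≤s q)) (hub₂≤b 5≤s)

      private
        1≤s+N : ∀ {s} → # 5 ≤ s → 1# ≤ s + N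
        1≤s+N 5≤s = ≤-trans (≤-by (# 4) (#-nonneg 4) (solve 0 (:# 5 := :# 1 :+ :# 4) Eq.refl))
          (≤-trans (≤-reflexive (Eq.sym (+-identityʳ _))) (+-mono-≤ 5≤s (<⇒≤ N>0)))

        1≤s : ∀ {s} → # 5 ≤ s → 1# ≤ s
        1≤s = ≤-trans (≤-by (# 4) (#-nonneg 4) (solve 0 (:# 5 := :# 1 :+ :# 4) Eq.refl))

        c-lip : Lipschitz c
        c-lip = *-lipschitz (const-lipschitz (# p)) (⁻¹-lipschitz (λ 5≤s _ → 1≤s+N 5≤s)
          (+-lipschitz id-lipschitz (const-lipschitz N)))

        i-lip : Lipschitz i
        i-lip = ⁻¹-lipschitz (λ 5≤s _ → 1≤s 5≤s) id-lipschitz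

        A-lip : Lipschitz A
        A-lip = +-lipschitz id-lipschitz (neg-lipschitz c-lip)

        κ-lip : Lipschitz κ
        κ-lip = +-lipschitz c-lip i-lip

        B-lip : Lipschitz B
        B-lip = +-lipschitz A-lip (neg-lipschitz κ-lip)

        θ-lip : Lipschitz θ
        θ-lip = ⁻¹-lipschitz (λ 5≤s _ → 1≤A-1 5≤s) (+-lipschitz A-lip (const-lipschitz (- 1#)))

        E-lip : Lipschitz E
        E-lip = ⁻¹-lipschitz (λ 5≤s _ → 1≤s-κ 5≤s) (+-lipschitz id-lipschitz (neg-lipschitz κ-lip))

        D-lip : Lipschitz D
        D-lip = ⁻¹-lipschitz (λ 5≤s _ → 1≤AB-1 5≤s)
          (+-lipschitz (*-lipschitz A-lip B-lip) (const-lipschitz (- 1#)))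

        leaves-lip : ∀ a b → Lipschitz (λ s → c s * a + b * i s)
        leaves-lip a b = +-lipschitz (*-lipschitz c-lip (const-lipschitz a)) (*-lipschitz (const-lipschitz b) i-lip)

      hub₁-solution : ∀ {t} → # 5 ≤ t → t < hub₁ (2 ℕ.+ q) t → ∃[ s ] t < s × s ≈ hub₁ (2 ℕ.+ q) s
      hub₁-solution = fixed-point (+-lipschitz (leaves-lip _ _) (+-lipschitz θ-lip θ-lip)) hub₁≤b

      hub₂-solution : ∀ {t} → # 5 ≤ t → t < hub₂ (1 ℕ.+ q) t → ∃[ s ] t < s × s ≈ hub₂ (1 ℕ.+ q) s
      hub₂-solution = fixed-point (+-lipschitz (leaves-lip _ _)
        (*-lipschitz (+-lipschitz (+-lipschitz A-lip B-lip) (const-lipschitz (# 2))) D-lip)) hub₂≤b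

      hub₃-solution : ∀ {t} → # 5 ≤ t → t < hub₃ q t → ∃[ s ] t < s × s ≈ hub₃ q s
      hub₃-solution = fixed-point (+-lipschitz (+-lipschitz (leaves-lip _ _) E-lip) (+-lipschitz θ-lip θ-lip)) hub₃≤b

    -- The number of edges is 8 + r here.
    5<hub₃ : ∀ r → 20 ℕ.≤ suc r ℕ.* suc p → # 5 < hub₃ (3 ℕ.+ r) (# 5)
    5<hub₃ r 20≤ = begin-strict
      # 5
        ≤⟨ 5≤star ⟩
      c₅ * # (5 ℕ.+ r) + # (3 ℕ.+ r) * i₅ + i₅ + (i₅ + i₅)
        <⟨ +-mono-<-≤ (+-monoʳ-< _ i<E) (+-mono-≤ i≤θ i≤θ) ⟩
      hub₃ (3 ℕ.+ r) (# 5) ∎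
      where
      open ≤-Reasoning
      open Large {# 5} ≤-refl
      c₅ = c (# 5)
      i₅ = i (# 5)
      i≤θ : i₅ ≤ θ (# 5)
      i≤θ = *-cancelˡ-≤ (*-pos 0<s 0<A-1) (begin
        # 5 * (A (# 5) + - 1#) * i₅        ≈⟨ solve 3 (λ s a i → s :* a :* i := a :* (s :* i)) Eq.refl (# 5) _ i₅ ⟩
        (A (# 5) + - 1#) * (# 5 * i₅)      ≈⟨ Eq.trans (*-congˡ s*i) (*-identityʳ _) ⟩
        A (# 5) + - 1#                     ≤⟨ ≤-by _ (+-nonneg 0≤c (<⇒≤ 0<1)) (solve 1 (λ c → :# 5 := (:# 5 :- c) :- :# 1 :+ (c :+ :# 1)) Eq.refl c₅) ⟩
        # 5                                ≈⟨ Eq.trans (*-congˡ [A-1]*θ) (*-identityʳ _) ⟨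
        # 5 * ((A (# 5) + - 1#) * θ (# 5)) ≈⟨ *-assoc _ _ _ ⟨
        # 5 * (A (# 5) + - 1#) * θ (# 5)   ∎)
      x = # r
      y = # p
      condition : # 20 ≤ (1# + x) * (1# + y)
      condition = ≤-trans (#-mono 20≤) (≤-reflexive (Eq.trans (#-* (suc r) (suc p)) (*-cong (#-suc r) (#-suc p))))
      -- After multiplication by 5 (5 + N) the difference of the two sides is exactly 6 ((r + 1) (p
      -- + 1) - 20).
      5≤star : # 5 ≤ c₅ * # (5 ℕ.+ r) + # (3 ℕ.+ r) * i₅ + i₅ + (i₅ + i₅)
      5≤star = *-cancelˡ-≤ (*-pos 0<s (s+N>0 0≤s)) (≤-by _
        (*-nonneg (#-nonneg 6) (gap≤ condition)) (begin-equality
          # 5 * (# 5 + N) * (c₅ * # (5 ℕ.+ r) + # (3 ℕ.+ r) * i₅ + i₅ + (i₅ + i₅))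
            ≈⟨ solve 5 (λ n c a b i → :# 5 :* n :* (c :* a :+ b :* i :+ i :+ (i :+ i)) :=
                 :# 5 :* a :* (c :* n) :+ n :* (b :+ :# 3) :* (:# 5 :* i)) Eq.refl (# 5 + N) c₅ (# (5 ℕ.+ r)) (# (3 ℕ.+ r)) i₅ ⟩
          # 5 * # (5 ℕ.+ r) * (c₅ * (# 5 + N)) + (# 5 + N) * (# (3 ℕ.+ r) + # 3) * (# 5 * i₅)
            ≈⟨ +-cong (*-cong (*-congˡ (#-+ 5 r)) (c*[s+N] 0≤s))
                 (*-cong (*-cong (+-congˡ (#-suc p)) (+-congʳ (#-+ 3 r))) s*i) ⟩
          # 5 * (# 5 + x) * y + (# 5 + (1# + y)) * (# 3 + x + # 3) * 1#
            ≈⟨ solve 2 (λ x y → :# 5 :* (:# 5 :+ x) :* y :+ (:# 5 :+ (:# 1 :+ y)) :* (:# 3 :+ x :+ :# 3) :* :# 1 :=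
                 :# 5 :* (:# 5 :+ (:# 1 :+ y)) :* :# 5 :+ :# 6 :* ((:# 1 :+ x) :* (:# 1 :+ y) :- :# 20)) Eq.refl x y ⟩
          # 5 * (# 5 + (1# + y)) * # 5 + # 6 * ((1# + x) * (1# + y) + - # 20)
            ≈⟨ +-congʳ (*-congʳ (*-congˡ (+-congˡ (#-suc p)))) ⟨
          # 5 * (# 5 + N) * # 5 + # 6 * ((1# + x) * (1# + y) + - # 20) ∎))

  -- Eigenvectors and subinvariant vectors of the explicit graphs.

  module StandardSpectra (p : ℕ) where

    open Coupling p
    open HubEquations p
    open AroundVertex using (around; around-mono; around-*)

    private
      leaves : ∀ {q} (f : Fin q → ℝ) → sum (λ j → f j + 0#) ≈ sum f
      leaves {q} f = ∑-cong {q} λ j → +-identityʳ _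

      no-leaves : ∀ q → sum {q} (λ j → 0# + 0#) ≈ 0#
      no-leaves q = ∑-zero {q} λ _ → +-identityʳ 0#

      one-leaf : ∀ {q} (j : Fin q) (f : Fin q → ℝ) → sum (λ j′ → 0# + [ j ≟ j′ ] f j′) ≈ f j
      one-leaf {q} j f = Eq.trans (∑-single {q} j (λ i i≢j → Eq.trans (+-identityˡ _) (Eq.reflexive ([≟]-≢ (i≢j ∘ ≡.sym) _))))
        (Eq.trans (+-identityˡ _) (Eq.reflexive ([≟]-refl j _)))

    module _ (q : ℕ) where

      -- The explicit edges come first in the numbering, so `around` unfolds to one bracket per
      -- explicit edge, source term plus target term, followed by the sum over the pendant edges. A
      -- bracket of two zeros is an edge that misses the vertex; this holds for all the evaluations
      -- that follow.
      around₁-0 : ∀ (g : Fin (3 ℕ.+ q) → ℝ) → around (graph₁ q) 0F (λ _ w → g w) ≈ g 1F + g 2F + sum (λ j → g (3 ↑ʳ j))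
      around₁-0 g = Eq.trans (+-congˡ (+-congˡ (+-congˡ (leaves {q} (λ j → g (3 ↑ʳ j))))))
        (solve 3 (λ a b S → (a :+ :# 0) :+ ((:# 0 :+ :# 0) :+ ((:# 0 :+ b) :+ S)) := a :+ b :+ S) Eq.refl _ _ _)

      around₁-1 : ∀ (g : Fin (3 ℕ.+ q) → ℝ) → around (graph₁ q) 1F (λ _ w → g w) ≈ g 0F + g 2F
      around₁-1 g = Eq.trans (+-congˡ (+-congˡ (+-congˡ (no-leaves q))))
        (solve 2 (λ a b → (:# 0 :+ a) :+ ((b :+ :# 0) :+ ((:# 0 :+ :# 0) :+ :# 0)) := a :+ b) Eq.refl _ _)

      around₁-2 : ∀ (g : Fin (3 ℕ.+ q) → ℝ) → around (graph₁ q) 2F (λ _ w → g w) ≈ g 1F + g 0F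
      around₁-2 g = Eq.trans (+-congˡ (+-congˡ (+-congˡ (no-leaves q))))
        (solve 2 (λ a b → (:# 0 :+ :# 0) :+ ((:# 0 :+ a) :+ ((b :+ :# 0) :+ :# 0)) := a :+ b) Eq.refl _ _)

      around₁-leaf : ∀ (g : Fin (3 ℕ.+ q) → ℝ) (j : Fin q) → around (graph₁ q) (3 ↑ʳ j) (λ _ w → g w) ≈ g 0F
      around₁-leaf g j = Eq.trans (+-congˡ (+-congˡ (+-congˡ (one-leaf j (λ _ → g 0F)))))
        (solve 1 (λ S → (:# 0 :+ :# 0) :+ ((:# 0 :+ :# 0) :+ ((:# 0 :+ :# 0) :+ S)) := S) Eq.refl _)

      around₂-0 : ∀ (g : Fin (4 ℕ.+ q) → ℝ) → around (graph₂ q) 0F (λ _ w → g w) ≈ g 1F + g 2F + sum (λ j → g (4 ↑ʳ j))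
      around₂-0 g = Eq.trans (+-congˡ (+-congˡ (+-congˡ (+-congˡ (leaves {q} (λ j → g (4 ↑ʳ j)))))))
        (solve 3 (λ a b S → (a :+ :# 0) :+ ((:# 0 :+ :# 0) :+ ((:# 0 :+ b) :+ ((:# 0 :+ :# 0) :+ S))) := a :+ b :+ S) Eq.refl _ _ _)

      around₂-1 : ∀ (g : Fin (4 ℕ.+ q) → ℝ) → around (graph₂ q) 1F (λ _ w → g w) ≈ g 0F + g 2F + g 3F
      around₂-1 g = Eq.trans (+-congˡ (+-congˡ (+-congˡ (+-congˡ (no-leaves q)))))
        (solve 3 (λ a b c → (:# 0 :+ a) :+ ((b :+ :# 0) :+ ((:# 0 :+ :# 0) :+ ((c :+ :# 0) :+ :# 0))) := a :+ b :+ c) Eq.refl _ _ _)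

      around₂-2 : ∀ (g : Fin (4 ℕ.+ q) → ℝ) → around (graph₂ q) 2F (λ _ w → g w) ≈ g 1F + g 0F
      around₂-2 g = Eq.trans (+-congˡ (+-congˡ (+-congˡ (+-congˡ (no-leaves q)))))
        (solve 2 (λ a b → (:# 0 :+ :# 0) :+ ((:# 0 :+ a) :+ ((b :+ :# 0) :+ ((:# 0 :+ :# 0) :+ :# 0))) := a :+ b) Eq.refl _ _)

      around₂-3 : ∀ (g : Fin (4 ℕ.+ q) → ℝ) → around (graph₂ q) 3F (λ _ w → g w) ≈ g 1F
      around₂-3 g = Eq.trans (+-congˡ (+-congˡ (+-congˡ (+-congˡ (no-leaves q)))))
        (solve 1 (λ a → (:# 0 :+ :# 0) :+ ((:# 0 :+ :# 0) :+ ((:# 0 :+ :# 0) :+ ((:# 0 :+ a) :+ :# 0))) := a) Eq.refl _)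

      around₂-leaf : ∀ (g : Fin (4 ℕ.+ q) → ℝ) (j : Fin q) → around (graph₂ q) (4 ↑ʳ j) (λ _ w → g w) ≈ g 0F
      around₂-leaf g j = Eq.trans (+-congˡ (+-congˡ (+-congˡ (+-congˡ (one-leaf j (λ _ → g 0F))))))
        (solve 1 (λ S → (:# 0 :+ :# 0) :+ ((:# 0 :+ :# 0) :+ ((:# 0 :+ :# 0) :+ ((:# 0 :+ :# 0) :+ S))) := S) Eq.refl _)

      around₃-0 : ∀ (g : Fin (5 ℕ.+ q) → ℝ) → around (graph₃ q) 0F (λ _ w → g w) ≈ g 1F + g 2F + g 3F + sum (λ j → g (5 ↑ʳ j))
      around₃-0 g = Eq.trans (+-congˡ (+-congˡ (+-congˡ (+-congˡ (+-congˡ (leaves {q} (λ j → g (5 ↑ʳ j))))))))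
        (solve 4 (λ a b c S → (a :+ :# 0) :+ ((:# 0 :+ :# 0) :+ ((:# 0 :+ b) :+ ((c :+ :# 0) :+ ((:# 0 :+ :# 0) :+ S)))) := a :+ b :+ c :+ S) Eq.refl _ _ _ _)

      around₃-1 : ∀ (g : Fin (5 ℕ.+ q) → ℝ) → around (graph₃ q) 1F (λ _ w → g w) ≈ g 0F + g 2F
      around₃-1 g = Eq.trans (+-congˡ (+-congˡ (+-congˡ (+-congˡ (+-congˡ (no-leaves q))))))
        (solve 2 (λ a b → (:# 0 :+ a) :+ ((b :+ :# 0) :+ ((:# 0 :+ :# 0) :+ ((:# 0 :+ :# 0) :+ ((:# 0 :+ :# 0) :+ :# 0)))) := a :+ b) Eq.refl _ _)

      around₃-2 : ∀ (g : Fin (5 ℕ.+ q) → ℝ) → around (graph₃ q) 2F (λ _ w → g w) ≈ g 1F + g 0F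
      around₃-2 g = Eq.trans (+-congˡ (+-congˡ (+-congˡ (+-congˡ (+-congˡ (no-leaves q))))))
        (solve 2 (λ a b → (:# 0 :+ :# 0) :+ ((:# 0 :+ a) :+ ((b :+ :# 0) :+ ((:# 0 :+ :# 0) :+ ((:# 0 :+ :# 0) :+ :# 0)))) := a :+ b) Eq.refl _ _)

      around₃-3 : ∀ (g : Fin (5 ℕ.+ q) → ℝ) → around (graph₃ q) 3F (λ _ w → g w) ≈ g 0F + g 4F
      around₃-3 g = Eq.trans (+-congˡ (+-congˡ (+-congˡ (+-congˡ (+-congˡ (no-leaves q))))))
        (solve 2 (λ a b → (:# 0 :+ :# 0) :+ ((:# 0 :+ :# 0) :+ ((:# 0 :+ :# 0) :+ ((:# 0 :+ a) :+ ((b :+ :# 0) :+ :# 0)))) := a :+ b) Eq.refl _ _)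

      around₃-4 : ∀ (g : Fin (5 ℕ.+ q) → ℝ) → around (graph₃ q) 4F (λ _ w → g w) ≈ g 3F
      around₃-4 g = Eq.trans (+-congˡ (+-congˡ (+-congˡ (+-congˡ (+-congˡ (no-leaves q))))))
        (solve 1 (λ a → (:# 0 :+ :# 0) :+ ((:# 0 :+ :# 0) :+ ((:# 0 :+ :# 0) :+ ((:# 0 :+ :# 0) :+ ((:# 0 :+ a) :+ :# 0)))) := a) Eq.refl _)

      around₃-leaf : ∀ (g : Fin (5 ℕ.+ q) → ℝ) (j : Fin q) → around (graph₃ q) (5 ↑ʳ j) (λ _ w → g w) ≈ g 0F
      around₃-leaf g j = Eq.trans (+-congˡ (+-congˡ (+-congˡ (+-congˡ (+-congˡ (one-leaf j (λ _ → g 0F)))))))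
        (solve 1 (λ S → (:# 0 :+ :# 0) :+ ((:# 0 :+ :# 0) :+ ((:# 0 :+ :# 0) :+ ((:# 0 :+ :# 0) :+ ((:# 0 :+ :# 0) :+ S)))) := S) Eq.refl _)

      around₄-0 : ∀ (g : Fin (4 ℕ.+ q) → ℝ) → around (graph₄ q) 0F (λ _ w → g w) ≈ g 1F + g 3F + sum (λ j → g (4 ↑ʳ j))
      around₄-0 g = Eq.trans (+-congˡ (+-congˡ (+-congˡ (+-congˡ (leaves {q} (λ j → g (4 ↑ʳ j)))))))
        (solve 3 (λ a b S → (a :+ :# 0) :+ ((:# 0 :+ :# 0) :+ ((:# 0 :+ :# 0) :+ ((:# 0 :+ b) :+ S))) := a :+ b :+ S) Eq.refl _ _ _)

      around₄-1 : ∀ (g : Fin (4 ℕ.+ q) → ℝ) → around (graph₄ q) 1F (λ _ w → g w) ≈ g 0F + g 2F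
      around₄-1 g = Eq.trans (+-congˡ (+-congˡ (+-congˡ (+-congˡ (no-leaves q)))))
        (solve 2 (λ a b → (:# 0 :+ a) :+ ((b :+ :# 0) :+ ((:# 0 :+ :# 0) :+ ((:# 0 :+ :# 0) :+ :# 0))) := a :+ b) Eq.refl _ _)

      around₄-2 : ∀ (g : Fin (4 ℕ.+ q) → ℝ) → around (graph₄ q) 2F (λ _ w → g w) ≈ g 1F + g 3F
      around₄-2 g = Eq.trans (+-congˡ (+-congˡ (+-congˡ (+-congˡ (no-leaves q)))))
        (solve 2 (λ a b → (:# 0 :+ :# 0) :+ ((:# 0 :+ a) :+ ((b :+ :# 0) :+ ((:# 0 :+ :# 0) :+ :# 0))) := a :+ b) Eq.refl _ _)

      around₄-3 : ∀ (g : Fin (4 ℕ.+ q) → ℝ) → around (graph₄ q) 3F (λ _ w → g w) ≈ g 2F + g 0F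
      around₄-3 g = Eq.trans (+-congˡ (+-congˡ (+-congˡ (+-congˡ (no-leaves q)))))
        (solve 2 (λ a b → (:# 0 :+ :# 0) :+ ((:# 0 :+ :# 0) :+ ((:# 0 :+ a) :+ ((b :+ :# 0) :+ :# 0))) := a :+ b) Eq.refl _ _)

      around₄-leaf : ∀ (g : Fin (4 ℕ.+ q) → ℝ) (j : Fin q) → around (graph₄ q) (4 ↑ʳ j) (λ _ w → g w) ≈ g 0F
      around₄-leaf g j = Eq.trans (+-congˡ (+-congˡ (+-congˡ (+-congˡ (one-leaf j (λ _ → g 0F))))))
        (solve 1 (λ S → (:# 0 :+ :# 0) :+ ((:# 0 :+ :# 0) :+ ((:# 0 :+ :# 0) :+ ((:# 0 :+ :# 0) :+ S))) := S) Eq.refl _)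

      module _ {s : ℝ} (5≤s : # 5 ≤ s) where

        open Large 5≤s

        weight₁ : Fin (3 ℕ.+ q) → ℝ
        weight₁ 0F = 1#
        weight₁ 1F = θ s
        weight₁ 2F = θ s
        weight₁ (suc (suc (suc _))) = i s

        -- Cramer's rule for A a = 1 + b and B b = 1 + a, the equations at the free corner and at
        -- the corner with a pendant edge.
        a₂ b₂ : ℝ
        a₂ = (B s + 1#) * D s
        b₂ = (A s + 1#) * D s

        weight₂ : Fin (4 ℕ.+ q) → ℝ
        weight₂ 0F = 1#
        weight₂ 1F = b₂
        weight₂ 2F = a₂
        weight₂ 3F = i s * b₂
        weight₂ (suc (suc (suc (suc _)))) = i s

        weight₃ : Fin (5 ℕ.+ q) → ℝ
        weight₃ 0F = 1#
        weight₃ 1F = θ s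
        weight₃ 2F = θ s
        weight₃ 3F = E s
        weight₃ 4F = i s * E s
        weight₃ (suc (suc (suc (suc (suc _))))) = i s

        Eigen Subinvariant : (Γ : Graph) → (Fin (Graph.n Γ) → ℝ) → Set
        Eigen Γ x = ∀ v → (s + c s) * x v ≈ around Γ v (λ _ w → x w + c s * x v)
        Subinvariant Γ y = ∀ v → (s + c s) * y v ≤ around Γ v (λ _ w → y w + c s * y v)

        private
          leaf-eigen : (s + c s) * i s ≈ 1# + c s * i s
          leaf-eigen = Eq.trans (distribʳ _ _ _) (+-congʳ s*i)

          triangle-eigen : (s + c s) * θ s ≈ 1# + c s * θ s + (θ s + c s * θ s)
          triangle-eigen = begin
            (s + c s) * θ s
              ≈⟨ solve 3 (λ s c t → (s :+ c) :* t := ((s :- c) :- :# 1) :* t :+ c :* t :+ (t :+ c :* t)) Eq.refl s (c s) (θ s) ⟩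
            (A s + - 1#) * θ s + c s * θ s + (θ s + c s * θ s)  ≈⟨ +-congʳ (+-congʳ [A-1]*θ) ⟩
            1# + c s * θ s + (θ s + c s * θ s) ∎
            where open ≈-Reasoning

          leaves-sum : ∀ r → sum {q} (λ _ → r + c s * 1#) ≈ # q * r + c s * # q
          leaves-sum r = Eq.trans (∑-const q _)
            (solve 3 (λ q r c → q :* (r :+ c :* :# 1) := q :* r :+ c :* q) Eq.refl (# q) r (c s))

        hub₁-equation : around (graph₁ q) 0F (λ _ w → weight₁ w + c s * 1#) ≈ hub₁ q s + c s
        hub₁-equation = begin
          around (graph₁ q) 0F (λ _ w → weight₁ w + c s * 1#)
            ≈⟨ around₁-0 (λ w → weight₁ w + c s * 1#) ⟩
          θ s + c s * 1# + (θ s + c s * 1#) + sum {q} (λ _ → i s + c s * 1#)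
            ≈⟨ +-congˡ (leaves-sum (i s)) ⟩
          θ s + c s * 1# + (θ s + c s * 1#) + (# q * i s + c s * # q)
            ≈⟨ solve 4 (λ c i t q → t :+ c :* :# 1 :+ (t :+ c :* :# 1) :+ (q :* i :+ c :* q) :=
                 c :* (:# 1 :+ q) :+ q :* i :+ (t :+ t) :+ c) Eq.refl (c s) (i s) (θ s) (# q) ⟩
          c s * (1# + # q) + # q * i s + (θ s + θ s) + c s
            ≈⟨ +-congʳ (+-congʳ (+-congʳ (*-congˡ (#-suc q)))) ⟨
          hub₁ q s + c s ∎
          where open ≈-Reasoning

        hub₂-equation : around (graph₂ q) 0F (λ _ w → weight₂ w + c s * 1#) ≈ hub₂ q s + c s
        hub₂-equation = begin
          around (graph₂ q) 0F (λ _ w → weight₂ w + c s * 1#)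
            ≈⟨ around₂-0 (λ w → weight₂ w + c s * 1#) ⟩
          b₂ + c s * 1# + (a₂ + c s * 1#) + sum {q} (λ _ → i s + c s * 1#)
            ≈⟨ +-congˡ (leaves-sum (i s)) ⟩
          b₂ + c s * 1# + (a₂ + c s * 1#) + (# q * i s + c s * # q)
            ≈⟨ solve 6 (λ c i a b d q → (a :+ :# 1) :* d :+ c :* :# 1 :+ ((b :+ :# 1) :* d :+ c :* :# 1) :+ (q :* i :+ c :* q) :=
                 c :* (:# 1 :+ q) :+ q :* i :+ (a :+ b :+ :# 2) :* d :+ c) Eq.refl (c s) (i s) (A s) (B s) (D s) (# q) ⟩
          c s * (1# + # q) + # q * i s + (A s + B s + # 2) * D s + c s
            ≈⟨ +-congʳ (+-congʳ (+-congʳ (*-congˡ (#-suc q)))) ⟨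
          hub₂ q s + c s ∎
          where open ≈-Reasoning

        hub₃-equation : around (graph₃ q) 0F (λ _ w → weight₃ w + c s * 1#) ≈ hub₃ q s + c s
        hub₃-equation = begin
          around (graph₃ q) 0F (λ _ w → weight₃ w + c s * 1#)
            ≈⟨ around₃-0 (λ w → weight₃ w + c s * 1#) ⟩
          θ s + c s * 1# + (θ s + c s * 1#) + (E s + c s * 1#) + sum {q} (λ _ → i s + c s * 1#)
            ≈⟨ +-congˡ (leaves-sum (i s)) ⟩
          θ s + c s * 1# + (θ s + c s * 1#) + (E s + c s * 1#) + (# q * i s + c s * # q)
            ≈⟨ solve 5 (λ c i t e q → t :+ c :* :# 1 :+ (t :+ c :* :# 1) :+ (e :+ c :* :# 1) :+ (q :* i :+ c :* q) :=
                 c :* (:# 1 :+ (:# 1 :+ q)) :+ q :* i :+ e :+ (t :+ t) :+ c) Eq.refl (c s) (i s) (θ s) (E s) (# q) ⟩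
          c s * (1# + (1# + # q)) + # q * i s + E s + (θ s + θ s) + c s
            ≈⟨ +-congʳ (+-congʳ (+-congʳ (+-congʳ (*-congˡ (Eq.trans (#-suc (suc q)) (+-congˡ (#-suc q))))))) ⟨
          hub₃ q s + c s ∎
          where open ≈-Reasoning

        private
          at-hub : ∀ {hub r} → s ≈ hub → r ≈ hub + c s → (s + c s) * 1# ≈ r
          at-hub s≈hub r≈ = Eq.trans (*-identityʳ _) (Eq.trans (+-congʳ s≈hub) (Eq.sym r≈))

        eigen₁ : s ≈ hub₁ q s → Eigen (graph₁ q) weight₁
        eigen₁ s≈hub 0F = at-hub s≈hub hub₁-equation
        eigen₁ _ 1F = Eq.trans triangle-eigen (Eq.sym (around₁-1 (λ w → weight₁ w + c s * θ s)))
        eigen₁ _ 2F = Eq.trans (Eq.trans triangle-eigen (+-comm _ _)) (Eq.sym (around₁-2 (λ w → weight₁ w + c s * θ s)))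
        eigen₁ _ (suc (suc (suc j))) = Eq.trans leaf-eigen (Eq.sym (around₁-leaf (λ w → weight₁ w + c s * i s) j))

        eigen₂ : s ≈ hub₂ q s → Eigen (graph₂ q) weight₂
        eigen₂ s≈hub 0F = at-hub s≈hub hub₂-equation
        eigen₂ _ 1F = Eq.trans (begin
          (s + c s) * b₂
            ≈⟨ solve 5 (λ s c i b d → let a = s :- c ; x = (a :+ :# 1) :* d in
                 (s :+ c) :* x := (a :- (c :+ i)) :* (a :+ :# 1) :* d :+ c :* x :+ c :* x :+ (i :* x :+ c :* x))
                 Eq.refl s (c s) (i s) (B s) (D s) ⟩
          B s * (A s + 1#) * D s + c s * b₂ + c s * b₂ + (i s * b₂ + c s * b₂)
            ≈⟨ +-congʳ (+-congʳ (+-congʳ (solve 3 (λ a b d → b :* (a :+ :# 1) :* d := (a :* b :- :# 1) :* d :+ (b :+ :# 1) :* d)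
                 Eq.refl (A s) (B s) (D s)))) ⟩
          (A s * B s + - 1#) * D s + a₂ + c s * b₂ + c s * b₂ + (i s * b₂ + c s * b₂)
            ≈⟨ +-congʳ (+-congʳ (+-congʳ (+-congʳ [AB-1]*D))) ⟩
          1# + a₂ + c s * b₂ + c s * b₂ + (i s * b₂ + c s * b₂)
            ≈⟨ solve 3 (λ a z y → :# 1 :+ a :+ z :+ z :+ y := :# 1 :+ z :+ (a :+ z) :+ y) Eq.refl a₂ (c s * b₂) _ ⟩
          1# + c s * b₂ + (a₂ + c s * b₂) + (i s * b₂ + c s * b₂) ∎)
          (Eq.sym (around₂-1 (λ w → weight₂ w + c s * b₂)))
          where open ≈-Reasoning
        eigen₂ _ 2F = Eq.trans (begin
          (s + c s) * a₂
            ≈⟨ solve 4 (λ s c b d → let a = s :- c ; x = (b :+ :# 1) :* d in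
                 (s :+ c) :* x := (a :* b :- :# 1) :* d :+ (a :+ :# 1) :* d :+ c :* x :+ c :* x)
                 Eq.refl s (c s) (B s) (D s) ⟩
          (A s * B s + - 1#) * D s + b₂ + c s * a₂ + c s * a₂
            ≈⟨ +-congʳ (+-congʳ (+-congʳ [AB-1]*D)) ⟩
          1# + b₂ + c s * a₂ + c s * a₂
            ≈⟨ solve 2 (λ b z → :# 1 :+ b :+ z :+ z := b :+ z :+ (:# 1 :+ z)) Eq.refl b₂ (c s * a₂) ⟩
          b₂ + c s * a₂ + (1# + c s * a₂) ∎)
          (Eq.sym (around₂-2 (λ w → weight₂ w + c s * a₂)))
          where open ≈-Reasoning
        eigen₂ _ 3F = Eq.trans (begin
          (s + c s) * (i s * b₂)      ≈⟨ *-assoc _ _ _ ⟨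
          (s + c s) * i s * b₂        ≈⟨ *-congʳ leaf-eigen ⟩
          (1# + c s * i s) * b₂       ≈⟨ solve 3 (λ c i b → (:# 1 :+ c :* i) :* b := b :+ c :* (i :* b)) Eq.refl (c s) (i s) b₂ ⟩
          b₂ + c s * (i s * b₂)       ∎)
          (Eq.sym (around₂-3 (λ w → weight₂ w + c s * (i s * b₂))))
          where open ≈-Reasoning
        eigen₂ _ (suc (suc (suc (suc j)))) = Eq.trans leaf-eigen (Eq.sym (around₂-leaf (λ w → weight₂ w + c s * i s) j))

        eigen₃ : s ≈ hub₃ q s → Eigen (graph₃ q) weight₃
        eigen₃ s≈hub 0F = at-hub s≈hub hub₃-equation
        eigen₃ _ 1F = Eq.trans triangle-eigen (Eq.sym (around₃-1 (λ w → weight₃ w + c s * θ s)))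
        eigen₃ _ 2F = Eq.trans (Eq.trans triangle-eigen (+-comm _ _)) (Eq.sym (around₃-2 (λ w → weight₃ w + c s * θ s)))
        eigen₃ _ 3F = Eq.trans (begin
          (s + c s) * E s
            ≈⟨ solve 4 (λ s c i e → (s :+ c) :* e := (s :- (c :+ i)) :* e :+ c :* e :+ (i :* e :+ c :* e)) Eq.refl s (c s) (i s) (E s) ⟩
          (s + - κ s) * E s + c s * E s + (i s * E s + c s * E s)
            ≈⟨ +-congʳ (+-congʳ [s-κ]*E) ⟩
          1# + c s * E s + (i s * E s + c s * E s) ∎)
          (Eq.sym (around₃-3 (λ w → weight₃ w + c s * E s)))
          where open ≈-Reasoning
        eigen₃ _ 4F = Eq.trans (begin
          (s + c s) * (i s * E s)      ≈⟨ *-assoc _ _ _ ⟨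
          (s + c s) * i s * E s        ≈⟨ *-congʳ leaf-eigen ⟩
          (1# + c s * i s) * E s       ≈⟨ solve 3 (λ c i b → (:# 1 :+ c :* i) :* b := b :+ c :* (i :* b)) Eq.refl (c s) (i s) (E s) ⟩
          E s + c s * (i s * E s)      ∎)
          (Eq.sym (around₃-4 (λ w → weight₃ w + c s * (i s * E s))))
          where open ≈-Reasoning
        eigen₃ _ (suc (suc (suc (suc (suc j))))) = Eq.trans leaf-eigen (Eq.sym (around₃-leaf (λ w → weight₃ w + c s * i s) j))

        -- A subinvariant vector is at most y 0 times the weights, which solve
        -- every equation except the one at the hub.
        private
          at-most-hub : ∀ Γ u (x y : Fin (Graph.n Γ) → ℝ) {hub} →
            around Γ u (λ _ w → x w + c s * 1#) ≈ hub + c s →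
            (∀ v → 0# ≤ x v) → (∀ v → y v ≤ x v * y u) → (∃[ v ] 0# < y v) →
            Subinvariant Γ y → s ≤ hub
          at-most-hub Γ u x y {hub} equation 0≤x y≤x (v , 0<yv) sub = *-cancelˡ-≤ 0<yu (≤-by _ (gap≤ (begin
            (s + c s) * y u                                    ≤⟨ sub u ⟩
            around Γ u (λ _ w → y w + c s * y u)
              ≤⟨ around-mono Γ u (λ _ w _ → ≤-trans (+-monoˡ-≤ _ (y≤x w)) (≤-reflexive
                   (solve 3 (λ x y c → x :* y :+ c :* y := y :* (x :+ c :* :# 1)) Eq.refl (x w) (y u) (c s)))) ⟩
            around Γ u (λ _ w → y u * (x w + c s * 1#))        ≈⟨ around-* Γ u (y u) (λ _ w → x w + c s * 1#) ⟨
            y u * around Γ u (λ _ w → x w + c s * 1#)          ≈⟨ *-congˡ equation ⟩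
            y u * (hub + c s)                                  ∎))
            (solve 4 (λ y h s c → y :* h := y :* s :+ (y :* (h :+ c) :- (s :+ c) :* y)) Eq.refl (y u) hub s (c s)))
            where
            open ≤-Reasoning
            0<yu : 0# < y u
            0<yu = ≰⇒> λ yu≤0 → ≤⇒≯ (≤-trans (y≤x v) (≤-trans (*-monoˡ-≤ (0≤x v) yu≤0) (≤-reflexive (zeroʳ _)))) 0<yv

          leaf-bound : ∀ {t h} → (s + c s) * t ≤ h + c s * t → t ≤ i s * h
          leaf-bound {t} {h} le = *-cancelˡ-≤ 0<s (≤-by _ (gap≤ le) (Eq.trans (Eq.trans (Eq.sym (*-assoc _ _ _)) (*-congʳ s*i))
            (solve 4 (λ s c t h → :# 1 :* h := s :* t :+ ((h :+ c :* t) :- (s :+ c) :* t)) Eq.refl s (c s) t h)))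

          -- A times the first inequality plus the second eliminates y and leaves (A² - 1) x ≤ (A +
          -- 1) h.
          triangle-bound : ∀ {x y h} → (s + c s) * x ≤ h + c s * x + (y + c s * x) →
            (s + c s) * y ≤ h + c s * y + (x + c s * y) → x ≤ θ s * h
          triangle-bound {x} {y} {h} x≤ y≤ = *-cancelˡ-≤ (*-pos 0<A-1 0<A+1) (≤-by _
            (+-nonneg (*-nonneg (<⇒≤ 0<A) (gap≤ x≤)) (gap≤ y≤)) (begin
              (A s + - 1#) * (A s + 1#) * (θ s * h)
                ≈⟨ solve 3 (λ a t h → (a :- :# 1) :* (a :+ :# 1) :* (t :* h) := (a :- :# 1) :* t :* ((a :+ :# 1) :* h)) Eq.refl (A s) (θ s) h ⟩
              (A s + - 1#) * θ s * ((A s + 1#) * h)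
                ≈⟨ *-congʳ [A-1]*θ ⟩
              1# * ((A s + 1#) * h)
                ≈⟨ solve 5 (λ s c x y h → let a = s :- c in
                     :# 1 :* ((a :+ :# 1) :* h) := (a :- :# 1) :* (a :+ :# 1) :* x :+
                       (a :* (h :+ c :* x :+ (y :+ c :* x) :- (s :+ c) :* x) :+ (h :+ c :* y :+ (x :+ c :* y) :- (s :+ c) :* y)))
                     Eq.refl s (c s) x y h ⟩
              (A s + - 1#) * (A s + 1#) * x + _ ∎))
            where
            open ≈-Reasoning
            0<A+1 : 0# < A s + 1#
            0<A+1 = +-pos 0<A (<⇒≤ 0<1)

        subinvariant₃ : ∀ y → (∃[ v ] 0# < y v) → Subinvariant (graph₃ q) y → s ≤ hub₃ q s
        subinvariant₃ y positive sub = at-most-hub (graph₃ q) 0F weight₃ y hub₃-equation weight-nonneg bound positive sub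
          where
          weight-nonneg : ∀ v → 0# ≤ weight₃ v
          weight-nonneg 0F = <⇒≤ 0<1
          weight-nonneg 1F = <⇒≤ 0<θ
          weight-nonneg 2F = <⇒≤ 0<θ
          weight-nonneg 3F = <⇒≤ 0<E
          weight-nonneg 4F = <⇒≤ (*-pos 0<i 0<E)
          weight-nonneg (suc (suc (suc (suc (suc _))))) = <⇒≤ 0<i
          at1 = ≤-trans (sub 1F) (≤-reflexive (around₃-1 (λ w → y w + c s * y 1F)))
          at2 = ≤-trans (sub 2F) (≤-reflexive (Eq.trans (around₃-2 (λ w → y w + c s * y 2F)) (+-comm _ _)))
          y4≤ : y 4F ≤ i s * y 3F
          y4≤ = leaf-bound (≤-trans (sub 4F) (≤-reflexive (around₃-4 (λ w → y w + c s * y 4F))))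
          y3≤ : y 3F ≤ E s * y 0F
          y3≤ = *-cancelˡ-≤ 0<s-κ (≤-by _ (+-nonneg (gap≤ (≤-trans (sub 3F) (≤-reflexive (around₃-3 (λ w → y w + c s * y 3F))))) (gap≤ y4≤))
            (Eq.trans (Eq.trans (Eq.sym (*-assoc _ _ _)) (*-congʳ [s-κ]*E))
              (solve 6 (λ s c i h w l → :# 1 :* h := (s :- (c :+ i)) :* w :+
                ((h :+ c :* w :+ (l :+ c :* w) :- (s :+ c) :* w) :+ (i :* w :- l))) Eq.refl s (c s) (i s) (y 0F) (y 3F) (y 4F))))
          bound : ∀ v → y v ≤ weight₃ v * y 0F
          bound 0F = ≤-reflexive (Eq.sym (*-identityˡ _))
          bound 1F = triangle-bound at1 at2
          bound 2F = triangle-bound at2 at1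
          bound 3F = y3≤
          bound 4F = ≤-trans y4≤ (≤-trans (*-monoˡ-≤ (<⇒≤ 0<i) y3≤) (≤-reflexive (Eq.sym (*-assoc _ _ _))))
          bound (suc (suc (suc (suc (suc j))))) =
            leaf-bound (≤-trans (sub (5 ↑ʳ j)) (≤-reflexive (around₃-leaf (λ w → y w + c s * y (5 ↑ʳ j)) j)))

        -- Cramer's rule survives with inequalities because the multipliers `A` and `B` used to
        -- eliminate one corner, and the determinant, are positive.
        subinvariant₂ : ∀ y → (∃[ v ] 0# < y v) → Subinvariant (graph₂ q) y → s ≤ hub₂ q s
        subinvariant₂ y positive sub = at-most-hub (graph₂ q) 0F weight₂ y hub₂-equation weight-nonneg bound positive sub
          where
          0≤b₂ = *-nonneg (+-nonneg (<⇒≤ 0<A) (<⇒≤ 0<1)) (<⇒≤ 0<D)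
          weight-nonneg : ∀ v → 0# ≤ weight₂ v
          weight-nonneg 0F = <⇒≤ 0<1
          weight-nonneg 1F = 0≤b₂
          weight-nonneg 2F = *-nonneg (+-nonneg (<⇒≤ 0<B) (<⇒≤ 0<1)) (<⇒≤ 0<D)
          weight-nonneg 3F = *-nonneg (<⇒≤ 0<i) 0≤b₂
          weight-nonneg (suc (suc (suc (suc _)))) = <⇒≤ 0<i
          h = y 0F
          b = y 1F
          a = y 2F
          y3≤ : y 3F ≤ i s * b
          y3≤ = leaf-bound (≤-trans (sub 3F) (≤-reflexive (around₂-3 (λ w → y w + c s * y 3F))))
          Bb≤ : B s * b ≤ h + a
          Bb≤ = ≤-by _ (+-nonneg (gap≤ (≤-trans (sub 1F) (≤-reflexive (around₂-1 (λ w → y w + c s * b))))) (gap≤ y3≤))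
            (solve 7 (λ s c i h a b l → h :+ a := (s :- c :- (c :+ i)) :* b :+
              ((h :+ c :* b :+ (a :+ c :* b) :+ (l :+ c :* b) :- (s :+ c) :* b) :+ (i :* b :- l))) Eq.refl s (c s) (i s) h a b (y 3F))
          Aa≤ : A s * a ≤ h + b
          Aa≤ = ≤-by _ (gap≤ (≤-trans (sub 2F) (≤-reflexive (around₂-2 (λ w → y w + c s * a)))))
            (solve 5 (λ s c h a b → h :+ b := (s :- c) :* a :+ (b :+ c :* a :+ (h :+ c :* a) :- (s :+ c) :* a)) Eq.refl s (c s) h a b)
          D-cancel : ∀ r → r * h ≈ (A s * B s + - 1#) * (r * D s * h)
          D-cancel r = Eq.trans (Eq.trans (Eq.sym (*-identityˡ _)) (*-congʳ (Eq.sym [AB-1]*D)))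
            (solve 4 (λ x d r h → x :* d :* (r :* h) := x :* (r :* d :* h)) Eq.refl (A s * B s + - 1#) (D s) r h)
          b≤ : b ≤ b₂ * h
          b≤ = *-cancelˡ-≤ 0<AB-1 (≤-trans (≤-by _ (+-nonneg (*-nonneg (<⇒≤ 0<A) (gap≤ Bb≤)) (gap≤ Aa≤))
            (solve 5 (λ A B a b h → (A :+ :# 1) :* h := (A :* B :- :# 1) :* b :+
              (A :* (h :+ a :- B :* b) :+ (h :+ b :- A :* a))) Eq.refl (A s) (B s) a b h)) (≤-reflexive (D-cancel _)))
          a≤ : a ≤ a₂ * h
          a≤ = *-cancelˡ-≤ 0<AB-1 (≤-trans (≤-by _ (+-nonneg (*-nonneg (<⇒≤ 0<B) (gap≤ Aa≤)) (gap≤ Bb≤))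
            (solve 5 (λ A B a b h → (B :+ :# 1) :* h := (A :* B :- :# 1) :* a :+
              (B :* (h :+ b :- A :* a) :+ (h :+ a :- B :* b))) Eq.refl (A s) (B s) a b h)) (≤-reflexive (D-cancel _)))
          bound : ∀ v → y v ≤ weight₂ v * h
          bound 0F = ≤-reflexive (Eq.sym (*-identityˡ _))
          bound 1F = b≤
          bound 2F = a≤
          bound 3F = ≤-trans y3≤ (≤-trans (*-monoˡ-≤ (<⇒≤ 0<i) b≤) (≤-reflexive (Eq.sym (*-assoc _ _ _))))
          bound (suc (suc (suc (suc j)))) =
            leaf-bound (≤-trans (sub (4 ↑ʳ j)) (≤-reflexive (around₂-leaf (λ w → y w + c s * y (4 ↑ʳ j)) j)))

        -- The two neighbours of the hub on the square are bounded by θ as well.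
        subinvariant₄ : ∀ y → (∀ v → 0# ≤ y v) → (∃[ v ] 0# < y v) → Subinvariant (graph₄ q) y → s ≤ hub₁ q s
        subinvariant₄ y 0≤y positive sub = at-most-hub (graph₄ q) 0F weight₄ y hub₄-equation weight-nonneg bound positive sub
          where
          weight₄ : Fin (4 ℕ.+ q) → ℝ
          weight₄ 0F = 1#
          weight₄ 1F = θ s
          -- With r = A s the equations would give 2 / (r² - 2) at the opposite corner and r / (r² -
          -- 2) at the sides. Both are replaced by larger multiples of θ, which brings the
          -- right-hand side at the hub to the form of `hub₁`.
          weight₄ 2F = θ s + θ s
          weight₄ 3F = θ s
          weight₄ (suc (suc (suc (suc _)))) = i s
          weight-nonneg : ∀ v → 0# ≤ weight₄ v
          weight-nonneg 0F = <⇒≤ 0<1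
          weight-nonneg 1F = <⇒≤ 0<θ
          weight-nonneg 2F = +-nonneg (<⇒≤ 0<θ) (<⇒≤ 0<θ)
          weight-nonneg 3F = <⇒≤ 0<θ
          weight-nonneg (suc (suc (suc (suc _)))) = <⇒≤ 0<i
          hub₄-equation : around (graph₄ q) 0F (λ _ w → weight₄ w + c s * 1#) ≈ hub₁ q s + c s
          hub₄-equation = Eq.trans (around₄-0 (λ w → weight₄ w + c s * 1#))
            (Eq.trans (Eq.sym (around₁-0 (λ w → weight₁ w + c s * 1#))) hub₁-equation)
          r = A s
          h = y 0F
          w = y 2F
          side-bound : ∀ {t} → (s + c s) * t ≤ h + c s * t + (w + c s * t) → r * t ≤ h + w
          side-bound {t} le = ≤-by _ (gap≤ le) (solve 5 (λ s c h w t →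
            h :+ w := (s :- c) :* t :+ (h :+ c :* t :+ (w :+ c :* t) :- (s :+ c) :* t)) Eq.refl s (c s) h w t)
          1≤ : r * y 1F ≤ h + w
          1≤ = side-bound (≤-trans (sub 1F) (≤-reflexive (around₄-1 (λ v → y v + c s * y 1F))))
          3≤ : r * y 3F ≤ h + w
          3≤ = side-bound (≤-trans (sub 3F) (≤-reflexive (Eq.trans (around₄-3 (λ v → y v + c s * y 3F)) (+-comm _ _))))
          [r²-2]w≤2h : (r * r + - # 2) * w ≤ # 2 * h
          [r²-2]w≤2h = ≤-by _ (+-nonneg (*-nonneg (<⇒≤ 0<A)
              (gap≤ (≤-trans (sub 2F) (≤-reflexive (around₄-2 (λ v → y v + c s * w)))))) (+-nonneg (gap≤ 1≤) (gap≤ 3≤)))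
            (solve 6 (λ s c h w x z → let r = s :- c in :# 2 :* h := (r :* r :- :# 2) :* w :+
              (r :* (x :+ c :* w :+ (z :+ c :* w) :- (s :+ c) :* w) :+ ((h :+ w :- r :* x) :+ (h :+ w :- r :* z))))
              Eq.refl s (c s) h w (y 1F) (y 3F))
          θ-cancel : ∀ {x z} → (r + - 1#) * x ≤ z → x ≤ θ s * z
          θ-cancel le = *-cancelˡ-≤ 0<A-1 (≤-trans le (≤-reflexive
            (Eq.sym (Eq.trans (Eq.sym (*-assoc _ _ _)) (Eq.trans (*-congʳ [A-1]*θ) (*-identityˡ _))))))
          0≤r-4 = gap≤ 4≤A
          side≤ : ∀ v → r * y v ≤ h + w → y v ≤ θ s * h
          side≤ v le = θ-cancel (*-cancelˡ-≤ (*-pos 0<A 0<A) (≤-by _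
            (+-nonneg (+-nonneg (*-nonneg 0≤r²-2 (gap≤ le)) (gap≤ [r²-2]w≤2h))
              (*-nonneg (*-nonneg (<⇒≤ 0<A) (+-nonneg 0≤r-4 (#-nonneg 2))) (0≤y v)))
            (solve 4 (λ r h w t → r :* r :* h := r :* r :* ((r :- :# 1) :* t) :+
              ((r :* r :- :# 2) :* (h :+ w :- r :* t) :+ (:# 2 :* h :- (r :* r :- :# 2) :* w) :+ r :* ((r :- :# 4) :+ :# 2) :* t))
              Eq.refl r h w (y v))))
            where
            0≤r²-2 : 0# ≤ r * r + - # 2
            0≤r²-2 = ≤-trans (+-nonneg (*-nonneg 0≤r-4 (+-nonneg (<⇒≤ 0<A) (#-nonneg 4))) (#-nonneg 14))
              (≤-reflexive (solve 1 (λ r → (r :- :# 4) :* (r :+ :# 4) :+ :# 14 := r :* r :- :# 2) Eq.refl r))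
          bound : ∀ v → y v ≤ weight₄ v * y 0F
          bound 0F = ≤-reflexive (Eq.sym (*-identityˡ _))
          bound 1F = side≤ 1F 1≤
          bound 2F = ≤-trans (θ-cancel (≤-by _ (+-nonneg (gap≤ [r²-2]w≤2h)
              (*-nonneg (+-nonneg (*-nonneg 0≤r-4 (+-nonneg (<⇒≤ 0<A) (#-nonneg 3))) (#-nonneg 11)) (0≤y 2F)))
            (solve 3 (λ r h w → :# 2 :* h := (r :- :# 1) :* w :+
              ((:# 2 :* h :- (r :* r :- :# 2) :* w) :+ ((r :- :# 4) :* (r :+ :# 3) :+ :# 11) :* w)) Eq.refl r h w)))
            (≤-reflexive (solve 2 (λ t h → t :* (:# 2 :* h) := (t :+ t) :* h) Eq.refl (θ s) h))
          bound 3F = side≤ 3F 3≤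
          bound (suc (suc (suc (suc j)))) =
            leaf-bound (≤-trans (sub (4 ↑ʳ j)) (≤-reflexive (around₄-leaf (λ w → y w + c s * y (4 ↑ʳ j)) j)))

  -- Counting paths of length two from a vertex of maximal value.

  module Neighbourhood
      {n : ℕ} (Adj : Fin n → Fin n → Set) (α : Fin n → Fin n → ℝ)
      (α-cases : ∀ v w → Bit (α v w) (Adj v w))
      (Adj-sym : ∀ {v w} → Adj v w → Adj w v) (Adj-irrefl : ∀ {v} → ¬ Adj v v)
      (u : Fin n) where

    α-adj : ∀ {v w} → Adj v w → α v w ≈ 1#
    α-adj {v} {w} a with α-cases v w
    ... | inj₁ (_ , ¬a) = contradiction a ¬a
    ... | inj₂ (eq , _) = eq

    α-nonadj : ∀ {v w} → ¬ Adj v w → α v w ≈ 0#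
    α-nonadj {v} {w} ¬a with α-cases v w
    ... | inj₁ (eq , _) = eq
    ... | inj₂ (_ , a) = contradiction a ¬a

    α-sym : ∀ v w → α v w ≈ α w v
    α-sym v w with α-cases v w
    ... | inj₁ (eq , ¬a) = Eq.trans eq (Eq.sym (α-nonadj (λ a → ¬a (Adj-sym a))))
    ... | inj₂ (eq , a) = Eq.trans eq (Eq.sym (α-adj (Adj-sym a)))

    -- Indicators of {u}, of the neighbours of u, and of the remaining vertices.
    υ ν ϱ : Fin n → ℝ
    υ v = [ v ≟ u ] 1#
    ν v = α u v
    ϱ v = 1# + - υ v + - ν v

    data Position (v : Fin n) : Set where
      centre : v ≡ u → υ v ≈ 1# → ν v ≈ 0# → ϱ v ≈ 0# → Position v
      near   : v ≢ u → Adj u v → υ v ≈ 0# → ν v ≈ 1# → ϱ v ≈ 0# → Position v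
      remote : v ≢ u → ¬ Adj u v → υ v ≈ 0# → ν v ≈ 0# → ϱ v ≈ 1# → Position v

    position : ∀ v → Position v
    position v with v ≟ u in eq
    ... | yes ≡.refl = centre ≡.refl υ≈1 ν≈0 (Eq.trans (+-cong (+-congˡ (-‿cong υ≈1)) (-‿cong ν≈0))
      (solve 0 (:# 1 :- :# 1 :- :# 0 := :# 0) Eq.refl))
      where
      υ≈1 = Eq.reflexive ([≟]-refl u 1#)
      ν≈0 = α-nonadj Adj-irrefl
    ... | no v≢u with α-cases u v
    ...   | inj₁ (ν≈0 , ¬a) = remote v≢u ¬a υ≈0 ν≈0 (Eq.trans (+-cong (+-congˡ (-‿cong υ≈0)) (-‿cong ν≈0))
      (solve 0 (:# 1 :- :# 0 :- :# 0 := :# 1) Eq.refl))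
      where υ≈0 = Eq.reflexive ([≟]-≢ v≢u 1#)
    ...   | inj₂ (ν≈1 , a) = near v≢u a υ≈0 ν≈1 (Eq.trans (+-cong (+-congˡ (-‿cong υ≈0)) (-‿cong ν≈1))
      (solve 0 (:# 1 :- :# 0 :- :# 1 := :# 0) Eq.refl))
      where υ≈0 = Eq.reflexive ([≟]-≢ v≢u 1#)

    private
      zero-mono : ∀ {b x y} → b ≈ 0# → b * x ≤ b * y
      zero-mono b≈0 = ≤-reflexive (Eq.trans (*-congʳ b≈0) (Eq.trans (zeroˡ _)
        (Eq.sym (Eq.trans (*-congʳ b≈0) (zeroˡ _)))))

      one-mono : ∀ {b x y} → b ≈ 1# → x ≤ y → b * x ≤ b * y
      one-mono b≈1 x≤y = *-monoˡ-≤ (≤-trans (<⇒≤ 0<1) (≤-reflexive (Eq.sym b≈1))) x≤y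

    α-mono : ∀ v w {x y} → (Adj v w → x ≤ y) → α v w * x ≤ α v w * y
    α-mono v w x≤y with α-cases v w
    ... | inj₁ (eq , _) = zero-mono eq
    ... | inj₂ (eq , a) = one-mono eq (x≤y a)

    ν-mono : ∀ v {x y} → (Adj u v → x ≤ y) → ν v * x ≤ ν v * y
    ν-mono = α-mono u

    ϱ-mono : ∀ v {x y} → (v ≢ u → ¬ Adj u v → x ≤ y) → ϱ v * x ≤ ϱ v * y
    ϱ-mono v x≤y with position v
    ... | centre _ _ _ eq    = zero-mono eq
    ... | near _ _ _ _ eq    = zero-mono eq
    ... | remote p q _ _ eq  = one-mono eq (x≤y p q)

    α-nonneg : ∀ v w → 0# ≤ α v w
    α-nonneg v w with α-cases v w
    ... | inj₁ (eq , _) = ≤-reflexive (Eq.sym eq)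
    ... | inj₂ (eq , _) = ≤-trans (<⇒≤ 0<1) (≤-reflexive (Eq.sym eq))

    ν-nonneg : ∀ v → 0# ≤ ν v
    ν-nonneg = α-nonneg u

    ϱ-nonneg : ∀ v → 0# ≤ ϱ v
    ϱ-nonneg v with position v
    ... | centre _ _ _ eq    = ≤-reflexive (Eq.sym eq)
    ... | near _ _ _ _ eq    = ≤-reflexive (Eq.sym eq)
    ... | remote p q _ _ eq  = ≤-trans (<⇒≤ 0<1) (≤-reflexive (Eq.sym eq))

    split : ∀ (f : Fin n → ℝ) → sum f ≈ f u + sum (λ w → ν w * f w) + sum (λ w → ϱ w * f w)
    split f = begin
      sum f
        ≈⟨ ∑-cong {n} (λ w → solve 3 (λ a b f → f := a :* f :+ (b :* f :+ (:# 1 :- a :- b) :* f)) Eq.refl (υ w) (ν w) (f w)) ⟩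
      sum (λ w → υ w * f w + (ν w * f w + ϱ w * f w))
        ≈⟨ Eq.trans (∑-+ {n} (λ w → υ w * f w) _) (+-congˡ (∑-+ {n} (λ w → ν w * f w) _)) ⟩
      sum (λ w → υ w * f w) + (sum (λ w → ν w * f w) + sum (λ w → ϱ w * f w))
        ≈⟨ +-congʳ (Eq.trans (∑-cong {n} (λ w → Eq.trans (*-comm _ _) (Eq.trans (when-* _ (f w) 1#) (when-cong _ (*-identityʳ _)))))
             (∑-[≟] u f)) ⟩
      f u + (sum (λ w → ν w * f w) + sum (λ w → ϱ w * f w))
        ≈⟨ +-assoc _ _ _ ⟨
      f u + sum (λ w → ν w * f w) + sum (λ w → ϱ w * f w) ∎
      where open ≈-Reasoning

    -- The numbers of neighbours of `v` that are adjacent to `u`, and of those that are remote from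
    -- `u`.
    inward outward : Fin n → ℝ
    inward v  = sum (λ w → ν w * α v w)
    outward v = sum (λ w → ϱ w * α v w)

    inward-nonneg : ∀ v → 0# ≤ inward v
    inward-nonneg v = ∑-nonneg {n} λ w → *-nonneg (ν-nonneg w) (α-nonneg v w)

    outward-nonneg : ∀ v → 0# ≤ outward v
    outward-nonneg v = ∑-nonneg {n} λ w → *-nonneg (ϱ-nonneg w) (α-nonneg v w)

    -- The degree of `u`; the number of edges between the neighbours of `u` and the remote vertices;
    -- twice the number of edges among remote vertices; twice the number among neighbours of `u`.
    d P M₀ M₂ : ℝ
    d  = sum ν
    P  = sum (λ v → ν v * outward v)
    M₀ = sum (λ v → ϱ v * outward v)
    M₂ = sum (λ v → ν v * inward v)

    P-nonneg : 0# ≤ P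
    P-nonneg = ∑-nonneg {n} λ v → *-nonneg (ν-nonneg v) (outward-nonneg v)

    M₀-nonneg : 0# ≤ M₀
    M₀-nonneg = ∑-nonneg {n} λ v → *-nonneg (ϱ-nonneg v) (outward-nonneg v)

    M₂-nonneg : 0# ≤ M₂
    M₂-nonneg = ∑-nonneg {n} λ v → *-nonneg (ν-nonneg v) (inward-nonneg v)

    swap-pairs : ∀ (g : Fin n → ℝ) →
      sum (λ v → ν v * sum (λ w → ϱ w * (α v w * g w))) ≈ sum (λ w → ϱ w * (inward w * g w))
    swap-pairs g = begin
      sum (λ v → ν v * sum (λ w → ϱ w * (α v w * g w)))
        ≈⟨ ∑-cong {n} (λ v → ∑-* {n} (ν v) _) ⟩
      sum (λ v → sum (λ w → ν v * (ϱ w * (α v w * g w))))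
        ≈⟨ ∑-swap {n} {n} _ ⟩
      sum (λ w → sum (λ v → ν v * (ϱ w * (α v w * g w))))
        ≈⟨ ∑-cong {n} (λ w → Eq.trans (∑-cong {n} (λ v → Eq.trans
             (solve 4 (λ n r a g → n :* (r :* (a :* g)) := (r :* g) :* (n :* a)) Eq.refl (ν v) (ϱ w) (α v w) (g w))
             (*-congˡ (*-congˡ (α-sym v w))))) (Eq.sym (∑-* {n} (ϱ w * g w) (λ v → ν v * α w v)))) ⟩
      sum (λ w → ϱ w * g w * inward w)
        ≈⟨ ∑-cong {n} (λ w → solve 3 (λ r g i → r :* g :* i := r :* (i :* g)) Eq.refl (ϱ w) (g w) (inward w)) ⟩
      sum (λ w → ϱ w * (inward w * g w)) ∎
      where open ≈-Reasoning

    P≈ : P ≈ sum (λ w → ϱ w * inward w)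
    P≈ = Eq.trans (∑-cong {n} (λ v → *-congˡ (∑-cong {n} (λ w → *-congˡ (Eq.sym (*-identityʳ _))))))
      (Eq.trans (swap-pairs (λ _ → 1#)) (∑-cong {n} (λ w → *-congˡ (*-identityʳ _))))

    -- Each of the edges counted twice in M₀ leaves w at most once.
    2outward≤M₀ : ∀ w → w ≢ u → ¬ Adj u w → # 2 * outward w ≤ M₀
    2outward≤M₀ w w≢u ¬uw = begin
      # 2 * outward w
        ≈⟨ solve 1 (λ x → :# 2 :* x := x :+ x) Eq.refl (outward w) ⟩
      outward w + outward w
        ≈⟨ +-cong at-w (∑-cong {n} (λ v → *-congˡ (α-sym w v))) ⟩
      sum (λ v → ϱ v * [ v ≟ w ] outward w) + sum (λ v → ϱ v * α v w)
        ≈⟨ ∑-+ {n} (λ v → ϱ v * [ v ≟ w ] outward w) _ ⟨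
      sum (λ v → ϱ v * [ v ≟ w ] outward w + ϱ v * α v w)
        ≤⟨ ∑-mono {n} (λ v → ≤-trans (≤-reflexive (Eq.sym (distribˡ _ _ _))) (ϱ-mono v (λ _ _ → dominated v))) ⟩
      M₀ ∎
      where
      open ≤-Reasoning
      ϱw≈1 : ϱ w ≈ 1#
      ϱw≈1 with position w
      ... | centre w≡u _ _ _   = contradiction w≡u w≢u
      ... | near _ uw _ _ _    = contradiction uw ¬uw
      ... | remote _ _ _ _ eq  = eq
      at-w : outward w ≈ sum (λ v → ϱ v * [ v ≟ w ] outward w)
      at-w = Eq.sym (Eq.trans (∑-cong {n} (λ v → when-* _ (ϱ v) _))
        (Eq.trans (∑-[≟] w (λ v → ϱ v * outward w)) (Eq.trans (*-congʳ ϱw≈1) (*-identityˡ _))))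
      dominated : ∀ v → [ v ≟ w ] outward w + α v w ≤ outward v
      dominated v with v ≟ w
      ... | yes ≡.refl = ≤-reflexive (Eq.trans (+-congˡ (α-nonadj Adj-irrefl)) (+-identityʳ _))
      ... | no _ = ≤-trans (≤-reflexive (Eq.trans (+-identityˡ _) (Eq.sym (Eq.trans (*-congʳ ϱw≈1) (*-identityˡ _)))))
        (term≤∑ {n} (λ x → *-nonneg (ϱ-nonneg x) (α-nonneg v x)) w)

    module Subinvariant {s c θ : ℝ} (5≤s : # 5 ≤ s) (0≤c : 0# ≤ c) (c≤1 : c ≤ 1#)
        (0<θ : 0# < θ) ([A-1]*θ : (s + - c + - 1#) * θ ≈ 1#)
        (y : Fin n → ℝ) (0≤y : ∀ v → 0# ≤ y v) (y≤1 : ∀ v → y v ≤ 1#) (yu≈1 : y u ≈ 1#)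
        (sub : ∀ v → (s + c) * y v ≤ sum (λ w → α v w * (y w + c * y v))) where

      private
        0<s = <-≤-trans (#-pos 4) 5≤s
        0≤s = <⇒≤ 0<s

      -- For a neighbour `v` of `u`, the parts of the right-hand side at `v` that come from other
      -- neighbours of `u` and from remote vertices. The edge back to `u` accounts for 1 + c y v.
      S₂ Sᵣ : Fin n → ℝ
      S₂ v = sum (λ w → ν w * (α v w * (y w + c * y v)))
      Sᵣ v = sum (λ w → ϱ w * (α v w * (y w + c * y v)))

      G₂ Gᵣ : ℝ
      G₂ = sum (λ v → ν v * S₂ v)
      Gᵣ = sum (λ v → ν v * Sᵣ v)

      near-bound : ∀ {v} → Adj u v → s * y v ≤ 1# + S₂ v + Sᵣ v
      near-bound {v} uv = ≤-by _ (gap≤ (≤-trans (sub v) (≤-reflexive (split (λ w → α v w * (y w + c * y v))))))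
        (Eq.trans (solve 5 (λ s c y p q → :# 1 :+ p :+ q := s :* y :+ ((:# 1 :* (:# 1 :+ c :* y) :+ p :+ q) :- (s :+ c) :* y)) Eq.refl s c (y v) (S₂ v) (Sᵣ v))
          (+-congˡ (+-congʳ (+-congʳ (+-congʳ (*-cong (Eq.sym (α-adj (Adj-sym uv))) (+-congʳ (Eq.sym yu≈1))))))))

      -- The inequality at `u`, multiplied by s, with the inequalities at its neighbours inserted.
      -- Each neighbour yields 1 + s c for the path back to `u` and its own edge, besides the paths
      -- leading elsewhere.
      centre-bound : s * (s + c) ≤ d * (1# + s * c) + (G₂ + Gᵣ)
      centre-bound = begin
        s * (s + c)
          ≈⟨ *-congˡ (Eq.sym (Eq.trans (*-congˡ yu≈1) (*-identityʳ _))) ⟩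
        s * ((s + c) * y u)
          ≤⟨ *-monoˡ-≤ 0≤s (sub u) ⟩
        s * sum (λ w → ν w * (y w + c * y u))
          ≈⟨ ∑-* {n} s _ ⟩
        sum (λ w → s * (ν w * (y w + c * y u)))
          ≈⟨ ∑-cong {n} (λ w → Eq.trans (*-congˡ (*-congˡ (+-congˡ (*-congˡ yu≈1))))
               (solve 4 (λ s n y c → s :* (n :* (y :+ c :* :# 1)) := n :* (s :* y :+ s :* c)) Eq.refl s (ν w) (y w) c)) ⟩
        sum (λ w → ν w * (s * y w + s * c))
          ≤⟨ ∑-mono {n} (λ w → ν-mono w (λ uw → +-monoˡ-≤ _ (near-bound uw))) ⟩
        sum (λ w → ν w * (1# + S₂ w + Sᵣ w + s * c))
          ≈⟨ ∑-cong {n} (λ w → solve 4 (λ n p q r → n :* (:# 1 :+ p :+ q :+ r) := (:# 1 :+ r) :* n :+ (n :* p :+ n :* q)) Eq.refl (ν w) (S₂ w) (Sᵣ w) (s * c)) ⟩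
        sum (λ w → (1# + s * c) * ν w + (ν w * S₂ w + ν w * Sᵣ w))
          ≈⟨ Eq.trans (∑-+ {n} (λ w → (1# + s * c) * ν w) _) (+-cong (Eq.trans (Eq.sym (∑-* {n} _ ν)) (*-comm _ _)) (∑-+ {n} (λ w → ν w * S₂ w) _)) ⟩
        d * (1# + s * c) + (G₂ + Gᵣ) ∎
        where open ≤-Reasoning

      degree-sum : ∀ w → ¬ Adj u w → sum (α w) ≈ inward w + outward w
      degree-sum w ¬uw = Eq.trans (split (α w)) (Eq.trans
        (+-congʳ (+-congʳ (α-nonadj (λ wu → ¬uw (Adj-sym wu))))) (+-congʳ (+-identityˡ _)))

      -- All values next to `w` are at most 1, so (s + c) y w ≤ (1 + c y w) deg w. Since deg w ≥ 1,
      -- the values y w and y v that are multiplied by c may then be raised to 1.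
      remote-bound : ∀ {v w} → Adj u v → ¬ Adj u w → Adj v w →
        s * (y w + c * y v) ≤ (1# + s * c) + (1# + c) * (inward w + outward w + - 1#)
      remote-bound {v} {w} uv ¬uw vw = ≤-by _
        (+-nonneg (+-nonneg (gap≤ local) (*-nonneg (*-nonneg 0≤c (gap≤ (y≤1 w))) (gap≤ 1≤deg)))
          (*-nonneg (*-nonneg 0≤s 0≤c) (gap≤ (y≤1 v))))
        (solve 5 (λ s c x z g → (:# 1 :+ s :* c) :+ (:# 1 :+ c) :* (g :- :# 1) := s :* (x :+ c :* z) :+
          ((:# 1 :+ c :* x) :* g :- (s :+ c) :* x :+ c :* (:# 1 :- x) :* (g :- :# 1) :+ s :* c :* (:# 1 :- z)))
          Eq.refl s c (y w) (y v) deg)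
        where
        deg = inward w + outward w
        1≤deg : 1# ≤ deg
        1≤deg = begin
          1#               ≈⟨ Eq.trans (*-cong (α-adj uv) (α-adj (Adj-sym vw))) (*-identityʳ _) ⟨
          ν v * α w v      ≤⟨ term≤∑ {n} (λ x → *-nonneg (ν-nonneg x) (α-nonneg w x)) v ⟩
          inward w         ≤⟨ ≤-by (outward w) (outward-nonneg w) Eq.refl ⟩
          deg              ∎
          where open ≤-Reasoning
        local : (s + c) * y w ≤ (1# + c * y w) * deg
        local = begin
          (s + c) * y w                               ≤⟨ sub w ⟩
          sum (λ x → α w x * (y x + c * y w))         ≤⟨ ∑-mono {n} (λ x → α-mono w x (λ _ → +-monoˡ-≤ _ (y≤1 x))) ⟩
          sum (λ x → α w x * (1# + c * y w))          ≈⟨ ∑-cong {n} (λ x → *-comm _ _) ⟩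
          sum (λ x → (1# + c * y w) * α w x)          ≈⟨ ∑-* {n} _ (α w) ⟨
          (1# + c * y w) * sum (α w)                  ≈⟨ *-congˡ (degree-sum w ¬uw) ⟩
          (1# + c * y w) * deg                        ∎
          where open ≤-Reasoning

      -- `remote-bound` depends on `w` alone, so the paths u v w are regrouped by `w`, which ends
      -- `inward w` of them; the square of `inward w` that arises is bounded by r times `inward w`.
      Gᵣ-bound : ∀ {r} → (∀ w → w ≢ u → ¬ Adj u w → inward w ≤ r) →
        s * Gᵣ ≤ (1# + s * c) * P + (1# + c) * ((r + - 1#) * P + sum (λ w → ϱ w * (inward w * outward w)))
      Gᵣ-bound {r} inward≤r = begin
        s * Gᵣ
          ≈⟨ Eq.trans (∑-* {n} s _) (∑-cong {n} (λ v → Eq.trans (swapˡ s (ν v) (Sᵣ v)) (*-congˡ (Eq.trans (∑-* {n} s _)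
               (∑-cong {n} (λ w → Eq.trans (swapˡ s (ϱ w) _) (*-congˡ (swapˡ s (α v w) _)))))))) ⟩
        sum (λ v → ν v * sum (λ w → ϱ w * (α v w * (s * (y w + c * y v)))))
          ≤⟨ ∑-mono {n} (λ v → ν-mono v (λ uv → ∑-mono {n} (λ w → ϱ-mono w (λ _ ¬uw → α-mono v w (λ vw →
               remote-bound uv ¬uw vw))))) ⟩
        sum (λ v → ν v * sum (λ w → ϱ w * (α v w * g w)))
          ≈⟨ swap-pairs g ⟩
        sum (λ w → ϱ w * (inward w * g w))
          ≤⟨ ∑-mono {n} (λ w → ϱ-mono w (λ w≢u ¬uw → ≤-by _
               (*-nonneg (*-nonneg (+-nonneg (<⇒≤ 0<1) 0≤c) (inward-nonneg w)) (gap≤ (inward≤r w w≢u ¬uw)))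
               (solve 5 (λ t b i o r → t :* i :+ b :* ((r :- :# 1) :* i :+ i :* o) :=
                 i :* (t :+ b :* (i :+ o :- :# 1)) :+ b :* i :* (r :- i)) Eq.refl (1# + s * c) (1# + c) (inward w) (outward w) r))) ⟩
        sum (λ w → ϱ w * ((1# + s * c) * inward w + (1# + c) * ((r + - 1#) * inward w + inward w * outward w)))
          ≈⟨ ∑-cong {n} (λ w → solve 6 (λ p t b r i o → p :* (t :* i :+ b :* ((r :- :# 1) :* i :+ i :* o)) :=
               (t :+ b :* (r :- :# 1)) :* (p :* i) :+ b :* (p :* (i :* o))) Eq.refl (ϱ w) (1# + s * c) (1# + c) r (inward w) (outward w)) ⟩
        sum (λ w → k₁ * (ϱ w * inward w) + (1# + c) * (ϱ w * (inward w * outward w)))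
          ≈⟨ Eq.trans (∑-+ {n} (λ w → k₁ * (ϱ w * inward w)) _)
               (+-cong (Eq.trans (Eq.sym (∑-* {n} k₁ _)) (*-congˡ (Eq.sym P≈))) (Eq.sym (∑-* {n} (1# + c) _))) ⟩
        k₁ * P + (1# + c) * X
          ≈⟨ solve 5 (λ t b r p x → (t :+ b :* (r :- :# 1)) :* p :+ b :* x := t :* p :+ b :* ((r :- :# 1) :* p :+ x))
               Eq.refl (1# + s * c) (1# + c) r P X ⟩
        (1# + s * c) * P + (1# + c) * ((r + - 1#) * P + X) ∎
        where
        open ≤-Reasoning
        swapˡ : ∀ a b x → a * (b * x) ≈ b * (a * x)
        swapˡ a b x = solve 3 (λ a b x → a :* (b :* x) := b :* (a :* x)) Eq.refl a b x
        g : Fin n → ℝ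
        g w = (1# + s * c) + (1# + c) * (inward w + outward w + - 1#)
        k₁ = (1# + s * c) + (1# + c) * (r + - 1#)
        X = sum (λ w → ϱ w * (inward w * outward w))

      cross-bound : ∀ {r} → (∀ w → w ≢ u → ¬ Adj u w → inward w ≤ r) →
        sum (λ w → ϱ w * (inward w * outward w)) ≤ r * M₀
      cross-bound {r} inward≤r = ≤-trans (∑-mono {n} λ w → ϱ-mono w λ w≢u ¬uw →
          ≤-trans (≤-reflexive (*-comm _ _)) (≤-trans (*-monoˡ-≤ (outward-nonneg w) (inward≤r w w≢u ¬uw)) (≤-reflexive (*-comm _ _))))
        (≤-reflexive (Eq.trans (∑-cong {n} λ w → solve 3 (λ p r o → p :* (r :* o) := r :* (p :* o)) Eq.refl (ϱ w) r (outward w))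
          (Eq.sym (∑-* {n} r _))))

      -- Here `outward w` is bounded by half of `M₀` and the factors `inward w` add up to `P`.
      -- Compared with `cross-bound` for r = 2 this is the better estimate when P ≤ 2.
      cross-bound′ : # 2 * sum (λ w → ϱ w * (inward w * outward w)) ≤ P * M₀
      cross-bound′ = begin
        # 2 * sum (λ w → ϱ w * (inward w * outward w))
          ≈⟨ Eq.trans (∑-* {n} (# 2) _) (∑-cong {n} λ w → solve 3 (λ p i o → :# 2 :* (p :* (i :* o)) := p :* (i :* (:# 2 :* o))) Eq.refl (ϱ w) (inward w) (outward w)) ⟩
        sum (λ w → ϱ w * (inward w * (# 2 * outward w)))
          ≤⟨ ∑-mono {n} (λ w → ϱ-mono w (λ w≢u ¬uw → *-monoˡ-≤ (inward-nonneg w) (2outward≤M₀ w w≢u ¬uw))) ⟩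
        sum (λ w → ϱ w * (inward w * M₀))
          ≈⟨ ∑-cong {n} (λ w → solve 3 (λ p i m → p :* (i :* m) := m :* (p :* i)) Eq.refl (ϱ w) (inward w) M₀) ⟩
        sum (λ w → M₀ * (ϱ w * inward w))
          ≈⟨ Eq.trans (Eq.sym (∑-* {n} M₀ _)) (Eq.trans (*-comm _ _) (*-congʳ (Eq.sym P≈))) ⟩
        P * M₀ ∎
        where open ≤-Reasoning

      -- With K edges, Q of which miss u, centre-bound and the lower bound on s give
      -- (1 + s c) (Q - 2) + 2 (1 + c) θ < G₂ + Gᵣ.
      module Excess {K Q : ℝ} (3≤Q : # 3 ≤ Q) (d+Q≤K : d + Q ≤ K) (edges : # 2 * P + M₀ + M₂ ≤ # 2 * Q)
          (s-large : (1# + s * c) * (K + - # 2) + # 2 * (1# + c) * θ < s * (s + c)) where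

        private
          a b : ℝ
          a = 1# + s * c
          b = 1# + c

          0≤a : 0# ≤ a
          0≤a = +-nonneg (<⇒≤ 0<1) (*-nonneg 0≤s 0≤c)

          0≤b : 0# ≤ b
          0≤b = +-nonneg (<⇒≤ 0<1) 0≤c

          b≤a : 0# ≤ a + - b
          b≤a = ≤-trans (*-nonneg 0≤c (+-nonneg (gap≤ 5≤s) (#-nonneg 4)))
            (≤-reflexive (solve 2 (λ s c → c :* ((s :- :# 5) :+ :# 4) := (:# 1 :+ s :* c) :- (:# 1 :+ c)) Eq.refl s c))

          0≤Q-3 = gap≤ 3≤Q

          1≤sθ : 1# ≤ s * θ
          1≤sθ = ≤-by (b * θ) (*-nonneg 0≤b (<⇒≤ 0<θ)) (Eq.trans
            (solve 3 (λ s c t → s :* t := (s :- c :- :# 1) :* t :+ (:# 1 :+ c) :* t) Eq.refl s c θ) (+-congʳ [A-1]*θ))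

          target : ℝ
          target = a * (Q + - # 2) + # 2 * b * θ

          target-large : # 5 * a * (Q + - # 2) + # 2 * b ≤ s * target
          target-large = ≤-by _ (+-nonneg (*-nonneg (*-nonneg 0≤a (+-nonneg 0≤Q-3 (<⇒≤ 0<1))) (gap≤ 5≤s))
              (*-nonneg (*-nonneg (#-nonneg 2) 0≤b) (gap≤ 1≤sθ)))
            (solve 5 (λ s a b t q → s :* (a :* (q :- :# 2) :+ :# 2 :* b :* t) := :# 5 :* a :* (q :- :# 2) :+ :# 2 :* b :+
              (a :* ((q :- :# 3) :+ :# 1) :* (s :- :# 5) :+ :# 2 :* b :* (s :* t :- :# 1))) Eq.refl s a b θ Q)

          G-large : target < G₂ + Gᵣ
          G-large = <-by _ (+-pos (gap< s-large) (+-nonneg (gap≤ centre-bound) (*-nonneg 0≤a (gap≤ d+Q≤K))))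
            (solve 9 (λ s c d g k q a b t → g := a :* (q :- :# 2) :+ :# 2 :* b :* t :+
              ((s :* (s :+ c) :- (a :* (k :- :# 2) :+ :# 2 :* b :* t)) :+
                ((d :* a :+ g :- s :* (s :+ c)) :+ a :* (k :- (d :+ q))))) Eq.refl s c d (G₂ + Gᵣ) K Q a b θ)

          refute : s * (G₂ + Gᵣ) ≤ s * target → ∀ {A : Set} → A
          refute le = contradiction G-large (≤⇒≯ (*-cancelˡ-≤ 0<s le))

          M₀≤ : 0# ≤ # 2 * Q + - (# 2 * P) + - M₂ + - M₀
          M₀≤ = ≤-trans (gap≤ edges) (≤-reflexive (solve 4 (λ p m0 m2 q → :# 2 :* q :- (:# 2 :* p :+ m0 :+ m2) :=
            :# 2 :* q :- :# 2 :* p :- m2 :- m0) Eq.refl P M₀ M₂ Q))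

          P≤Q : 0# ≤ Q + - P
          P≤Q = *-cancelˡ-≤ (#-pos 1) (≤-trans (≤-reflexive (zeroʳ _)) (≤-trans (+-nonneg (+-nonneg M₀≤ M₂-nonneg) M₀-nonneg)
            (≤-reflexive (solve 4 (λ p m0 m2 q → :# 2 :* q :- :# 2 :* p :- m2 :- m0 :+ m2 :+ m0 := :# 2 :* (q :- p)) Eq.refl P M₀ M₂ Q))))

          M₀≤′ : 0# ≤ # 2 * Q + - (# 2 * P) + - M₀
          M₀≤′ = ≤-trans (+-nonneg M₀≤ M₂-nonneg)
            (≤-reflexive (solve 4 (λ p m0 m2 q → :# 2 :* q :- :# 2 :* p :- m2 :- m0 :+ m2 := :# 2 :* q :- :# 2 :* p :- m0) Eq.refl P M₀ M₂ Q))

        -- Every path u v w with w ≠ u ends at a remote vertex, so G₂ vanishes, and the matter is to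
        -- bound the sum X of products of `inward` and `outward`. For P ≥ 3 one has X ≤ 2 M₀ and M₀
        -- ≤ 2 Q - 2 P. For P ≤ 2 one has X ≤ P M₀ / 2 ≤ P (Q - P), and the assumed sign of the
        -- product says P (Q - P) ≤ 2 (Q - 2).
        no-triangle-absurd : (∀ {v w} → Adj u v → Adj u w → ¬ Adj v w) →
          (∀ w → w ≢ u → ¬ Adj u w → inward w ≤ # 2) → (P ≤ # 2 × 0# ≤ (# 2 + - P) * (Q + - # 2 + - P)) ⊎ # 3 ≤ P →
          ∀ {A : Set} → A
        no-triangle-absurd no-triangle inward≤2 P-small-or-large = refute (begin
          s * (G₂ + Gᵣ)                                ≈⟨ *-congˡ (Eq.trans (+-congʳ G₂≈0) (+-identityˡ _)) ⟩
          s * Gᵣ                                       ≤⟨ Gᵣ-bound inward≤2 ⟩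
          a * P + b * ((# 2 + - 1#) * P + X)           ≤⟨ counts P-small-or-large ⟩
          # 5 * a * (Q + - # 2) + # 2 * b              ≤⟨ target-large ⟩
          s * target                                   ∎)
          where
          open ≤-Reasoning
          X = sum (λ w → ϱ w * (inward w * outward w))
          G₂≈0 : G₂ ≈ 0#
          G₂≈0 = ≤-antisym (≤-trans (∑-mono {n} {g = λ v → ν v * 0#} (λ v → ν-mono v (λ uv →
              ≤-trans (∑-mono {n} {g = λ w → ν w * (α v w * 0#)} (λ w → ν-mono w (λ uw → α-mono v w (λ vw → contradiction vw (no-triangle uv uw)))))
                (≤-reflexive (∑-zero {n} (λ w → Eq.trans (*-congˡ (zeroʳ _)) (zeroʳ _)))))))
              (≤-reflexive (∑-zero {n} (λ v → zeroʳ _))))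
            (∑-nonneg {n} (λ v → *-nonneg (ν-nonneg v) (∑-nonneg {n} (λ w → *-nonneg (ν-nonneg w) (*-nonneg (α-nonneg v w) (+-nonneg (0≤y w) (*-nonneg 0≤c (0≤y v))))))))
          rest : 0# ≤ (a + - b) * (# 4 * (Q + - # 3) + (Q + - P) + # 2)
          rest = *-nonneg b≤a (+-nonneg (+-nonneg (*-nonneg (#-nonneg 4) 0≤Q-3) P≤Q) (#-nonneg 2))
          counts : (P ≤ # 2 × 0# ≤ (# 2 + - P) * (Q + - # 2 + - P)) ⊎ # 3 ≤ P →
            a * P + b * ((# 2 + - 1#) * P + X) ≤ # 5 * a * (Q + - # 2) + # 2 * b
          counts (inj₂ 3≤P) = ≤-by _
            (+-nonneg (+-nonneg (+-nonneg (*-nonneg 0≤b (gap≤ (cross-bound inward≤2))) (*-nonneg (*-nonneg (#-nonneg 2) 0≤b) M₀≤′))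
              (*-nonneg 0≤b (+-nonneg (+-nonneg 0≤Q-3 (*-nonneg (#-nonneg 2) (gap≤ 3≤P))) (<⇒≤ 0<1)))) rest)
            (solve 6 (λ a b p q m x → :# 5 :* a :* (q :- :# 2) :+ :# 2 :* b := a :* p :+ b :* ((:# 2 :- :# 1) :* p :+ x) :+
              (b :* (:# 2 :* m :- x) :+ :# 2 :* b :* (:# 2 :* q :- :# 2 :* p :- m) :+
                b :* ((q :- :# 3) :+ :# 2 :* (p :- :# 3) :+ :# 1) :+ (a :- b) :* (:# 4 :* (q :- :# 3) :+ (q :- p) :+ :# 2)))
              Eq.refl a b P Q M₀ X)
          counts (inj₁ (P≤2 , product)) = *-cancelˡ-≤ (#-pos 1) (≤-by _
            (+-nonneg (+-nonneg (+-nonneg (+-nonneg (*-nonneg 0≤b (gap≤ cross-bound′)) (*-nonneg (*-nonneg 0≤b P-nonneg) M₀≤′))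
              (*-nonneg (*-nonneg (#-nonneg 2) 0≤b) product))
              (*-nonneg (*-nonneg (#-nonneg 2) 0≤b) (+-nonneg (+-nonneg (*-nonneg (#-nonneg 3) 0≤Q-3) (*-nonneg (#-nonneg 2) (gap≤ P≤2))) (<⇒≤ 0<1))))
              (*-nonneg (#-nonneg 2) rest))
            (solve 6 (λ a b p q m x → :# 2 :* (:# 5 :* a :* (q :- :# 2) :+ :# 2 :* b) := :# 2 :* (a :* p :+ b :* ((:# 2 :- :# 1) :* p :+ x)) :+
              (b :* (p :* m :- :# 2 :* x) :+ b :* p :* (:# 2 :* q :- :# 2 :* p :- m) :+
                :# 2 :* b :* ((:# 2 :- p) :* (q :- :# 2 :- p)) :+
                :# 2 :* b :* (:# 3 :* (q :- :# 3) :+ :# 2 :* (:# 2 :- p) :+ :# 1) :+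
                :# 2 :* ((a :- b) :* (:# 4 :* (q :- :# 3) :+ (q :- p) :+ :# 2))))
              Eq.refl a b P Q M₀ X))

        module Triangle {x z : Fin n} (x≢z : x ≢ z) (ux : Adj u x) (uz : Adj u z) (xz : Adj x z)
            (only : ∀ {v w} → Adj u v → Adj u w → Adj v w → (v ≡ x × w ≡ z) ⊎ (v ≡ z × w ≡ x)) where

          private
            two-terms : ∀ {f : Fin n → ℝ} → (∀ v → 0# ≤ f v) → f x + f z ≤ sum f
            two-terms {f} 0≤f = begin
              f x + f z                                          ≈⟨ +-cong (∑-[≟] x f) (∑-[≟] z f) ⟨
              sum (λ v → [ v ≟ x ] f v) + sum (λ v → [ v ≟ z ] f v) ≈⟨ ∑-+ {n} (λ v → [ v ≟ x ] f v) _ ⟨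
              sum (λ v → [ v ≟ x ] f v + [ v ≟ z ] f v)          ≤⟨ ∑-mono {n} pointwise ⟩
              sum f                                              ∎
              where
              open ≤-Reasoning
              pointwise : ∀ v → [ v ≟ x ] f v + [ v ≟ z ] f v ≤ f v
              pointwise v with v ≟ x | v ≟ z
              ... | yes p | yes q = contradiction (≡.trans (≡.sym p) q) x≢z
              ... | yes _ | no _  = ≤-reflexive (+-identityʳ _)
              ... | no _  | yes _ = ≤-reflexive (+-identityˡ _)
              ... | no _  | no _  = ≤-trans (≤-reflexive (+-identityˡ _)) (0≤f v)

            at-most : ∀ {v w₀} (f : Fin n → ℝ) → (∀ w → 0# ≤ f w) → Adj u v → (∀ {w} → Adj u w → Adj v w → w ≡ w₀) →
              sum (λ w → ν w * (α v w * f w)) ≤ f w₀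
            at-most {v} {w₀} f 0≤f uv only-w₀ = ≤-trans (∑-mono {n} pointwise) (≤-reflexive (∑-[≟] w₀ f))
              where
              pointwise : ∀ w → ν w * (α v w * f w) ≤ [ w ≟ w₀ ] f w
              pointwise w with w ≟ w₀
              ... | yes _ = ≤-trans (ν-mono w {y = f w} (λ _ → ≤-trans (α-mono v w {y = f w} (λ _ → ≤-refl)) (≤-trans (*-monoʳ (α≤1 v w)) (≤-reflexive (*-identityˡ _)))))
                              (≤-trans (*-monoʳ (α≤1 u w)) (≤-reflexive (*-identityˡ _)))
                where
                α≤1 : ∀ v w → α v w ≤ 1#
                α≤1 v w with α-cases v w
                ... | inj₁ (eq , _) = ≤-trans (≤-reflexive eq) (<⇒≤ 0<1)
                ... | inj₂ (eq , _) = ≤-reflexive eq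
                *-monoʳ : ∀ {p q} → p ≤ q → p * f w ≤ q * f w
                *-monoʳ p≤q = ≤-trans (≤-reflexive (*-comm _ _)) (≤-trans (*-monoˡ-≤ (0≤f w) p≤q) (≤-reflexive (*-comm _ _)))
              ... | no w≢w₀ = ≤-trans (ν-mono w {y = 0#} (λ uw → ≤-trans (α-mono v w {y = 0#} (λ vw → contradiction (only-w₀ uw vw) w≢w₀)) (≤-reflexive (zeroʳ _)))) (≤-reflexive (zeroʳ _))

            only-x : ∀ {w} → Adj u w → Adj x w → w ≡ z
            only-x uw xw with only ux uw xw
            ... | inj₁ (_ , eq) = eq
            ... | inj₂ (x≡z , _) = contradiction x≡z x≢z

            only-z : ∀ {w} → Adj u w → Adj z w → w ≡ x
            only-z uw zw with only uz uw zw
            ... | inj₁ (z≡x , _) = contradiction (≡.sym z≡x) x≢z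
            ... | inj₂ (_ , eq) = eq

            nonneg-term : ∀ v w → 0# ≤ y w + c * y v
            nonneg-term v w = +-nonneg (0≤y w) (*-nonneg 0≤c (0≤y v))

            S₂x≤ : S₂ x ≤ y z + c * y x
            S₂x≤ = at-most (λ w → y w + c * y x) (nonneg-term x) ux only-x

            S₂z≤ : S₂ z ≤ y x + c * y z
            S₂z≤ = at-most (λ w → y w + c * y z) (nonneg-term z) uz only-z

            Sᵣ≤ : ∀ v → Sᵣ v ≤ b * outward v
            Sᵣ≤ v = ≤-trans (∑-mono {n} (λ w → ϱ-mono w {y = α v w * b} (λ _ _ → α-mono v w (λ _ →
                +-mono-≤ (y≤1 w) (≤-trans (*-monoˡ-≤ 0≤c (y≤1 v)) (≤-reflexive (*-identityʳ c)))))))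
              (≤-reflexive (Eq.trans (∑-cong {n} (λ w → solve 3 (λ r a b → r :* (a :* b) := b :* (r :* a)) Eq.refl (ϱ w) (α v w) b))
                (Eq.sym (∑-* {n} b _))))

            Y = y x + y z

            outward≤P : outward x + outward z ≤ P
            outward≤P = ≤-trans (≤-reflexive (Eq.sym (+-cong (Eq.trans (*-congʳ (α-adj ux)) (*-identityˡ _)) (Eq.trans (*-congʳ (α-adj uz)) (*-identityˡ _)))))
              (two-terms (λ v → *-nonneg (ν-nonneg v) (outward-nonneg v)))

            -- The inequalities at `x` and `z` are added. Each of the two contains the value at the
            -- other, so what remains on the left is (s - c - 1) Y, and the edges to remote vertices
            -- add up to at most `P`.
            Y≤ : Y ≤ θ * (# 2 + b * P)
            Y≤ = *-cancelˡ-≤ 0<A-1 (≤-trans (≤-by _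
              (+-nonneg (+-nonneg (+-nonneg (gap≤ (near-bound ux)) (gap≤ (near-bound uz))) (+-nonneg (gap≤ S₂x≤) (gap≤ S₂z≤)))
                (+-nonneg (+-nonneg (gap≤ (Sᵣ≤ x)) (gap≤ (Sᵣ≤ z))) (*-nonneg 0≤b (gap≤ outward≤P))))
              (solve 11 (λ s c x z p ox oz s2x s2z srx srz → let b = :# 1 :+ c in
                :# 2 :+ b :* p := (s :- c :- :# 1) :* (x :+ z) :+
                ((:# 1 :+ s2x :+ srx :- s :* x) :+ (:# 1 :+ s2z :+ srz :- s :* z) :+
                  ((z :+ c :* x :- s2x) :+ (x :+ c :* z :- s2z)) :+
                  ((b :* ox :- srx) :+ (b :* oz :- srz) :+ b :* (p :- (ox :+ oz)))))
                Eq.refl s c (y x) (y z) P (outward x) (outward z) (S₂ x) (S₂ z) (Sᵣ x) (Sᵣ z)))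
              (≤-reflexive (Eq.sym (Eq.trans (Eq.sym (*-assoc _ _ _)) (Eq.trans (*-congʳ [A-1]*θ) (*-identityˡ _))))))
              where
              0<A-1 : 0# < s + - c + - 1#
              0<A-1 = <-≤-trans (#-pos 2) (≤-by _ (+-nonneg (gap≤ 5≤s) (gap≤ c≤1))
                (solve 2 (λ s c → s :- c :- :# 1 := :# 3 :+ ((s :- :# 5) :+ (:# 1 :- c))) Eq.refl s c))

            G₂≤ : G₂ ≤ b * Y
            G₂≤ = begin
              G₂                                                           ≤⟨ ∑-mono {n} pointwise ⟩
              sum (λ v → [ v ≟ x ] S₂ v + [ v ≟ z ] S₂ v)                  ≈⟨ ∑-+ {n} (λ v → [ v ≟ x ] S₂ v) _ ⟩
              sum (λ v → [ v ≟ x ] S₂ v) + sum (λ v → [ v ≟ z ] S₂ v)      ≈⟨ +-cong (∑-[≟] x S₂) (∑-[≟] z S₂) ⟩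
              S₂ x + S₂ z                                                  ≤⟨ +-mono-≤ S₂x≤ S₂z≤ ⟩
              y z + c * y x + (y x + c * y z)
                ≈⟨ solve 3 (λ x z c → z :+ c :* x :+ (x :+ c :* z) := (:# 1 :+ c) :* (x :+ z)) Eq.refl (y x) (y z) c ⟩
              b * Y ∎
              where
              open ≤-Reasoning
              pointwise : ∀ v → ν v * S₂ v ≤ [ v ≟ x ] S₂ v + [ v ≟ z ] S₂ v
              pointwise v with v ≟ x | v ≟ z
              ... | yes p | yes q = contradiction (≡.trans (≡.sym p) q) x≢z
              ... | yes ≡.refl | no _ = ≤-reflexive (Eq.trans (*-congʳ (α-adj ux)) (Eq.trans (*-identityˡ _) (Eq.sym (+-identityʳ _))))
              ... | no _ | yes ≡.refl = ≤-reflexive (Eq.trans (*-congʳ (α-adj uz)) (Eq.trans (*-identityˡ _) (Eq.sym (+-identityˡ _))))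
              ... | no v≢x | no v≢z = ≤-trans (ν-mono v {y = 0#} (λ uv → ≤-trans
                  (∑-mono {n} {g = λ w → ν w * (α v w * 0#)} (λ w → ν-mono w (λ uw → α-mono v w (λ vw → neither (only uv uw vw)))))
                  (≤-reflexive (∑-zero {n} (λ w → Eq.trans (*-congˡ (zeroʳ _)) (zeroʳ _))))))
                (≤-reflexive (Eq.trans (zeroʳ _) (Eq.sym (+-identityˡ _))))
                where
                neither : ∀ {w} {B : Set} → (v ≡ x × w ≡ z) ⊎ (v ≡ z × w ≡ x) → B
                neither (inj₁ (v≡x , _)) = contradiction v≡x v≢x
                neither (inj₂ (v≡z , _)) = contradiction v≡z v≢z

            2≤M₂ : # 2 ≤ M₂
            2≤M₂ = begin
              # 2                                  ≈⟨ solve 0 (:# 2 := :# 1 :* :# 1 :+ :# 1 :* :# 1) Eq.refl ⟩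
              1# * 1# + 1# * 1#                    ≤⟨ +-mono-≤ (*-monoˡ-≤ (<⇒≤ 0<1) (inward≥1 uz xz)) (*-monoˡ-≤ (<⇒≤ 0<1) (inward≥1 ux (Adj-sym xz))) ⟩
              1# * inward x + 1# * inward z        ≈⟨ +-cong (*-congʳ (α-adj ux)) (*-congʳ (α-adj uz)) ⟨
              ν x * inward x + ν z * inward z      ≤⟨ two-terms (λ v → *-nonneg (ν-nonneg v) (inward-nonneg v)) ⟩
              M₂                                   ∎
              where
              open ≤-Reasoning
              inward≥1 : ∀ {v w} → Adj u w → Adj v w → 1# ≤ inward v
              inward≥1 {v} {w} uw vw = ≤-trans (≤-reflexive (Eq.sym (Eq.trans (*-cong (α-adj uw) (α-adj vw)) (*-identityʳ _))))
                (term≤∑ {n} (λ x → *-nonneg (ν-nonneg x) (α-nonneg v x)) w)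

            -- Multiplication by s - c - 1 removes θ. In terms of s - 5 and 1 - c the difference is
            -- a sum of nonnegative terms; for c = 0 it is s² - 5 s + 2, which is negative at s = 4.
            2sbbθ+2a≤sa : # 2 * (s * (b * b * θ)) + # 2 * a ≤ s * a
            2sbbθ+2a≤sa = *-cancelˡ-≤ 0<A-1 (≤-by _ 0≤rest (begin-equality
              (s + - c + - 1#) * (s * a)
                ≈⟨ solve 2 (λ s c → let t = s :- :# 5 ; e = :# 1 :- c ; a = :# 1 :+ s :* c ; b = :# 1 :+ c in
                     (s :- c :- :# 1) :* (s :* a) := :# 2 :* (s :* (b :* b)) :* :# 1 :+ (s :- c :- :# 1) :* (:# 2 :* a) :+
                     (:# 2 :+ :# 5 :* t :+ t :* t :+ c :* (:# 12 :+ :# 32 :* t :+ :# 11 :* (t :* t) :+ t :* t :* t) :+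
                      c :* e :* (:# 25 :+ :# 10 :* t :+ t :* t))) Eq.refl s c ⟩
              # 2 * (s * (b * b)) * 1# + (s + - c + - 1#) * (# 2 * a) + r
                ≈⟨ +-congʳ (+-congʳ (*-congˡ [A-1]*θ)) ⟨
              # 2 * (s * (b * b)) * ((s + - c + - 1#) * θ) + (s + - c + - 1#) * (# 2 * a) + r
                ≈⟨ +-congʳ (solve 5 (λ s c b a t → :# 2 :* (s :* (b :* b)) :* ((s :- c :- :# 1) :* t) :+ (s :- c :- :# 1) :* (:# 2 :* a) :=
                     (s :- c :- :# 1) :* (:# 2 :* (s :* (b :* b :* t)) :+ :# 2 :* a)) Eq.refl s c b a θ) ⟩
              (s + - c + - 1#) * (# 2 * (s * (b * b * θ)) + # 2 * a) + r ∎))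
              where
              open ≤-Reasoning
              t = s + - # 5
              e = 1# + - c
              r = # 2 + # 5 * t + t * t + c * (# 12 + # 32 * t + # 11 * (t * t) + t * t * t) + c * e * (# 25 + # 10 * t + t * t)
              0≤t = gap≤ 5≤s
              0≤tt = *-nonneg 0≤t 0≤t
              0≤rest : 0# ≤ r
              0≤rest = +-nonneg (+-nonneg (+-nonneg (+-nonneg (#-nonneg 2) (*-nonneg (#-nonneg 5) 0≤t)) 0≤tt)
                (*-nonneg 0≤c (+-nonneg (+-nonneg (+-nonneg (#-nonneg 12) (*-nonneg (#-nonneg 32) 0≤t)) (*-nonneg (#-nonneg 11) 0≤tt)) (*-nonneg 0≤tt 0≤t))))
                (*-nonneg (*-nonneg 0≤c (gap≤ c≤1)) (+-nonneg (+-nonneg (#-nonneg 25) (*-nonneg (#-nonneg 10) 0≤t)) 0≤tt))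
              0<A-1 : 0# < s + - c + - 1#
              0<A-1 = <-≤-trans (#-pos 2) (≤-by _ (+-nonneg (gap≤ 5≤s) (gap≤ c≤1))
                (solve 2 (λ s c → s :- c :- :# 1 := :# 3 :+ ((s :- :# 5) :+ (:# 1 :- c))) Eq.refl s c))

            4b≤sa : # 4 * b ≤ s * a
            4b≤sa = ≤-by _ (+-nonneg (+-nonneg (*-nonneg (gap≤ 5≤s) 0≤a) (*-nonneg (#-nonneg 4) b≤a)) 0≤a)
              (solve 3 (λ s a b → s :* a := :# 4 :* b :+ ((s :- :# 5) :* a :+ :# 4 :* (a :- b) :+ a)) Eq.refl s a b)

          -- The 2 in `Y≤` produces 2 b θ, the share of the triangle in `target`, and cancels. Four
          -- times the rest is at most s a (2 P + M₀) ≤ s a (2 Q - 2), because the side x z counts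
          -- twice in M₂, and 2 Q - 2 ≤ 4 (Q - 2) is the assumption 3 ≤ Q.
          triangle-absurd : (∀ w → w ≢ u → ¬ Adj u w → inward w ≤ 1#) → ∀ {A : Set} → A
          triangle-absurd inward≤1 = refute (begin
            s * (G₂ + Gᵣ)
              ≈⟨ distribˡ _ _ _ ⟩
            s * G₂ + s * Gᵣ
              ≤⟨ +-mono-≤ (*-monoˡ-≤ 0≤s (≤-trans G₂≤ (*-monoˡ-≤ 0≤b Y≤))) (≤-trans (Gᵣ-bound inward≤1)
                   (+-monoʳ-≤ _ (*-monoˡ-≤ 0≤b (+-monoʳ-≤ _ (cross-bound inward≤1))))) ⟩
            s * (b * (θ * (# 2 + b * P))) + (a * P + b * ((1# + - 1#) * P + 1# * M₀))
              ≤⟨ *-cancelˡ-≤ (#-pos 3) (≤-by _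
                   (+-nonneg (+-nonneg (*-nonneg (*-nonneg (#-nonneg 2) P-nonneg) (gap≤ 2sbbθ+2a≤sa)) (*-nonneg M₀-nonneg (gap≤ 4b≤sa)))
                     (*-nonneg (*-nonneg 0≤s 0≤a) (+-nonneg (+-nonneg M₀≤ (gap≤ 2≤M₂)) (*-nonneg (#-nonneg 2) 0≤Q-3))))
                   (solve 8 (λ s a b t p m m2 q → :# 4 :* (s :* (a :* (q :- :# 2) :+ :# 2 :* b :* t)) :=
                     :# 4 :* (s :* (b :* (t :* (:# 2 :+ b :* p))) :+ (a :* p :+ b :* ((:# 1 :- :# 1) :* p :+ :# 1 :* m))) :+
                     (:# 2 :* p :* (s :* a :- (:# 2 :* (s :* (b :* b :* t)) :+ :# 2 :* a)) :+ m :* (s :* a :- :# 4 :* b) :+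
                       s :* a :* ((:# 2 :* q :- :# 2 :* p :- m2 :- m) :+ (m2 :- :# 2) :+ :# 2 :* (q :- :# 3))))
                     Eq.refl s a b θ P M₀ M₂ Q)) ⟩
            s * target ∎)
            where open ≤-Reasoning

  -- At most two edges miss a vertex of maximal value.

  module ManyMissingEdges (p : ℕ) (Γ : Graph) where

    open Graph Γ
    open Adjacency Γ
    open PowerSpectrum p Γ
    open HubEquations p

    α : Fin n → Fin n → ℝ
    α v w = χ (inj₁ v) (inj₁ w)

    α-cases : ∀ v w → Bit (α v w) (Adj v w)
    α-cases v w with adj? v w
    ... | yes (e , j) = inj₂ (χ-adjacent (inj₁ v) (inj₁ w)
      ((λ eq → Joins⇒≢ j (inj₁-injective eq)) , e , Joins⇒Ends j , Joins⇒Ends (Joins-sym j)) , e , j)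
    ... | no ¬adj = inj₁ (χ-nonadjacent (inj₁ v) (inj₁ w)
      (λ { (v≢w , e , ve , we) → ¬adj (e , Ends² (v≢w ∘ ≡.cong inj₁) ve we) }) , ¬adj)

    module _ (u : Fin n) where

      open Neighbourhood Adj α α-cases Adj-sym Adj-irrefl u public

      misses : Fin k → ℝ
      misses e = 1# + - ([ u ≟ src e ] 1# + [ u ≟ tgt e ] 1#)

      misses-bit : ∀ e → Bit (misses e) (¬ Ends e u)
      misses-bit e with ends? e u
      ... | yes end = inj₁ (Eq.trans (+-congˡ (-‿cong (end-sum end))) (-‿inverseʳ 1#) , λ ¬end → ¬end end)
      ... | no ¬end = inj₂ (Eq.trans (+-congˡ (-‿cong (non-end-sum ¬end))) (solve 0 (:# 1 :- :# 0 := :# 1) Eq.refl) , ¬end)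

      Q : ℝ
      Q = sum misses

      d+Q≈k : d + Q ≈ # k
      d+Q≈k = begin
        d + Q
          ≈⟨ +-congʳ (Eq.trans (∑-cong {n} (λ w → Eq.sym (*-identityʳ _))) (around-weight u (λ _ → 1#))) ⟩
        around u (λ _ _ → 1#) + Q
          ≈⟨ ∑-+ {k} (λ e → [ u ≟ src e ] 1# + [ u ≟ tgt e ] 1#) _ ⟨
        sum (λ e → ([ u ≟ src e ] 1# + [ u ≟ tgt e ] 1#) + misses e)
          ≈⟨ ∑-cong {k} (λ e → solve 1 (λ x → x :+ (:# 1 :- x) := :# 1) Eq.refl ([ u ≟ src e ] 1# + [ u ≟ tgt e ] 1#)) ⟩
        sum {k} (λ _ → 1#)
          ≈⟨ Eq.trans (∑-const k 1#) (*-identityʳ _) ⟩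
        # k ∎
        where open ≈-Reasoning

      -- Both sides count the pairs of adjacent vertices other than u.
      handshake : # 2 * P + M₀ + M₂ ≈ # 2 * Q
      handshake = begin
        # 2 * P + M₀ + M₂
          ≈⟨ solve 3 (λ p m0 m2 → :# 2 :* p :+ m0 :+ m2 := (m2 :+ p) :+ (p :+ m0)) Eq.refl P M₀ M₂ ⟩
        (M₂ + P) + (P + M₀)
          ≈⟨ +-congˡ (+-congʳ P≈) ⟩
        (M₂ + P) + (sum (λ w → ϱ w * inward w) + M₀)
          ≈⟨ +-cong (∑-+ {n} (λ v → ν v * inward v) _) (∑-+ {n} (λ v → ϱ v * inward v) _) ⟨
        sum (λ v → ν v * inward v + ν v * outward v) + sum (λ v → ϱ v * inward v + ϱ v * outward v)
          ≈⟨ ∑-+ {n} (λ v → ν v * inward v + ν v * outward v) _ ⟨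
        sum (λ v → ν v * inward v + ν v * outward v + (ϱ v * inward v + ϱ v * outward v))
          ≈⟨ ∑-cong {n} (λ v → solve 4 (λ a b x y → a :* x :+ a :* y :+ ((:# 1 :- b :- a) :* x :+ (:# 1 :- b :- a) :* y) :=
               (:# 1 :- b) :* (x :+ y)) Eq.refl (ν v) (υ v) (inward v) (outward v)) ⟩
        sum (λ v → g v * (inward v + outward v))
          ≈⟨ ∑-cong {n} (λ v → *-congˡ (away v)) ⟩
        sum (λ v → g v * around v (λ _ x → g x))
          ≈⟨ ∑-cong {n} (λ v → ∑-* {k} (g v) _) ⟩
        sum (λ v → sum (λ e → g v * ([ v ≟ src e ] g (tgt e) + [ v ≟ tgt e ] g (src e))))
          ≈⟨ ∑-swap {n} {k} _ ⟩
        sum (λ e → sum (λ v → g v * ([ v ≟ src e ] g (tgt e) + [ v ≟ tgt e ] g (src e))))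
          ≈⟨ ∑-cong {k} (λ e → Eq.trans (∑-cong {n} (λ v → Eq.trans (distribˡ _ _ _) (+-cong (when-* (does (v ≟ src e)) (g v) _) (when-* (does (v ≟ tgt e)) (g v) _))))
               (Eq.trans (∑-+ {n} (λ v → [ v ≟ src e ] (g v * g (tgt e))) _)
                 (+-cong (∑-[≟] (src e) (λ v → g v * g (tgt e))) (∑-[≟] (tgt e) (λ v → g v * g (src e)))))) ⟩
        sum (λ e → g (src e) * g (tgt e) + g (tgt e) * g (src e))
          ≈⟨ ∑-cong {k} (λ e → Eq.trans (solve 2 (λ x y → (:# 1 :- x) :* (:# 1 :- y) :+ (:# 1 :- y) :* (:# 1 :- x) :=
               :# 2 :* (:# 1 :- (x :+ y)) :+ :# 2 :* (x :* y)) Eq.refl (υ (src e)) (υ (tgt e)))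
               (Eq.trans (+-cong (*-congˡ (+-congˡ (-‿cong (+-cong (flip (src e)) (flip (tgt e)))))) (*-congˡ (disjoint e)))
                 (Eq.trans (+-congˡ (zeroʳ _)) (+-identityʳ _)))) ⟩
        sum (λ e → # 2 * misses e)
          ≈⟨ ∑-* {k} (# 2) misses ⟨
        # 2 * Q ∎
        where
        open ≈-Reasoning
        g : Fin n → ℝ
        g v = 1# + - υ v
        flip : ∀ v → υ v ≈ [ u ≟ v ] 1#
        flip v with v ≟ u | u ≟ v
        ... | yes _ | yes _ = Eq.refl
        ... | no _  | no _  = Eq.refl
        ... | yes eq | no neq = contradiction (≡.sym eq) neq
        ... | no neq | yes eq = contradiction (≡.sym eq) neq
        disjoint : ∀ e → υ (src e) * υ (tgt e) ≈ 0#
        disjoint e with src e ≟ u | tgt e ≟ u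
        ... | yes p | yes q = contradiction (≡.trans p (≡.sym q)) (loopless e)
        ... | yes _ | no _  = zeroʳ _
        ... | no _  | _     = zeroˡ _
        away : ∀ v → inward v + outward v ≈ around v (λ _ x → g x)
        away v = Eq.trans (Eq.trans (Eq.sym (∑-+ {n} (λ w → ν w * α v w) _))
          (∑-cong {n} (λ w → solve 3 (λ a b x → a :* x :+ (:# 1 :- b :- a) :* x := x :* (:# 1 :- b)) Eq.refl (ν w) (υ w) (α v w))))
          (around-weight v g)

      -- For Q = 3 the product (2 - P) (Q - 2 - P) is negative strictly between P = 1 and P = 2;
      -- integrality excludes this range.
      P-natural : IsNatural P
      P-natural = ∑-natural {n} λ v → *-natural (bit-natural (α-cases u v)) (∑-natural {n} λ w →
        *-natural (ϱ-natural w) (bit-natural (α-cases v w)))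
        where
        ϱ-natural : ∀ w → IsNatural (ϱ w)
        ϱ-natural w with position w
        ... | centre _ _ _ eq   = 0 , eq
        ... | near _ _ _ _ eq   = 0 , eq
        ... | remote _ _ _ _ eq = 1 , eq

    -- `u` maximises `y`, and `y` is rescaled to the value 1 there, as the counting requires. Three
    -- edges missing `u` are refuted separately according to whether `u` lies on a triangle.
    at-most-two-miss : AtMostOneCycle Γ → ∀ {q} → k ≡ 5 ℕ.+ q → ∀ {s} → # 5 ≤ s → hub₃ q s ≤ s →
      (y : Fin n → ℝ) → (∀ v → 0# ≤ y v) → (∃[ v ] 0# < y v) →
      (∀ v → (s + c s) * y v ≤ around v (λ _ w → y w + c s * y v)) → ∃[ u ] AtMostTwoMiss u
    at-most-two-miss unique {q} k≡ {s} 5≤s hub₃≤s y 0≤y (v₀ , 0<yv₀) sub = u , few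
      where
      open Large 5≤s
      maximum : ∀ {n} (f : Fin n → ℝ) → Fin n → ∃[ u ] ∀ v → f v ≤ f u
      maximum {suc n} f _ = argmax f
      u = proj₁ (maximum y v₀)
      y≤yu = proj₂ (maximum y v₀)
      0<yu : 0# < y u
      0<yu = <-≤-trans 0<yv₀ (y≤yu v₀)
      r = y u ⁻¹
      0≤r = <⇒≤ (⁻¹-pos 0<yu)
      x : Fin n → ℝ
      x v = r * y v
      x-sub : ∀ v → (s + c s) * x v ≤ sum (λ w → α v w * (x w + c s * x v))
      x-sub v = begin
        (s + c s) * (r * y v)
          ≈⟨ solve 3 (λ a r y → a :* (r :* y) := r :* (a :* y)) Eq.refl (s + c s) r (y v) ⟩
        r * ((s + c s) * y v)
          ≤⟨ *-monoˡ-≤ 0≤r (sub v) ⟩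
        r * around v (λ _ w → y w + c s * y v)
          ≈⟨ around-* v r (λ _ w → y w + c s * y v) ⟩
        around v (λ _ w → r * (y w + c s * y v))
          ≈⟨ around-cong v {λ _ w → r * (y w + c s * y v)} {λ _ w → x w + c s * x v} (λ _ w _ →
               solve 4 (λ r y c z → r :* (y :+ c :* z) := r :* y :+ c :* (r :* z)) Eq.refl r (y w) (c s) (y v)) ⟩
        around v (λ _ w → x w + c s * x v)
          ≈⟨ around-weight v (λ w → x w + c s * x v) ⟨
        sum (λ w → α v w * (x w + c s * x v)) ∎
        where open ≤-Reasoning

      -- Multiply hub₃ ≤ s by s, replace `E` by the smaller `i`, and use s i = 1 and s θ = 1 + (1 +
      -- c) θ; the coefficients add up because k = 5 + q.
      s-large : (1# + s * c s) * (# k + - # 2) + # 2 * (1# + c s) * θ s < s * (s + c s)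
      s-large = <-by _ (+-pos (*-pos 0<s (gap< i<E)) (*-nonneg 0≤s (gap≤ hub₃≤s))) (begin
        s * (s + C)
          ≈⟨ solve 7 (λ s c n q i e t → s :* (s :+ c) := s :* c :+ (s :* c :* n :+ q :* (s :* i) :+ (s :* i) :+ (s :* t :+ s :* t)) :+
               (s :* (e :- i) :+ s :* (s :- (c :* n :+ q :* i :+ e :+ (t :+ t))))) Eq.refl s C (# (2 ℕ.+ q)) (# q) (i s) (E s) t ⟩
        s * C + (s * C * # (2 ℕ.+ q) + # q * (s * i s) + s * i s + (s * t + s * t)) + rest
          ≈⟨ +-congʳ (+-congˡ (+-cong (+-cong (+-cong (*-congˡ (#-+ 2 q)) (*-congˡ s*i)) s*i) (+-cong sθ sθ))) ⟩
        s * C + (s * C * (# 2 + # q) + # q * 1# + 1# + (1# + (1# + C) * t + (1# + (1# + C) * t))) + rest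
          ≈⟨ +-congʳ (solve 4 (λ s c q t → s :* c :+ (s :* c :* (:# 2 :+ q) :+ q :* :# 1 :+ :# 1 :+ (:# 1 :+ (:# 1 :+ c) :* t :+ (:# 1 :+ (:# 1 :+ c) :* t))) :=
               (:# 1 :+ s :* c) :* (:# 5 :+ q :- :# 2) :+ :# 2 :* (:# 1 :+ c) :* t) Eq.refl s C (# q) t) ⟩
        (1# + s * C) * (# 5 + # q + - # 2) + # 2 * (1# + C) * t + rest
          ≈⟨ +-congʳ (+-congʳ (*-congˡ (+-congʳ (Eq.trans (Eq.reflexive (≡.cong #_ k≡)) (#-+ 5 q))))) ⟨
        (1# + s * C) * (# k + - # 2) + # 2 * (1# + C) * t + rest ∎)
        where
        open ≈-Reasoning
        C = c s
        t = θ s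
        rest = s * (E s + - i s) + s * (s + - hub₃ q s)
        sθ : s * t ≈ 1# + (1# + C) * t
        sθ = Eq.trans (solve 3 (λ s c t → s :* t := (s :- c :- :# 1) :* t :+ (:# 1 :+ c) :* t) Eq.refl s C t) (+-congʳ [A-1]*θ)

      few : AtMostTwoMiss u
      few {e} {f} {g} e≢f e≢g f≢g e∌u f∌u with ends? g u
      ... | yes end = end
      ... | no g∌u = absurd
        where
        3≤Q : # 3 ≤ Q u
        3≤Q = ones≤count (misses-bit u) e≢f e≢g f≢g e∌u f∌u g∌u
        x≤1 : ∀ v → x v ≤ 1#
        x≤1 v = ≤-trans (*-monoˡ-≤ 0≤r (y≤yu v)) (≤-reflexive (Eq.trans (*-comm _ _) (*⁻¹ 0<yu)))
        xu≈1 : x u ≈ 1#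
        xu≈1 = Eq.trans (*-comm _ _) (*⁻¹ 0<yu)
        0≤x : ∀ v → 0# ≤ x v
        0≤x v = *-nonneg 0≤r (0≤y v)

        inward-bits : ∀ w v → Bit (ν u v * α w v) (Adj u v × Adj w v)
        inward-bits w v = bit-* (α-cases u v) (α-cases w v)

        P-cases : ∃[ m ] P u ≈ # m → (P u ≤ # 2 × 0# ≤ (# 2 + - P u) * (Q u + - # 2 + - P u)) ⊎ # 3 ≤ P u
        P-cases (0 , eq) = inj₁ (≤-trans (≤-reflexive eq) (#-nonneg 2) , *-nonneg (gap≤ (≤-trans (≤-reflexive eq) (#-nonneg 2)))
          (≤-trans (+-nonneg (gap≤ 3≤Q) (gap≤ {P u} {1#} (≤-trans (≤-reflexive eq) (<⇒≤ 0<1))))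
            (≤-reflexive (solve 2 (λ q p → (q :- :# 3) :+ (:# 1 :- p) := q :- :# 2 :- p) Eq.refl (Q u) (P u)))))
        P-cases (1 , eq) = inj₁ (P≤2 , *-nonneg (gap≤ P≤2)
          (≤-trans (+-nonneg (gap≤ 3≤Q) (gap≤ {P u} {1#} (≤-reflexive eq)))
            (≤-reflexive (solve 2 (λ q p → (q :- :# 3) :+ (:# 1 :- p) := q :- :# 2 :- p) Eq.refl (Q u) (P u)))))
          where
          P≤2 : P u ≤ # 2
          P≤2 = ≤-trans (≤-reflexive eq) (#-mono {1} {2} (ℕ.s≤s ℕ.z≤n))
        P-cases (2 , eq) = inj₁ (≤-reflexive eq , ≤-reflexive (Eq.sym
          (Eq.trans (*-congʳ (Eq.trans (+-congˡ (-‿cong eq)) (-‿inverseʳ (# 2)))) (zeroˡ _))))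
        P-cases (suc (suc (suc m)) , eq) = inj₂ (≤-trans (#-mono {3} {3 ℕ.+ m} (ℕ.s≤s (ℕ.s≤s (ℕ.s≤s ℕ.z≤n)))) (≤-reflexive (Eq.sym eq)))

        absurd : ∀ {A : Set} → A
        absurd with any? (λ v → any? (λ w → adj? u v ×-dec (adj? u w ×-dec adj? v w)))
        ... | no none = Subinvariant.Excess.no-triangle-absurd u 5≤s 0≤c c≤1′ 0<θ [A-1]*θ x 0≤x x≤1 xu≈1 x-sub
          {# k} {Q u} 3≤Q (≤-reflexive (d+Q≈k u)) (≤-reflexive (handshake u)) s-large (λ {v} {w} uv uw vw → none (v , w , uv , uw , vw))
          (λ w w≢u ¬uw → count≤2 (inward-bits w) (λ i≢j i≢l j≢l (ui , wi) (uj , wj) (ul , wl) →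
            no-three-paths unique (w≢u ∘ ≡.sym) i≢j i≢l j≢l ui wi uj wj ul wl))
          (P-cases (P-natural u))
        ... | yes (a , b , ua , ub , ab) = Subinvariant.Excess.Triangle.triangle-absurd u 5≤s 0≤c c≤1′ 0<θ [A-1]*θ x 0≤x x≤1 xu≈1 x-sub
          {# k} {Q u} 3≤Q (≤-reflexive (d+Q≈k u)) (≤-reflexive (handshake u)) s-large (Adj⇒≢ ab) ua ub ab
          (λ uv uw vw → unique-triangle unique ua ub ab uv uw vw)
          (λ w w≢u ¬uw → count≤1 (inward-bits w) (λ (ui , wi) (uj , wj) →
            no-triangle-and-square unique ua ub ab (w≢u ∘ ≡.sym) ¬uw ui uj (Adj-sym wi) (Adj-sym wj)))

  -- Comparison of the spectral radii.

  module Radii (p q : ℕ) (5<hub : # 5 < HubEquations.hub₃ p q (# 5)) where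

    open Coupling p
    open HubEquations p
    open Large
    Radius : Hypergraph → ℝ → Set
    Radius H ρ = λ₁[ 𝓡 , 2+ p , H ]≈ ρ

    σ : ℝ → ℝ
    σ ρ = N * ρ + - # p

    σ-cancel : ∀ {ρ ρ′} → σ ρ < σ ρ′ → ρ < ρ′
    σ-cancel {ρ} {ρ′} lt = *-cancelˡ-< N>0 (<-by _ (gap< lt)
      (solve 3 (λ a b p → b := a :+ ((b :- p) :- (a :- p))) Eq.refl (N * ρ) (N * ρ′) (# p)))

    module _ {H : Hypergraph} {ρ : ℝ} (radius : Radius H ρ) where

      private
        1≉0 : ¬ 1# ≈ 0#
        1≉0 = >0⇒≉0 0<1

      -- A solution of s = hub s beyond t makes the explicit vector an eigenvector, so the radius
      -- lies beyond t. It is applied with t = 5 and with t the transformed radius of a competitor.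
      above₁ : IsPower p (graph₁ (2 ℕ.+ q)) H → ∀ {t} → # 5 ≤ t → t < hub₁ (2 ℕ.+ q) t → t < σ ρ
      above₁ power {t} 5≤t t<hub = <-≤-trans t<s (PowerSpectrum.eigenvalue≤radius p (graph₁ (2 ℕ.+ q)) power radius
        (0≤s 5≤s) (StandardSpectra.weight₁ p (2 ℕ.+ q) 5≤s) {0F} 1≉0 (StandardSpectra.eigen₁ p (2 ℕ.+ q) 5≤s s≈hub))
        where
        solution = hub₁-solution q 5≤t t<hub
        s = proj₁ solution
        t<s : t < s
        t<s = proj₁ (proj₂ solution)
        s≈hub : s ≈ hub₁ (2 ℕ.+ q) s
        s≈hub = proj₂ (proj₂ solution)
        5≤s : # 5 ≤ s
        5≤s = ≤-trans 5≤t (<⇒≤ t<s)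

      above₂ : IsPower p (graph₂ (1 ℕ.+ q)) H → ∀ {t} → # 5 ≤ t → t < hub₂ (1 ℕ.+ q) t → t < σ ρ
      above₂ power {t} 5≤t t<hub = <-≤-trans t<s (PowerSpectrum.eigenvalue≤radius p (graph₂ (1 ℕ.+ q)) power radius
        (0≤s 5≤s) (StandardSpectra.weight₂ p (1 ℕ.+ q) 5≤s) {0F} 1≉0 (StandardSpectra.eigen₂ p (1 ℕ.+ q) 5≤s s≈hub))
        where
        solution = hub₂-solution q 5≤t t<hub
        s = proj₁ solution
        t<s : t < s
        t<s = proj₁ (proj₂ solution)
        s≈hub : s ≈ hub₂ (1 ℕ.+ q) s
        s≈hub = proj₂ (proj₂ solution)
        5≤s : # 5 ≤ s
        5≤s = ≤-trans 5≤t (<⇒≤ t<s)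

      above₃ : IsPower p (graph₃ q) H → ∀ {t} → # 5 ≤ t → t < hub₃ q t → t < σ ρ
      above₃ power {t} 5≤t t<hub = <-≤-trans t<s (PowerSpectrum.eigenvalue≤radius p (graph₃ q) power radius
        (0≤s 5≤s) (StandardSpectra.weight₃ p q 5≤s) {0F} 1≉0 (StandardSpectra.eigen₃ p q 5≤s s≈hub))
        where
        solution = hub₃-solution q 5≤t t<hub
        s = proj₁ solution
        t<s : t < s
        t<s = proj₁ (proj₂ solution)
        s≈hub : s ≈ hub₃ q s
        s≈hub = proj₂ (proj₂ solution)
        5≤s : # 5 ≤ s
        5≤s = ≤-trans 5≤t (<⇒≤ t<s)

      module _ (5≤σ : # 5 ≤ σ ρ) where

        private
          subinvariant : ∀ Γ → IsPower p Γ H → ∃[ y ] (∀ v → 0# ≤ y v) × (∃[ v ] 0# < y v) ×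
            (∀ v → (σ ρ + c (σ ρ)) * y v ≤ AroundVertex.around Γ v (λ _ w → y w + c (σ ρ) * y v))
          subinvariant Γ power = PowerSpectrum.radius-subinvariant p Γ power radius (0≤s 5≤σ)

        below₂ : IsPower p (graph₂ (1 ℕ.+ q)) H → σ ρ ≤ hub₂ (1 ℕ.+ q) (σ ρ)
        below₂ power = StandardSpectra.subinvariant₂ p (1 ℕ.+ q) 5≤σ _ (proj₁ (proj₂ (proj₂ Y))) (proj₂ (proj₂ (proj₂ Y)))
          where Y = subinvariant _ power

        below₃ : IsPower p (graph₃ q) H → σ ρ ≤ hub₃ q (σ ρ)
        below₃ power = StandardSpectra.subinvariant₃ p q 5≤σ _ (proj₁ (proj₂ (proj₂ Y))) (proj₂ (proj₂ (proj₂ Y)))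
          where Y = subinvariant _ power

        below₄ : IsPower p (graph₄ (1 ℕ.+ q)) H → σ ρ < hub₃ q (σ ρ)
        below₄ power = ≤-<-trans
          (StandardSpectra.subinvariant₄ p (1 ℕ.+ q) 5≤σ _ (proj₁ (proj₂ Y)) (proj₁ (proj₂ (proj₂ Y))) (proj₂ (proj₂ (proj₂ Y))))
          (hub₁<hub₃ 5≤σ q)
          where Y = subinvariant _ power

        few-miss : ∀ {Γ} → IsPower p Γ H → AtMostOneCycle Γ → Graph.k Γ ≡ 5 ℕ.+ q → hub₃ q (σ ρ) ≤ σ ρ →
          ∃[ u ] Adjacency.AtMostTwoMiss Γ u
        few-miss {Γ} power unique k≡ hub≤σ =
          ManyMissingEdges.at-most-two-miss p Γ unique k≡ 5≤σ hub≤σ _ (proj₁ (proj₂ Y)) (proj₁ (proj₂ (proj₂ Y))) (proj₂ (proj₂ (proj₂ Y)))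
          where Y = subinvariant Γ power

    -- If the smaller radius reaches 5 on the scale of s, it satisfies s ≤ hub₂ s < hub₁ s, and this
    -- same s is handed to `above₁`; otherwise t = 5 is enough.
    first>second : ∀ {H₁ H₂ ρ₁ ρ₂} → IsPower p (graph₁ (2 ℕ.+ q)) H₁ → IsPower p (graph₂ (1 ℕ.+ q)) H₂ →
      Radius H₁ ρ₁ → Radius H₂ ρ₂ → ρ₂ < ρ₁
    first>second {ρ₂ = ρ₂} power₁ power₂ radius₁ radius₂ with <-or-≥ (σ ρ₂) (# 5)
    ... | inj₁ σ<5 = σ-cancel (<-trans σ<5 (above₁ radius₁ power₁ ≤-refl
      (<-trans 5<hub (<-trans (hub₃<hub₂ ≤-refl q) (hub₂<hub₁ ≤-refl (1 ℕ.+ q))))))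
    ... | inj₂ 5≤σ = σ-cancel (above₁ radius₁ power₁ 5≤σ
      (≤-<-trans (below₂ radius₂ 5≤σ power₂) (hub₂<hub₁ 5≤σ (1 ℕ.+ q))))

    second>third : ∀ {H₂ H₃ ρ₂ ρ₃} → IsPower p (graph₂ (1 ℕ.+ q)) H₂ → IsPower p (graph₃ q) H₃ →
      Radius H₂ ρ₂ → Radius H₃ ρ₃ → ρ₃ < ρ₂
    second>third {ρ₃ = ρ₃} power₂ power₃ radius₂ radius₃ with <-or-≥ (σ ρ₃) (# 5)
    ... | inj₁ σ<5 = σ-cancel (<-trans σ<5 (above₂ radius₂ power₂ ≤-refl (<-trans 5<hub (hub₃<hub₂ ≤-refl q))))
    ... | inj₂ 5≤σ = σ-cancel (above₂ radius₂ power₂ 5≤σ (≤-<-trans (below₃ radius₃ 5≤σ power₃) (hub₃<hub₂ 5≤σ q)))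

    third>others : ∀ {H₁ H₂ H₃ H ρ₃ ρ} → IsPower p (graph₁ (2 ℕ.+ q)) H₁ → IsPower p (graph₂ (1 ℕ.+ q)) H₂ →
      IsPower p (graph₃ q) H₃ → IsConnectedUnicyclicPower (2+ p) (5 ℕ.+ q) H →
      ¬ (H ≅ H₁) → ¬ (H ≅ H₂) → ¬ (H ≅ H₃) → Radius H₃ ρ₃ → Radius H ρ → ρ < ρ₃
    third>others {H = H} {ρ₃} {ρ} power₁ power₂ power₃ (connected , (_ , looseCycle , same) , _ , size≡k , isPower) H≇H₁ H≇H₂ H≇H₃ radius₃ radius =
      σ-cancel (compare-with-5 (<-or-≥ (σ ρ) (# 5)))
      where
      Γ = proj₁ (isPowerOfGraph⇒isPower isPower)
      H-power : IsPower p Γ H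
      H-power = proj₂ (isPowerOfGraph⇒isPower isPower)
      unique : AtMostOneCycle Γ
      unique = PowerCycles.atMostOneCycle H-power same
      k≡5+q : Graph.k Γ ≡ 5 ℕ.+ q
      k≡5+q = ≡.trans (≡.sym (PowerProperties.size≡ H-power)) size≡k
      shape : ∃[ u ] Adjacency.AtMostTwoMiss Γ u → Shape Γ q
      shape (u , few) = Classify.shape Γ (PowerProperties.connected⇒ H-power connected) unique
        (proj₁ (PowerCycles.cycle H-power looseCycle)) u few k≡5+q
      by-shape : # 5 ≤ σ ρ → Shape Γ q → σ ρ < hub₃ q (σ ρ)
      by-shape 5≤σ (shape₁ iso) = contradiction (powers-≅ (≅ᴳ-power iso H-power) power₁) H≇H₁
      by-shape 5≤σ (shape₂ iso) = contradiction (powers-≅ (≅ᴳ-power iso H-power) power₂) H≇H₂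
      by-shape 5≤σ (shape₃ iso) = contradiction (powers-≅ (≅ᴳ-power iso H-power) power₃) H≇H₃
      by-shape 5≤σ (shape₄ iso) = below₄ radius 5≤σ (≅ᴳ-power iso H-power)
      compare-with-hub : # 5 ≤ σ ρ → σ ρ < hub₃ q (σ ρ) ⊎ hub₃ q (σ ρ) ≤ σ ρ → σ ρ < hub₃ q (σ ρ)
      compare-with-hub 5≤σ (inj₁ σ<hub) = σ<hub
      -- The case assumption leads to one of four shapes. Three are excluded by non-isomorphism, and
      -- for the quadrangle `below₄` proves the goal directly.
      compare-with-hub 5≤σ (inj₂ hub≤σ) = by-shape 5≤σ (shape (few-miss radius 5≤σ H-power unique k≡5+q hub≤σ))
      compare-with-5 : σ ρ < # 5 ⊎ # 5 ≤ σ ρ → σ ρ < σ ρ₃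
      compare-with-5 (inj₁ σ<5) = <-trans σ<5 (above₃ radius₃ power₃ ≤-refl 5<hub)
      compare-with-5 (inj₂ 5≤σ) = above₃ radius₃ power₃ 5≤σ (compare-with-hub 5≤σ (<-or-≥ (σ ρ) (hub₃ q (σ ρ))))

    three-largest : ∀ {H₁ H₂ H₃} → IsPower p (graph₁ (2 ℕ.+ q)) H₁ → IsPower p (graph₂ (1 ℕ.+ q)) H₂ →
      IsPower p (graph₃ q) H₃ → ∀ {ρ₁ ρ₂ ρ₃} →
      λ₁[ 𝓡 , 2+ p , H₁ ]≈ ρ₁ → λ₁[ 𝓡 , 2+ p , H₂ ]≈ ρ₂ → λ₁[ 𝓡 , 2+ p , H₃ ]≈ ρ₃ →
      (ρ₂ <[ 𝓡 ] ρ₁) × (ρ₃ <[ 𝓡 ] ρ₂) ×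
      (∀ H → IsConnectedUnicyclicPower (2+ p) (5 ℕ.+ q) H →
        ¬ (H ≅ H₁) → ¬ (H ≅ H₂) → ¬ (H ≅ H₃) →
        ∀ {ρ} → λ₁[ 𝓡 , 2+ p , H ]≈ ρ → ρ <[ 𝓡 ] ρ₃)
    three-largest power₁ power₂ power₃ radius₁ radius₂ radius₃ =
      first>second power₁ power₂ radius₁ radius₂ ,
      second>third power₂ power₃ radius₂ radius₃ ,
      λ H unicyclic H≇H₁ H≇H₂ H≇H₃ radius → third>others power₁ power₂ power₃ unicyclic H≇H₁ H≇H₂ H≇H₃ radius₃ radius

open import Data.Nat.Base using (_∸_; _*_; _≤_)

theorem3p4p1 : (𝓡 : CompleteOrderedField) (m k : ℕ) .{{_ : NonTrivial m}} →
    20 ≤ (k ∸ 7) * (m ∸ 1) →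
    (j : Fin (k ∸ 4)) (i : Fin (m ∸ 1)) →
    let H₁ = UC₃ m (k ∸ 3) 0 0
        H₂ = UC₃ m (k ∸ 4) 1 0
        H₃ = U₃C m (k ∸ 4) j i
    in
    IsConnectedUnicyclicPower m k H₁ ×
    IsConnectedUnicyclicPower m k H₂ ×
    IsConnectedUnicyclicPower m k H₃ ×
    (∀ {ρ₁ ρ₂ ρ₃} →
      λ₁[ 𝓡 , m , H₁ ]≈ ρ₁ → λ₁[ 𝓡 , m , H₂ ]≈ ρ₂ → λ₁[ 𝓡 , m , H₃ ]≈ ρ₃ →
      (ρ₂ <[ 𝓡 ] ρ₁) × (ρ₃ <[ 𝓡 ] ρ₂) ×
      (∀ H → IsConnectedUnicyclicPower m k H →
        ¬ (H ≅ H₁) → ¬ (H ≅ H₂) → ¬ (H ≅ H₃) →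
        ∀ {ρ} → λ₁[ 𝓡 , m , H ]≈ ρ → ρ <[ 𝓡 ] ρ₃))
-- With k = 8 + r the truncated k - 7 is r + 1, and the parameter `q` of the comparison, k - 5, is 3
-- + r.
theorem3p4p1 𝓡 m@(suc (suc p)) k@(suc (suc (suc (suc (suc (suc (suc (suc r)))))))) 20≤ j i =
  isConnectedUnicyclicPower H₁-power (UC₃-connectedUnicyclic (k ∸ 3) 0 0) (UC₃-uniform (k ∸ 3) 0 0) (k≡ 8 r) ,
  isConnectedUnicyclicPower H₂-power (UC₃-connectedUnicyclic (k ∸ 4) 1 0) (UC₃-uniform (k ∸ 4) 1 0)
    (≡.cong (7 ℕ.+_) (ℕ.+-comm r 1)) ,
  isConnectedUnicyclicPower H₃-power (U₃C-connectedUnicyclic (k ∸ 4) j i) (U₃C-uniform (k ∸ 4) j i)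
    (≡.trans (ℕ.+-comm (7 ℕ.+ (r ℕ.+ 0)) 1) (k≡ 8 r)) ,
  OrderedField.Radii.three-largest 𝓡 p (3 ℕ.+ r) (OrderedField.HubEquations.5<hub₃ 𝓡 p r 20≤)
    {UC₃ m (k ∸ 3) 0 0} {UC₃ m (k ∸ 4) 1 0} {U₃C m (k ∸ 4) j i}
    (≅ᴳ-power (H₁-graph (k ∸ 3) ≡.refl) H₁-power)
    (≅ᴳ-power (H₂-graph (k ∸ 4) ≡.refl) H₂-power)
    (≅ᴳ-power (H₃-graph (k ∸ 4) ≡.refl j i) H₃-power)
  where
  open ThreeGraphs p
  H₁-power = UC₃-power i (k ∸ 3) 0 0
  H₂-power = UC₃-power i (k ∸ 4) 1 0
  H₃-power = U₃C-power (k ∸ 4) j i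
-- For m below 2 the type of `i` is empty, for k at most 4 that of `j`; for k from 5 to 7 truncation
-- turns the hypothesis into 20 ≤ 0.
theorem3p4p1 𝓡 0 k _ j ()
theorem3p4p1 𝓡 1 k _ j ()
theorem3p4p1 𝓡 (suc (suc p)) 5 () j i
theorem3p4p1 𝓡 (suc (suc p)) 6 () j i
theorem3p4p1 𝓡 (suc (suc p)) 7 () j i
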